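{- Let $H$ be a graph with $\alpha(H)\le 2$ such that $H$ is an induced subgraph of one of the following graphs: $K_1+P_4$, $K_2+(K_1\cup K_3)$, $K_1+(K_1\cup K_4)$, $K_7^-$, $K_7$, or the kite graph. Let $G$ be an $H$-free finite simple graph on $n$ vertices with $\alpha(G)\le 2$. Then $oh(G)\ge \chi(G)$.
   Context: $\alpha$ denotes independence number and $\chi$ chromatic number. $G$ is $H$-free if $G$ has no induced subgraph isomorphic to $H$. For vertex-disjoint graphs $G_1,G_2$, the join $G_1+G_2$ has vertex set $V(G_1)\cup V(G_2)$ and edge set $E(G_1)\cup E(G_2)\cup\{xy: x\in V(G_1), y\in V(G_2)\}$; the union $G_1\cup G_2$ is the disjoint union (edge set $E(G_1)\cup E(G_2)$). $P_4$ is the path on four vertices, $K_k$ the complete graph on $k$ vertices, and $K_7^-$ is $K_7$ with one edge deleted. The kite is the graph obtained from $K_4^-$ ($K_4$ minus an edge) by adding a new vertex adjacent to exactly one vertex of degree two in $K_4^-$. A $K_t$-expansion in $G$ consists of $t$ vertex-disjoint trees in $G$, every two of which are joined by an edge of $G$; it is odd if its vertices can be two-colored so that tree edges are bichromatic but the edges joining different trees are monochromatic. $oh(G)$ is the largest $t$ such that $G$ contains an odd $K_t$-expansion (odd $K_t$ minor). -}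

module Defs where

open import Data.Nat using (ℕ; zero; suc; _+_; _≤_; _<_)
open import Data.Bool using (Bool; true; false; _∨_; _∧_; not)
open import Data.Bool.Properties using (∨-comm)
open import Data.Fin using (Fin; zero; suc; splitAt) renaming (_<_ to _<ᶠ_)
open import Data.Fin.Properties using (_≟_)
open import Data.Fin.Subset using (Subset; _∈_; ∣_∣)
open import Data.Maybe using (Maybe; just; nothing)
open import Data.Product using (Σ; _×_; _,_)
open import Data.Sum using (_⊎_; inj₁; inj₂)
open import Relation.Nullary using (¬_; yes; no)
open import Relation.Nullary.Decidable using (⌊_⌋)
open import Relation.Binary.PropositionalEquality using (_≡_; _≢_; refl; sym; cong₂)

record Graph (n : ℕ) : Set where
  field
    adj  : Fin n → Fin n → Bool
    adj-sym : ∀ u v → adj u v ≡ adj v u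
    adj-irr : ∀ u → adj u u ≡ false
open Graph public

Adj : ∀ {n} → Graph n → Fin n → Fin n → Set
Adj G u v = adj G u v ≡ true

eqᵇ : ∀ {n} → Fin n → Fin n → Bool
eqᵇ i j = ⌊ i ≟ j ⌋

private
  eqᵇ-sym : ∀ {n} (i j : Fin n) → eqᵇ i j ≡ eqᵇ j i
  eqᵇ-sym i j with i ≟ j | j ≟ i
  ... | yes _ | yes _ = refl
  ... | no _  | no _  = refl
  ... | yes p | no ¬q = Data.Empty.⊥-elim (¬q (sym p))
    where import Data.Empty
  ... | no ¬p | yes q = Data.Empty.⊥-elim (¬p (sym q))
    where import Data.Empty

  eqᵇ-refl : ∀ {n} (i : Fin n) → eqᵇ i i ≡ true
  eqᵇ-refl i with i ≟ i
  ... | yes _ = refl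
  ... | no ¬p = Data.Empty.⊥-elim (¬p refl)
    where import Data.Empty

  ∧-false : ∀ b → b ∧ false ≡ false
  ∧-false true = refl
  ∧-false false = refl

mkGraph : ∀ {n} → (Fin n → Fin n → Bool) → Graph n
mkGraph f = record
  { adj = λ u v → (f u v ∨ f v u) ∧ not (eqᵇ u v)
  ; adj-sym = λ u v → cong₂ (λ a b → a ∧ not b) (∨-comm (f u v) (f v u)) (eqᵇ-sym u v)
  ; adj-irr = λ u → helper u
  }
  where
  helper : ∀ u → (f u u ∨ f u u) ∧ not (eqᵇ u u) ≡ false
  helper u rewrite eqᵇ-refl u = ∧-false (f u u ∨ f u u)

K : (k : ℕ) → Graph k
K k = mkGraph (λ _ _ → true)

P4 : Graph 4
P4 = mkGraph e
  where
  e : Fin 4 → Fin 4 → Bool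
  e zero (suc zero) = true
  e (suc zero) (suc (suc zero)) = true
  e (suc (suc zero)) (suc (suc (suc zero))) = true
  e _ _ = false

K7⁻ : Graph 7
K7⁻ = mkGraph e
  where
  e : Fin 7 → Fin 7 → Bool
  e zero (suc zero) = false
  e (suc zero) zero = false
  e _ _ = true

-- kite: K_4^- on {0,1,2,3} (K_4 minus the edge {2,3}, so 2 and 3 have
-- degree two), plus vertex 4 adjacent exactly to vertex 3.
kite : Graph 5
kite = mkGraph e
  where
  e : Fin 5 → Fin 5 → Bool
  e zero (suc zero) = true
  e zero (suc (suc zero)) = true
  e zero (suc (suc (suc zero))) = true
  e (suc zero) (suc (suc zero)) = true
  e (suc zero) (suc (suc (suc zero))) = true
  e (suc (suc (suc zero))) (suc (suc (suc (suc zero)))) = true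
  e _ _ = false

_∪ᴳ_ : ∀ {a b} → Graph a → Graph b → Graph (a + b)
_∪ᴳ_ {a} {b} G₁ G₂ = mkGraph e
  where
  e : Fin (a + b) → Fin (a + b) → Bool
  e u v with splitAt a u | splitAt a v
  ... | inj₁ x | inj₁ y = adj G₁ x y
  ... | inj₂ x | inj₂ y = adj G₂ x y
  ... | _ | _ = false

_+ᴳ_ : ∀ {a b} → Graph a → Graph b → Graph (a + b)
_+ᴳ_ {a} {b} G₁ G₂ = mkGraph e
  where
  e : Fin (a + b) → Fin (a + b) → Bool
  e u v with splitAt a u | splitAt a v
  ... | inj₁ x | inj₁ y = adj G₁ x y
  ... | inj₂ x | inj₂ y = adj G₂ x y
  ... | _ | _ = true

InducedSub : ∀ {m n} → Graph m → Graph n → Set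
InducedSub {m} {n} H G =
  Σ (Fin m → Fin n) λ f →
    (∀ i j → f i ≡ f j → i ≡ j) × (∀ i j → adj H i j ≡ adj G (f i) (f j))

Free : ∀ {m n} → Graph m → Graph n → Set
Free H G = ¬ InducedSub H G

Independent : ∀ {n} → Graph n → Subset n → Set
Independent G S = ∀ u v → u ∈ S → v ∈ S → ¬ Adj G u v

αAtMost : ∀ {n} → Graph n → ℕ → Set
αAtMost {n} G k = ∀ (S : Subset n) → Independent G S → ∣ S ∣ ≤ k

Colourable : ∀ {n} → Graph n → ℕ → Set
Colourable {n} G k = Σ (Fin n → Fin k) λ c → ∀ u v → Adj G u v → c u ≢ c v

IsChromaticNumber : ∀ {n} → Graph n → ℕ → Set
IsChromaticNumber G k = Colourable G k × (∀ j → Colourable G j → k ≤ j)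

-- Odd K_t-expansions.
-- Trees T_0..T_{t-1}: vertex v lies in tree i iff branch v ≡ just i
-- (so the trees are vertex-disjoint).  Each tree T_i is given as a
-- rooted spanning tree of its vertex set: root i is in T_i, every other
-- vertex v of T_i has a parent in T_i adjacent to v in G, and a depth
-- function strictly decreases towards the root (so the parent edges form
-- a tree on V(T_i)).  The tree edges are the edges {v, parent v}.
-- For each pair i < j a joining edge u w of G with u ∈ T_i, w ∈ T_j is
-- chosen.  A 2-colouring makes tree edges bichromatic and the joining
-- edges monochromatic.

record OddExpansion {n} (G : Graph n) (t : ℕ) : Set where
  field
    branch : Fin n → Maybe (Fin t)
    root   : Fin t → Fin n
    root-in : ∀ i → branch (root i) ≡ just i
    parent : Fin n → Fin n
    depth  : Fin n → ℕ
    parent-ok : ∀ v i → branch v ≡ just i → v ≢ root i →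
                branch (parent v) ≡ just i × Adj G v (parent v) × depth (parent v) < depth v
    colour : Fin n → Bool
    tree-bichromatic : ∀ v i → branch v ≡ just i → v ≢ root i → colour v ≢ colour (parent v)
    link : ∀ i j → i <ᶠ j → Σ (Fin n) λ u → Σ (Fin n) λ w →
             branch u ≡ just i × branch w ≡ just j × Adj G u w × colour u ≡ colour w

OhAtLeast : ∀ {n} → Graph n → ℕ → Set
OhAtLeast G k = Σ ℕ λ t → k ≤ t × OddExpansion G t

InAllowedFamily : ∀ {m} → Graph m → Set
InAllowedFamily H =
  InducedSub H (K 1 +ᴳ P4) ⊎
  InducedSub H (K 2 +ᴳ (K 1 ∪ᴳ K 3)) ⊎
  InducedSub H (K 1 +ᴳ (K 1 ∪ᴳ K 4)) ⊎
  InducedSub H K7⁻ ⊎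
  InducedSub H (K 7) ⊎
  InducedSub H kite

{-# OPTIONS --safe #-}

-- The complement C of G is triangle-free, and a colouring of G is a matching of C together with the unmatched vertices.
-- By Gallai's lemma for C it therefore suffices to find k trees in every set S of 2k − 1 vertices. The trees are single
-- vertices, edges, and gulls: induced three-vertex paths of G, the triples spanning exactly one edge of C. Every vertex is
-- adjacent in G to an end of a gull, so disjoint gulls can be added to any family of trees.
--
-- Take the vertices of a largest stable set Q of C as single trees. The gulls form a two-graph, and exchanging vertices of
-- a largest packing with leftover ones shows that k − |Q| disjoint gulls exist outside Q unless some set outside Q contains
-- no gull and is larger than Q; Hall's condition for Q rules this out as soon as |S| + 3 ≤ 4|Q|. Ramsey bounds
-- give this inequality for |S| ≤ 21, and excluding the gem, the kite, K₂ + (K₁ ∪ K₃) or K₁ + (K₁ ∪ K₄) gives it beyond;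
-- so does excluding K₇⁻ when |Q| ≥ 7.
--
-- There remain the sets S with |Q| ≤ 6 and 23 ≤ |S| ≤ 25. Counting edges of C excludes |S| = 25. If |S| = 23, counting
-- yields a vertex v₁ with six neighbours in C and a stable set v₁, …, v₄ whose common non-neighbours contain a pentagon.
-- Then twelve trees are v₁, …, v₄, five edges of G joining the pentagon to neighbours of v₁, and three gulls.

module Submission where

open import Defs
open import Data.Nat using (ℕ; zero; suc; _+_; _*_; _∸_; _≤_; _<_; z≤n; s≤s; _≤ᵇ_; _<ᵇ_; _≡ᵇ_)
open import Data.Nat.Properties
  using (≤-refl; ≤-trans; ≤-reflexive; ≤-antisym; ≤-pred; m≤n+m; m≤n⇒m≤1+n; m≤n⇒m<n∨m≡n;
         ≮⇒≥; ≰⇒>; <⇒≱; _≤?_; +-mono-≤; *-monoʳ-≤; *-monoˡ-≤; +-comm; +-identityʳ; *-identityʳ; *-zeroʳ;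
         *-comm; *-distribˡ-+; +-cancelʳ-≤; m∸n+n≡m; m≤n+o⇒m∸n≤o; *-cancelˡ-≤; ≤ᵇ⇒≤; <ᵇ⇒<; ≡ᵇ⇒≡; module ≤-Reasoning)
open import Data.Nat.Tactic.RingSolver using (solve-∀)
open import Data.Bool using (Bool; true; false; _∨_; _∧_; not; _xor_; T; if_then_else_)
open import Data.Bool.Properties using () renaming (_≟_ to _≟ᵇ_)
open import Data.Fin using (Fin; zero; suc; combine; remQuot; inject≤; splitAt; join; fromℕ<; toℕ; inject₁) renaming (_<_ to _<ᶠ_)
open import Data.Fin.Properties using (any?; all?; pigeonhole; remQuot-combine; inject≤-injective; join-splitAt; toℕ-fromℕ<)
  renaming (_≟_ to _≟ᶠ_; suc-injective to sucᶠ-injective; <⇒≢ to <⇒≢ᶠ; <-cmp to <-cmpᶠ)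
open import Data.List using (List; []; _∷_; _++_; length; map; filter; concatMap; cartesianProduct; allFin)
open import Data.List.Relation.Unary.All as Allₚ using (All; []; _∷_) renaming (all? to all?ᴸ)
import Data.List.Relation.Unary.All.Properties as Allₚ
open import Data.List.Relation.Unary.Any using (Any; here; there)
import Data.List.Relation.Unary.Any.Properties as Anyₚ
open import Data.List.Membership.Propositional using () renaming (_∈_ to _∈ᴸ_)
open import Data.List.Membership.Propositional.Properties using (∈-allFin; ∈-filter⁺)
open import Data.Vec using (tabulate)
open import Data.Vec.Properties using (lookup∘tabulate; []=⇒lookup)
open import Data.Fin.Subset using (∣_∣)
open import Data.Maybe using (Maybe; just; nothing)
open import Data.Product using (Σ; _×_; _,_; proj₁; proj₂; ∃; ∃-syntax)
open import Data.Sum using (_⊎_; inj₁; inj₂)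
open import Data.Empty using (⊥; ⊥-elim)
open import Data.Unit using (⊤; tt)
open import Function using (_∘_; case_of_)
open import Relation.Binary.Definitions using (tri<; tri≈; tri>)
open import Relation.Nullary using (¬_; Dec; yes; no)
open import Relation.Nullary.Decidable using (⌊_⌋; map′; ¬?; _×-dec_; _⊎-dec_; _→-dec_; toWitness)
open import Relation.Binary.PropositionalEquality
  using (_≡_; _≢_; refl; sym; trans; cong; cong₂; subst; subst₂; module ≡-Reasoning)

-- The threshold |S| + 3 ≤ 4|Q| is a count of vertices: beside Q there must be s = k - |Q| disjoint
-- gulls among 2k - 1 - |Q| vertices, and 3s ≤ 2k - 1 - |Q| says the same. For |Q| = 6 and |S| = 23
-- it fails by one vertex, since six gulls need 18 vertices and 17 are left. This is why edges,
-- which cost only two vertices, have to enter. The vertices of the pentagon are not pairwise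
-- adjacent in G, so the five edges through them meet each other in the other colour, at their ends
-- among the neighbours of v₁, while the pentagon vertices meet the single trees. The twelve trees
-- use 4 + 10 + 9 vertices, which is all of S.
--
-- Largest packings, stable sets and matchings, and Gallai's case distinctions, are treated under
-- double negation. Nothing is lost: there are finitely many candidates for k trees and it is
-- decidable whether they form an expansion, so an exhaustive search removes the double negation at
-- the end.

-- Linear arithmetic over ℕ: A ≤ B implies a ≤ b if a + B ≤ b + A holds coefficientwise. In lin n (a ≼ b) (A ≼ B) the
-- two inequalities are given in n atoms $0, $1, …; the ones that unification does not find are supplied in {…}.

data Expr : Set where
  con : ℕ → Expr
  var : ℕ → Expr
  _⊞_ : Expr → Expr → Expr
  _⊠_ : ℕ → Expr → Expr

data Ineq : Set where
  _≼_ : Expr → Expr → Ineq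

infix 4 _≼_
infixl 6 _⊞_
infixr 7 _⊠_

pattern $0 = var 0
pattern $1 = var 1
pattern $2 = var 2
pattern $3 = var 3
pattern $4 = var 4
pattern $5 = var 5
pattern $6 = var 6
pattern $7 = var 7
pattern $8 = var 8
pattern $9 = var 9
pattern $10 = var 10
pattern $11 = var 11

-- a product, because unification finds its components by η
Env : ℕ → Set
Env zero = ⊤
Env (suc n) = ℕ × Env n

at : ∀ n → Env n → ℕ → ℕ
at zero _ _ = 0
at (suc n) ρ zero = proj₁ ρ
at (suc n) ρ (suc i) = at n (proj₂ ρ) i

values : ∀ n → Env n → List ℕ
values zero _ = []
values (suc n) ρ = proj₁ ρ ∷ values n (proj₂ ρ)

⟦_⟧ : Expr → ∀ {n} → Env n → ℕ
⟦ con k ⟧ ρ = k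
⟦ var i ⟧ {n} ρ = at n ρ i
⟦ a ⊞ b ⟧ ρ = ⟦ a ⟧ ρ + ⟦ b ⟧ ρ
⟦ k ⊠ a ⟧ ρ = k * ⟦ a ⟧ ρ

dot : List ℕ → List ℕ → ℕ
dot [] _ = 0
dot (_ ∷ _) [] = 0
dot (k ∷ ks) (x ∷ xs) = k * x + dot ks xs

unit : ℕ → List ℕ
unit zero = 1 ∷ []
unit (suc i) = 0 ∷ unit i

add : List ℕ → List ℕ → List ℕ
add [] ys = ys
add (x ∷ xs) [] = x ∷ xs
add (x ∷ xs) (y ∷ ys) = x + y ∷ add xs ys

scale : ℕ → List ℕ → List ℕ
scale k [] = []
scale k (x ∷ xs) = k * x ∷ scale k xs

-- The head of the list is the constant term, hence the `1` in front of the values in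
-- `linear-sound`.
linear : Expr → List ℕ
linear (con k) = k ∷ []
linear (var i) = 0 ∷ unit i
linear (a ⊞ b) = add (linear a) (linear b)
linear (k ⊠ a) = scale k (linear a)

dot-unit : ∀ i n (ρ : Env n) → dot (unit i) (values n ρ) ≡ at n ρ i
dot-unit zero zero ρ = refl
dot-unit zero (suc n) ρ = trans (+-identityʳ _) (+-identityʳ _)
dot-unit (suc i) zero ρ = refl
dot-unit (suc i) (suc n) ρ = dot-unit i n (proj₂ ρ)

dot-add : ∀ xs ys ρ → dot (add xs ys) ρ ≡ dot xs ρ + dot ys ρ
dot-add [] ys ρ = refl
dot-add (x ∷ xs) [] ρ = sym (+-identityʳ _)
dot-add (x ∷ xs) (y ∷ ys) [] = refl
dot-add (x ∷ xs) (y ∷ ys) (r ∷ ρ) rewrite dot-add xs ys ρ = rearrange x y r (dot xs ρ) (dot ys ρ)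
  where
  rearrange : ∀ x y r a b → (x + y) * r + (a + b) ≡ x * r + a + (y * r + b)
  rearrange = solve-∀

dot-scale : ∀ k xs ρ → dot (scale k xs) ρ ≡ k * dot xs ρ
dot-scale k [] ρ = sym (*-zeroʳ k)
dot-scale k (x ∷ xs) [] = sym (*-zeroʳ k)
dot-scale k (x ∷ xs) (r ∷ ρ) rewrite dot-scale k xs ρ = rearrange k x r (dot xs ρ)
  where
  rearrange : ∀ k x r a → k * x * r + k * a ≡ k * (x * r + a)
  rearrange = solve-∀

linear-sound : ∀ e {n} (ρ : Env n) → dot (linear e) (1 ∷ values n ρ) ≡ ⟦ e ⟧ ρ
linear-sound (con k) ρ = trans (+-identityʳ _) (*-identityʳ k)
linear-sound (var i) ρ = dot-unit i _ ρ
linear-sound (a ⊞ b) ρ = trans (dot-add (linear a) (linear b) _) (cong₂ _+_ (linear-sound a ρ) (linear-sound b ρ))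
linear-sound (k ⊠ a) ρ = trans (dot-scale k (linear a) _) (cong (k *_) (linear-sound a ρ))

leq : List ℕ → List ℕ → Bool
leq [] ys = true
leq (x ∷ xs) [] = (x ≤ᵇ 0) ∧ leq xs []
leq (x ∷ xs) (y ∷ ys) = (x ≤ᵇ y) ∧ leq xs ys

∧-fst : ∀ {a b} → a ∧ b ≡ true → a ≡ true
∧-fst {true} _ = refl

∧-snd : ∀ {a b} → a ∧ b ≡ true → b ≡ true
∧-snd {true} h = h

∧-intro : ∀ {a b} → a ≡ true → b ≡ true → a ∧ b ≡ true
∧-intro refl refl = refl

≤ᵇ-sound : ∀ {m n} → (m ≤ᵇ n) ≡ true → m ≤ n
≤ᵇ-sound {m} {n} h = ≤ᵇ⇒≤ m n (subst T (sym h) tt)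

leq-sound : ∀ xs ys ρ → leq xs ys ≡ true → dot xs ρ ≤ dot ys ρ
leq-sound [] ys ρ h = z≤n
leq-sound (x ∷ xs) [] [] h = z≤n
leq-sound (x ∷ xs) [] (r ∷ ρ) h =
  +-mono-≤ (*-monoˡ-≤ r (≤ᵇ-sound {x} (∧-fst h))) (leq-sound xs [] ρ (∧-snd {x ≤ᵇ 0} h))
leq-sound (x ∷ xs) (y ∷ ys) [] h = z≤n
leq-sound (x ∷ xs) (y ∷ ys) (r ∷ ρ) h =
  +-mono-≤ (*-monoˡ-≤ r (≤ᵇ-sound {x} (∧-fst h))) (leq-sound xs ys ρ (∧-snd {x ≤ᵇ y} h))

HoldsAt : Ineq → ∀ {n} → Env n → Set
HoldsAt (a ≼ b) ρ = ⟦ a ⟧ ρ ≤ ⟦ b ⟧ ρ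

entails : Ineq → Ineq → Bool
entails (A ≼ B) (a ≼ b) = leq (linear (a ⊞ B)) (linear (b ⊞ A))

opaque
  entails-sound : ∀ hyp goal {n} (ρ : Env n) → T (entails hyp goal) → HoldsAt hyp ρ → HoldsAt goal ρ
  entails-sound (A ≼ B) (a ≼ b) ρ h A≤B = +-cancelʳ-≤ (⟦ B ⟧ ρ) (⟦ a ⟧ ρ) (⟦ b ⟧ ρ)
    (≤-trans (subst₂ _≤_ (linear-sound (a ⊞ B) ρ) (linear-sound (b ⊞ A) ρ) (leq-sound (linear (a ⊞ B)) (linear (b ⊞ A)) (1 ∷ values _ ρ) (T⇒≡ h)))
             (+-mono-≤ (≤-refl {⟦ b ⟧ ρ}) A≤B))
    where
    T⇒≡ : ∀ {b} → T b → b ≡ true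
    T⇒≡ {true} _ = refl

lin : ∀ n {ρ : Env n} goal hyp {_ : T (entails hyp goal)} → HoldsAt hyp ρ → HoldsAt goal ρ
lin n {ρ} goal hyp {t} = entails-sound hyp goal ρ t

absurd-≤ : ∀ n {ρ : Env n} hyp {_ : T (entails hyp (con 1 ≼ con 0))} → HoldsAt hyp ρ → ⊥
absurd-≤ n {ρ} hyp {t} h = <⇒≱ (entails-sound hyp (con 1 ≼ con 0) ρ t h) z≤n

infixl 6 _⊕_
infixr 7 _⊗_

-- `lin` takes one hypothesis, so several inequalities are added up first. The summands, with the
-- multipliers given by `_⊗_`, form a Farkas certificate for the conclusion.
_⊕_ : ∀ {a b c d} → a ≤ b → c ≤ d → a + c ≤ b + d
_⊕_ = +-mono-≤

_⊗_ : ∀ k {a b} → a ≤ b → k * a ≤ k * b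
_⊗_ k = *-monoʳ-≤ k

eq≤ : ∀ {a b : ℕ} → a ≡ b → a ≤ b
eq≤ = ≤-reflexive

eq≥ : ∀ {a b : ℕ} → a ≡ b → b ≤ a
eq≥ e = ≤-reflexive (sym e)


-- Classical reasoning under double negation

¬¬_ : Set → Set
¬¬ A = ¬ ¬ A
infix 3 ¬¬_

return : ∀ {A : Set} → A → ¬¬ A
return a k = k a

infixl 1 _>>=_
_>>=_ : ∀ {A B : Set} → ¬¬ A → (A → ¬¬ B) → ¬¬ B
(m >>= f) k = m (λ a → f a k)

em : ∀ (A : Set) → ¬¬ (A ⊎ ¬ A)
em A k = k (inj₂ (λ a → k (inj₁ a)))

absurd : ∀ {A : Set} → ⊥ → ¬¬ A
absurd ()

¬¬-all : ∀ {n} {P : Fin n → Set} → (∀ i → ¬¬ P i) → ¬¬ (∀ i → P i)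
¬¬-all {zero} h = return λ ()
¬¬-all {suc n} h = h zero >>= λ p → ¬¬-all (h ∘ suc) >>= λ ps → return λ { zero → p ; (suc i) → ps i }

opaque
  -- In `go` the number `k` bounds the improvements still possible below `b`. Whether an improvement
  -- exists is undecided for an arbitrary `X`, which is why the result stands under double negation.
  maximal : ∀ {X : Set} (μ : X → ℕ) b → (∀ x → μ x ≤ b) → X → ¬¬ (∃[ x ] (∀ y → μ y ≤ μ x))
  maximal {X} μ b bound x₀ = go b x₀ (m≤n+m b (μ x₀))
    where
    go : ∀ k x → b ≤ μ x + k → ¬¬ (∃[ x ] (∀ y → μ y ≤ μ x))
    go zero x h = return (x , λ y → ≤-trans (bound y) (≤-trans h (≤-reflexive (+-identityʳ _))))
    go (suc k) x h = em (∃[ y ] (μ x < μ y)) >>= λ where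
      (inj₁ (y , x<y)) → go k y (lin 4 ($0 ≼ $1 ⊞ $2) ($0 ⊞ (con 1 ⊞ $3) ≼ $3 ⊞ (con 1 ⊞ $2) ⊞ $1) (h ⊕ x<y))
      (inj₂ none) → return (x , λ y → ≮⇒≥ (λ x<y → none (y , x<y)))

-- Booleans, and equality on `Fin n` as a Boolean

true-or-false : ∀ b → b ≡ true ⊎ b ≡ false
true-or-false true = inj₁ refl
true-or-false false = inj₂ refl

clash : ∀ {b} {A : Set} → b ≡ true → b ≡ false → A
clash refl ()

¬true⇒false : ∀ {b} → ¬ (b ≡ true) → b ≡ false
¬true⇒false {true} h = ⊥-elim (h refl)
¬true⇒false {false} h = refl

¬false⇒true : ∀ {b} → ¬ (b ≡ false) → b ≡ true
¬false⇒true {true} h = refl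
¬false⇒true {false} h = ⊥-elim (h refl)

not-true : ∀ {b} → not b ≡ true → b ≡ false
not-true {false} _ = refl

not-false : ∀ {b} → b ≡ false → not b ≡ true
not-false refl = refl

∨-elim : ∀ {a b} → a ∨ b ≡ true → a ≡ true ⊎ b ≡ true
∨-elim {true} _ = inj₁ refl
∨-elim {false} h = inj₂ h

∨-introˡ : ∀ {a b} → a ≡ true → a ∨ b ≡ true
∨-introˡ refl = refl

∨-introʳ : ∀ {a b} → b ≡ true → a ∨ b ≡ true
∨-introʳ {true} _ = refl
∨-introʳ {false} h = h

eqᵇ-refl : ∀ {n} (i : Fin n) → eqᵇ i i ≡ true
eqᵇ-refl i with i ≟ᶠ i
... | yes _ = refl
... | no ¬p = ⊥-elim (¬p refl)

eqᵇ-true : ∀ {n} {i j : Fin n} → eqᵇ i j ≡ true → i ≡ j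
eqᵇ-true {i = i} {j} h with i ≟ᶠ j
... | yes p = p

eqᵇ-false : ∀ {n} {i j : Fin n} → i ≢ j → eqᵇ i j ≡ false
eqᵇ-false {i = i} {j} h with i ≟ᶠ j
... | yes p = ⊥-elim (h p)
... | no _ = refl

eqᵇ-≢ : ∀ {n} {i j : Fin n} → eqᵇ i j ≡ false → i ≢ j
eqᵇ-≢ {i = i} h refl = clash (eqᵇ-refl i) h

-- Sums and cardinalities of Boolean subsets of Fin n

sum : ∀ {n} → (Fin n → ℕ) → ℕ
sum {zero} f = 0
sum {suc n} f = f zero + sum (f ∘ suc)

sum-cong : ∀ {n} {f g : Fin n → ℕ} → (∀ i → f i ≡ g i) → sum f ≡ sum g
sum-cong {zero} h = refl
sum-cong {suc n} h = cong₂ _+_ (h zero) (sum-cong (h ∘ suc))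

sum-mono : ∀ {n} {f g : Fin n → ℕ} → (∀ i → f i ≤ g i) → sum f ≤ sum g
sum-mono {zero} h = z≤n
sum-mono {suc n} h = +-mono-≤ (h zero) (sum-mono (h ∘ suc))

sum-+ : ∀ {n} (f g : Fin n → ℕ) → sum (λ i → f i + g i) ≡ sum f + sum g
sum-+ {zero} f g = refl
sum-+ {suc n} f g rewrite sum-+ (f ∘ suc) (g ∘ suc) = swap (f zero) (g zero) (sum (f ∘ suc)) (sum (g ∘ suc))
  where
  swap : ∀ a b c d → a + b + (c + d) ≡ a + c + (b + d)
  swap = solve-∀

sum-* : ∀ {n} k (f : Fin n → ℕ) → sum (λ i → k * f i) ≡ k * sum f
sum-* {zero} k f = sym (*-zeroʳ k)
sum-* {suc n} k f rewrite sum-* k (f ∘ suc) = sym (*-distribˡ-+ k (f zero) _)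

sum-0 : ∀ {n} → sum {n} (λ _ → 0) ≡ 0
sum-0 {zero} = refl
sum-0 {suc n} = sum-0 {n}

sum-swap : ∀ {n m} (f : Fin n → Fin m → ℕ) → sum (λ i → sum (f i)) ≡ sum (λ j → sum (λ i → f i j))
sum-swap {zero} {m} f = sym (sum-0 {m})
sum-swap {suc n} f rewrite sum-swap (f ∘ suc) = sym (sum-+ (f zero) _)

b2n : Bool → ℕ
b2n true = 1
b2n false = 0

Sub : ℕ → Set
Sub n = Fin n → Bool

infix 4 _∈_ _∉_ _⊆_
_∈_ _∉_ : ∀ {n} → Fin n → Sub n → Set
v ∈ S = S v ≡ true
v ∉ S = S v ≡ false

_⊆_ : ∀ {n} → Sub n → Sub n → Set
S ⊆ T = ∀ v → v ∈ S → v ∈ T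

infixr 7 _∩_
infixr 6 _∪_
infixl 7 _∖_ _─_
⁅_⁆ : ∀ {n} → Fin n → Sub n
⁅ x ⁆ v = eqᵇ x v

opaque
  _∩_ _∪_ _∖_ : ∀ {n} → Sub n → Sub n → Sub n
  (S ∩ T) v = S v ∧ T v
  (S ∪ T) v = S v ∨ T v
  (S ∖ T) v = S v ∧ not (T v)

  _─_ : ∀ {n} → Sub n → Fin n → Sub n
  (S ─ x) v = S v ∧ not (eqᵇ x v)

∅ full : ∀ {n} → Sub n
∅ v = false
full v = true

opaque
  # : ∀ {n} → Sub n → ℕ
  # S = sum (λ v → b2n (S v))

opaque
  unfolding _∖_
  ∖-in : ∀ {n} {S T : Sub n} {v} → v ∈ S → v ∉ T → v ∈ S ∖ T
  ∖-in h k = ∧-intro h (not-false k)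

  ∖-left : ∀ {n} {S T : Sub n} {v} → v ∈ S ∖ T → v ∈ S
  ∖-left = ∧-fst

  ∖-right : ∀ {n} {S T : Sub n} {v} → v ∈ S ∖ T → v ∉ T
  ∖-right {S = S} {v = v} h = not-true (∧-snd {S v} h)

  ─-in : ∀ {n} {S : Sub n} {x v} → v ∈ S → x ≢ v → v ∈ S ─ x
  ─-in h k = ∧-intro h (not-false (eqᵇ-false k))

  ─-left : ∀ {n} {S : Sub n} {x v} → v ∈ S ─ x → v ∈ S
  ─-left = ∧-fst

  ─-right : ∀ {n} {S : Sub n} {x v} → v ∈ S ─ x → x ≢ v
  ─-right {S = S} {x} {v} h = eqᵇ-≢ (not-true (∧-snd {S v} h))

  ∩-in : ∀ {n} {S T : Sub n} {v} → v ∈ S → v ∈ T → v ∈ S ∩ T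
  ∩-in = ∧-intro

  ∩-left : ∀ {n} {S T : Sub n} {v} → v ∈ S ∩ T → v ∈ S
  ∩-left = ∧-fst

  ∩-right : ∀ {n} {S T : Sub n} {v} → v ∈ S ∩ T → v ∈ T
  ∩-right {S = S} {v = v} = ∧-snd {S v}

  ∪-inˡ : ∀ {n} {S T : Sub n} {v} → v ∈ S → v ∈ S ∪ T
  ∪-inˡ = ∨-introˡ

  ∪-inʳ : ∀ {n} {S T : Sub n} {v} → v ∈ T → v ∈ S ∪ T
  ∪-inʳ {S = S} {v = v} = ∨-introʳ {S v}

  ∪-out : ∀ {n} {S T : Sub n} {v} → v ∈ S ∪ T → v ∈ S ⊎ v ∈ T
  ∪-out = ∨-elim

opaque
  unfolding #
  #-mono : ∀ {n} {S T : Sub n} → S ⊆ T → # S ≤ # T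
  #-mono {S = S} {T} h = sum-mono λ v → pt (S v) (T v) (h v)
    where
    pt : ∀ a b → (a ≡ true → b ≡ true) → b2n a ≤ b2n b
    pt false _ _ = z≤n
    pt true b k rewrite k refl = ≤-refl

opaque
  unfolding #
  #-∪ : ∀ {n} {S T U : Sub n} → (∀ v → v ∈ S → v ∈ T ⊎ v ∈ U) → # S ≤ # T + # U
  #-∪ {S = S} {T} {U} h = ≤-trans (sum-mono λ v → pt (S v) (T v) (U v) (h v)) (≤-reflexive (sum-+ (b2n ∘ T) (b2n ∘ U)))
    where
    pt : ∀ a b c → (a ≡ true → b ≡ true ⊎ c ≡ true) → b2n a ≤ b2n b + b2n c
    pt false _ _ _ = z≤n
    pt true b c k with k refl
    ... | inj₁ refl = s≤s z≤n
    ... | inj₂ refl = m≤n+m 1 (b2n b)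

opaque
  unfolding #
  #-⊎ : ∀ {n} {S T U : Sub n} → T ⊆ S → U ⊆ S → (∀ v → v ∈ T → v ∈ U → ⊥) → # T + # U ≤ # S
  #-⊎ {S = S} {T} {U} h k d = ≤-trans (≤-reflexive (sym (sum-+ (b2n ∘ T) (b2n ∘ U)))) (sum-mono λ v → pt (S v) (T v) (U v) (h v) (k v) (d v))
    where
    pt : ∀ a b c → (b ≡ true → a ≡ true) → (c ≡ true → a ≡ true) → (b ≡ true → c ≡ true → ⊥) → b2n b + b2n c ≤ b2n a
    pt a false false _ _ _ = z≤n
    pt a true false f _ _ rewrite f refl = ≤-refl
    pt a false true _ g _ rewrite g refl = ≤-refl
    pt a true true _ _ e = ⊥-elim (e refl refl)

opaque
  unfolding #
  #-∅ : ∀ {n} {S : Sub n} → (∀ v → v ∈ S → ⊥) → # S ≡ 0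
  #-∅ {n} {S} h = trans (sum-cong λ v → cong b2n (¬true⇒false (h v))) (sum-0 {n})

opaque
  unfolding #
  #-⁅⁆ : ∀ {n} (x : Fin n) → # ⁅ x ⁆ ≡ 1
  #-⁅⁆ {suc n} zero = cong suc (#-∅ {n} {λ v → eqᵇ zero (suc v)} λ v h → case eqᵇ-true {i = Fin.zero} {suc v} h of λ ())
  #-⁅⁆ {suc n} (suc x) = trans (cong (_+ # (λ v → eqᵇ (suc x) (suc v))) (cong b2n (eqᵇ-false {i = suc x} {zero} λ ())))
    (trans (sum-cong λ v → cong b2n (shift v)) (#-⁅⁆ x))
    where
    shift : ∀ v → eqᵇ (suc x) (suc v) ≡ eqᵇ x v
    shift v with true-or-false (eqᵇ x v)
    ... | inj₁ e = trans (subst (λ w → eqᵇ (suc x) (suc w) ≡ true) (eqᵇ-true {i = x} e) (eqᵇ-refl (suc x))) (sym e)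
    ... | inj₂ e = trans (eqᵇ-false (eqᵇ-≢ {i = x} e ∘ sucᶠ-injective)) (sym e)

opaque
  unfolding # _∖_
  #-split : ∀ {n} (S T : Sub n) → # S ≡ # (S ∩ T) + # (S ∖ T)
  #-split S T = trans (sum-cong λ v → pt (S v) (T v)) (sum-+ (b2n ∘ (S ∩ T)) (b2n ∘ (S ∖ T)))
    where
    pt : ∀ a b → b2n a ≡ b2n (a ∧ b) + b2n (a ∧ not b)
    pt false _ = refl
    pt true true = refl
    pt true false = refl

opaque
  unfolding # _∖_
  #-─ : ∀ {n} (S : Sub n) {x} → x ∈ S → # S ≡ suc (# (S ─ x))
  #-─ S {x} x∈ = trans (#-split S ⁅ x ⁆) (cong (_+ # (S ─ x)) (trans (sum-cong λ v → cong b2n (pt v)) (#-⁅⁆ x)))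
    where
    pt : ∀ v → (S ∩ ⁅ x ⁆) v ≡ ⁅ x ⁆ v
    pt v with true-or-false (eqᵇ x v)
    ... | inj₁ e rewrite e | sym (eqᵇ-true {i = x} e) | x∈ = refl
    ... | inj₂ e rewrite e with S v
    ...   | true = refl
    ...   | false = refl

opaque
  unfolding #
  #-pos : ∀ {n} (S : Sub n) → 1 ≤ # S → ∃[ v ] v ∈ S
  #-pos {suc n} S h with true-or-false (S zero)
  ... | inj₁ e = zero , e
  ... | inj₂ e = case #-pos (S ∘ suc) (subst (λ b → 1 ≤ b2n b + # (S ∘ suc)) e h) of λ { (v , p) → suc v , p }

opaque
  unfolding #
  #-≤ : ∀ {n} (S : Sub n) → # S ≤ n
  #-≤ {zero} S = z≤n
  #-≤ {suc n} S with S zero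
  ... | true = s≤s (#-≤ (S ∘ suc))
  ... | false = m≤n⇒m≤1+n (#-≤ (S ∘ suc))

opaque
  elements : ∀ {n} (S : Sub n) m → m ≤ # S → Σ (Fin m → Fin n) λ f → (∀ i → f i ∈ S) × (∀ {i j} → f i ≡ f j → i ≡ j)
  elements {n} S zero h = (λ ()) , (λ ()) , λ { {()} }
  elements {n} S (suc m) h with #-pos S (≤-trans (s≤s z≤n) h)
  ... | x , x∈ with elements (S ─ x) m (lin 3 ($0 ≼ $1) (con 1 ⊞ $0 ⊞ $2 ≼ $2 ⊞ (con 1 ⊞ $1)) (h ⊕ eq≤ (#-─ S x∈)))
  ...   | f , f∈ , inj = f′ , f′∈ , inj′
    where
    f′ : Fin (suc m) → Fin n
    f′ zero = x
    f′ (suc i) = f i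
    f′∈ : ∀ i → f′ i ∈ S
    f′∈ zero = x∈
    f′∈ (suc i) = ─-left {S = S} (f∈ i)
    inj′ : ∀ {i j : Fin (suc m)} → f′ i ≡ f′ j → i ≡ j
    inj′ {zero} {zero} e = refl
    inj′ {zero} {suc j} e = ⊥-elim (─-right {S = S} (f∈ j) e)
    inj′ {suc i} {zero} e = ⊥-elim (─-right {S = S} (f∈ i) (sym e))
    inj′ {suc i} {suc j} e = cong suc (inj e)

opaque
  sumOver : ∀ {n} → Sub n → (Fin n → ℕ) → ℕ
  sumOver S f = sum (λ v → b2n (S v) * f v)

opaque
  unfolding # sumOver
  sumOver-mono : ∀ {n} (S : Sub n) {f g : Fin n → ℕ} → (∀ v → v ∈ S → f v ≤ g v) → sumOver S f ≤ sumOver S g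
  sumOver-mono S h = sum-mono λ v → pt (S v) (h v)
    where
    pt : ∀ a {x y} → (a ≡ true → x ≤ y) → b2n a * x ≤ b2n a * y
    pt false _ = z≤n
    pt true k = +-mono-≤ (k refl) z≤n

opaque
  unfolding # sumOver
  sumOver-const : ∀ {n} (S : Sub n) k → sumOver S (λ _ → k) ≡ k * # S
  sumOver-const S k = trans (sum-cong λ v → *-comm (b2n (S v)) k) (sum-* k (b2n ∘ S))

opaque
  unfolding # sumOver
  sumOver-+ : ∀ {n} (S : Sub n) f g → sumOver S (λ v → f v + g v) ≡ sumOver S f + sumOver S g
  sumOver-+ S f g = trans (sum-cong λ v → *-distribˡ-+ (b2n (S v)) (f v) (g v)) (sum-+ (λ v → b2n (S v) * f v) (λ v → b2n (S v) * g v))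

opaque
  unfolding # sumOver
  sumOver-* : ∀ {n} (S : Sub n) k f → sumOver S (λ v → k * f v) ≡ k * sumOver S f
  sumOver-* S k f = trans (sum-cong λ v → swap (b2n (S v)) k (f v)) (sum-* k (λ v → b2n (S v) * f v))
    where
    swap : ∀ a b c → a * (b * c) ≡ b * (a * c)
    swap = solve-∀

opaque
  unfolding # sumOver _∖_
  sumOver-# : ∀ {n} (S T : Sub n) → sumOver S (λ v → b2n (T v)) ≡ # (S ∩ T)
  sumOver-# S T = sum-cong λ v → pt (S v) (T v)
    where
    pt : ∀ a b → b2n a * b2n b ≡ b2n (a ∧ b)
    pt false _ = refl
    pt true true = refl
    pt true false = refl

opaque
  unfolding # sumOver
  sumOver-swap : ∀ {n} (S T : Sub n) (f : Fin n → Fin n → ℕ) →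
    sumOver S (λ u → sumOver T (f u)) ≡ sumOver T (λ v → sumOver S (λ u → f u v))
  sumOver-swap S T f = begin
    sum (λ u → b2n (S u) * sum (λ v → b2n (T v) * f u v))   ≡⟨ sum-cong (λ u → sym (sum-* (b2n (S u)) (λ v → b2n (T v) * f u v))) ⟩
    sum (λ u → sum (λ v → b2n (S u) * (b2n (T v) * f u v)))  ≡⟨ sum-swap (λ u v → b2n (S u) * (b2n (T v) * f u v)) ⟩
    sum (λ v → sum (λ u → b2n (S u) * (b2n (T v) * f u v)))  ≡⟨ sum-cong (λ v → sum-cong λ u → swap (b2n (S u)) (b2n (T v)) (f u v)) ⟩
    sum (λ v → sum (λ u → b2n (T v) * (b2n (S u) * f u v)))  ≡⟨ sum-cong (λ v → sum-* (b2n (T v)) (λ u → b2n (S u) * f u v)) ⟩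
    sum (λ v → b2n (T v) * sum (λ u → b2n (S u) * f u v))   ∎
    where
    open ≡-Reasoning
    swap : ∀ a b c → a * (b * c) ≡ b * (a * c)
    swap = solve-∀

opaque
  unfolding # sumOver
  -- Both sides are compared with the number of related pairs, summed over `B` and over `A`.
  double-count : ∀ {n} (A B : Sub n) (r : Fin n → Fin n → Bool) k l →
    (∀ a → a ∈ A → # (B ∩ r a) ≤ k) → (∀ b → b ∈ B → l ≤ # (A ∩ λ a → r a b)) → l * # B ≤ k * # A
  double-count A B r k l hA hB = begin
    l * # B                                       ≡⟨ sym (sumOver-const B l) ⟩
    sumOver B (λ _ → l)                           ≤⟨ sumOver-mono B hB ⟩
    sumOver B (λ b → # (A ∩ λ a → r a b))         ≡⟨ sum-cong (λ b → cong (b2n (B b) *_) (sym (sumOver-# A (λ a → r a b)))) ⟩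
    sumOver B (λ b → sumOver A (λ a → b2n (r a b))) ≡⟨ sym (sumOver-swap A B (λ a b → b2n (r a b))) ⟩
    sumOver A (λ a → sumOver B (λ b → b2n (r a b))) ≡⟨ sum-cong (λ a → cong (b2n (A a) *_) (sumOver-# B (r a))) ⟩
    sumOver A (λ a → # (B ∩ r a))                 ≤⟨ sumOver-mono A hA ⟩
    sumOver A (λ _ → k)                           ≡⟨ sumOver-const A k ⟩
    k * # A                                       ∎
    where open ≤-Reasoning

#-─-≤ : ∀ {n} (S : Sub n) a → # S ≤ suc (# (S ─ a))
#-─-≤ S a = lin 3 ($0 ≼ con 1 ⊞ $1) ($0 ⊞ $2 ≼ $2 ⊞ $1 ⊞ con 1) (#-∪ {S = S} {⁅ a ⁆} {S ─ a} split ⊕ eq≤ (#-⁅⁆ a))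
  where
  split : ∀ v → v ∈ S → v ∈ ⁅ a ⁆ ⊎ v ∈ S ─ a
  split v v∈ with true-or-false (eqᵇ a v)
  ... | inj₁ e = inj₁ e
  ... | inj₂ e = inj₂ (─-in v∈ (eqᵇ-≢ e))

-- Boolean identities by truth tables

BoolFun : ℕ → Set
BoolFun zero = Bool
BoolFun (suc k) = Bool → BoolFun k

check : ∀ k → BoolFun k → Bool
check zero b = b
check (suc k) f = check k (f true) ∧ check k (f false)

Holds : ∀ k → BoolFun k → Set
Holds zero b = b ≡ true
Holds (suc k) f = ∀ b → Holds k (f b)

tautology : ∀ k (f : BoolFun k) → check k f ≡ true → Holds k f
tautology zero f h = h
tautology (suc k) f h true = tautology k (f true) (∧-fst h)
tautology (suc k) f h false = tautology k (f false) (∧-snd {check k (f true)} h)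

_≈ᵇ_ : Bool → Bool → Bool
a ≈ᵇ b = not (a xor b)

≈ᵇ-sound : ∀ a b → a ≈ᵇ b ≡ true → a ≡ b
≈ᵇ-sound true true _ = refl
≈ᵇ-sound false false _ = refl

-- Images of finite sequences, and transpositions

opaque
  image : ∀ {m n} → (Fin m → Fin n) → Sub n
  image f v = ⌊ any? (λ i → f i ≟ᶠ v) ⌋

  image-in : ∀ {m n} (f : Fin m → Fin n) i → f i ∈ image f
  image-in f i with any? (λ j → f j ≟ᶠ f i)
  ... | yes _ = refl
  ... | no k = ⊥-elim (k (i , refl))

  image-out : ∀ {m n} (f : Fin m → Fin n) {v} → v ∈ image f → ∃[ i ] f i ≡ v
  image-out f {v} h with any? (λ i → f i ≟ᶠ v)
  ... | yes p = p

image-∉ : ∀ {m n} (f : Fin m → Fin n) {v} → v ∉ image f → ∀ i → f i ≢ v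
image-∉ f h i refl = clash (image-in f i) h

∉-image : ∀ {m n} (f : Fin m → Fin n) {v} → (∀ i → f i ≢ v) → v ∉ image f
∉-image f h = ¬true⇒false λ k → case image-out f k of λ { (i , e) → h i e }

#-image-≤ : ∀ {m n} (f : Fin m → Fin n) → # (image f) ≤ m
#-image-≤ {zero} f = ≤-reflexive (#-∅ λ v h → case image-out f h of λ { (() , _) })
#-image-≤ {suc m} f = lin 4 ($0 ≼ con 1 ⊞ $1) ($0 ⊞ $2 ⊞ $3 ≼ $3 ⊞ $2 ⊞ $1 ⊞ con 1) (#-∪ {S = image f} {⁅ f zero ⁆} {image (f ∘ suc)} split ⊕ #-image-≤ (f ∘ suc) ⊕ eq≤ (#-⁅⁆ (f zero)))
  where
  split : ∀ v → v ∈ image f → v ∈ ⁅ f zero ⁆ ⊎ v ∈ image (f ∘ suc)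
  split v h with image-out f h
  ... | zero , refl = inj₁ (eqᵇ-refl (f zero))
  ... | suc i , refl = inj₂ (image-in (f ∘ suc) i)

#-image-≥ : ∀ {m n} (f : Fin m → Fin n) → (∀ {i j} → f i ≡ f j → i ≡ j) → m ≤ # (image f)
#-image-≥ {zero} f inj = z≤n
#-image-≥ {suc m} f inj = lin 4 (con 1 ⊞ $0 ≼ $1) ($2 ⊞ $3 ⊞ $0 ⊞ con 1 ≼ $1 ⊞ $3 ⊞ $2) (#-⊎ {S = image f} {⁅ f zero ⁆} {image (f ∘ suc)} first others disjoint
  ⊕ #-image-≥ (f ∘ suc) (sucᶠ-injective ∘ inj) ⊕ eq≥ (#-⁅⁆ (f zero)))
  where
  first : ⁅ f zero ⁆ ⊆ image f
  first v h = subst (_∈ image f) (eqᵇ-true {i = f zero} h) (image-in f zero)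
  others : image (f ∘ suc) ⊆ image f
  others v h with image-out (f ∘ suc) h
  ... | i , refl = image-in f (suc i)
  disjoint : ∀ v → v ∈ ⁅ f zero ⁆ → v ∈ image (f ∘ suc) → ⊥
  disjoint v h k with image-out (f ∘ suc) k
  ... | i , e with inj {zero} {suc i} (trans (eqᵇ-true {i = f zero} h) (sym e))
  ...   | ()

-- The transposition of `x` and `y`. Applied to all vertices of a packing it exchanges a packed
-- vertex for a leftover; as an involution it keeps the packing injective.
τ : ∀ {n} → Fin n → Fin n → Fin n → Fin n
τ x y v = if eqᵇ x v then y else (if eqᵇ y v then x else v)

τ-left : ∀ {n} (x y : Fin n) → τ x y x ≡ y
τ-left x y rewrite eqᵇ-refl x = refl

τ-right : ∀ {n} (x y : Fin n) → τ x y y ≡ x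
τ-right x y with true-or-false (eqᵇ x y)
... | inj₁ e rewrite e = sym (eqᵇ-true {i = x} e)
... | inj₂ e rewrite e | eqᵇ-refl y = refl

τ-other : ∀ {n} (x y : Fin n) {v} → x ≢ v → y ≢ v → τ x y v ≡ v
τ-other x y h k rewrite eqᵇ-false h | eqᵇ-false k = refl

τ-involutive : ∀ {n} (x y v : Fin n) → τ x y (τ x y v) ≡ v
τ-involutive x y v with true-or-false (eqᵇ x v) | true-or-false (eqᵇ y v)
... | inj₁ e | _ rewrite e = trans (τ-right x y) (eqᵇ-true {i = x} e)
... | inj₂ e | inj₁ e′ rewrite e | e′ = trans (τ-left x y) (eqᵇ-true {i = y} e′)
... | inj₂ e | inj₂ e′ rewrite e | e′ = τ-other x y (eqᵇ-≢ {i = x} e) (eqᵇ-≢ {i = y} e′)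

-- Triangle-free complements, the two-graph of gulls, and packing by exchanges

-- c is the adjacency of the complement of a graph with independence number at most two.

record TriangleFree (n : ℕ) : Set where
  field
    c : Fin n → Fin n → Bool
    c-sym : ∀ u v → c u v ≡ c v u
    c-irr : ∀ u → c u u ≡ false
    c-tri : ∀ u v w → c u v ≡ true → c v w ≡ true → c u w ≡ true → ⊥

pattern 0F = zero
pattern 1F = suc zero
pattern 2F = suc (suc zero)

n1 n2 : Fin 3 → Fin 3
n1 0F = 1F
n1 1F = 2F
n1 2F = 0F
n2 0F = 2F
n2 1F = 0F
n2 2F = 1F

fin3 : ∀ k (j : Fin 3) → j ≡ k ⊎ j ≡ n1 k ⊎ j ≡ n2 k
fin3 0F 0F = inj₁ refl
fin3 0F 1F = inj₂ (inj₁ refl)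
fin3 0F 2F = inj₂ (inj₂ refl)
fin3 1F 0F = inj₂ (inj₂ refl)
fin3 1F 1F = inj₁ refl
fin3 1F 2F = inj₂ (inj₁ refl)
fin3 2F 0F = inj₂ (inj₁ refl)
fin3 2F 1F = inj₂ (inj₂ refl)
fin3 2F 2F = inj₁ refl

n1-≢ : ∀ k → n1 k ≢ k
n1-≢ 0F ()
n1-≢ 1F ()
n1-≢ 2F ()

n2-≢ : ∀ k → n2 k ≢ k
n2-≢ 0F ()
n2-≢ 1F ()
n2-≢ 2F ()

-- Three vertices are a gull when they span exactly one edge of the complement, that is, when they
-- induce a three-vertex path in the graph. As the complement is triangle-free this is the parity g,
-- and the gulls form a two-graph (g is a cocycle).

module Gulls {n} (𝒞 : TriangleFree n) where
  open TriangleFree 𝒞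

  g : Fin n → Fin n → Fin n → Bool
  g u v w = c u v xor (c u w xor c v w)

  -- Each of the six pairs lies in two of the four triples, so its contribution cancels.
  cocycle : ∀ u v w x → g u v w xor (g u v x xor (g u w x xor g v w x)) ≡ false
  cocycle u v w x = ≈ᵇ-sound _ false (tautology 6
    (λ a b d e f h → ((a xor (b xor e)) xor ((a xor (d xor f)) xor ((b xor (d xor h)) xor (e xor (f xor h))))) ≈ᵇ false) refl
    (c u v) (c u w) (c u x) (c v w) (c v x) (c w x))

  g-swap₁ : ∀ u v w → g u v w ≡ g v u w
  g-swap₁ u v w rewrite c-sym v u = ≈ᵇ-sound _ _ (tautology 3 (λ a b e → (a xor (b xor e)) ≈ᵇ (a xor (e xor b))) refl (c u v) (c u w) (c v w))

  g-swap₂ : ∀ u v w → g u v w ≡ g u w v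
  g-swap₂ u v w rewrite c-sym w v = ≈ᵇ-sound _ _ (tautology 3 (λ a b e → (a xor (b xor e)) ≈ᵇ (b xor (a xor e))) refl (c u v) (c u w) (c v w))

  g-rot : ∀ u v w → g u v w ≡ g v w u
  g-rot u v w = trans (g-swap₁ u v w) (g-swap₂ v u w)

  g-rev : ∀ u v w → g u v w ≡ g w v u
  g-rev u v w = trans (g-rot u v w) (g-swap₁ v w u)

  g-irr : ∀ u w → g u u w ≡ false
  g-irr u w rewrite c-irr u with c u w
  ... | true = refl
  ... | false = refl

  gull-≢₁₂ : ∀ {u v w} → g u v w ≡ true → u ≢ v
  gull-≢₁₂ {u} {v} {w} h refl = clash h (g-irr u w)

  gull-≢₁₃ : ∀ {u v w} → g u v w ≡ true → u ≢ w
  gull-≢₁₃ {u} {v} {w} h = gull-≢₁₂ (trans (sym (g-swap₂ u v w)) h)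

  gull-≢₂₃ : ∀ {u v w} → g u v w ≡ true → v ≢ w
  gull-≢₂₃ {u} {v} {w} h = gull-≢₁₂ (trans (sym (g-rot u v w)) h)

  private
    fourth : ∀ a b d e → a xor (b xor (d xor e)) ≡ false → a ≡ false → b ≡ false → d ≡ false → e ≡ false
    fourth false false false e h _ _ _ = h

  even : ∀ {u v w x} → g u v w ≡ false → g u v x ≡ false → g u w x ≡ false → g v w x ≡ false
  even {u} {v} {w} {x} = fourth (g u v w) (g u v x) (g u w x) (g v w x) (cocycle u v w x)

  -- Every triple spans zero or two edges of the complement, so on `Z` the complement is edgeless or
  -- complete bipartite.
  Coherent : Sub n → Set
  Coherent Z = ∀ {x y z} → x ∈ Z → y ∈ Z → z ∈ Z → g x y z ≡ false

  gull : (Fin 3 → Fin n) → Bool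
  gull t = g (t 0F) (t 1F) (t 2F)

  gull-cong : ∀ {s t} → (∀ a → s a ≡ t a) → gull s ≡ gull t
  gull-cong h rewrite h 0F | h 1F | h 2F = refl

  gull-at : ∀ t k → gull t ≡ g (t k) (t (n1 k)) (t (n2 k))
  gull-at t 0F = refl
  gull-at t 1F = g-rot _ _ _
  gull-at t 2F = sym (g-rot _ _ _)

  gull-injective : ∀ t → gull t ≡ true → ∀ {a b} → t a ≡ t b → a ≡ b
  gull-injective t h {a} {b} e with fin3 a b
  ... | inj₁ refl = refl
  ... | inj₂ (inj₁ refl) = ⊥-elim (gull-≢₁₂ (trans (sym (gull-at t a)) h) e)
  ... | inj₂ (inj₂ refl) = ⊥-elim (gull-≢₁₃ (trans (sym (gull-at t a)) h) e)

  -- x replaces the k-th vertex of t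
  swapped : (Fin 3 → Fin n) → Fin 3 → Fin n → Bool
  swapped t k x = g x (t (n1 k)) (t (n2 k))

  -- By `cocycle` for `x` and the vertices of `t`, an odd number of the three replacements are
  -- gulls.
  some-slot : ∀ t x → gull t ≡ true → ∃[ k ] swapped t k x ≡ true
  some-slot t x h with true-or-false (swapped t 0F x) | true-or-false (swapped t 1F x) | true-or-false (swapped t 2F x)
  ... | inj₁ e | _ | _ = 0F , e
  ... | inj₂ _ | inj₁ e | _ = 1F , e
  ... | inj₂ _ | inj₂ _ | inj₁ e = 2F , e
  ... | inj₂ e₀ | inj₂ e₁ | inj₂ e₂ =
    clash h (even e₂ e₁′ e₀)
    where
    e₁′ : g x (t 0F) (t 2F) ≡ false
    e₁′ = trans (g-swap₂ x _ _) e₁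

  record Packing (D : Sub n) (r : ℕ) : Set where
    field
      p : Fin r → Fin 3 → Fin n
      p∈ : ∀ i a → p i a ∈ D
      gulls : ∀ i → gull (p i) ≡ true
      p-injective : ∀ {i j a b} → p i a ≡ p j b → i ≡ j × a ≡ b

    Out : Fin n → Set
    Out x = x ∈ D × (∀ i a → p i a ≢ x)

    flat : Fin (r * 3) → Fin n
    flat k = p (proj₁ (remQuot 3 k)) (proj₂ (remQuot {r} 3 k))

    rest : Sub n
    rest = D ∖ image flat

    rest-out : ∀ {x} → x ∈ rest → Out x
    rest-out {x} h = ∖-left {S = D} {T = image flat} h , λ i a e →
      image-∉ flat (∖-right {S = D} {T = image flat} h) (combine i a)
        (trans (cong₂ p (cong proj₁ (remQuot-combine {r} i a)) (cong proj₂ (remQuot-combine {r} i a))) e)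

    out-rest : ∀ {x} → Out x → x ∈ rest
    out-rest (h , k) = ∖-in {S = D} {T = image flat} h (∉-image flat λ j e → k _ _ e)

    #-rest : # D ≤ # rest + r * 3
    #-rest = ≤-trans (#-∪ {S = D} {rest} {image flat} split) (lin 3 ($0 ⊞ $1 ≼ $0 ⊞ $2) ($1 ≼ $2) (#-image-≤ flat))
      where
      split : ∀ v → v ∈ D → v ∈ rest ⊎ v ∈ image flat
      split v h with true-or-false (image flat v)
      ... | inj₁ k = inj₂ k
      ... | inj₂ k = inj₁ (∖-in {S = D} {T = image flat} h k)

  open Packing

  empty : ∀ {D} → Packing D 0
  empty = record { p = λ () ; p∈ = λ () ; gulls = λ () ; p-injective = λ {} }

  extend : ∀ {D r} (P : Packing D r) {x y z} → Out P x → Out P y → Out P z → g x y z ≡ true → Packing D (suc r)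
  extend {D} {r} P {x} {y} {z} ox oy oz h = record { p = q ; p∈ = q∈ ; gulls = qg ; p-injective = qi }
    where
    t : Fin 3 → Fin n
    t 0F = x
    t 1F = y
    t 2F = z
    ot : ∀ a → Out P (t a)
    ot 0F = ox
    ot 1F = oy
    ot 2F = oz
    q : Fin (suc r) → Fin 3 → Fin n
    q zero = t
    q (suc i) = p P i
    q∈ : ∀ i a → q i a ∈ D
    q∈ zero a = proj₁ (ot a)
    q∈ (suc i) a = p∈ P i a
    qg : ∀ i → gull (q i) ≡ true
    qg zero = h
    qg (suc i) = gulls P i
    qi : ∀ {i j a b} → q i a ≡ q j b → i ≡ j × a ≡ b
    qi {zero} {zero} e = refl , gull-injective t h e
    qi {zero} {suc j} {a} {b} e = ⊥-elim (proj₂ (ot a) j b (sym e))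
    qi {suc i} {zero} {a} {b} e = ⊥-elim (proj₂ (ot b) i a e)
    qi {suc i} {suc j} e with p-injective P e
    ... | refl , k = refl , k

  record Exchanged {D r} (P : Packing D r) (i : Fin r) (k : Fin 3) (x : Fin n) : Set where
    field
      Q : Packing D r
      out : ∀ {y} → Out P y → x ≢ y → Out Q y
      freed : Out Q (p P i k)
      same : ∀ {j a} → (j , a) ≢ (i , k) → p Q j a ≡ p P j a
      changed : p Q i k ≡ x

  exchange : ∀ {D r} (P : Packing D r) i k {x} → Out P x → swapped (p P i) k x ≡ true → Exchanged P i k x
  exchange {D} {r} P i k {x} (x∈ , x∉) h = record
    { Q = record { p = q ; p∈ = q∈ ; gulls = qg ; p-injective = qi }
    ; out = λ { {y} (y∈ , y∉) x≢y → y∈ , λ j a e →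
        y∉ j a (trans (sym (τ-involutive w x (p P j a))) (trans (cong (τ w x) e) (τ-other w x (y∉ i k) x≢y))) }
    ; freed = p∈ P i k , λ j a e → x∉ j a (trans (sym (τ-involutive w x (p P j a))) (trans (cong (τ w x) e) (τ-left w x)))
    ; same = same
    ; changed = τ-left w x
    }
    where
    w : Fin n
    w = p P i k
    q : Fin r → Fin 3 → Fin n
    q j a = τ w x (p P j a)
    same : ∀ {j a} → (j , a) ≢ (i , k) → q j a ≡ p P j a
    same {j} {a} ne = τ-other w x (λ e → case p-injective P e of λ { (refl , refl) → ne refl }) (λ e → x∉ j a (sym e))
    q∈ : ∀ j a → q j a ∈ D
    q∈ j a with true-or-false (eqᵇ w (p P j a)) | true-or-false (eqᵇ x (p P j a))
    ... | inj₁ e | _ rewrite e = x∈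
    ... | inj₂ e | inj₁ e′ rewrite e | e′ = p∈ P i k
    ... | inj₂ e | inj₂ e′ rewrite e | e′ = p∈ P j a
    qg : ∀ j → gull (q j) ≡ true
    qg j with j ≟ᶠ i
    ... | no j≢i = trans (gull-cong λ a → same {j} {a} λ { refl → j≢i refl }) (gulls P j)
    ... | yes refl = trans (gull-at (q i) k)
      (trans (cong₂ (λ a b → a b) (cong₂ g (τ-left w x) (same λ e → n1-≢ k (cong proj₂ e))) (same λ e → n2-≢ k (cong proj₂ e))) h)
    qi : ∀ {j l a b} → q j a ≡ q l b → j ≡ l × a ≡ b
    qi {j} {l} {a} {b} e = p-injective P (trans (sym (τ-involutive w x _)) (trans (cong (τ w x) e) (τ-involutive w x _)))

  module Saturated {D : Sub n} {r : ℕ} (none : ¬ Packing D (suc r)) where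

    leftover : (P : Packing D r) → ∀ {x y z} → Out P x → Out P y → Out P z → g x y z ≡ false
    leftover P ox oy oz = ¬true⇒false λ h → none (extend P ox oy oz h)

    -- w and x can replace each other in P, hence w joins the rest
    joins : (P : Packing D r) → ∀ i k {x} → Out P x → swapped (p P i) k x ≡ true →
      ∀ {y z} → Out P y → Out P z → x ≢ y → x ≢ z → g (p P i k) y z ≡ false
    joins P i k ox h oy oz x≢y x≢z = leftover Q freed (out oy x≢y) (out oz x≢z)
      where open Exchanged (exchange P i k ox h)

    same-swapped : (P : Packing D r) → ∀ i k {x} (ox : Out P x) (h : swapped (p P i) k x ≡ true) →
      ∀ {j} → j ≢ i → ∀ b y → swapped (p (Exchanged.Q (exchange P i k ox h)) j) b y ≡ swapped (p P j) b y
    same-swapped P i k ox h j≢i b y = cong₂ (g y) (same λ { refl → j≢i refl }) (same λ { refl → j≢i refl })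
      where open Exchanged (exchange P i k ox h)

    -- Two exchanges in a row: `y₁` frees the vertex `v` in slot `b` of `P j`, and `v` then replaces
    -- some vertex `p P i a`, which becomes a leftover beside `y₂` and `z`. With `y₂` starting the
    -- chain it becomes a leftover beside `y₁` and `z`. In a saturated packing it then forms a gull
    -- with neither pair, against `blocked`.
    no-common-slot : (P : Packing D r) → ∀ {i j} → j ≢ i → ∀ {y₁ y₂ z} → Out P y₁ → Out P y₂ → Out P z →
      y₁ ≢ y₂ → y₁ ≢ z → y₂ ≢ z →
      (∀ a → g (p P i a) y₂ z ≡ true ⊎ g (p P i a) y₁ z ≡ true) →
      ∀ b → swapped (p P j) b y₁ ≡ true → swapped (p P j) b y₂ ≡ true → ⊥
    no-common-slot P {i} {j} j≢i {y₁} {y₂} {z} o₁ o₂ oz y₁≢y₂ y₁≢z y₂≢z blocked b h₁ h₂ = contra (blocked a)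
      where
      v : Fin n
      v = p P j b
      slot : ∃[ a ] swapped (p P i) a v ≡ true
      slot = some-slot (p P i) v (gulls P i)
      a : Fin 3
      a = proj₁ slot
      go : ∀ {x x′} (ox : Out P x) (h : swapped (p P j) b x ≡ true) → Out P x′ → x ≢ x′ → x ≢ z → g (p P i a) x′ z ≡ false
      go {x} {x′} ox h ox′ ne nz = subst (λ u → g u x′ z ≡ false) (same λ e → j≢i (sym (cong proj₁ e)))
        (joins Q i a freed (trans (same-swapped P j b ox h (j≢i ∘ sym) a v) (proj₂ slot))
          (out ox′ ne) (out oz nz) (proj₂ ox′ j b) (proj₂ oz j b))
        where open Exchanged (exchange P j b ox h)
      contra : g (p P i a) y₂ z ≡ true ⊎ g (p P i a) y₁ z ≡ true → ⊥
      contra (inj₁ e) = clash e (go o₁ h₁ o₂ y₁≢y₂ y₁≢z)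
      contra (inj₂ e) = clash e (go o₂ h₂ o₁ (y₁≢y₂ ∘ sym) y₂≢z)

    -- With two candidates for the slot, its vertex can be freed even if one of the candidates has
    -- to stay a leftover.
    Double : (P : Packing D r) → Fin r → Set
    Double P i = ∃[ k ] ∃[ x ] ∃[ x′ ] (x ≢ x′ × Out P x × Out P x′ × swapped (p P i) k x ≡ true × swapped (p P i) k x′ ≡ true)

    four-leftovers : (P : Packing D r) → ∀ i (x : Fin 4 → Fin n) → (∀ k → Out P (x k)) → (∀ {k l} → x k ≡ x l → k ≡ l) → Double P i
    four-leftovers P i x ox inj with pigeonhole {3} {4} (s≤s (s≤s (s≤s (s≤s z≤n)))) (λ k → proj₁ (some-slot (p P i) (x k) (gulls P i)))
    ... | k , l , k<l , e = _ , x k , x l , (λ q → <⇒≢ᶠ k<l (inj q)) , ox k , ox l ,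
      proj₂ (some-slot (p P i) (x k) (gulls P i)) ,
      subst (λ s → swapped (p P i) s (x l) ≡ true) (sym e) (proj₂ (some-slot (p P i) (x l) (gulls P i)))

    -- If every leftover has its own slot in P i, then P i and the three leftovers form the two-graph of the
    -- pentagon. This excludes a second gull P j.
    module Pentagon (P : Packing D r) {i j : Fin r} (j≢i : j ≢ i) (x : Fin 3 → Fin n) (ox : ∀ k → Out P (x k))
      (x-inj : ∀ {k l} → x k ≡ x l → k ≡ l) (own : ∀ k → swapped (p P i) k (x k) ≡ true)
      (foreign : ∀ k l → k ≢ l → swapped (p P i) k (x l) ≡ false) where

      w : Fin 3 → Fin n
      w = p P i

      third : ∀ k l m → k ≢ m → l ≢ m → k ≢ l → ∀ y → swapped w m y ≡ g (w k) (w l) y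
      third k l m k≢m l≢m k≢l y with fin3 m k | fin3 m l
      ... | inj₁ e | _ = ⊥-elim (k≢m e)
      ... | _ | inj₁ e = ⊥-elim (l≢m e)
      ... | inj₂ (inj₁ e) | inj₂ (inj₁ e′) = ⊥-elim (k≢l (trans e (sym e′)))
      ... | inj₂ (inj₂ e) | inj₂ (inj₂ e′) = ⊥-elim (k≢l (trans e (sym e′)))
      ... | inj₂ (inj₁ refl) | inj₂ (inj₂ refl) = g-rot y _ _
      ... | inj₂ (inj₂ refl) | inj₂ (inj₁ refl) = trans (g-rot y _ _) (g-swap₁ _ _ y)

      -- Among the four triples of `w k`, `w l`, `x m`, `x k`, the triple without `x k` is a gull by
      -- `own`, the one without `x m` is not by `foreign`, and the one without `w k` is not by
      -- `joins`. Parity decides the last one.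
      beta : ∀ k l m → k ≢ m → l ≢ m → k ≢ l → g (w k) (x m) (x k) ≡ true
      beta k l m k≢m l≢m k≢l = solve′ _ _ _ _ (cocycle (w k) (w l) (x m) (x k))
        (trans (sym (third k l m k≢m l≢m k≢l (x m))) (own m))
        (trans (sym (third k l m k≢m l≢m k≢l (x k))) (foreign m k (k≢m ∘ sym)))
        (joins P i l (ox l) (own l) (ox m) (ox k) (l≢m ∘ x-inj) (k≢l ∘ sym ∘ x-inj))
        where
        solve′ : ∀ a b d e → a xor (b xor (d xor e)) ≡ false → a ≡ true → b ≡ false → e ≡ false → d ≡ true
        solve′ true false true false _ _ _ _ = refl

      pair : ∀ k l m → k ≢ m → l ≢ m → k ≢ l → ∀ b → swapped (p P j) b (x k) ≡ true → swapped (p P j) b (x l) ≡ true → ⊥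
      pair k l m k≢m l≢m k≢l = no-common-slot P j≢i (ox k) (ox l) (ox m) (k≢l ∘ x-inj) (k≢m ∘ x-inj) (l≢m ∘ x-inj) blocked
        where
        blocked : ∀ a → g (w a) (x l) (x m) ≡ true ⊎ g (w a) (x k) (x m) ≡ true
        blocked a with a ≟ᶠ k | a ≟ᶠ l
        ... | yes refl | _ = inj₂ (trans (g-swap₂ _ _ _) (beta k l m k≢m l≢m k≢l))
        ... | _ | yes refl = inj₁ (trans (g-swap₂ _ _ _) (beta l k m l≢m k≢m (k≢l ∘ sym)))
        ... | no a≢k | no a≢l = inj₁ (subst (λ a → g (w a) (x l) (x m) ≡ true) m≡a (beta m k l (l≢m ∘ sym) k≢l (k≢m ∘ sym)))
          where
          m≡a : m ≡ a
          m≡a with fin3 k a | fin3 k m | fin3 k l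
          ... | inj₁ e | _ | _ = ⊥-elim (a≢k e)
          ... | _ | inj₁ e | _ = ⊥-elim (k≢m (sym e))
          ... | _ | _ | inj₁ e = ⊥-elim (k≢l (sym e))
          ... | inj₂ (inj₁ e) | inj₂ (inj₁ e′) | _ = trans e′ (sym e)
          ... | inj₂ (inj₂ e) | inj₂ (inj₂ e′) | _ = trans e′ (sym e)
          ... | inj₂ (inj₁ e) | inj₂ (inj₂ e′) | inj₂ (inj₁ e″) = ⊥-elim (a≢l (trans e (sym e″)))
          ... | inj₂ (inj₁ e) | inj₂ (inj₂ e′) | inj₂ (inj₂ e″) = ⊥-elim (l≢m (trans e″ (sym e′)))
          ... | inj₂ (inj₂ e) | inj₂ (inj₁ e′) | inj₂ (inj₂ e″) = ⊥-elim (a≢l (trans e (sym e″)))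
          ... | inj₂ (inj₂ e) | inj₂ (inj₁ e′) | inj₂ (inj₁ e″) = ⊥-elim (l≢m (trans e″ (sym e′)))

      private
        module X₁ = Exchanged (exchange P i 0F (ox 0F) (own 0F))

        row₁ : ∀ b y → swapped (p X₁.Q j) b y ≡ swapped (p P j) b y
        row₁ = same-swapped P i 0F (ox 0F) (own 0F) j≢i

        at₁ : ∀ {a} → a ≢ 0F → p X₁.Q i a ≡ w a
        at₁ ne = X₁.same (ne ∘ cong proj₂)

        out₁ : ∀ k → k ≢ 0F → Out X₁.Q (x k)
        out₁ k ne = X₁.out (ox k) (λ e → ne (sym (x-inj e)))

      -- The argument of `pair` after `x 0F` has replaced `w 0F`, which thereby is a leftover.
      freed-pair : ∀ l m → l ≢ 0F → m ≢ 0F → l ≢ m → ∀ b → swapped (p P j) b (w 0F) ≡ true → swapped (p P j) b (x l) ≡ true → ⊥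
      freed-pair l m l≢0 m≢0 l≢m b h₁ h₂ =
        no-common-slot X₁.Q j≢i X₁.freed (out₁ l l≢0) (out₁ m m≢0) (proj₂ (ox l) i 0F) (proj₂ (ox m) i 0F) (l≢m ∘ x-inj) blocked b
          (trans (row₁ b _) h₁) (trans (row₁ b _) h₂)
        where
        blocked : ∀ a → g (p X₁.Q i a) (x l) (x m) ≡ true ⊎ g (p X₁.Q i a) (w 0F) (x m) ≡ true
        blocked a with a ≟ᶠ 0F | a ≟ᶠ l | a ≟ᶠ m
        ... | yes refl | _ | _ = inj₂ (subst (λ u → g u (w 0F) (x m) ≡ true) (sym X₁.changed)
                (trans (g-rot _ _ _) (beta 0F l m (m≢0 ∘ sym) l≢m (l≢0 ∘ sym))))
        ... | no a≢0 | yes refl | _ = inj₁ (subst (λ u → g u (x l) (x m) ≡ true) (sym (at₁ a≢0))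
                (trans (g-swap₂ _ _ _) (beta l 0F m l≢m (m≢0 ∘ sym) l≢0)))
        ... | no a≢0 | no _ | yes refl = inj₁ (subst (λ u → g u (x l) (x m) ≡ true) (sym (at₁ a≢0))
                (beta m 0F l (l≢m ∘ sym) (l≢0 ∘ sym) m≢0))
        ... | no a≢0 | no a≢l | no a≢m with fin3 0F a | fin3 0F l | fin3 0F m
        ...   | inj₁ e | _ | _ = ⊥-elim (a≢0 e)
        ...   | _ | inj₁ e | _ = ⊥-elim (l≢0 e)
        ...   | _ | _ | inj₁ e = ⊥-elim (m≢0 e)
        ...   | inj₂ (inj₁ e) | inj₂ (inj₁ e′) | _ = ⊥-elim (a≢l (trans e (sym e′)))
        ...   | inj₂ (inj₂ e) | inj₂ (inj₂ e′) | _ = ⊥-elim (a≢l (trans e (sym e′)))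
        ...   | inj₂ (inj₁ e) | _ | inj₂ (inj₁ e′) = ⊥-elim (a≢m (trans e (sym e′)))
        ...   | inj₂ (inj₂ e) | _ | inj₂ (inj₂ e′) = ⊥-elim (a≢m (trans e (sym e′)))
        ...   | inj₂ (inj₁ e) | inj₂ (inj₂ e′) | inj₂ (inj₂ e″) = ⊥-elim (l≢m (trans e′ (sym e″)))
        ...   | inj₂ (inj₂ e) | inj₂ (inj₁ e′) | inj₂ (inj₁ e″) = ⊥-elim (l≢m (trans e′ (sym e″)))

      private
        ox₁ : Out X₁.Q (x 2F)
        ox₁ = out₁ 2F λ ()
        h₂ : swapped (p X₁.Q i) 1F (x 2F) ≡ true
        h₂ = trans (cong₂ (g (x 2F)) (at₁ {2F} λ ()) X₁.changed) (trans (g-rot _ _ _) (beta 2F 1F 0F (λ ()) (λ ()) (λ ())))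
        module X₂ = Exchanged (exchange X₁.Q i 1F ox₁ h₂)
        ox₂ : Out X₂.Q (x 1F)
        ox₂ = X₂.out (out₁ 1F λ ()) (λ e → case x-inj e of λ ())
        at₂ : p X₂.Q i 2F ≡ w 2F
        at₂ = trans (X₂.same λ ()) (at₁ λ ())
        h₃ : swapped (p X₂.Q i) 0F (x 1F) ≡ true
        h₃ = trans (cong₂ (g (x 1F)) X₂.changed at₂) (trans (sym (g-rot _ _ _)) (beta 2F 0F 1F (λ ()) (λ ()) (λ ())))
        module X₃ = Exchanged (exchange X₂.Q i 0F ox₂ h₃)
        row₃ : ∀ b y → swapped (p X₃.Q j) b y ≡ swapped (p P j) b y
        row₃ b y = trans (same-swapped X₂.Q i 0F ox₂ h₃ j≢i b y) (trans (same-swapped X₁.Q i 1F ox₁ h₂ j≢i b y) (row₁ b y))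
        x≢w : ∀ k a → x k ≢ w a
        x≢w k a e = proj₂ (ox k) i a (sym e)
        w₁ : p X₁.Q i 1F ≡ w 1F
        w₁ = at₁ λ ()
        x₀ : p X₂.Q i 0F ≡ x 0F
        x₀ = trans (X₂.same λ ()) X₁.changed
        oa : Out X₃.Q (w 0F)
        oa = X₃.out (X₂.out X₁.freed (x≢w 2F 0F)) (x≢w 1F 0F)
        ob : Out X₃.Q (x 0F)
        ob = subst (Out X₃.Q) x₀ X₃.freed
        oc : Out X₃.Q (w 1F)
        oc = X₃.out (subst (Out X₂.Q) w₁ X₂.freed) (x≢w 1F 1F)

      -- Here `w 0F` and `x 0F` must be leftovers simultaneously. The three exchanges above turn
      -- `P i` into `x 1F`, `x 2F`, `w 2F` and leave `w 0F`, `x 0F` and `w 1F` free.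
      freed-own : ∀ b → swapped (p P j) b (w 0F) ≡ true → swapped (p P j) b (x 0F) ≡ true → ⊥
      freed-own b h h′ = no-common-slot X₃.Q j≢i oa ob oc (x≢w 0F 0F ∘ sym)
        (λ e → case gull-injective w (gulls P i) e of λ ()) (x≢w 0F 1F) blocked b (trans (row₃ b _) h) (trans (row₃ b _) h′)
        where
        blocked : ∀ a → g (p X₃.Q i a) (x 0F) (w 1F) ≡ true ⊎ g (p X₃.Q i a) (w 0F) (w 1F) ≡ true
        blocked 0F = inj₁ (subst (λ u → g u (x 0F) (w 1F) ≡ true) (sym X₃.changed)
          (trans (g-swap₂ _ _ _) (trans (g-swap₁ _ _ _) (trans (g-swap₂ _ _ _) (beta 1F 2F 0F (λ ()) (λ ()) (λ ()))))))
        blocked 1F = inj₂ (subst (λ u → g u (w 0F) (w 1F) ≡ true) (sym (trans (X₃.same λ ()) X₂.changed)) (own 2F))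
        blocked 2F = inj₁ (subst (λ u → g u (x 0F) (w 1F) ≡ true) (sym (trans (X₃.same λ ()) at₂)) (trans (g-rot _ _ _) (own 0F)))

      y : Fin 4 → Fin n
      y 0F = x 0F
      y 1F = x 1F
      y 2F = x 2F
      y (suc (suc (suc zero))) = w 0F

      -- Each of the four vertices `y` fits a slot of `P j`, but no two of them fit the same of its
      -- three slots.
      pentagon : ⊥
      pentagon with pigeonhole {3} {4} (s≤s (s≤s (s≤s (s≤s z≤n)))) (λ k → proj₁ (some-slot (p P j) (y k) (gulls P j)))
      ... | k , l , k<l , e = cases k l k<l _ (proj₂ (some-slot (p P j) (y k) (gulls P j)))
          (subst (λ s → swapped (p P j) s (y l) ≡ true) (sym e) (proj₂ (some-slot (p P j) (y l) (gulls P j))))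
        where
        cases : ∀ k l → k Data.Fin.< l → ∀ b → swapped (p P j) b (y k) ≡ true → swapped (p P j) b (y l) ≡ true → ⊥
        cases 0F 1F _ = pair 0F 1F 2F (λ ()) (λ ()) (λ ())
        cases 0F 2F _ = pair 0F 2F 1F (λ ()) (λ ()) (λ ())
        cases 1F 2F _ = pair 1F 2F 0F (λ ()) (λ ()) (λ ())
        cases 0F (suc (suc (suc zero))) _ b h h′ = freed-own b h′ h
        cases 1F (suc (suc (suc zero))) _ b h h′ = freed-pair 1F 2F (λ ()) (λ ()) (λ ()) b h′ h
        cases 2F (suc (suc (suc zero))) _ b h h′ = freed-pair 2F 1F (λ ()) (λ ()) (λ ()) b h′ h
        cases 1F 1F (s≤s ())
        cases 2F 1F (s≤s ())
        cases (suc (suc (suc zero))) 1F (s≤s ())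
        cases 2F 2F (s≤s (s≤s ()))
        cases (suc (suc (suc zero))) 2F (s≤s (s≤s ()))
        cases (suc (suc (suc zero))) (suc (suc (suc zero))) (s≤s (s≤s (s≤s ())))

    -- Unless some slot accepts two leftovers, the leftovers and the slots of `P i` correspond one
    -- to one, and this is the situation that `Pentagon` excludes.
    three-leftovers : (P : Packing D r) → ∀ {i j} → j ≢ i → (x : Fin 3 → Fin n) → (∀ k → Out P (x k)) → (∀ {k l} → x k ≡ x l → k ≡ l) → Double P i
    three-leftovers P {i} {j} j≢i x ox x-inj = search
      where
      t : Fin 3 → Fin n
      t = p P i
      a : Fin 3 → Fin 3
      a k = proj₁ (some-slot t (x k) (gulls P i))
      ha : ∀ k → swapped t (a k) (x k) ≡ true
      ha k = proj₂ (some-slot t (x k) (gulls P i))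
      double : ∀ {s k l} → k ≢ l → swapped t s (x k) ≡ true → swapped t s (x l) ≡ true → Double P i
      double {s} {k} {l} ne h h′ = s , x k , x l , (ne ∘ x-inj) , ox k , ox l , h , h′
      inverse : a 0F ≢ a 1F → a 0F ≢ a 2F → a 1F ≢ a 2F → ∀ s → ∃[ k ] a k ≡ s
      inverse h₁ h₂ h₃ s with fin3 (a 0F) s | fin3 (a 0F) (a 1F) | fin3 (a 0F) (a 2F)
      ... | inj₁ e | _ | _ = 0F , sym e
      ... | _ | inj₁ e | _ = ⊥-elim (h₁ (sym e))
      ... | _ | _ | inj₁ e = ⊥-elim (h₂ (sym e))
      ... | inj₂ (inj₁ e) | inj₂ (inj₁ e′) | _ = 1F , trans e′ (sym e)
      ... | inj₂ (inj₂ e) | inj₂ (inj₂ e′) | _ = 1F , trans e′ (sym e)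
      ... | inj₂ (inj₁ e) | _ | inj₂ (inj₁ e′) = 2F , trans e′ (sym e)
      ... | inj₂ (inj₂ e) | _ | inj₂ (inj₂ e′) = 2F , trans e′ (sym e)
      ... | inj₂ (inj₁ e) | inj₂ (inj₂ e′) | inj₂ (inj₂ e″) = ⊥-elim (h₃ (trans e′ (sym e″)))
      ... | inj₂ (inj₂ e) | inj₂ (inj₁ e′) | inj₂ (inj₁ e″) = ⊥-elim (h₃ (trans e′ (sym e″)))
      generic : (∀ s → ∃[ k ] a k ≡ s) → Double P i
      generic inv with any? (λ s → any? λ l → any? λ k → dec s k l)
        where
        dec : ∀ s k l → Dec (k ≢ l × swapped t s (x k) ≡ true × swapped t s (x l) ≡ true)
        dec s k l with k ≟ᶠ l | true-or-false (swapped t s (x k)) | true-or-false (swapped t s (x l))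
        ... | yes e | _ | _ = no λ (h , _) → h e
        ... | no _ | inj₂ e | _ = no λ (_ , h , _) → clash h e
        ... | no _ | inj₁ _ | inj₂ e = no λ (_ , _ , h) → clash h e
        ... | no ne | inj₁ h | inj₁ h′ = yes (ne , h , h′)
      ... | yes (s , l , k , ne , h , h′) = double ne h h′
      ... | no ¬d = ⊥-elim (Pentagon.pentagon P j≢i (x ∘ inv₁) (ox ∘ inv₁)
              (λ {s} {s′} e → trans (sym (proj₂ (inv s))) (trans (cong a (x-inj e)) (proj₂ (inv s′)))) own
              (λ s s′ ne → ¬true⇒false λ h → ¬d (s , inv₁ s′ , inv₁ s , inv-≢ ne , own s , h)))
        where
        inv₁ : Fin 3 → Fin 3
        inv₁ s = proj₁ (inv s)
        own : ∀ s → swapped t s (x (inv₁ s)) ≡ true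
        own s = subst (λ s′ → swapped t s′ (x (inv₁ s)) ≡ true) (proj₂ (inv s)) (ha (inv₁ s))
        inv-≢ : ∀ {s s′} → s ≢ s′ → inv₁ s ≢ inv₁ s′
        inv-≢ {s} {s′} ne e = ne (trans (sym (proj₂ (inv s))) (trans (cong a e) (proj₂ (inv s′))))
      search : Double P i
      search with a 0F ≟ᶠ a 1F | a 0F ≟ᶠ a 2F | a 1F ≟ᶠ a 2F
      ... | yes e | _ | _ = double {a 0F} {0F} {1F} (λ ()) (ha 0F) (subst (λ s → swapped t s (x 1F) ≡ true) (sym e) (ha 1F))
      ... | no _ | yes e | _ = double {a 0F} {0F} {2F} (λ ()) (ha 0F) (subst (λ s → swapped t s (x 2F) ≡ true) (sym e) (ha 2F))
      ... | no _ | no _ | yes e = double {a 1F} {1F} {2F} (λ ()) (ha 1F) (subst (λ s → swapped t s (x 2F) ≡ true) (sym e) (ha 2F))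
      ... | no h₁ | no h₂ | no h₃ = generic (inverse h₁ h₂ h₃)

    -- Three leftovers beside a single gull do not suffice: in a pentagon with an isolated vertex
    -- there are no two disjoint gulls, and yet no slot of a gull accepts two of the other three
    -- vertices. A fourth leftover or a second gull excludes this.
    doubles : (P : Packing D r) → 3 ≤ # (rest P) → (4 ≤ # (rest P) ⊎ (∀ i → ∃[ j ] j ≢ i)) → ∀ i → Double P i
    doubles P _ (inj₁ h) i with elements (rest P) 4 h
    ... | x , x∈ , inj = four-leftovers P i x (λ k → rest-out P (x∈ k)) inj
    doubles P h (inj₂ k) i with elements (rest P) 3 h
    ... | x , x∈ , inj = three-leftovers P (proj₂ (k i)) x (λ k → rest-out P (x∈ k)) inj

    module Extension (P : Packing D r) (h : 3 ≤ # (rest P)) (dbl : ∀ i → Double P i) where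

      w : Fin r → Fin n
      w i = p P i (proj₁ (dbl i))

      private
        avoid : ∀ a b → ∃[ z ] (Out P z × a ≢ z × b ≢ z)
        avoid a b with #-pos (rest P ─ a ─ b) (lin 3 (con 1 ≼ $0) (con 3 ⊞ $1 ⊞ $2 ≼ $1 ⊞ (con 1 ⊞ $2) ⊞ (con 1 ⊞ $0)) (h ⊕ #-─-≤ (rest P) a ⊕ #-─-≤ (rest P ─ a) b))
        ... | z , z∈ = z , rest-out P (─-left (─-left z∈)) , ─-right (─-left z∈) , ─-right z∈

      -- If one of the two candidates for the slot differs from `y` and `z`, it frees `w i` beside
      -- them. If `y` and `z` are the candidates themselves, the claim holds for each of them with a
      -- third leftover `t`, and `even` combines the two.
      joins-rest : ∀ i {y z} → Out P y → Out P z → g (w i) y z ≡ false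
      joins-rest i {y} {z} oy oz with dbl i
      ... | k , x , x′ , x≢x′ , ox , ox′ , hx , hx′ = go (x ≟ᶠ y) (x ≟ᶠ z) (x′ ≟ᶠ y) (x′ ≟ᶠ z)
        where
        by : ∀ {y z} → Out P y → Out P z → x ≢ y → x ≢ z → g (p P i k) y z ≡ false
        by = joins P i k ox hx
        by′ : ∀ {y z} → Out P y → Out P z → x′ ≢ y → x′ ≢ z → g (p P i k) y z ≡ false
        by′ = joins P i k ox′ hx′
        both : ∀ {y z} → Out P y → Out P z → x ≢ y → x′ ≢ z → g (p P i k) y z ≡ false
        both {y} {z} oy oz ne ne′ with x′ ≟ᶠ y | x ≟ᶠ z
        ... | no ne″ | _ = by′ oy oz ne″ ne′
        ... | yes _ | no ne″ = by oy oz ne ne″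
        ... | yes refl | yes refl = trans (g-rot _ _ _) (even (leftover P ot oy oz)
              (trans (trans (g-swap₁ _ _ _) (sym (g-rot _ _ _))) (by oy ot ne (t≢z ∘ sym)))
              (trans (trans (g-swap₁ _ _ _) (sym (g-rot _ _ _))) (by′ oz ot ne′ (t≢y ∘ sym))))
          where
          t : Fin n
          t = proj₁ (avoid y z)
          ot : Out P t
          ot = proj₁ (proj₂ (avoid y z))
          t≢y : t ≢ y
          t≢y e = proj₁ (proj₂ (proj₂ (avoid y z))) (sym e)
          t≢z : t ≢ z
          t≢z e = proj₂ (proj₂ (proj₂ (avoid y z))) (sym e)
        go : Dec (x ≡ y) → Dec (x ≡ z) → Dec (x′ ≡ y) → Dec (x′ ≡ z) → g (p P i k) y z ≡ false
        go (no a) (no b) _ _ = by oy oz a b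
        go _ _ (no a) (no b) = by′ oy oz a b
        go (no a) _ _ (no b) = both oy oz a b
        go _ (no a) (no b) _ = trans (g-swap₂ _ _ _) (both oz oy a b)
        go (yes e) _ (yes e′) _ = ⊥-elim (x≢x′ (trans e (sym e′)))
        go _ (yes e) _ (yes e′) = ⊥-elim (x≢x′ (trans e (sym e′)))

      private
        exchange-both : ∀ {i j} → j ≢ i → ∀ {x y} → x ≢ y → Out P x → Out P y →
          swapped (p P i) (proj₁ (dbl i)) x ≡ true → swapped (p P j) (proj₁ (dbl j)) y ≡ true →
          ∃[ z ] (Out P z × g (w i) (w j) z ≡ false)
        exchange-both {i} {j} j≢i {x} {y} x≢y ox oy hx hy with avoid x y
        ... | z , oz , x≢z , y≢z = z , oz , trans (g-swap₁ _ _ _)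
              (subst (λ u → g u (w i) z ≡ false) (same λ e → j≢i (cong proj₁ e))
                (joins Q j _ (out oy x≢y) (trans (same-swapped P i _ ox hx j≢i _ y) hy) freed (out oz x≢z)
                  (λ e → proj₂ oy i _ (sym e)) y≢z))
          where open Exchanged (exchange P i (proj₁ (dbl i)) ox hx)

        spare₁ spare₂ : Fin r → Fin n
        spare₁ i = proj₁ (proj₂ (dbl i))
        spare₂ i = proj₁ (proj₂ (proj₂ (dbl i)))
        o₁ : ∀ i → Out P (spare₁ i)
        o₁ i = proj₁ (proj₂ (proj₂ (proj₂ (proj₂ (dbl i)))))
        o₂ : ∀ i → Out P (spare₂ i)
        o₂ i = proj₁ (proj₂ (proj₂ (proj₂ (proj₂ (proj₂ (dbl i))))))
        h₁ : ∀ i → swapped (p P i) (proj₁ (dbl i)) (spare₁ i) ≡ true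
        h₁ i = proj₁ (proj₂ (proj₂ (proj₂ (proj₂ (proj₂ (proj₂ (dbl i)))))))
        h₂ : ∀ i → swapped (p P i) (proj₁ (dbl i)) (spare₂ i) ≡ true
        h₂ i = proj₂ (proj₂ (proj₂ (proj₂ (proj₂ (proj₂ (proj₂ (dbl i)))))))

      -- `w i` and `w j` have to be freed by different leftovers; if the first candidates coincide,
      -- the second one for `i` is taken. This yields the claim for one leftover `z`, and `even`
      -- carries it over to `y`.
      joins-each-other : ∀ {i j} → j ≢ i → ∀ {y} → Out P y → g (w i) (w j) y ≡ false
      joins-each-other {i} {j} j≢i {y} oy = from choose
        where
        choose : ∃[ z ] (Out P z × g (w i) (w j) z ≡ false)
        choose with spare₁ i ≟ᶠ spare₁ j
        ... | no ne = exchange-both j≢i ne (o₁ i) (o₁ j) (h₁ i) (h₁ j)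
        ... | yes e = exchange-both j≢i (λ e′ → proj₁ (proj₂ (proj₂ (proj₂ (dbl i)))) (trans e (sym e′))) (o₂ i) (o₁ j) (h₂ i) (h₁ j)
        from : ∃[ z ] (Out P z × g (w i) (w j) z ≡ false) → g (w i) (w j) y ≡ false
        from (z , oz , e) = trans (g-rev _ _ _) (even {z} {y} {w j} {w i}
          (trans (sym (g-rot _ _ _)) (joins-rest j oz oy)) (trans (sym (g-rot _ _ _)) (joins-rest i oz oy)) (trans (g-rev _ _ _) e))

      core : Sub n
      core = rest P ∪ image w

      core-coherent : Coherent core
      core-coherent {x} {y} {z} hx hy hz = even {a} (ref hx hy) (ref hx hz) (ref hy hz)
        where
        three : ∃[ a ] (Out P a × x ≢ a × x ≢ a)
        three = avoid x x
        a : Fin n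
        a = proj₁ three
        oa : Out P a
        oa = proj₁ (proj₂ three)
        ref : ∀ {u v} → u ∈ core → v ∈ core → g a u v ≡ false
        ref {u} {v} hu hv with ∪-out {S = rest P} hu | ∪-out {S = rest P} hv
        ... | inj₁ ku | inj₁ kv = leftover P oa (rest-out P ku) (rest-out P kv)
        ... | inj₂ ku | inj₁ kv with image-out w ku
        ...   | i , refl = trans (g-swap₁ _ _ _) (joins-rest i oa (rest-out P kv))
        ref {u} {v} hu hv | inj₁ ku | inj₂ kv with image-out w kv
        ...   | i , refl = trans (sym (g-rot _ _ _)) (joins-rest i oa (rest-out P ku))
        ref {u} {v} hu hv | inj₂ ku | inj₂ kv with image-out w ku | image-out w kv
        ...   | i , refl | j , refl with j ≟ᶠ i
        ...     | yes refl = trans (g-rot _ _ _) (g-irr _ _)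
        ...     | no j≢i = trans (g-rot _ _ _) (joins-each-other j≢i oa)

      core⊆D : core ⊆ D
      core⊆D v hv with ∪-out {S = rest P} hv
      ... | inj₁ k = proj₁ (rest-out P k)
      ... | inj₂ k with image-out w k
      ...   | i , refl = p∈ P i _

      #-core : # (rest P) + r ≤ # core
      #-core = lin 4 {# (rest P) , r , # core , # (image (λ i → p P i (proj₁ (dbl i)))) , _} ($0 ⊞ $1 ≼ $2) ($0 ⊞ $3 ⊞ $1 ≼ $2 ⊞ $3) (#-⊎ {S = core} {rest P} {image w} (λ _ → ∪-inˡ) (λ _ → ∪-inʳ) disjoint ⊕ #-image-≥ w (proj₁ ∘ p-injective P))
        where
        disjoint : ∀ v → v ∈ rest P → v ∈ image w → ⊥
        disjoint v h k with image-out w k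
        ... | i , e = proj₂ (rest-out P h) i _ e

    coherent-core : (P : Packing D r) → 3 ≤ # (rest P) → (∀ i → Double P i) → ∃[ Z ] (Z ⊆ D × Coherent Z × # (rest P) + r ≤ # Z)
    coherent-core P h dbl = core , core⊆D , core-coherent , #-core
      where open Extension P h dbl

  -- If only `r < s` gulls can be packed, the coherent core has at least `# D` - 2`r` vertices, more
  -- than the second hypothesis allows. The last hypothesis supplies the fourth leftover for the
  -- step from one gull to two; the step to more than two has either six leftovers or a second gull.
  gull-packing : ∀ D s → 3 * s ≤ # D → (∀ Z → Z ⊆ D → Coherent Z → # Z + 2 * s ≤ # D + 1) → (s ≡ 2 → 7 ≤ # D) → ¬¬ Packing D s
  gull-packing D s h₁ h₂ h₃ = go s ≤-refl
    where
    go : ∀ t → t ≤ s → ¬¬ Packing D t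
    go zero _ = return empty
    go (suc r) r<s = go r (lin 2 ($0 ≼ $1) (con 1 ⊞ $0 ≼ $1) r<s) >>= λ P none → step P none
      where
      step : (P : Packing D r) → ¬ Packing D (suc r) → ⊥
      step P none = finish (Saturated.coherent-core none P leftovers (Saturated.doubles none P leftovers (mode r r<s (lin 4 {# D , # (rest P) , r , r * 3 , _} ($0 ≼ $1 ⊞ 3 ⊠ $2) ($0 ⊞ $3 ≼ $1 ⊞ $3 ⊞ 3 ⊠ $2) (#-rest P ⊕ eq≤ (*-comm r 3))))))
        where
        size : 3 * suc r ≤ # D
        size = lin 3 {r , _ , s , _} (3 ⊠ (con 1 ⊞ $0) ≼ $1) (3 ⊠ $2 ⊞ 3 ⊠ (con 1 ⊞ $0) ≼ $1 ⊞ 3 ⊠ $2) (h₁ ⊕ 3 ⊗ r<s)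
        leftovers : 3 ≤ # (rest P)
        leftovers = lin 4 {_ , r , _ , _ , _} (con 3 ≼ $0) (3 ⊠ (con 1 ⊞ $1) ⊞ $2 ⊞ $3 ≼ $2 ⊞ ($0 ⊞ $3) ⊞ 3 ⊠ $1) (size ⊕ #-rest P ⊕ eq≤ (*-comm r 3))
        mode : ∀ r → suc r ≤ s → # D ≤ # (rest P) + 3 * r → 4 ≤ # (rest P) ⊎ (∀ (i : Fin r) → ∃[ j ] j ≢ i)
        mode zero _ _ = inj₂ λ ()
        mode (suc zero) 2≤s q with m≤n⇒m<n∨m≡n 2≤s
        ... | inj₁ 3≤s = inj₁ (lin 3 {_ , s , # D , _} (con 4 ≼ $0) ($1 ⊞ (2 ⊠ $1) ⊞ 3 ⊠ con 3 ⊞ $2 ≼ $2 ⊞ 3 ⊠ $1 ⊞ ($0 ⊞ con 3)) (h₁ ⊕ 3 ⊗ 3≤s ⊕ q))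
        ... | inj₂ e = inj₁ (lin 2 (con 4 ≼ $0) (con 7 ⊞ $1 ≼ $1 ⊞ ($0 ⊞ con 3)) (h₃ (sym e) ⊕ q))
        mode (suc (suc r)) _ _ = inj₂ λ { zero → suc zero , (λ ()) ; (suc i) → zero , (λ ()) }
        finish : ∃[ Z ] (Z ⊆ D × Coherent Z × # (rest P) + r ≤ # Z) → ⊥
        finish (Z , Z⊆D , coherent , #Z) = absurd-≤ 6 {# Z , s , # (rest P) , r , # D , r * 3 , _} ($0 ⊞ 2 ⊠ $1 ⊞ ($2 ⊞ $3) ⊞ $4 ⊞ (con 1 ⊞ $3) ⊞ (con 1 ⊞ $3) ⊞ $5 ≼ $4 ⊞ con 1 ⊞ $0 ⊞ ($2 ⊞ $5) ⊞ $1 ⊞ $1 ⊞ 3 ⊠ $3) (h₂ Z Z⊆D coherent ⊕ #Z ⊕ #-rest P ⊕ r<s ⊕ r<s ⊕ eq≤ (*-comm r 3))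

-- Trees and expansions

module Families {n} (𝒞 : TriangleFree n) where
  open TriangleFree 𝒞
  open Gulls 𝒞 using (g; gull; Packing; gull-injective)

  Near : Fin n → Fin n → Set
  Near u v = u ≢ v × c u v ≡ false

  Near-sym : ∀ {u v} → Near u v → Near v u
  Near-sym {u} {v} (h , k) = (h ∘ sym) , trans (c-sym v u) k

  -- A tree of an expansion: a single vertex (left = mid = right), an edge (left = right) or a path,
  -- where left and right get one colour and mid the other one, except in a single vertex.
  record Tree : Set where
    constructor tree
    field left mid right : Fin n
  open Tree public

  data _isEndOf_ (v : Fin n) (t : Tree) : Set where
    isLeft : v ≡ left t → v isEndOf t
    isRight : v ≡ right t → v isEndOf t

  _isIn_ : Fin n → Tree → Set
  v isIn t = v isEndOf t ⊎ v ≡ mid t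

  Valid : Tree → Set
  Valid t = (left t ≡ mid t × right t ≡ mid t) ⊎ (Near (left t) (mid t) × Near (right t) (mid t))

  -- A link between middles is monochromatic only if neither tree is a single vertex, since the
  -- middle of such a tree has the colour of the ends.
  Linked : Tree → Tree → Set
  Linked s t = (∃[ u ] ∃[ v ] (u isEndOf s × v isEndOf t × Near u v)) ⊎ (left s ≢ mid s × left t ≢ mid t × Near (mid s) (mid t))

  Disjoint : Tree → Tree → Set
  Disjoint s t = ∀ {u} → u isIn s → u isIn t → ⊥

  Apart : Tree → Tree → Set
  Apart s t = Disjoint s t × Linked s t

  Apart-sym : ∀ {s t} → Apart s t → Apart t s
  Apart-sym (d , inj₁ (u , v , hu , hv , k)) = (λ a b → d b a) , inj₁ (v , u , hv , hu , Near-sym k)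
  Apart-sym (d , inj₂ (hs , ht , k)) = (λ a b → d b a) , inj₂ (ht , hs , Near-sym k)

  record Family (S : Sub n) (t : ℕ) : Set where
    field
      trees : Fin t → Tree
      valid : ∀ i → Valid (trees i)
      within : ∀ i {v} → v isIn trees i → v ∈ S
      apart : ∀ {i j} → i ≢ j → Apart (trees i) (trees j)
  open Family

  family-⊆ : ∀ {S T t} → S ⊆ T → Family S t → Family T t
  family-⊆ h F = record { trees = trees F ; valid = valid F ; within = λ i k → h _ (within F i k) ; apart = apart F }

  family-≤ : ∀ {S s t} → s ≤ t → Family S t → Family S s
  family-≤ h F = record
    { trees = λ i → trees F (inject≤ i h) ; valid = λ i → valid F _ ; within = λ i → within F _
    ; apart = λ i≢j → apart F (i≢j ∘ inject≤-injective h h _ _) }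

  family-++ : ∀ {S T s t} (F : Family S s) (H : Family T t) → (∀ i j → Apart (trees F i) (trees H j)) → Family (S ∪ T) (s + t)
  family-++ {S} {T} {s} {t} F H cross = record { trees = f ∘ splitAt s ; valid = fv ∘ splitAt s ; within = λ i → fw (splitAt s i) ; apart = fa′ }
    where
    f : Fin s ⊎ Fin t → Tree
    f (inj₁ i) = trees F i
    f (inj₂ j) = trees H j
    fv : ∀ k → Valid (f k)
    fv (inj₁ i) = valid F i
    fv (inj₂ j) = valid H j
    fw : ∀ k {v} → v isIn f k → v ∈ S ∪ T
    fw (inj₁ i) h = ∪-inˡ (within F i h)
    fw (inj₂ j) h = ∪-inʳ (within H j h)
    fa : ∀ k l → k ≢ l → Apart (f k) (f l)
    fa (inj₁ i) (inj₁ j) ne = apart F (ne ∘ cong inj₁)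
    fa (inj₂ i) (inj₂ j) ne = apart H (ne ∘ cong inj₂)
    fa (inj₁ i) (inj₂ j) ne = cross i j
    fa (inj₂ i) (inj₁ j) ne = Apart-sym (cross j i)
    fa′ : ∀ {i j} → i ≢ j → Apart (f (splitAt s i)) (f (splitAt s j))
    fa′ {i} {j} ne = fa (splitAt s i) (splitAt s j) λ e → ne (trans (sym (join-splitAt s t i)) (trans (cong (join s t) e) (join-splitAt s t j)))

  family-∅ : ∀ {S} → Family S 0
  family-∅ = record { trees = λ () ; valid = λ () ; within = λ () ; apart = λ { {()} } }

  isIn-single : ∀ {u v} → u isIn tree v v v → u ≡ v
  isIn-single (inj₁ (isLeft e)) = e
  isIn-single (inj₁ (isRight e)) = e
  isIn-single (inj₂ e) = e

  Stable : Sub n → Set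
  Stable Q = ∀ {u v} → u ∈ Q → v ∈ Q → c u v ≡ false

  singles : ∀ {Q} m → Stable Q → m ≤ # Q → Σ (Family Q m) λ F → ∀ i → ∃[ v ] (v ∈ Q × trees F i ≡ tree v v v)
  singles {Q} m ind h with elements Q m h
  ... | f , f∈ , inj = record
    { trees = λ i → tree (f i) (f i) (f i) ; valid = λ i → inj₁ (refl , refl)
    ; within = λ i k → subst (_∈ Q) (sym (isIn-single k)) (f∈ i)
    ; apart = λ {i} {j} ne → (λ h k → ne (inj (trans (sym (isIn-single h)) (isIn-single k)))) ,
        inj₁ (_ , _ , isLeft refl , isLeft refl , (ne ∘ inj) , ind (f∈ i) (f∈ j)) }
    , λ i → f i , f∈ i , refl

  gull-tree : ∀ {x y z} → g x y z ≡ true → ∃[ t ] (Valid t × c (left t) (right t) ≡ true × (∀ {v} → v isIn t → v ≡ x ⊎ v ≡ y ⊎ v ≡ z))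
  gull-tree {x} {y} {z} h = build (true-or-false (c x y)) (true-or-false (c x z)) (true-or-false (c y z))
    where
    swap : ∀ {u v b} → c u v ≡ b → c v u ≡ b
    swap {u} {v} k = trans (c-sym v u) k
    sep : ∀ {u v w} → c u v ≡ true → c w v ≡ false → u ≢ w
    sep k l refl = clash k l
    build : c x y ≡ true ⊎ c x y ≡ false → c x z ≡ true ⊎ c x z ≡ false → c y z ≡ true ⊎ c y z ≡ false →
      ∃[ t ] (Valid t × c (left t) (right t) ≡ true × (∀ {v} → v isIn t → v ≡ x ⊎ v ≡ y ⊎ v ≡ z))
    build (inj₁ a) (inj₂ b) (inj₂ d) = tree x z y , inj₂ ((sep a (swap d) , b) , (sep (swap a) (swap b) , d)) , a ,
      λ { (inj₁ (isLeft e)) → inj₁ e ; (inj₁ (isRight e)) → inj₂ (inj₁ e) ; (inj₂ e) → inj₂ (inj₂ e) }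
    build (inj₂ a) (inj₁ b) (inj₂ d) = tree x y z , inj₂ ((sep b d , a) , (sep (swap b) (swap a) , swap d)) , b ,
      λ { (inj₁ (isLeft e)) → inj₁ e ; (inj₁ (isRight e)) → inj₂ (inj₂ e) ; (inj₂ e) → inj₂ (inj₁ e) }
    build (inj₂ a) (inj₂ b) (inj₁ d) = tree y x z , inj₂ ((sep d b , swap a) , (sep (swap d) a , swap b)) , d ,
      λ { (inj₁ (isLeft e)) → inj₂ (inj₁ e) ; (inj₁ (isRight e)) → inj₂ (inj₂ e) ; (inj₂ e) → inj₁ e }
    build (inj₁ a) (inj₁ b) (inj₁ d) = ⊥-elim (c-tri x y z a d b)
    build (inj₁ a) (inj₁ b) (inj₂ d) = clash h (cong₂ _xor_ a (cong₂ _xor_ b d))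
    build (inj₁ a) (inj₂ b) (inj₁ d) = clash h (cong₂ _xor_ a (cong₂ _xor_ b d))
    build (inj₂ a) (inj₁ b) (inj₁ d) = clash h (cong₂ _xor_ a (cong₂ _xor_ b d))
    build (inj₂ a) (inj₂ b) (inj₂ d) = clash h (cong₂ _xor_ a (cong₂ _xor_ b d))

  -- every vertex sees one of the two ends of a gull
  gull-linked : ∀ {s t} → c (left s) (right s) ≡ true → Disjoint s t → Apart s t
  gull-linked {s} {t} h d = d , linked (true-or-false (c (left s) (left t)))
    where
    linked : c (left s) (left t) ≡ true ⊎ c (left s) (left t) ≡ false → Linked s t
    linked (inj₂ k) = inj₁ (_ , _ , isLeft refl , isLeft refl , (λ e → d (inj₁ (isLeft refl)) (inj₁ (isLeft e))) , k)
    linked (inj₁ k) = inj₁ (_ , _ , isRight refl , isLeft refl , (λ e → d (inj₁ (isRight refl)) (inj₁ (isLeft e))) ,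
      ¬true⇒false λ k′ → c-tri (left s) (right s) (left t) h k′ k)

  module _ {D s} (P : Packing D s) where
    open Packing P

    private
      t : ∀ i → _
      t i = gull-tree (gulls i)
      slot : ∀ i {v} → v isIn proj₁ (t i) → ∃[ a ] v ≡ p i a
      slot i h with proj₂ (proj₂ (proj₂ (t i))) h
      ... | inj₁ e = 0F , e
      ... | inj₂ (inj₁ e) = 1F , e
      ... | inj₂ (inj₂ e) = 2F , e

    gull-family : Σ (Family D s) λ F → ∀ i → c (left (trees F i)) (right (trees F i)) ≡ true
    gull-family = record
      { trees = λ i → proj₁ (t i) ; valid = λ i → proj₁ (proj₂ (t i))
      ; within = λ i h → subst (_∈ D) (sym (proj₂ (slot i h))) (p∈ i _)
      ; apart = λ {i} {j} ne → gull-linked (proj₁ (proj₂ (proj₂ (t i))))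
          λ h k → ne (proj₁ (p-injective (trans (sym (proj₂ (slot i h))) (proj₂ (slot j k))))) }
      , λ i → proj₁ (proj₂ (proj₂ (t i)))

  add-gulls : ∀ {S D s t} → Family S t → Packing D s → (∀ v → v ∈ S → v ∈ D → ⊥) → Family (D ∪ S) (s + t)
  add-gulls F P d = family-++ (proj₁ (gull-family P)) F λ i j →
    gull-linked (proj₂ (gull-family P) i) λ h k → d _ (within F j k) (within (proj₁ (gull-family P)) i h)

  join-family : ∀ {S T s t} → Family S s → Family T t → (∀ u v → u ∈ S → v ∈ T → Near u v) → Family (S ∪ T) (s + t)
  join-family F H near = family-++ F H λ i j →
    (λ h k → proj₁ (near _ _ (within F i h) (within H j k)) refl) ,
    inj₁ (_ , _ , isLeft refl , isLeft refl , near _ _ (within F i (inj₁ (isLeft refl))) (within H j (inj₁ (isLeft refl))))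

-- Seagulls beside a largest stable set

module Seagulls {n} (𝒞 : TriangleFree n) where
  open TriangleFree 𝒞
  open Gulls 𝒞 using (g; Coherent; gull-packing)
  open Families 𝒞

  opaque
    touched : Sub n → Sub n
    touched A x = ⌊ any? (λ a → (A a ∧ c a x) ≟ᵇ true) ⌋

    touched-in : ∀ {A a x} → a ∈ A → c a x ≡ true → x ∈ touched A
    touched-in {A} {a} {x} h k with any? (λ a → (A a ∧ c a x) ≟ᵇ true)
    ... | yes _ = refl
    ... | no ¬p = ⊥-elim (¬p (a , ∧-intro h k))

    touched-out : ∀ {A x} → x ∈ touched A → ∃[ a ] (a ∈ A × c a x ≡ true)
    touched-out {A} {x} h with any? (λ a → (A a ∧ c a x) ≟ᵇ true)
    ... | yes (a , p) = a , ∧-fst p , ∧-snd {A a} p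

  untouched : ∀ {A a x} → a ∈ A → x ∉ touched A → c a x ≡ false
  untouched h k = ¬true⇒false λ e → clash (touched-in h e) k

  LargestStable : Sub n → Sub n → Set
  LargestStable S Q = Q ⊆ S × Stable Q × (∀ Q′ → Q′ ⊆ S → Stable Q′ → # Q′ ≤ # Q)

  largest-stable : ∀ S → ¬¬ (∃[ Q ] LargestStable S Q)
  largest-stable S = maximal {∃[ Q ] (Q ⊆ S × Stable Q)} (λ (Q , _) → # Q) n (λ (Q , _) → #-≤ Q) (∅ , (λ _ ()) , λ ()) >>= λ where
    ((Q , Q⊆ , st) , max) → return (Q , Q⊆ , (λ {u} {v} → st {u} {v}) , λ Q′ s t → max (Q′ , s , λ {u} {v} → t {u} {v}))

  stable-∪ : ∀ {A B} → Stable A → Stable B → (∀ {a b} → a ∈ A → b ∈ B → c a b ≡ false) → Stable (A ∪ B)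
  stable-∪ {A} {B} sa sb sab hu hv with ∪-out {S = A} hu | ∪-out {S = A} hv
  ... | inj₁ u | inj₁ v = sa u v
  ... | inj₂ u | inj₂ v = sb u v
  ... | inj₁ u | inj₂ v = sab u v
  ... | inj₂ u | inj₁ v = trans (c-sym _ _) (sab v u)

  ∪-size : ∀ {A B : Sub n} → (∀ v → v ∈ A → v ∈ B → ⊥) → # A + # B ≤ # (A ∪ B)
  ∪-size = #-⊎ (λ _ → ∪-inˡ) (λ _ → ∪-inʳ)

  -- Replacing the neighbours of `A` in `Q` by `A` gives a stable set again, which cannot be larger
  -- than `Q`.
  hall : ∀ {S Q A} → LargestStable S Q → A ⊆ S ∖ Q → Stable A → # A ≤ # (Q ∩ touched A)
  hall {S} {Q} {A} (Q⊆ , st , max) A⊆ sa = lin 5 {# A , # (Q ∩ touched A) , # (A ∪ O) , # O , # Q , _} ($0 ≼ $1) ($2 ⊞ ($0 ⊞ $3) ⊞ $4 ≼ $4 ⊞ $2 ⊞ ($1 ⊞ $3)) (max (A ∪ O) sub union-stable ⊕ ∪-size {A} {O} apart ⊕ eq≤ (#-split Q (touched A)))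
    where
    O : Sub n
    O = Q ∖ touched A
    union-stable : Stable (A ∪ O)
    union-stable = stable-∪ {A} {O} (λ {u} {v} → sa {u} {v}) (λ u v → st (∖-left u) (∖-left v)) λ a b → untouched {A} a (∖-right {S = Q} b)
    apart : ∀ v → v ∈ A → v ∈ O → ⊥
    apart v a b = clash (∖-left b) (∖-right {S = S} (A⊆ v a))
    sub : A ∪ O ⊆ S
    sub v h with ∪-out {S = A} h
    ... | inj₁ a = ∖-left (A⊆ v a)
    ... | inj₂ b = Q⊆ v (∖-left b)

  -- For `u` in `Z`, the non-neighbours `A` and the neighbours `B` of `u` in `Z` are stable and
  -- completely joined in the complement. `hall` applies to both, and their neighbourhoods in `Q`
  -- are disjoint, because a common neighbour would lie in a triangle with one vertex of each side.
  coherent-bound : ∀ {S Q Z} → LargestStable S Q → Z ⊆ S ∖ Q → Coherent Z → # Z ≤ # Q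
  coherent-bound {S} {Q} {Z} L Z⊆ coh with true-or-false (1 ≤ᵇ # Z)
  ... | inj₂ e = lin 2 ($0 ≼ $1) ($0 ≼ con 0) (≮⇒≥ {0} {# Z} (λ h → clash (≤ᵇ-complete h) e))
    where
    ≤ᵇ-complete : ∀ {m n} → m ≤ n → (m ≤ᵇ n) ≡ true
    ≤ᵇ-complete z≤n = refl
    ≤ᵇ-complete (s≤s {zero} z≤n) = refl
    ≤ᵇ-complete (s≤s {suc m} h) = ≤ᵇ-complete h
  ... | inj₁ e with #-pos Z (≤ᵇ-sound e)
  ...   | u , u∈ = lin 6 {# Z , # Q , # (Z ∖ c u) , # (Z ∩ c u) , # (Q ∩ touched A) , # (Q ∩ touched B) , _} ($0 ≼ $1) ($2 ⊞ $3 ⊞ ($4 ⊞ $5) ⊞ $0 ≼ $4 ⊞ $5 ⊞ $1 ⊞ ($3 ⊞ $2)) (hall L (λ v h → Z⊆ v (∖-left h)) sA ⊕ hall L (λ v h → Z⊆ v (∩-left h)) sB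
            ⊕ #-⊎ {S = Q} {Q ∩ touched A} {Q ∩ touched B} (λ _ → ∩-left) (λ _ → ∩-left) disjoint ⊕ eq≤ (#-split Z (c u)))
    where
    A B : Sub n
    A = Z ∖ c u
    B = Z ∩ c u
    edge : ∀ {v w} → v ∈ Z → w ∈ Z → c v w ≡ c u v xor c u w
    edge {v} {w} hv hw = solve′ (c u v) (c u w) (c v w) (coh u∈ hv hw)
      where
      solve′ : ∀ a b d → a xor (b xor d) ≡ false → d ≡ a xor b
      solve′ true true false _ = refl
      solve′ true false true _ = refl
      solve′ false true true _ = refl
      solve′ false false false _ = refl
    sA : Stable A
    sA hv hw = trans (edge (∖-left hv) (∖-left hw)) (cong₂ _xor_ (∖-right {S = Z} hv) (∖-right {S = Z} hw))
    sB : Stable B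
    sB hv hw = trans (edge (∩-left hv) (∩-left hw)) (cong₂ _xor_ (∩-right {S = Z} hv) (∩-right {S = Z} hw))
    disjoint : ∀ x → x ∈ Q ∩ touched A → x ∈ Q ∩ touched B → ⊥
    disjoint x hA hB with touched-out (∩-right {S = Q} hA) | touched-out (∩-right {S = Q} hB)
    ... | a , a∈ , ax | b , b∈ , bx = c-tri a b x
      (trans (edge (∖-left a∈) (∩-left b∈)) (cong₂ _xor_ (∖-right {S = Z} a∈) (∩-right {S = Z} b∈))) bx ax

  -- `coherent-bound` is exactly what `gull-packing` asks of coherent sets, as `# Q + 2 * s` equals
  -- `# D + 1`. Size nine with `# Q ≡ 3` is the one case in which two gulls would have to fill six
  -- vertices.
  seagull-family : ∀ {S Q} k → LargestStable S Q → # S + 1 ≡ 2 * k → # S + 3 ≤ 4 * # Q → (# S ≡ 9 → 4 ≤ # Q) → ¬¬ Family S k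
  seagull-family {S} {Q} k L@(Q⊆ , st , _) size large nine = go (k ≤? # Q)
    where
    D : Sub n
    D = S ∖ Q
    #D : # S ≡ # Q + # D
    #D = trans (#-split S Q) (cong (_+ # D) (≤-antisym (#-mono λ _ → ∩-right) (#-mono λ v h → ∩-in (Q⊆ v h) h)))
    sub : D ∪ Q ⊆ S
    sub v h with ∪-out {S = D} h
    ... | inj₁ d = ∖-left d
    ... | inj₂ q = Q⊆ v q
    go : Dec (k ≤ # Q) → ¬¬ Family S k
    go (yes h) = return (family-⊆ Q⊆ (proj₁ (singles k st h)))
    go (no h) = gull-packing D s (lin 5 {s , # D , k , # Q , # S , _} (3 ⊠ $0 ≼ $1) ($2 ⊞ con 1 ⊞ 3 ⊠ ($0 ⊞ $3) ⊞ 2 ⊠ $2 ⊞ $4 ≼ 2 ⊠ $3 ⊞ 3 ⊠ $2 ⊞ ($4 ⊞ con 1) ⊞ ($3 ⊞ $1)) (hk ⊕ 3 ⊗ eq≤ s+q ⊕ eq≥ size ⊕ eq≤ #D))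
        (λ Z Z⊆ coh → lin 6 {# Z , s , # D , # S , k , # Q , _} ($0 ⊞ 2 ⊠ $1 ≼ $2 ⊞ con 1) ($0 ⊞ $3 ⊞ 2 ⊠ $4 ⊞ 2 ⊠ ($1 ⊞ $5) ≼ $5 ⊞ ($5 ⊞ $2) ⊞ ($3 ⊞ con 1) ⊞ 2 ⊠ $4) (coherent-bound L Z⊆ coh ⊕ eq≤ #D ⊕ eq≥ size ⊕ 2 ⊗ eq≤ s+q))
        seven
      >>= λ P → return (family-⊆ sub (subst (Family (D ∪ Q)) s+q (add-gulls (proj₁ (singles (# Q) st ≤-refl)) P λ v q d → clash q (∖-right {S = S} d))))
      where
      s : ℕ
      s = k ∸ # Q
      s+q : s + # Q ≡ k
      s+q = m∸n+n≡m {k} {# Q} (lin 2 ($0 ≼ $1) (con 1 ⊞ $0 ≼ $1) (≰⇒> h))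
      hk : k + 1 ≤ 2 * # Q
      hk = *-cancelˡ-≤ {k + 1} {2 * # Q} 2 (lin 3 {k , # Q , _ , _} (2 ⊠ ($0 ⊞ con 1) ≼ 2 ⊠ 2 ⊠ $1) ($2 ⊞ con 3 ⊞ 2 ⊠ $0 ≼ 4 ⊠ $1 ⊞ ($2 ⊞ con 1)) (large ⊕ eq≥ size))
      seven : s ≡ 2 → 7 ≤ # D
      seven e = by (# Q ≤? 3)
        where
        by : Dec (# Q ≤ 3) → 7 ≤ # D
        by (no q) = lin 5 {# D , # S , s , # Q , k , _} (con 7 ≼ $0) (con 4 ⊞ $1 ⊞ 2 ⊠ ($2 ⊞ $3) ⊞ 2 ⊠ $4 ⊞ 2 ⊠ con 2 ≼ $3 ⊞ ($3 ⊞ $0) ⊞ 2 ⊠ $4 ⊞ ($1 ⊞ con 1) ⊞ 2 ⊠ $2) (≰⇒> q ⊕ eq≤ #D ⊕ 2 ⊗ eq≤ s+q ⊕ eq≥ size ⊕ 2 ⊗ eq≥ e)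
        -- With `s ≡ 2` the inequality `hk` reads `# Q + 3 ≤ 2 * # Q`, so only `# Q ≡ 3`, `k ≡ 5`
        -- and `# S ≡ 9` remain.
        by (yes q) = ⊥-elim (absurd-≤ 1 (con 4 ⊞ $0 ≼ $0 ⊞ con 3) (nine (≤-antisym (lin 4 {_ , _ , k , s , _} ($0 ≼ con 9) ($1 ⊞ $1 ⊞ ($0 ⊞ con 1) ⊞ 2 ⊠ $2 ⊞ 2 ⊠ $3 ≼ con 3 ⊞ con 3 ⊞ 2 ⊠ $2 ⊞ 2 ⊠ ($3 ⊞ $1) ⊞ 2 ⊠ con 2) (q ⊕ q ⊕ eq≤ size ⊕ 2 ⊗ eq≥ s+q ⊕ 2 ⊗ eq≤ e)) (lin 4 {_ , k , s , # Q , _} (con 9 ≼ $0) (2 ⊠ $1 ⊞ 4 ⊠ ($2 ⊞ $3) ⊞ 4 ⊠ con 2 ⊞ 2 ⊠ ($1 ⊞ con 1) ≼ $0 ⊞ con 1 ⊞ 4 ⊠ $1 ⊞ 4 ⊠ $2 ⊞ 2 ⊠ 2 ⊠ $3) (eq≥ size ⊕ 4 ⊗ eq≤ s+q ⊕ 4 ⊗ eq≥ e ⊕ 2 ⊗ hk))) ⊕ q))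

-- Parity arguments

handshake : ∀ {n} (r : Fin n → Fin n → Bool) → (∀ u v → r u v ≡ r v u) → (∀ u → r u u ≡ false) →
  ∃[ k ] sum (λ u → sum (λ v → b2n (r u v))) ≡ 2 * k
handshake {zero} r rs ri = 0 , refl
handshake {suc n} r rs ri with handshake (λ u v → r (suc u) (suc v)) (λ u v → rs _ _) (λ u → ri _)
... | k , e = row + k , (begin
  (b2n (r zero zero) + row) + sum (λ u → b2n (r (suc u) zero) + inner u)  ≡⟨ cong₂ (λ b x → (b2n b + row) + x) (ri zero) (sum-+ (λ u → b2n (r (suc u) zero)) inner) ⟩
  row + (sum (λ u → b2n (r (suc u) zero)) + sum inner)                     ≡⟨ cong₂ (λ x y → row + (x + y)) (sum-cong λ u → cong b2n (rs (suc u) zero)) e ⟩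
  row + (row + 2 * k)                                                      ≡⟨ double row k ⟩
  2 * (row + k)                                                            ∎)
  where
  open ≡-Reasoning
  row : ℕ
  row = sum (λ v → b2n (r zero (suc v)))
  inner : Fin n → ℕ
  inner u = sum (λ v → b2n (r (suc u) (suc v)))
  double : ∀ a k → a + (a + 2 * k) ≡ 2 * (a + k)
  double = solve-∀

parity : ∀ m → ∃[ k ] (m ≡ 2 * k ⊎ m + 1 ≡ 2 * k)
parity zero = 0 , inj₁ refl
parity (suc m) with parity m
... | k , inj₁ e = suc k , inj₂ (trans (cong (λ x → suc x + 1) e) (shift k))
  where
  shift : ∀ k → suc (2 * k) + 1 ≡ 2 * suc k
  shift = solve-∀
... | k , inj₂ e = k , inj₁ (trans (+-comm 1 m) e)

even-step : ∀ {a b} j k → a ≡ 2 * j → b ≡ 2 * k → a < b → a + 2 ≤ b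
even-step j k refl refl h = lin 2 {j , k , _} (2 ⊠ $0 ⊞ con 2 ≼ 2 ⊠ $1) (2 ⊠ (con 1 ⊞ $0) ≼ 2 ⊠ $1) (2 ⊗ half h)
  where
  half : 2 * j < 2 * k → j < k
  half h = ≰⇒> λ k≤j → <⇒≱ h (2 ⊗ k≤j)

-- Matchings of the complement, and Gallai's lemma

module Matchings {n} (𝒞 : TriangleFree n) where
  open TriangleFree 𝒞
  open Families 𝒞

  -- An involution whose fixed points are the unmatched vertices. Consequently `size` below counts
  -- matched vertices, that is, twice the number of edges.
  record Matching (S : Sub n) : Set where
    field
      mate : Fin n → Fin n
      involutive : ∀ v → mate (mate v) ≡ v
      edge : ∀ v → mate v ≢ v → v ∈ S × c v (mate v) ≡ true

    opaque
      covered : Sub n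
      covered v = not (eqᵇ (mate v) v)

      covered-in : ∀ {v} → mate v ≢ v → v ∈ covered
      covered-in h = not-false (eqᵇ-false h)

      covered-out : ∀ {v} → v ∈ covered → mate v ≢ v
      covered-out h = eqᵇ-≢ (not-true h)

      missed : ∀ {v} → v ∉ covered → mate v ≡ v
      missed {v} h with mate v ≟ᶠ v
      ... | yes e = e

    mate-injective : ∀ {u v} → mate u ≡ mate v → u ≡ v
    mate-injective {u} {v} e = trans (sym (involutive u)) (trans (cong mate e) (involutive v))

    mate-edge : ∀ {v} → mate v ≢ v → mate v ∈ S
    mate-edge {v} h = proj₁ (edge (mate v) λ e → h (sym (trans (sym (involutive v)) e)))
  open Matching

  size : ∀ {S} → Matching S → ℕ
  size M = # (covered M)

  opaque
    unfolding #
    size-even : ∀ {S} (M : Matching S) → ∃[ k ] size M ≡ 2 * k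
    size-even M with handshake r r-sym r-irr
      where
      r : Fin n → Fin n → Bool
      r u v = covered M u ∧ eqᵇ (mate M u) v
      half : ∀ u v → r u v ≡ true → r v u ≡ true
      half u v h with eqᵇ-true {i = mate M u} (∧-snd {covered M u} h)
      ... | refl = ∧-intro (covered-in M λ e → covered-out M {u} (∧-fst h) (mate-injective M e))
                     (subst (λ w → eqᵇ (mate M (mate M u)) w ≡ true) (involutive M u) (eqᵇ-refl _))
      r-sym : ∀ u v → r u v ≡ r v u
      r-sym u v with true-or-false (r u v) | true-or-false (r v u)
      ... | inj₁ a | _ = trans a (sym (half u v a))
      ... | _ | inj₁ b = trans (half v u b) (sym b)
      ... | inj₂ a | inj₂ b = trans a (sym b)
      r-irr : ∀ u → r u u ≡ false
      r-irr u = ¬true⇒false λ h → covered-out M {u} (∧-fst h) (eqᵇ-true {i = mate M u} (∧-snd {covered M u} h))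
    ... | k , e = k , trans (sum-cong row) e
      where
      row : ∀ u → b2n (covered M u) ≡ sum (λ v → b2n (covered M u ∧ eqᵇ (mate M u) v))
      row u with covered M u
      ... | true = sym (#-⁅⁆ (mate M u))
      ... | false = sym (sum-0 {n})

  Maximum : ∀ {S} → Matching S → Set
  Maximum {S} M = ∀ (N : Matching S) → size N ≤ size M

  idle : ∀ S → Matching S
  idle S = record { mate = λ v → v ; involutive = λ v → refl ; edge = λ v h → ⊥-elim (h refl) }

  matching-⊆ : ∀ {S T} → S ⊆ T → Matching S → Matching T
  matching-⊆ h M = record { mate = mate M ; involutive = involutive M ; edge = λ v k → h v (proj₁ (edge M v k)) , proj₂ (edge M v k) }

  maximum : ∀ S → ¬¬ (∃[ M ] Maximum {S} M)
  maximum S = maximal size n (λ M → #-≤ (covered M)) (idle S)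

  add-edge : ∀ {S} (M : Matching S) {x y} → mate M x ≡ x → mate M y ≡ y → x ∈ S → y ∈ S → c x y ≡ true →
    Σ (Matching S) λ N → (mate N x ≡ y) × (mate N y ≡ x) × (∀ {v} → x ≢ v → y ≢ v → mate N v ≡ mate M v) × (size M + 2 ≤ size N)
  add-edge {S} M {x} {y} ex ey x∈ y∈ cxy = N , Nx , Ny , other , grow
    where
    f : Fin n → Fin n
    f v = τ x y (mate M v)
    Nx : f x ≡ y
    Nx = trans (cong (τ x y) ex) (τ-left x y)
    Ny : f y ≡ x
    Ny = trans (cong (τ x y) ey) (τ-right x y)
    other : ∀ {v} → x ≢ v → y ≢ v → f v ≡ mate M v
    other h k = τ-other x y (λ e → h (mate-injective M (trans ex e))) (λ e → k (mate-injective M (trans ey e)))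
    x≢y : x ≢ y
    x≢y refl = clash cxy (c-irr x)
    data Place (v : Fin n) : Set where
      isX : x ≡ v → Place v
      isY : y ≡ v → Place v
      neither : x ≢ v → y ≢ v → Place v
    place : ∀ v → Place v
    place v with x ≟ᶠ v | y ≟ᶠ v
    ... | yes e | _ = isX e
    ... | no _ | yes e = isY e
    ... | no h | no k = neither h k
    N : Matching S
    N = record { mate = f ; involutive = inv ; edge = edge′ }
      where
      inv : ∀ v → f (f v) ≡ v
      inv v with place v
      ... | isX refl = trans (cong f Nx) Ny
      ... | isY refl = trans (cong f Ny) Nx
      ... | neither h k = trans (cong f (other h k)) (trans (other (λ e → h (mate-injective M (trans ex e))) (λ e → k (mate-injective M (trans ey e)))) (involutive M v))
      edge′ : ∀ v → f v ≢ v → v ∈ S × c v (f v) ≡ true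
      edge′ v h with place v
      ... | isX refl = x∈ , trans (cong (c x) Nx) cxy
      ... | isY refl = y∈ , trans (cong (c y) Ny) (trans (c-sym y x) cxy)
      ... | neither k l = proj₁ e , trans (cong (c v) (other k l)) (proj₂ e)
        where e = edge M v (λ e → h (trans (other k l) e))
    grow : size M + 2 ≤ size N
    grow = lin 4 ($0 ⊞ con 2 ≼ $1) (con 1 ⊞ $2 ⊞ (con 1 ⊞ $3) ⊞ $0 ≼ $1 ⊞ $2 ⊞ $3) (eq≥ (#-─ (covered N) {x} (covered-in N λ e → x≢y (trans (sym e) Nx)))
        ⊕ eq≥ (#-─ (covered N ─ x) {y} (─-in (covered-in N λ e → x≢y (trans (sym Ny) e)) x≢y))
        ⊕ #-mono {S = covered M} {covered N ─ x ─ y} sub)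
      where
      sub : covered M ⊆ covered N ─ x ─ y
      sub v h with place v
      ... | isX refl = ⊥-elim (covered-out M h ex)
      ... | isY refl = ⊥-elim (covered-out M h ey)
      ... | neither k l = ─-in (─-in (covered-in N λ e → covered-out M h (trans (sym (other k l)) e)) k) l

  remove-edge : ∀ {S} (M : Matching S) {y z} → mate M y ≡ z →
    Σ (Matching S) λ N → (mate N y ≡ y) × (mate N z ≡ z) × (∀ {v} → y ≢ v → z ≢ v → mate N v ≡ mate M v) × (size M ≤ size N + 2)
  remove-edge {S} M {y} {z} ey = N , Ny , Nz , other , shrink
    where
    ez : mate M z ≡ y
    ez = trans (cong (mate M) (sym ey)) (involutive M y)
    f : Fin n → Fin n
    f v = if eqᵇ y v then v else (if eqᵇ z v then v else mate M v)
    Ny : f y ≡ y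
    Ny rewrite eqᵇ-refl y = refl
    Nz : f z ≡ z
    Nz with true-or-false (eqᵇ y z)
    ... | inj₁ e rewrite e = refl
    ... | inj₂ e rewrite e | eqᵇ-refl z = refl
    other : ∀ {v} → y ≢ v → z ≢ v → f v ≡ mate M v
    other h k rewrite eqᵇ-false h | eqᵇ-false k = refl
    data Place (v : Fin n) : Set where
      isY : y ≡ v → Place v
      isZ : z ≡ v → Place v
      neither : y ≢ v → z ≢ v → Place v
    place : ∀ v → Place v
    place v with y ≟ᶠ v | z ≟ᶠ v
    ... | yes e | _ = isY e
    ... | no _ | yes e = isZ e
    ... | no h | no k = neither h k
    N : Matching S
    N = record { mate = f ; involutive = inv ; edge = edge′ }
      where
      inv : ∀ v → f (f v) ≡ v
      inv v with place v
      ... | isY refl = trans (cong f Ny) Ny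
      ... | isZ refl = trans (cong f Nz) Nz
      ... | neither h k = trans (cong f (other h k)) (trans (other (λ e → k (mate-injective M (trans ez e))) (λ e → h (mate-injective M (trans ey e)))) (involutive M v))
      edge′ : ∀ v → f v ≢ v → v ∈ S × c v (f v) ≡ true
      edge′ v h with place v
      ... | isY refl = ⊥-elim (h Ny)
      ... | isZ refl = ⊥-elim (h Nz)
      ... | neither k l = proj₁ e , trans (cong (c v) (other k l)) (proj₂ e)
        where e = edge M v (λ e → h (trans (other k l) e))
    shrink : size M ≤ size N + 2
    shrink = lin 4 ($0 ≼ $1 ⊞ con 2) ($0 ⊞ $2 ⊞ $3 ≼ con 1 ⊞ $2 ⊞ (con 1 ⊞ $3) ⊞ $1) (#-─-≤ (covered M) y ⊕ #-─-≤ (covered M ─ y) z ⊕ #-mono {S = covered M ─ y ─ z} {covered N} sub)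
      where
      sub : covered M ─ y ─ z ⊆ covered N
      sub v h = covered-in N λ e → covered-out M {v} (─-left (─-left h))
        (trans (sym (other (─-right (─-left h)) (─-right h))) e)

  unaugmentable : ∀ {S} {M : Matching S} → Maximum M → ∀ {x y} → mate M x ≡ x → mate M y ≡ y → x ∈ S → y ∈ S → c x y ≡ true → ⊥
  unaugmentable {M = M} max ex ey x∈ y∈ cxy with add-edge M ex ey x∈ y∈ cxy
  ... | N , _ , _ , _ , grow = absurd-≤ 2 {# (covered N) , # (covered M) , _} ($0 ⊞ ($1 ⊞ con 2) ≼ $1 ⊞ $0) (max N ⊕ grow)

  Missed₂ : Sub n → Fin n → Fin n → Set
  Missed₂ S u v = Σ (Matching S) λ M → Maximum M × mate M u ≡ u × mate M v ≡ v

  -- Among the maximum matchings missing t take one sharing as many edges with M as possible.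
  transit : ∀ {S} (M : Matching S) → Maximum M → ∀ {u v t} → u ≢ v → mate M u ≡ u → mate M v ≡ v →
    ∀ k (N : Matching S) → Maximum N → mate N t ≡ t → n ≤ # (covered M ∩ λ w → eqᵇ (mate M w) (mate N w)) + k →
    Missed₂ S u t ⊎ Missed₂ S v t
  transit {S} M maxM {u} {v} {t} u≢v eu ev k N maxN et fuel = search (mate N u ≟ᶠ u) (mate N v ≟ᶠ v) (mate M t ≟ᶠ t)
    where
    search : Dec (mate N u ≡ u) → Dec (mate N v ≡ v) → Dec (mate M t ≡ t) → Missed₂ S u t ⊎ Missed₂ S v t
    search (yes e) _ _ = inj₁ (N , maxN , e , et)
    search _ (yes e) _ = inj₂ (N , maxN , e , et)
    search _ _ (yes e) = inj₁ (M , maxM , eu , e)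
    search (no Nu) (no Nv) (no Mt) = swap (proj₁ pick) (─-left (proj₂ pick)) (─-right (proj₂ pick))
      where
      X Y : Sub n
      X = covered M ∖ covered N
      Y = covered N ∖ covered M
      uncovered : ∀ {w} (L : Matching S) → mate L w ≡ w → w ∉ covered L
      uncovered L e = ¬true⇒false λ h → covered-out L h e
      two : 2 ≤ # Y
      two = lin 3 (con 2 ≼ $0) (con 1 ⊞ $1 ⊞ (con 1 ⊞ $2) ≼ $0 ⊞ $1) (eq≥ (#-─ Y {u} (∖-in (covered-in N Nu) (uncovered M eu))) ⊕ eq≥ (#-─ (Y ─ u) {v} (─-in (∖-in (covered-in N Nv) (uncovered M ev)) u≢v)))
      -- `N` is not larger than `M`, so `M` covers at least as many vertices missed by `N` as
      -- conversely. Two are needed in order to avoid `t`.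
      X≥2 : 2 ≤ # X
      X≥2 = lin 6 {# X , size N , # (covered M) , # (covered N ∩ covered M) , # (covered N ∖ covered M) , # (covered M ∩ covered N) , _} (con 2 ≼ $0) (con 2 ⊞ $1 ⊞ $2 ⊞ ($3 ⊞ $4) ⊞ $5 ≼ $4 ⊞ $2 ⊞ ($5 ⊞ $0) ⊞ $1 ⊞ $3) (two ⊕ maxM N ⊕ eq≤ (#-split (covered M) (covered N)) ⊕ eq≥ (#-split (covered N) (covered M)) ⊕
        #-mono {S = covered M ∩ covered N} {covered N ∩ covered M} (λ _ h → ∩-in (∩-right {S = covered M} h) (∩-left h)))
      pick : ∃[ x ] x ∈ X ─ t
      pick = #-pos (X ─ t) (lin 2 (con 1 ≼ $0) (con 2 ⊞ $1 ≼ $1 ⊞ (con 1 ⊞ $0)) (X≥2 ⊕ #-─-≤ X t))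
      -- The mate `y` of `x` in `M` is covered by `N`, as otherwise the edge from `x` to `y` would
      -- enlarge `N`. Exchanging the edge of `N` at `y` for that edge keeps the size, still misses
      -- `t`, and gives agreement with `M` at `x`.
      swap : ∀ x → x ∈ X → t ≢ x → Missed₂ S u t ⊎ Missed₂ S v t
      swap x x∈X t≢x = improve _ refl (remove-edge N {mate M x} refl)
        where
        y : Fin n
        y = mate M x
        Mx : mate M x ≢ x
        Mx = covered-out M {x} (∖-left x∈X)
        ex : mate N x ≡ x
        ex = missed N (∖-right {S = covered M} x∈X)
        x∈S : x ∈ S
        x∈S = proj₁ (edge M x Mx)
        y∈S : y ∈ S
        y∈S = mate-edge M Mx
        cxy : c x y ≡ true
        cxy = proj₂ (edge M x Mx)
        Ny : mate N y ≢ y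
        Ny e = unaugmentable maxN ex e x∈S y∈S cxy
        t≢y : t ≢ y
        t≢y e = Ny (subst (λ w → mate N w ≡ w) e et)
        improve : ∀ z → mate N y ≡ z →
          (Σ (Matching S) λ N⁻ → (mate N⁻ y ≡ y) × (mate N⁻ z ≡ z) × (∀ {w} → y ≢ w → z ≢ w → mate N⁻ w ≡ mate N w) × (size N ≤ size N⁻ + 2)) →
          Missed₂ S u t ⊎ Missed₂ S v t
        improve z ez (N⁻ , N⁻y , N⁻z , other , shrink) = finish (add-edge N⁻ {x} {y} (trans (other Mx z≢x) ex) N⁻y x∈S y∈S cxy)
          where
          Nz : mate N z ≡ y
          Nz = trans (cong (mate N) (sym ez)) (involutive N y)
          z≢x : z ≢ x
          z≢x e = Mx (trans (sym Nz) (trans (cong (mate N) e) ex))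
          z≢t : z ≢ t
          z≢t e = t≢y (trans (sym et) (trans (cong (mate N) (sym e)) Nz))
          finish : (Σ (Matching S) λ N′ → (mate N′ x ≡ y) × (mate N′ y ≡ x) × (∀ {w} → x ≢ w → y ≢ w → mate N′ w ≡ mate N⁻ w) × (size N⁻ + 2 ≤ size N′)) →
            Missed₂ S u t ⊎ Missed₂ S v t
          finish (N′ , N′x , N′y , other′ , grow) = recurse k fuel
            where
            A A′ : Sub n
            A = covered M ∩ λ w → eqᵇ (mate M w) (mate N w)
            A′ = covered M ∩ λ w → eqᵇ (mate M w) (mate N′ w)
            max′ : Maximum N′
            max′ L = lin 4 ($0 ≼ $1) ($0 ⊞ $2 ⊞ ($3 ⊞ con 2) ≼ $2 ⊞ ($3 ⊞ con 2) ⊞ $1) (maxN L ⊕ shrink ⊕ grow)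
            e′t : mate N′ t ≡ t
            e′t = trans (other′ (t≢x ∘ sym) (t≢y ∘ sym)) (trans (other (t≢y ∘ sym) z≢t) et)
            keep : A ⊆ A′ ─ x
            keep w h = ─-in (∩-in (∩-left h) (subst (λ a → eqᵇ (mate M w) a ≡ true) unchanged same-mate)) x≢w
              where
              same-mate : eqᵇ (mate M w) (mate N w) ≡ true
              same-mate = ∩-right {S = covered M} h
              agree : mate M w ≡ mate N w
              agree = eqᵇ-true {i = mate M w} same-mate
              x≢w : x ≢ w
              x≢w e = Mx (trans (cong (mate M) e) (trans agree (trans (cong (mate N) (sym e)) ex)))
              y≢w : y ≢ w
              y≢w e = z≢x (trans (sym ez) (trans (cong (mate N) e) (trans (sym agree) (trans (cong (mate M) (sym e)) (involutive M x)))))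
              z≢w : z ≢ w
              z≢w e = x≢w (mate-injective M (sym (trans agree (trans (cong (mate N) (sym e)) Nz))))
              unchanged : mate N w ≡ mate N′ w
              unchanged = sym (trans (other′ x≢w y≢w) (other y≢w z≢w))
            gain : suc (# A) ≤ # A′
            gain = lin 3 (con 1 ⊞ $0 ≼ $1) ($0 ⊞ (con 1 ⊞ $2) ≼ $2 ⊞ $1) (#-mono {S = A} {A′ ─ x} keep ⊕ eq≥ (#-─ A′ {x} (∩-in (covered-in M Mx) (subst (λ a → eqᵇ y a ≡ true) (sym N′x) (eqᵇ-refl y)))))
            recurse : ∀ k → n ≤ # A + k → Missed₂ S u t ⊎ Missed₂ S v t
            recurse zero fuel = ⊥-elim (absurd-≤ 3 {n , # A , # A′ , _} ($0 ⊞ (con 1 ⊞ $1) ⊞ $2 ≼ $1 ⊞ con 0 ⊞ $2 ⊞ $0) (fuel ⊕ gain ⊕ #-≤ A′))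
            recurse (suc k) fuel = transit M maxM u≢v eu ev k N′ max′ e′t (lin 4 ($0 ≼ $1 ⊞ $2) ($0 ⊞ (con 1 ⊞ $3) ≼ $3 ⊞ (con 1 ⊞ $2) ⊞ $1) (fuel ⊕ gain))

  recombine : ∀ {S B} → B ⊆ S → (M₁ : Matching B) (M₂ : Matching (S ∖ B)) → Σ (Matching S) λ M → size M₁ + size M₂ ≤ size M
  recombine {S} {B} B⊆ M₁ M₂ = M , lin 3 {size M₁ , size M₂ , size M , _} ($0 ⊞ $1 ≼ $2) ($0 ⊞ $1 ≼ $2) (#-⊎ {S = covered M} {covered M₁} {covered M₂} sub₁ sub₂ disjoint)
    where
    f : Fin n → Fin n
    f v = if B v then mate M₁ v else mate M₂ v
    f-in : ∀ {v} → v ∈ B → f v ≡ mate M₁ v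
    f-in h rewrite h = refl
    f-out : ∀ {v} → v ∉ B → f v ≡ mate M₂ v
    f-out h rewrite h = refl
    stays-in : ∀ {v} → v ∈ B → mate M₁ v ∈ B
    stays-in {v} h with mate M₁ v ≟ᶠ v
    ... | yes e = subst (_∈ B) (sym e) h
    ... | no ne = mate-edge M₁ ne
    stays-out : ∀ {v} → v ∉ B → mate M₂ v ∉ B
    stays-out {v} h with mate M₂ v ≟ᶠ v
    ... | yes e = subst (_∉ B) (sym e) h
    ... | no ne = ∖-right {S = S} (mate-edge M₂ ne)
    M : Matching S
    M = record { mate = f ; involutive = inv ; edge = edge′ }
      where
      inv : ∀ v → f (f v) ≡ v
      inv v with true-or-false (B v)
      ... | inj₁ h = trans (cong f (f-in h)) (trans (f-in (stays-in h)) (involutive M₁ v))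
      ... | inj₂ h = trans (cong f (f-out h)) (trans (f-out (stays-out h)) (involutive M₂ v))
      edge′ : ∀ v → f v ≢ v → v ∈ S × c v (f v) ≡ true
      edge′ v ne with true-or-false (B v)
      ... | inj₁ h = B⊆ v h , trans (cong (c v) (f-in h)) (proj₂ (edge M₁ v λ e → ne (trans (f-in h) e)))
      ... | inj₂ h = ∖-left (proj₁ e) , trans (cong (c v) (f-out h)) (proj₂ e)
        where e = edge M₂ v (λ e → ne (trans (f-out h) e))
    sub₁ : covered M₁ ⊆ covered M
    sub₁ v h = covered-in M λ e → covered-out M₁ h (trans (sym (f-in (proj₁ (edge M₁ v (covered-out M₁ h))))) e)
    sub₂ : covered M₂ ⊆ covered M
    sub₂ v h = covered-in M λ e → covered-out M₂ h (trans (sym (f-out (∖-right {S = S} (proj₁ (edge M₂ v (covered-out M₂ h)))))) e)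
    disjoint : ∀ v → v ∈ covered M₁ → v ∈ covered M₂ → ⊥
    disjoint v h k = clash (proj₁ (edge M₁ v (covered-out M₁ h))) (∖-right {S = S} (proj₁ (edge M₂ v (covered-out M₂ k))))

  -- a family at least as large as the number of colour classes given by some matching of the complement
  Good : Sub n → Set
  Good S = ∃[ t ] (Family S t × Σ (Matching S) λ M → 2 * # S ≤ 2 * t + size M)

  module Reduction (odd : ∀ S k → # S + 1 ≡ 2 * k → ¬¬ Family S k) where

    -- If `# S` is even, parity makes `M` perfect. Then half of `# S` trees are enough, and the odd
    -- case provides them after any vertex has been dropped.
    near-perfect : ∀ {S} (M : Matching S) → # S ≤ size M + 1 → ¬¬ Good S
    near-perfect {S} M h with parity (# S)
    ... | k , inj₂ e = odd S k e >>= λ F → return (k , F , M , lin 3 {# S , k , # (covered M) , _} (2 ⊠ $0 ≼ 2 ⊠ $1 ⊞ $2) ($0 ⊞ ($0 ⊞ con 1) ≼ $2 ⊞ con 1 ⊞ (2 ⊠ $1)) (h ⊕ eq≤ e))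
    ... | zero , inj₁ e = return (0 , family-∅ , M , lin 2 {# S , # (covered M) , _} (2 ⊠ $0 ≼ 2 ⊠ con 0 ⊞ $1) (2 ⊠ $0 ≼ 2 ⊠ (2 ⊠ con 0)) (2 ⊗ eq≤ e))
    ... | suc k , inj₁ e with #-pos S (lin 2 (con 1 ≼ $0) (2 ⊠ (con 1 ⊞ $1) ≼ $0) (eq≥ e))
    ...   | x , x∈ = odd (S ─ x) (suc k) (trans (+-comm _ 1) (trans (sym (#-─ S x∈)) e)) >>= λ F →
              return (suc k , family-⊆ (λ _ → ─-left) F , M , lin 3 {# S , k , # (covered M) , _} (2 ⊠ $0 ≼ 2 ⊠ (con 1 ⊞ $1) ⊞ $2) ($0 ⊞ $0 ≼ $2 ⊞ (2 ⊠ (con 1 ⊞ $1))) (full-size (size-even M) ⊕ eq≤ e))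
      where
      full-size : ∃[ j ] size M ≡ 2 * j → # S ≤ size M
      full-size (j , e′) = ≮⇒≥ λ lt → absurd-≤ 2 {size M , # S , _} ($0 ⊞ con 2 ⊞ $1 ≼ $1 ⊞ ($0 ⊞ con 1)) (even-step j (suc k) e′ e lt ⊕ h)

    -- Gallai's argument as an induction on the size. A vertex covered by every maximum matching is
    -- dropped, an edge of the matching paying for it. If there is none and some maximum matching
    -- misses two vertices, `S` falls into two parts without complement edges between them.
    good : ∀ m S → # S ≤ m → ¬¬ Good S
    good zero S h = return (0 , family-∅ , idle S , lin 2 {# S , _ , _} (2 ⊠ $0 ≼ 2 ⊠ con 0 ⊞ $1) (2 ⊠ $0 ≼ 2 ⊠ con 0) (2 ⊗ h))
    good (suc m) S h = maximum S >>= λ (M₀ , max₀) → step M₀ max₀ (# S ≤? size M₀ + 1)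
      where
      -- A matching of `S ─ v` misses `v`, so it is not maximum in `S`; by parity it lacks a whole
      -- edge.
      shorter : ∀ v → ((M : Matching S) → Maximum M → mate M v ≢ v) → (M₀ : Matching S) → Maximum M₀ → (M : Matching (S ─ v)) → size M + 2 ≤ size M₀
      shorter v always M₀ max₀ M = even-step (proj₁ (size-even M)) (proj₁ (size-even M₀)) (proj₂ (size-even M)) (proj₂ (size-even M₀))
        (≰⇒> λ le → always M′ (λ N → ≤-trans (max₀ N) (≤-trans le same-size)) fixed)
        where
        M′ : Matching S
        M′ = matching-⊆ (λ _ → ─-left) M
        same-size : size M ≤ size M′
        same-size = #-mono λ w k → covered-in M′ (covered-out M k)
        fixed : mate M′ v ≡ v
        fixed with mate M v ≟ᶠ v
        ... | yes e = e
        ... | no ne = ⊥-elim (─-right {S = S} (proj₁ (edge M v ne)) refl)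
      -- `B` consists of `u` and the vertices that no maximum matching misses together with `u`. For
      -- an edge between `a` in `B` and `b` outside, `transit` yields a maximum matching that misses
      -- `u` and `a`, against the choice of `B`, or `a` and `b`, which could be enlarged; if `a` is
      -- `u`, a matching missing `u` and `b` could be enlarged. As `u` is inside and `v` outside,
      -- both parts are smaller than `S`.
      separate : ∀ u v → u ∈ S → v ∈ S → u ≢ v → Missed₂ S u v → (∀ v → v ∈ S → ¬¬ (Σ (Matching S) λ M → Maximum M × mate M v ≡ v)) → ¬¬ Good S
      separate u v u∈ v∈ u≢v uv missable = ¬¬-all (λ t → em (Missed₂ S u t)) >>= λ d → divide d
        where
        divide : (∀ t → Missed₂ S u t ⊎ ¬ Missed₂ S u t) → ¬¬ Good S
        divide d = distinct-near >>= λ near →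
          good m B (lin 4 ($0 ≼ $1) ($2 ⊞ $0 ⊞ (con 1 ⊞ $3) ≼ con 1 ⊞ $1 ⊞ $3 ⊞ $2) (h ⊕ #-mono {S = B} {S ─ v} (λ t t∈ → ─-in (B⊆ t t∈) λ { refl → clash t∈ v∉ }) ⊕ eq≥ (#-─ S v∈))) >>= λ where
            (s , F , M , e) → good m (S ∖ B) (lin 4 ($0 ≼ $1) ($2 ⊞ $0 ⊞ (con 1 ⊞ $3) ≼ con 1 ⊞ $1 ⊞ $3 ⊞ $2) (h ⊕ #-mono {S = S ∖ B} {S ─ u} (λ t t∈ → ─-in (∖-left t∈) λ { refl → clash uB (∖-right {S = S} t∈) }) ⊕ eq≥ (#-─ S u∈))) >>= λ where
              (t , H , N , e′) → return (s + t , family-⊆ sub (join-family F H near) , proj₁ (recombine B⊆ M N) ,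
                lin 9 {# S , s , t , _ , # B , # (S ∖ B) , _ , _ , # (S ∩ B) , _} (2 ⊠ $0 ≼ 2 ⊠ ($1 ⊞ $2) ⊞ $3) (2 ⊠ $4 ⊞ 2 ⊠ $5 ⊞ ($6 ⊞ $7) ⊞ 2 ⊠ $0 ⊞ 2 ⊠ $8 ≼ 2 ⊠ $1 ⊞ $6 ⊞ (2 ⊠ $2 ⊞ $7) ⊞ $3 ⊞ 2 ⊠ ($8 ⊞ $5) ⊞ 2 ⊠ $4) (e ⊕ e′ ⊕ proj₂ (recombine B⊆ M N) ⊕ 2 ⊗ eq≤ (#-split S B) ⊕ 2 ⊗ #-mono {S = S ∩ B} {B} (λ _ → ∩-right {S = S})))
          where
          side : ∀ {A : Set} → A ⊎ ¬ A → Bool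
          side (inj₁ _) = true
          side (inj₂ _) = false
          B : Sub n
          B t = S t ∧ (eqᵇ u t ∨ not (side (d t)))
          B⊆ : B ⊆ S
          B⊆ t = ∧-fst
          uB : u ∈ B
          uB = ∧-intro u∈ (∨-introˡ (eqᵇ-refl u))
          B-out : ∀ {t} → t ∈ B → u ≡ t ⊎ ¬ Missed₂ S u t
          B-out {t} h = go (d t) (∨-elim {eqᵇ u t} (∧-snd {S t} h))
            where
            go : (e : Missed₂ S u t ⊎ ¬ Missed₂ S u t) → eqᵇ u t ≡ true ⊎ not (side e) ≡ true → u ≡ t ⊎ ¬ Missed₂ S u t
            go _ (inj₁ e) = inj₁ (eqᵇ-true {i = u} e)
            go (inj₂ k) (inj₂ _) = inj₂ k
          ∉B : ∀ {t} → t ∈ S → t ∉ B → u ≢ t × Missed₂ S u t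
          ∉B {t} t∈ h = go (d t) (λ k → clash (∧-intro t∈ k) h)
            where
            go : (e : Missed₂ S u t ⊎ ¬ Missed₂ S u t) → ¬ (eqᵇ u t ∨ not (side e) ≡ true) → u ≢ t × Missed₂ S u t
            go (inj₁ k) h = (λ { refl → h (∨-introˡ (eqᵇ-refl u)) }) , k
            go (inj₂ _) h = ⊥-elim (h (∨-introʳ {eqᵇ u t} refl))
          v∉ : v ∉ B
          v∉ = ¬true⇒false λ h → case B-out h of λ { (inj₁ e) → u≢v e ; (inj₂ k) → k uv }
          sub : B ∪ (S ∖ B) ⊆ S
          sub t h with ∪-out {S = B} h
          ... | inj₁ k = B⊆ t k
          ... | inj₂ k = ∖-left k
          separated : ∀ a b → a ∈ B → b ∈ S ∖ B → ¬ (c a b ≡ true)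
          separated a b a∈ b∈ cab with ∉B (∖-left b∈) (∖-right {S = S} b∈) | B-out a∈
          ... | u≢b , (M , max , eu , eb) | inj₁ refl = unaugmentable max eu eb u∈ (∖-left b∈) cab
          ... | u≢b , (M , max , eu , eb) | inj₂ k = missable a (B⊆ a a∈) λ where
                (N , maxN , ea) → case transit M max u≢b eu eb n N maxN ea (m≤n+m n _) of λ where
                  (inj₁ ua) → k ua
                  (inj₂ (L , maxL , eb′ , ea′)) → unaugmentable maxL ea′ eb′ (B⊆ a a∈) (∖-left b∈) cab
          distinct-near : ¬¬ (∀ a b → a ∈ B → b ∈ S ∖ B → Near a b)
          distinct-near = return λ a b a∈ b∈ → (λ { refl → clash a∈ (∖-right {S = S} b∈) }) , ¬true⇒false (separated a b a∈ b∈)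

      split : (M₀ : Matching S) → Maximum M₀ → ¬ # S ≤ size M₀ + 1 → (∀ v → v ∈ S → ¬¬ (Σ (Matching S) λ M → Maximum M × mate M v ≡ v)) → ¬¬ Good S
      split M₀ max₀ large missable = separate (proj₁ pick₁) (proj₁ pick₂) (∖-left (proj₂ pick₁)) (∖-left (─-left (proj₂ pick₂))) (─-right (proj₂ pick₂))
          (M₀ , max₀ , missed M₀ (∖-right {S = S} (proj₂ pick₁)) , missed M₀ (∖-right {S = S} (─-left (proj₂ pick₂)))) missable
        where
        rest : Sub n
        rest = S ∖ covered M₀
        two : 2 ≤ # rest
        two = lin 4 {# rest , size M₀ , # S , # (S ∩ covered M₀) , _} (con 2 ≼ $0) (con 1 ⊞ ($1 ⊞ con 1) ⊞ $2 ⊞ $3 ≼ $2 ⊞ ($3 ⊞ $0) ⊞ $1) (≰⇒> large ⊕ eq≤ (#-split S (covered M₀)) ⊕ #-mono {S = S ∩ covered M₀} {covered M₀} (λ _ → ∩-right {S = S}))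
        pick₁ : ∃[ x ] x ∈ rest
        pick₁ = #-pos rest (lin 1 (con 1 ≼ $0) (con 2 ≼ $0) two)
        pick₂ : ∃[ x ] x ∈ rest ─ proj₁ pick₁
        pick₂ = #-pos (rest ─ proj₁ pick₁) (lin 2 (con 1 ≼ $0) (con 2 ⊞ $1 ≼ $1 ⊞ (con 1 ⊞ $0)) (two ⊕ #-─-≤ rest (proj₁ pick₁)))
      step : (M₀ : Matching S) → Maximum M₀ → Dec (# S ≤ size M₀ + 1) → ¬¬ Good S
      step M₀ max₀ (yes small) = near-perfect M₀ small
      step M₀ max₀ (no large) = em (∃[ v ] (v ∈ S × ((M : Matching S) → Maximum M → mate M v ≢ v))) >>= λ where
        (inj₁ (v , v∈ , always)) → good m (S ─ v) (lin 3 ($0 ≼ $1) ($2 ⊞ (con 1 ⊞ $0) ≼ con 1 ⊞ $1 ⊞ $2) (h ⊕ eq≥ (#-─ S v∈))) >>= λ where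
          (t , F , M , e) → return (t , family-⊆ (λ _ → ─-left) F , M₀ , lin 5 {# S , t , _ , # (S ─ v) , _ , _} (2 ⊠ $0 ≼ 2 ⊠ $1 ⊞ $2) (2 ⊠ $3 ⊞ 2 ⊠ $0 ⊞ ($4 ⊞ con 2) ≼ 2 ⊠ $1 ⊞ $4 ⊞ 2 ⊠ (con 1 ⊞ $3) ⊞ $2) (e ⊕ 2 ⊗ eq≤ (#-─ S v∈) ⊕ shorter v always M₀ max₀ M))
        (inj₂ missable) → split M₀ max₀ large λ v v∈ k → missable (v , v∈ , λ M max e → k (M , max , e))

  -- The colour classes are the matched pairs and the unmatched vertices. The inequality is their
  -- number, doubled to avoid a division.
  colouring : ∀ m {S} → # S ≤ m → (M : Matching S) →
    ∃[ t ] (2 * t + size M ≤ 2 * # S × Σ (Fin n → ℕ) λ col → (∀ v → v ∈ S → col v < t) × (∀ u v → u ∈ S → v ∈ S → Near u v → col u ≢ col v))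
  colouring m {S} h M with 1 ≤? # S
  ... | no empty = 0 , lin 2 {# (covered M) , # S , _} (2 ⊠ con 0 ⊞ $0 ≼ 2 ⊠ $1) (2 ⊠ $0 ⊞ 1 ⊠ con 0 ≼ 2 ⊠ $1 ⊞ 1 ⊠ $0) (2 ⊗ #-mono {S = covered M} {S} (λ v k → proj₁ (edge M v (covered-out M k)))  ⊕ 1 ⊗ z≤n {size M}) , (λ _ → 0) , (λ v v∈ → ⊥-elim (none v v∈)) , λ u v u∈ → ⊥-elim (none u u∈)
    where
    none : ∀ v → v ∈ S → ⊥
    none v v∈ = empty (lin 2 (con 1 ≼ $0) (con 1 ⊞ $1 ≼ $0) (eq≥ (#-─ S v∈)))
  colouring zero {S} h M | yes pos = ⊥-elim (absurd-≤ 1 ($0 ⊞ con 1 ≼ con 0 ⊞ $0) (h ⊕ pos))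
  colouring (suc m) {S} h M | yes pos with #-pos S pos
  ... | v , v∈ with remove-edge M {v} refl
  ...   | N , Nv , Nw , other , shrink = extend (colouring m (lin 3 ($0 ≼ $1) ($2 ⊞ (con 1 ⊞ $0) ≼ con 1 ⊞ $1 ⊞ $2) (h ⊕ fewer)) N′)
    where
    w : Fin n
    w = mate M v
    S′ : Sub n
    S′ = S ─ v ─ w
    fewer : suc (# S′) ≤ # S
    fewer = lin 3 (con 1 ⊞ $0 ≼ $1) (con 1 ⊞ $2 ⊞ $0 ≼ $1 ⊞ $2) (eq≥ (#-─ S v∈) ⊕ #-mono {S = S′} {S ─ v} (λ _ → ─-left))
    N′ : Matching S′
    N′ = record { mate = mate N ; involutive = involutive N
                ; edge = λ x ne → ─-in (─-in (proj₁ (edge N x ne)) (λ { refl → ne Nv })) (λ { refl → ne Nw }) , proj₂ (edge N x ne) }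
    same-size : size N ≤ size N′
    same-size = #-mono λ x k → covered-in N′ (covered-out N k)
    bound : size M + 2 * # S′ + 2 ≤ size N′ + 2 * # S
    bound with w ≟ᶠ v
    ... | yes e = lin 5 {# (covered M) , # (S ─ v ─ mate M v) , # (covered N′) , # S , size N , _} ($0 ⊞ (2 ⊠ $1) ⊞ con 2 ≼ $2 ⊞ (2 ⊠ $3)) ($0 ⊞ $4 ⊞ 2 ⊠ (con 1 ⊞ $1) ≼ $4 ⊞ $2 ⊞ 2 ⊠ $3) (#-mono {S = covered M} {covered N} (λ x k → covered-in N λ ex → covered-out M k (trans (sym (other (λ { refl → covered-out M k e }) (λ { refl → covered-out M k (trans (cong (mate M) e) refl) }))) ex)) ⊕ same-size ⊕ 2 ⊗ fewer)
    ... | no ne = lin 6 {# (covered M) , # (S ─ v ─ mate M v) , # (covered N′) , # S , size N , # (S ─ v) , _} ($0 ⊞ (2 ⊠ $1) ⊞ con 2 ≼ $2 ⊞ (2 ⊠ $3)) ($0 ⊞ $4 ⊞ 2 ⊠ (con 1 ⊞ $5) ⊞ 2 ⊠ (con 1 ⊞ $1) ≼ $4 ⊞ con 2 ⊞ $2 ⊞ 2 ⊠ $3 ⊞ 2 ⊠ $5) (shrink ⊕ same-size ⊕ 2 ⊗ eq≥ (#-─ S v∈) ⊕ 2 ⊗ eq≥ (#-─ (S ─ v) {w} (─-in (mate-edge M ne) (λ e → ne (sym e)))))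
    extend : (∃[ t ] (2 * t + size N′ ≤ 2 * # S′ × Σ (Fin n → ℕ) λ col → (∀ v → v ∈ S′ → col v < t) × (∀ u v → u ∈ S′ → v ∈ S′ → Near u v → col u ≢ col v))) →
      ∃[ t ] (2 * t + size M ≤ 2 * # S × Σ (Fin n → ℕ) λ col → (∀ v → v ∈ S → col v < t) × (∀ u v → u ∈ S → v ∈ S → Near u v → col u ≢ col v))
    extend (t , e , col , col< , proper) = suc t , lin 5 {t , _ , # S , _ , # S′ , _} (2 ⊠ (con 1 ⊞ $0) ⊞ $1 ≼ 2 ⊠ $2) (2 ⊠ $0 ⊞ $3 ⊞ ($1 ⊞ 2 ⊠ $4 ⊞ con 2) ≼ 2 ⊠ $4 ⊞ ($3 ⊞ 2 ⊠ $2)) (e ⊕ bound) , col′ , col′< , proper′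
      where
      col′ : Fin n → ℕ
      col′ x = if S′ x then col x else t
      in-col : ∀ {x} → x ∈ S′ → col′ x ≡ col x
      in-col k rewrite k = refl
      out-col : ∀ {x} → x ∉ S′ → col′ x ≡ t
      out-col k rewrite k = refl
      col′< : ∀ x → x ∈ S → col′ x < suc t
      col′< x x∈ with true-or-false (S′ x)
      ... | inj₁ k = subst (_< suc t) (sym (in-col k)) (m≤n⇒m≤1+n (col< x k))
      ... | inj₂ k = subst (_< suc t) (sym (out-col k)) ≤-refl
      outside : ∀ {x} → x ∈ S → x ∉ S′ → x ≡ v ⊎ x ≡ w
      outside {x} x∈ k with v ≟ᶠ x | w ≟ᶠ x
      ... | yes e | _ = inj₁ (sym e)
      ... | no _ | yes e = inj₂ (sym e)
      ... | no a | no b = clash (─-in (─-in x∈ a) b) k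
      not-both : ∀ {x y} → x ≡ v ⊎ x ≡ w → y ≡ v ⊎ y ≡ w → Near x y → ⊥
      not-both (inj₁ refl) (inj₁ refl) (ne , _) = ne refl
      not-both (inj₂ refl) (inj₂ refl) (ne , _) = ne refl
      not-both (inj₁ refl) (inj₂ refl) (ne , k) = clash (proj₂ (edge M v (ne ∘ sym))) k
      not-both (inj₂ refl) (inj₁ refl) (ne , k) = clash (proj₂ (edge M v ne)) (trans (c-sym _ _) k)
      proper′ : ∀ x y → x ∈ S → y ∈ S → Near x y → col′ x ≢ col′ y
      proper′ x y x∈ y∈ near e with true-or-false (S′ x) | true-or-false (S′ y)
      ... | inj₁ k | inj₁ l = proper x y k l near (trans (sym (in-col k)) (trans e (in-col l)))
      ... | inj₁ k | inj₂ l = absurd-≤ 1 (con 1 ⊞ $0 ≼ $0) (subst (_< t) (trans (sym (in-col k)) (trans e (out-col l))) (col< x k))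
      ... | inj₂ k | inj₁ l = absurd-≤ 1 (con 1 ⊞ $0 ≼ $0) (subst (_< t) (trans (sym (in-col l)) (trans (sym e) (out-col k))) (col< y l))
      ... | inj₂ k | inj₂ l = not-both (outside x∈ k) (outside y∈ l) near

-- Back to graphs and odd expansions

opaque
  unfolding #
  card-tabulate : ∀ {n} (S : Sub n) → ∣ tabulate S ∣ ≡ # S
  card-tabulate {zero} S = refl
  card-tabulate {suc n} S with S zero
  ... | true = cong suc (card-tabulate (S ∘ suc))
  ... | false = card-tabulate (S ∘ suc)

eqᵇ-comm : ∀ {n} (i j : Fin n) → eqᵇ i j ≡ eqᵇ j i
eqᵇ-comm i j with i ≟ᶠ j
... | yes refl = sym (eqᵇ-refl i)
... | no ne = sym (eqᵇ-false (ne ∘ sym))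

complement : ∀ {n} (G : Graph n) → αAtMost G 2 → TriangleFree n
complement {n} G α = record { c = c ; c-sym = c-sym ; c-irr = c-irr ; c-tri = c-tri }
  where
  c : Fin n → Fin n → Bool
  c u v = not (adj G u v) ∧ not (eqᵇ u v)
  c-sym : ∀ u v → c u v ≡ c v u
  c-sym u v = cong₂ (λ a b → not a ∧ not b) (adj-sym G u v) (eqᵇ-comm u v)
  c-irr : ∀ u → c u u ≡ false
  c-irr u = ¬true⇒false λ h → clash (eqᵇ-refl u) (not-true (∧-snd {not (adj G u u)} h))
  c-tri : ∀ u v w → c u v ≡ true → c v w ≡ true → c u w ≡ true → ⊥
  c-tri u v w uv vw uw = absurd-≤ 2 {∣ tabulate (image t) ∣ , # (image t) , _} ($0 ⊞ $1 ⊞ con 3 ≼ con 2 ⊞ $0 ⊞ $1) (α (tabulate (image t)) independent ⊕ eq≥ (card-tabulate (image t)) ⊕ #-image-≥ t t-injective)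
    where
    t : Fin 3 → Fin n
    t 0F = u
    t 1F = v
    t 2F = w
    flip : ∀ {x y} → c x y ≡ true → c y x ≡ true
    flip {x} {y} h = trans (c-sym y x) h
    off : ∀ a b → a ≢ b → c (t a) (t b) ≡ true
    off 0F 0F ne = ⊥-elim (ne refl)
    off 0F 1F _ = uv
    off 0F 2F _ = uw
    off 1F 0F _ = flip uv
    off 1F 1F ne = ⊥-elim (ne refl)
    off 1F 2F _ = vw
    off 2F 0F _ = flip uw
    off 2F 1F _ = flip vw
    off 2F 2F ne = ⊥-elim (ne refl)
    t-injective : ∀ {a b} → t a ≡ t b → a ≡ b
    t-injective {a} {b} e with a ≟ᶠ b
    ... | yes p = p
    ... | no ne = ⊥-elim (clash (off a b ne) (trans (cong (λ x → c x (t b)) e) (c-irr (t b))))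
    independent : Independent G (tabulate (image t))
    independent x y x∈ y∈ adjacent
      with image-out t (trans (sym (lookup∘tabulate (image t) x)) ([]=⇒lookup x∈))
         | image-out t (trans (sym (lookup∘tabulate (image t) y)) ([]=⇒lookup y∈))
    ... | a , refl | b , refl with a ≟ᶠ b
    ...   | yes refl = clash adjacent (adj-irr G (t a))
    ...   | no ne = clash adjacent (not-true (∧-fst (off a b ne)))

module Conclusion {n} (G : Graph n) (α : αAtMost G 2) where
  𝒞 : TriangleFree n
  𝒞 = complement G α
  open TriangleFree 𝒞
  open Families 𝒞
  open Family

  near⇒adjacent : ∀ {u v} → Near u v → Adj G u v
  near⇒adjacent {u} {v} (ne , h) = ¬false⇒true λ e → clash (∧-intro (not-false e) (not-false (eqᵇ-false ne))) h

  adjacent⇒near : ∀ {u v} → Adj G u v → Near u v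
  adjacent⇒near {u} {v} h = (λ { refl → clash h (adj-irr G u) }) , ¬true⇒false λ e → clash h (not-true (∧-fst e))

  isEndOf? : ∀ v t → Dec (v isEndOf t)
  isEndOf? v t with v ≟ᶠ left t | v ≟ᶠ right t
  ... | yes e | _ = yes (isLeft e)
  ... | no _ | yes e = yes (isRight e)
  ... | no a | no b = no λ { (isLeft e) → a e ; (isRight e) → b e }

  isIn? : ∀ v t → Dec (v isIn t)
  isIn? v t = isEndOf? v t ⊎-dec (v ≟ᶠ mid t)

  Near? : ∀ u v → Dec (Near u v)
  Near? u v = (¬? (u ≟ᶠ v)) ×-dec (c u v ≟ᵇ false)

  Valid? : ∀ t → Dec (Valid t)
  Valid? t = ((left t ≟ᶠ mid t) ×-dec (right t ≟ᶠ mid t)) ⊎-dec (Near? (left t) (mid t) ×-dec Near? (right t) (mid t))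

  Linked? : ∀ s t → Dec (Linked s t)
  Linked? s t = any? (λ u → any? λ v → isEndOf? u s ×-dec (isEndOf? v t ×-dec Near? u v))
    ⊎-dec ((¬? (left s ≟ᶠ mid s)) ×-dec ((¬? (left t ≟ᶠ mid t)) ×-dec Near? (mid s) (mid t)))

  Disjoint? : ∀ s t → Dec (Disjoint s t)
  Disjoint? s t = map′ (λ h {u} → h u) (λ h u → h {u}) (all? λ u → isIn? u s →-dec ¬? (isIn? u t))

  Expansion : ∀ k → (Fin k → Tree) → Set
  Expansion k f = (∀ i → Valid (f i)) × (∀ i j → i ≢ j → Apart (f i) (f j))

  Expansion? : ∀ k f → Dec (Expansion k f)
  Expansion? k f = (all? λ i → Valid? (f i)) ×-dec
    (all? λ i → all? λ j → (¬? (i ≟ᶠ j)) →-dec map′ (λ (d , l) → (λ {u} → d {u}) , l) (λ (d , l) → (λ {u} → d {u}) , l) (Disjoint? (f i) (f j) ×-dec Linked? (f i) (f j)))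

  -- Functions are enumerated one value at a time; `ext` takes the place of function extensionality.
  search : ∀ k (P : (Fin k → Tree) → Set) → (∀ f → Dec (P f)) → (∀ {f h} → (∀ i → f i ≡ h i) → P f → P h) → Dec (∃ P)
  search zero P P? ext with P? (λ ())
  ... | yes p = yes (_ , p)
  ... | no ¬p = no λ (f , p) → ¬p (ext (λ ()) p)
  search (suc k) P P? ext with any? (λ l → any? λ m → any? λ r →
      search k (λ f → P (cons (tree l m r) f)) (λ f → P? _) (λ e → ext λ { zero → refl ; (suc i) → e i }))
    where
    cons : Tree → (Fin k → Tree) → Fin (suc k) → Tree
    cons t f zero = t
    cons t f (suc i) = f i
  ... | yes (l , m , r , f , p) = yes (_ , p)
  ... | no ¬p = no λ (f , p) → ¬p (left (f zero) , mid (f zero) , right (f zero) , f ∘ suc , ext (λ { zero → refl ; (suc i) → refl }) p)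

  expansion : ∀ {k} → ¬¬ Family full k → ∃ (Expansion k)
  expansion {k} F with search k (Expansion k) (Expansion? k) (λ {f} {h} e (v , a) →
      (λ i → subst Valid (e i) (v i)) , λ i j ne → subst₂ Apart (e i) (e j) (a i j ne))
  ... | yes E = E
  ... | no ¬E = ⊥-elim (F λ F → ¬E (trees F , valid F , λ i j → apart F))

  module _ {k} (f : Fin k → Tree) (E : Expansion k f) where

    private
      branch : Fin n → Maybe (Fin k)
      branch v with any? (λ i → isIn? v (f i))
      ... | yes (i , _) = just i
      ... | no _ = nothing

      branch-in : ∀ {v i} → v isIn f i → branch v ≡ just i
      branch-in {v} {i} h with any? (λ i → isIn? v (f i))
      ... | no ¬p = ⊥-elim (¬p (i , h))
      ... | yes (j , h′) with j ≟ᶠ i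
      ...   | yes refl = refl
      ...   | no ne = ⊥-elim (proj₁ (proj₂ E j i ne) h′ h)

      branch-out : ∀ {v i} → branch v ≡ just i → v isIn f i
      branch-out {v} e with any? (λ i → isIn? v (f i))
      branch-out {v} refl | yes (i , h) = h

      -- With the middle as root every tree has depth at most one, and the colour of a vertex tells
      -- whether it is an end. Values outside the trees are arbitrary.
      root : Fin k → Fin n
      root i = mid (f i)

      parent-in : Fin n → Maybe (Fin k) → Fin n
      parent-in v nothing = v
      parent-in v (just i) = root i

      depth-in : Fin n → Maybe (Fin k) → ℕ
      depth-in v nothing = 0
      depth-in v (just i) = if eqᵇ v (root i) then 0 else 1

      colour-in : Fin n → Maybe (Fin k) → Bool
      colour-in v nothing = false
      colour-in v (just i) = ⌊ isEndOf? v (f i) ⌋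

      end-true : ∀ {v t} → v isEndOf t → ⌊ isEndOf? v t ⌋ ≡ true
      end-true {v} {t} h with isEndOf? v t
      ... | yes _ = refl
      ... | no k = ⊥-elim (k h)

      end-false : ∀ {v t} → ¬ (v isEndOf t) → ⌊ isEndOf? v t ⌋ ≡ false
      end-false {v} {t} h with isEndOf? v t
      ... | yes k = ⊥-elim (h k)
      ... | no _ = refl

      root-in : ∀ i → branch (root i) ≡ just i
      root-in i = branch-in (inj₂ refl)

      colour : Fin n → Bool
      colour v = colour-in v (branch v)

      colour-end : ∀ {v i} → v isEndOf f i → colour v ≡ true
      colour-end {v} {i} h rewrite branch-in {v} {i} (inj₁ h) = end-true h

      mid-not-end : ∀ i → left (f i) ≢ mid (f i) → ¬ (mid (f i) isEndOf f i)
      mid-not-end i ne (isLeft e) = ne (sym e)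
      mid-not-end i ne (isRight e) with proj₁ E i
      ... | inj₁ (l , _) = ne l
      ... | inj₂ (_ , (r , _)) = r (sym e)

      colour-mid : ∀ i → left (f i) ≢ mid (f i) → colour (mid (f i)) ≡ false
      colour-mid i ne rewrite root-in i = end-false (mid-not-end i ne)

      proper-end : ∀ {v i} → v isIn f i → v ≢ root i → v isEndOf f i × Near v (root i) × left (f i) ≢ mid (f i)
      proper-end (inj₂ e) ne = ⊥-elim (ne e)
      proper-end {v} {i} (inj₁ h) ne with proj₁ E i | h
      ... | inj₁ (l , _) | isLeft e = ⊥-elim (ne (trans e l))
      ... | inj₁ (_ , r) | isRight e = ⊥-elim (ne (trans e r))
      ... | inj₂ (l , _) | isLeft e = h , subst (λ x → Near x (root i)) (sym e) l , proj₁ l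
      ... | inj₂ (l , r) | isRight e = h , subst (λ x → Near x (root i)) (sym e) r , proj₁ l

    odd-expansion : OddExpansion G k
    odd-expansion = record
      { branch = branch ; root = root ; root-in = root-in
      ; parent = λ v → parent-in v (branch v)
      ; depth = λ v → depth-in v (branch v)
      ; parent-ok = parent-ok
      ; colour = colour
      ; tree-bichromatic = bichromatic
      ; link = λ i j i<j → link i j (proj₂ (proj₂ E i j (<⇒≢ᶠ i<j))) }
      where
      parent-ok : ∀ v i → branch v ≡ just i → v ≢ root i →
        branch (parent-in v (branch v)) ≡ just i × Adj G v (parent-in v (branch v)) ×
        depth-in (parent-in v (branch v)) (branch (parent-in v (branch v))) < depth-in v (branch v)
      parent-ok v i bv ne rewrite bv | root-in i | eqᵇ-refl (root i) | eqᵇ-false ne =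
        refl , near⇒adjacent (proj₁ (proj₂ (proper-end (branch-out bv) ne))) , s≤s z≤n
      bichromatic : ∀ v i → branch v ≡ just i → v ≢ root i → colour v ≢ colour (parent-in v (branch v))
      bichromatic v i bv ne e with proper-end (branch-out bv) ne
      ... | end , _ , proper = clash (trans (sym e) (colour-end end))
              (subst (λ b → colour (parent-in v b) ≡ false) (sym bv) (colour-mid i proper))
      link : ∀ i j → Linked (f i) (f j) → Σ (Fin n) λ u → Σ (Fin n) λ w →
        branch u ≡ just i × branch w ≡ just j × Adj G u w × colour u ≡ colour w
      link i j (inj₁ (u , w , hu , hw , near)) = u , w , branch-in (inj₁ hu) , branch-in (inj₁ hw) , near⇒adjacent near ,
        trans (colour-end hu) (sym (colour-end hw))
      link i j (inj₂ (hi , hj , near)) = mid (f i) , mid (f j) , root-in i , root-in j , near⇒adjacent near ,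
        trans (colour-mid i hi) (sym (colour-mid j hj))

  -- Trees and colours are measured against the same matching `M`: the colouring obtained from `M`
  -- has at most as many colours as there are trees, and `k` is at most its number of colours.
  conclude : (∀ S k → # S + 1 ≡ 2 * k → ¬¬ Family S k) → ∀ k → IsChromaticNumber G k → OhAtLeast G k
  conclude odd k (_ , least) = k , ≤-refl , odd-expansion _ (proj₂ (expansion family))
    where
    open Matchings 𝒞
    family : ¬¬ Family full k
    family = Reduction.good odd n full (#-≤ full) >>= λ (t , F , M , e) → return (family-≤ (bound t M e (colouring n (#-≤ full) M)) F)
      where
      bound : ∀ t (M : Matching full) → 2 * # (full {n}) ≤ 2 * t + size M →
        ∃[ s ] (2 * s + size M ≤ 2 * # (full {n}) × Σ (Fin n → ℕ) λ col → (∀ v → v ∈ full → col v < s) × (∀ u v → u ∈ full → v ∈ full → Near u v → col u ≢ col v)) → k ≤ t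
      bound t M e (s , e′ , col , col< , proper) = ≤-trans
        (least s ((λ v → fromℕ< (col< v refl)) , λ u v a e → proper u v refl refl (adjacent⇒near a)
          (trans (sym (toℕ-fromℕ< (col< u refl))) (trans (cong toℕ e) (toℕ-fromℕ< (col< v refl))))))
        (*-cancelˡ-≤ {s} {t} 2 (lin 4 {s , t , # full , _ , _} (2 ⊠ $0 ≼ 2 ⊠ $1) (2 ⊠ $2 ⊞ (2 ⊠ $0 ⊞ $3) ≼ 2 ⊠ $1 ⊞ $3 ⊞ 2 ⊠ $2) (e ⊕ e′)))

-- Small Ramsey numbers

module Ramsey {n} (𝒞 : TriangleFree n) where
  open TriangleFree 𝒞
  open Families 𝒞 using (Stable)
  open Seagulls 𝒞

  deg : Sub n → Fin n → ℕ
  deg S v = # (S ∩ c v)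

  far : Sub n → Fin n → Sub n
  far S v = (S ∖ c v) ─ v

  far-in : ∀ {S v w} → w ∈ S → c v w ≡ false → v ≢ w → w ∈ far S v
  far-in h k ne = ─-in (∖-in h k) ne

  far-⊆ : ∀ {S v w} → w ∈ far S v → w ∈ S
  far-⊆ h = ∖-left (─-left h)

  far-c : ∀ {S v w} → w ∈ far S v → c v w ≡ false
  far-c {S} h = ∖-right {S = S} (─-left h)

  far-≢ : ∀ {S v w} → w ∈ far S v → v ≢ w
  far-≢ h = ─-right h

  opaque
    #-far : ∀ S {v} → v ∈ S → # S ≡ deg S v + suc (# (far S v))
    #-far S {v} v∈ = trans (#-split S (c v)) (cong (deg S v +_) (#-─ (S ∖ c v) (∖-in v∈ (c-irr v))))

  StableBound : Sub n → ℕ → Set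
  StableBound S m = ∀ Q → Q ⊆ S → Stable Q → # Q ≤ m

  neighbours-stable : ∀ S v → Stable (S ∩ c v)
  neighbours-stable S v {a} {b} ha hb = ¬true⇒false λ h → c-tri v a b (∩-right {S = S} ha) h (∩-right {S = S} hb)

  deg-bound : ∀ {S m} → StableBound S m → ∀ v → deg S v ≤ m
  deg-bound {S} b v = b (S ∩ c v) (λ _ → ∩-left) (neighbours-stable S v)

  singleton-stable : ∀ v → Stable ⁅ v ⁆
  singleton-stable v {a} {b} ha hb = subst₂ (λ x y → c x y ≡ false) (eqᵇ-true {i = v} ha) (eqᵇ-true {i = v} hb) (c-irr v)

  insert-stable : ∀ {v Q} → Stable Q → (∀ {w} → w ∈ Q → c v w ≡ false) → Stable (⁅ v ⁆ ∪ Q)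
  insert-stable {v} {Q} st h = stable-∪ {⁅ v ⁆} {Q} (singleton-stable v) st λ {a} {b} a∈ b∈ → subst (λ x → c x b ≡ false) (eqᵇ-true {i = v} a∈) (h b∈)

  insert-size : ∀ {v} {Q : Sub n} → (∀ {w} → w ∈ Q → v ≢ w) → suc (# Q) ≤ # (⁅ v ⁆ ∪ Q)
  insert-size {v} {Q} h = lin 3 (con 1 ⊞ $0 ≼ $1) ($2 ⊞ $0 ⊞ con 1 ≼ $1 ⊞ $2) (∪-size {⁅ v ⁆} {Q} (λ w a b → h b (eqᵇ-true {i = v} a)) ⊕ eq≥ (#-⁅⁆ v))

  insert-⊆ : ∀ {v} {Q S : Sub n} → v ∈ S → Q ⊆ S → ⁅ v ⁆ ∪ Q ⊆ S
  insert-⊆ {v} {Q} {S} v∈ Q⊆ w h with ∪-out {S = ⁅ v ⁆} h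
  ... | inj₁ e = subst (_∈ S) (eqᵇ-true {i = v} e) v∈
  ... | inj₂ k = Q⊆ w k

  far-bound : ∀ {S m v} → StableBound S (suc m) → v ∈ S → StableBound (far S v) m
  far-bound {S} {m} {v} b v∈ Q Q⊆ st = ≤-pred (≤-trans (insert-size {v} {Q} λ h → far-≢ {S} (Q⊆ _ h))
    (b (⁅ v ⁆ ∪ Q) (insert-⊆ v∈ λ w h → far-⊆ (Q⊆ w h)) (insert-stable {v} {Q} st λ h → far-c {S} (Q⊆ _ h))))

  opaque
    unfolding # sumOver _∖_
    degree-sum-even : ∀ S → ∃[ k ] sumOver S (deg S) ≡ 2 * k
    degree-sum-even S with handshake (λ u v → S u ∧ (S v ∧ c u v)) (λ u v → pt (S u) (S v) (c-sym u v)) (λ u → irr (S u) (c-irr u))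
      where
      pt : ∀ a b {x y} → x ≡ y → a ∧ (b ∧ x) ≡ b ∧ (a ∧ y)
      pt true true refl = refl
      pt true false refl = refl
      pt false true refl = refl
      pt false false refl = refl
      irr : ∀ a {x} → x ≡ false → a ∧ (a ∧ x) ≡ false
      irr true refl = refl
      irr false refl = refl
    ... | k , e = k , trans (sum-cong row) e
      where
      row : ∀ u → b2n (S u) * sum (λ v → b2n (S v ∧ c u v)) ≡ sum (λ v → b2n (S u ∧ (S v ∧ c u v)))
      row u with S u
      ... | true = +-identityʳ _
      ... | false = sym (sum-0 {n})

  -- The bound R(3, m + 1) ≤ r + 1, for sets of vertices of the given triangle-free graph.
  RamseyBound : ℕ → ℕ → Set
  RamseyBound m r = ∀ S → StableBound S m → # S ≤ r

  -- The neighbours of a vertex form a stable set, so there are at most `suc m`; the vertex itself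
  -- and at most `r` far vertices complete the count.
  ramsey-step : ∀ {m r} → RamseyBound m r → RamseyBound (suc m) (r + suc (suc m))
  ramsey-step {m} {r} R S b with 1 ≤? # S
  ... | no h = lin 3 ($0 ≼ $1 ⊞ (con 1 ⊞ (con 1 ⊞ $2))) (con 1 ⊞ $0 ⊞ con 0 ≼ con 1 ⊞ ($1 ⊞ $2)) (≰⇒> h ⊕ z≤n {r + m})
  ... | yes h with #-pos S h
  ...   | v , v∈ = lin 5 ($0 ≼ $1 ⊞ (con 1 ⊞ (con 1 ⊞ $2))) ($0 ⊞ $3 ⊞ $4 ≼ $3 ⊞ (con 1 ⊞ $4) ⊞ (con 1 ⊞ $2) ⊞ $1) (eq≤ (#-far S v∈) ⊕ deg-bound b v ⊕ R (far S v) (far-bound b v∈))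

  -- a graph with an odd number of vertices is not regular of odd degree
  ramsey-parity : ∀ {m r} k → RamseyBound m r → suc m * (r + suc (suc m)) ≡ 2 * k + 1 → RamseyBound (suc m) (r + suc m)
  ramsey-parity {m} {r} k R odd S b with # S ≤? r + suc m
  ... | yes h = h
  ... | no h = ⊥-elim (impossible (degree-sum-even S))
    where
    size : # S ≡ r + suc (suc m)
    size = ≤-antisym (ramsey-step R S b) (lin 3 ($0 ⊞ (con 1 ⊞ (con 1 ⊞ $1)) ≼ $2) (con 1 ⊞ ($0 ⊞ (con 1 ⊞ $1)) ≼ $2) (≰⇒> h))
    regular : ∀ v → v ∈ S → suc m ≤ deg S v
    regular v v∈ = lin 5 (con 1 ⊞ $0 ≼ $1) ($2 ⊞ ($3 ⊞ (con 1 ⊞ (con 1 ⊞ $0))) ⊞ $4 ≼ $1 ⊞ (con 1 ⊞ $4) ⊞ $2 ⊞ $3) (eq≤ (#-far S v∈) ⊕ eq≥ size ⊕ R (far S v) (far-bound b v∈))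
    total : sumOver S (deg S) ≡ 2 * k + 1
    total = trans (≤-antisym (≤-trans (sumOver-mono S λ v _ → deg-bound b v) (≤-reflexive (sumOver-const S (suc m))))
                             (≤-trans (≤-reflexive (sym (sumOver-const S (suc m)))) (sumOver-mono S regular)))
                  (trans (cong (suc m *_) size) odd)
    impossible : ∃[ j ] sumOver S (deg S) ≡ 2 * j → ⊥
    impossible (j , e) = odd≢even j k (trans (sym e) total)
      where
      odd≢even : ∀ j k → 2 * j ≡ 2 * k + 1 → ⊥
      odd≢even j k e = absurd-≤ 2 {k , j , _} (2 ⊠ $0 ⊞ con 2 ⊞ 2 ⊠ $1 ≼ 2 ⊠ $1 ⊞ (2 ⊠ $0 ⊞ con 1)) (even-step k j refl refl (lin 2 {k , j , _} (con 1 ⊞ 2 ⊠ $0 ≼ 2 ⊠ $1) (2 ⊠ $0 ⊞ con 1 ≼ 2 ⊠ $1) (eq≥ e)) ⊕ eq≤ e)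

  ramsey₀ : RamseyBound 0 0
  ramsey₀ S b with 1 ≤? # S
  ... | no h = ≤-pred (≰⇒> h)
  ... | yes h with #-pos S h
  ...   | v , v∈ = ⊥-elim (absurd-≤ 1 ($0 ⊞ con 1 ≼ con 0 ⊞ $0) (b ⁅ v ⁆ (λ w k → subst (_∈ S) (eqᵇ-true {i = v} k) v∈) (singleton-stable v) ⊕ eq≥ (#-⁅⁆ v)))

  ramsey₁ : RamseyBound 1 2
  ramsey₁ = ramsey-step ramsey₀

  ramsey₂ : RamseyBound 2 5
  ramsey₂ = ramsey-step ramsey₁

  -- Nine vertices of degree 3 would have degree sum 27 = 2 · 13 + 1. Likewise 5 · 19 = 2 · 47 + 1
  -- in `ramsey₅`.
  ramsey₃ : RamseyBound 3 8
  ramsey₃ = ramsey-parity 13 ramsey₂ refl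

  ramsey₄ : RamseyBound 4 13
  ramsey₄ = ramsey-step ramsey₃

  ramsey₅ : RamseyBound 5 18
  ramsey₅ = ramsey-parity 47 ramsey₄ refl

  -- Each Ramsey bound is just good enough, for `q` = 1 and 5 only because `# S` is odd; from 6 on,
  -- 21 + 3 = 4 · 6 suffices.
  small-case : ∀ {S Q} k → LargestStable S Q → # S + 1 ≡ 2 * k → # S ≤ 21 → # S + 3 ≤ 4 * # Q
  small-case {S} {Q} k (_ , _ , max) e h = cases (# Q) max
    where
    not-even : ∀ j → # S ≤ 2 * j → # S + 1 ≤ 2 * j
    not-even j le with m≤n⇒m<n∨m≡n le
    ... | inj₁ lt = lin 2 {# S , j , _} ($0 ⊞ con 1 ≼ 2 ⊠ $1) (con 1 ⊞ $0 ≼ 2 ⊠ $1) lt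
    ... | inj₂ eq = ⊥-elim (absurd-≤ 2 {# S , k , _} ($0 ⊞ con 2 ⊞ (2 ⊠ $1) ≼ 2 ⊠ $1 ⊞ ($0 ⊞ con 1)) (even-step j k eq refl (lin 2 {# S , k , _} (con 1 ⊞ $0 ≼ 2 ⊠ $1) ($0 ⊞ con 1 ≼ 2 ⊠ $1) (eq≤ e)) ⊕ eq≥ e))
    cases : ∀ q → (∀ Q → Q ⊆ S → Stable Q → # Q ≤ q) → # S + 3 ≤ 4 * q
    cases 0 b = ⊥-elim (absurd-≤ 1 ($0 ⊞ con 1 ≼ 2 ⊠ con 0) (not-even 0 (ramsey₀ S b)))
    cases 1 b = lin 1 ($0 ⊞ con 3 ≼ 4 ⊠ con 1) ($0 ⊞ con 1 ≼ 2 ⊠ con 1) (not-even 1 (ramsey₁ S b))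
    cases 2 b = lin 1 ($0 ⊞ con 3 ≼ 4 ⊠ con 2) ($0 ≼ con 5) (ramsey₂ S b)
    cases 3 b = lin 1 ($0 ⊞ con 3 ≼ 4 ⊠ con 3) ($0 ≼ con 8) (ramsey₃ S b)
    cases 4 b = lin 1 ($0 ⊞ con 3 ≼ 4 ⊠ con 4) ($0 ≼ con 13) (ramsey₄ S b)
    cases 5 b = lin 1 ($0 ⊞ con 3 ≼ 4 ⊠ con 5) ($0 ⊞ con 1 ≼ 2 ⊠ con 9) (not-even 9 (ramsey₅ S b))
    cases (suc (suc (suc (suc (suc (suc q)))))) b = lin 2 ($0 ⊞ con 3 ≼ 4 ⊠ (con 1 ⊞ (con 1 ⊞ (con 1 ⊞ (con 1 ⊞ (con 1 ⊞ (con 1 ⊞ $1))))))) ($0 ⊞ con 0 ≼ con 21 ⊞ 4 ⊠ $1) (h ⊕ z≤n {4 * q})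

  nine : ∀ {S Q} → LargestStable S Q → # S ≡ 9 → 4 ≤ # Q
  nine {S} {Q} (_ , _ , max) e = ≮⇒≥ λ lt → absurd-≤ 1 ($0 ⊞ con 9 ≼ con 8 ⊞ $0) (ramsey₃ S (λ Q′ s t → ≤-trans (max Q′ s t) (≤-pred lt)) ⊕ eq≥ e)

  -- Each round puts a stable set `A` into the result and deletes `A` with its neighbours. If every
  -- round deletes at most `b` / `a` vertices per vertex gained, so does the whole process.
  greedy : ∀ a b S → (∀ H → H ⊆ S → 1 ≤ # H → ∃[ A ] (A ⊆ H × Stable A × 1 ≤ # A × a * # (H ∩ (A ∪ touched A)) ≤ b * # A)) →
    ∃[ Q ] (Q ⊆ S × Stable Q × a * # S ≤ b * # Q)
  greedy a b S step = go (# S) S (λ _ h → h) ≤-refl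
    where
    go : ∀ m H → H ⊆ S → # H ≤ m → ∃[ Q ] (Q ⊆ H × Stable Q × a * # H ≤ b * # Q)
    go m H H⊆ h with 1 ≤? # H
    ... | no empty = ∅ , (λ _ ()) , (λ ()) , ≤-trans (*-monoʳ-≤ a (≤-pred (≰⇒> empty))) (≤-trans (≤-reflexive (*-zeroʳ a)) z≤n)
    go zero H H⊆ h | yes pos = ⊥-elim (absurd-≤ 1 ($0 ⊞ con 1 ≼ con 0 ⊞ $0) (h ⊕ pos))
    go (suc m) H H⊆ h | yes pos with step H H⊆ pos
    ... | A , A⊆ , sA , A≥1 , ratio with go m (H ∖ (A ∪ touched A)) (λ v k → H⊆ v (∖-left k)) (lin 5 ($0 ≼ $1) ($2 ⊞ ($3 ⊞ $0) ⊞ con 1 ⊞ $4 ≼ con 1 ⊞ $1 ⊞ $2 ⊞ $4 ⊞ $3) (h ⊕ eq≥ (#-split H (A ∪ touched A)) ⊕ A≥1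
              ⊕ #-mono {S = A} {H ∩ (A ∪ touched A)} (λ v k → ∩-in (A⊆ v k) (∪-inˡ k))))
    ...   | Q , Q⊆ , sQ , ratio′ = A ∪ Q , sub , stable-∪ {A} {Q} sA sQ across ,
            ≤-trans (≤-reflexive (trans (cong (a *_) (#-split H (A ∪ touched A))) (*-distribˡ-+ a _ _)))
              (≤-trans (ratio ⊕ ratio′) (≤-trans (≤-reflexive (sym (*-distribˡ-+ b _ _))) (*-monoʳ-≤ b (∪-size {A} {Q} apart))))
      where
      sub : A ∪ Q ⊆ H
      sub v k with ∪-out {S = A} k
      ... | inj₁ x = A⊆ v x
      ... | inj₂ x = ∖-left (Q⊆ v x)
      outside : ∀ {v} → v ∈ Q → v ∉ A ∪ touched A
      outside {v} k = ∖-right {S = H} (Q⊆ v k)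
      apart : ∀ v → v ∈ A → v ∈ Q → ⊥
      apart v x y = clash (∪-inˡ x) (outside y)
      across : ∀ {u v} → u ∈ A → v ∈ Q → c u v ≡ false
      across x y = ¬true⇒false λ e → clash (∪-inʳ {S = A} (touched-in x e)) (outside y)

-- Large stable sets in the complement

module Forbidden {n} (𝒞 : TriangleFree n) where
  open TriangleFree 𝒞
  open Families 𝒞 using (Stable; Family)
  open Seagulls 𝒞
  open Ramsey 𝒞

  argmax : ∀ (f : Fin n → ℕ) b S → (∀ v → f v ≤ b) → 1 ≤ # S → ∃[ v ] (v ∈ S × (∀ w → w ∈ S → f w ≤ f v))
  argmax f b S bound h = go b (proj₁ (#-pos S h)) (proj₂ (#-pos S h)) (m≤n+m b _)
    where
    go : ∀ k v → v ∈ S → b ≤ f v + k → ∃[ v ] (v ∈ S × (∀ w → w ∈ S → f w ≤ f v))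
    go k v v∈ fuel with any? (λ w → (S w ≟ᵇ true) ×-dec (suc (f v) ≤? f w))
    ... | no none = v , v∈ , λ w w∈ → ≮⇒≥ λ lt → none (w , w∈ , lt)
    go zero v v∈ fuel | yes (w , w∈ , lt) = ⊥-elim (absurd-≤ 3 {b , f v , f w , _} ($0 ⊞ (con 1 ⊞ $1) ⊞ $2 ≼ $1 ⊞ con 0 ⊞ $2 ⊞ $0) (fuel ⊕ lt ⊕ bound w))
    go (suc k) v v∈ fuel | yes (w , w∈ , lt) = go k w w∈ (lin 4 ($0 ≼ $1 ⊞ $2) ($0 ⊞ (con 1 ⊞ $3) ≼ $3 ⊞ (con 1 ⊞ $2) ⊞ $1) (fuel ⊕ lt))

  max-degree : ∀ S → 1 ≤ # S → ∃[ v ] (v ∈ S × (∀ w → w ∈ S → deg S w ≤ deg S v))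
  max-degree S = argmax (deg S) n S (λ v → #-≤ (S ∩ c v))

  c-flip : ∀ {u v b} → c u v ≡ b → c v u ≡ b
  c-flip {u} {v} h = trans (c-sym v u) h

  closed-single : ∀ H v → # (H ∩ (⁅ v ⁆ ∪ touched ⁅ v ⁆)) ≤ suc (deg H v)
  closed-single H v = lin 3 ($0 ≼ con 1 ⊞ $1) ($0 ⊞ $2 ≼ $2 ⊞ $1 ⊞ con 1) (#-∪ {S = H ∩ (⁅ v ⁆ ∪ touched ⁅ v ⁆)} {⁅ v ⁆} {H ∩ c v} split ⊕ eq≤ (#-⁅⁆ v))
    where
    split : ∀ w → w ∈ H ∩ (⁅ v ⁆ ∪ touched ⁅ v ⁆) → w ∈ ⁅ v ⁆ ⊎ w ∈ H ∩ c v
    split w h with ∪-out {S = ⁅ v ⁆} (∩-right {S = H} h)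
    ... | inj₁ e = inj₁ e
    ... | inj₂ k with touched-out k
    ...   | a , a∈ , e = inj₂ (∩-in (∩-left h) (subst (λ x → c x w ≡ true) (sym (eqᵇ-true {i = v} a∈)) e))

  second : Sub n → Fin n → Sub n
  second H v = (H ∩ touched (H ∩ c v)) ─ v

  closed-neighbours : ∀ H v → # (H ∩ ((H ∩ c v) ∪ touched (H ∩ c v))) ≤ deg H v + suc (# (second H v))
  closed-neighbours H v = lin 4 ($0 ≼ $1 ⊞ (con 1 ⊞ $2)) ($0 ⊞ $3 ≼ $1 ⊞ $3 ⊞ (con 1 ⊞ $2)) (#-∪ {S = H ∩ (A ∪ touched A)} {A} {H ∩ touched A} split ⊕ #-─-≤ (H ∩ touched A) v)
    where
    A : Sub n
    A = H ∩ c v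
    split : ∀ w → w ∈ H ∩ (A ∪ touched A) → w ∈ A ⊎ w ∈ H ∩ touched A
    split w h with ∪-out {S = A} (∩-right {S = H} h)
    ... | inj₁ k = inj₁ k
    ... | inj₂ k = inj₂ (∩-in (∩-left h) k)

  other-neighbours : ∀ {H v B} → v ∈ H → B ⊆ H ─ v → ∀ a → a ∈ H ∩ c v → suc (# (B ∩ c a)) ≤ deg H a
  other-neighbours {H} {v} {B} v∈ B⊆ a a∈ = lin 3 (con 1 ⊞ $0 ≼ $1) ($0 ⊞ (con 1 ⊞ $2) ≼ $2 ⊞ $1) (#-mono {S = B ∩ c a} {(H ∩ c a) ─ v} sub ⊕ eq≥ (#-─ (H ∩ c a) {v} (∩-in v∈ (c-flip (∩-right {S = H} a∈)))))
    where
    sub : B ∩ c a ⊆ (H ∩ c a) ─ v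
    sub w h = ─-in (∩-in (─-left (B⊆ w (∩-left h))) (∩-right {S = B} h)) (─-right {S = H} (B⊆ w (∩-left h)))

  second-⊆ : ∀ H v → second H v ⊆ H ─ v
  second-⊆ H v w h = ─-in (∩-left (─-left h)) (─-right h)

  module _ {S Q} (L : LargestStable S Q) (big : 23 ≤ # S) where

    private
      nonempty : 1 ≤ # S
      nonempty = lin 1 (con 1 ≼ $0) (con 23 ≼ $0) big

      stable≤ : StableBound S (# Q)
      stable≤ = proj₂ (proj₂ L)

      -- `4 * # Q` is at least 4/3 of `# S`, and one third of 23 exceeds 3.
      large₃ : # S ≤ 3 * # Q → # S + 3 ≤ 4 * # Q
      large₃ h = *-cancelˡ-≤ {# S + 3} {4 * # Q} 3 (lin 2 {_ , # Q , _} (3 ⊠ ($0 ⊞ con 3) ≼ 3 ⊠ 4 ⊠ $1) (4 ⊠ $0 ⊞ con 23 ≼ 4 ⊠ 3 ⊠ $1 ⊞ $0) (4 ⊗ h ⊕ big))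

      large₂ : # S ≤ 2 * # Q → # S + 3 ≤ 4 * # Q
      large₂ h = lin 2 {_ , # Q , _} ($0 ⊞ con 3 ≼ 4 ⊠ $1) (2 ⊠ $0 ⊞ con 23 ≼ 2 ⊠ 2 ⊠ $1 ⊞ $0) (2 ⊗ h ⊕ big)

      greedy-bound : ∀ a b → (∀ H → H ⊆ S → 1 ≤ # H → ∃[ A ] (A ⊆ H × Stable A × 1 ≤ # A × a * # (H ∩ (A ∪ touched A)) ≤ b * # A)) → a * # S ≤ b * # Q
      greedy-bound a b step with greedy a b S step
      ... | I , I⊆ , st , h = ≤-trans h (*-monoʳ-≤ b (stable≤ I I⊆ st))

      single : ∀ {v} (H : Sub n) → v ∈ H → ⁅ v ⁆ ⊆ H
      single {v} H v∈ w h = subst (_∈ H) (eqᵇ-true {i = v} h) v∈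

    -- The complement of the gem is an induced path on four vertices and an isolated vertex `v`. So
    -- the far set of `v` contains no such path, and a stable set takes half of it. With at most
    -- `# Q` neighbours of `v`, and `v` added to the stable set, `# S` is less than `3 * # Q`.
    gem-free : (∀ {v p q r s} → c p q ≡ true → c q r ≡ true → c r s ≡ true → c p r ≡ false → c p s ≡ false → c q s ≡ false →
      c v p ≡ false → c v q ≡ false → c v r ≡ false → c v s ≡ false → ⊥) → # S + 3 ≤ 4 * # Q
    gem-free no-gem = finish (half (# H) H (λ _ h → far-c {S} h) ≤-refl)
      where
      v : Fin n
      v = proj₁ (#-pos S nonempty)
      v∈ : v ∈ S
      v∈ = proj₂ (#-pos S nonempty)
      H : Sub n
      H = far S v
      finish : ∃[ I ] (I ⊆ H × Stable I × # H ≤ 2 * # I) → # S + 3 ≤ 4 * # Q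
      finish (I , I⊆ , st , h) = large₃ (lin 5 {_ , _ , _ , _ , # I , _} ($0 ≼ 3 ⊠ $1) ($2 ⊞ $0 ⊞ $3 ⊞ 2 ⊠ (con 1 ⊞ $4) ≼ 2 ⊠ $4 ⊞ ($3 ⊞ (con 1 ⊞ $2)) ⊞ $1 ⊞ 2 ⊠ $1) (h ⊕ eq≤ (#-far S v∈) ⊕ deg-bound stable≤ v ⊕ 2 ⊗ far-size))
        where
        far-size : suc (# I) ≤ # Q
        far-size = ≤-trans (insert-size {v} {I} λ k → far-≢ {S} (I⊆ _ k))
          (stable≤ (⁅ v ⁆ ∪ I) (insert-⊆ v∈ λ w k → far-⊆ (I⊆ w k)) (insert-stable {v} {I} st λ k → far-c {S} (I⊆ _ k)))
      -- in the second neighbourhood every component is complete bipartite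
      half : ∀ m H → (∀ w → w ∈ H → c v w ≡ false) → # H ≤ m → ∃[ I ] (I ⊆ H × Stable I × # H ≤ 2 * # I)
      half m H iso h with 1 ≤? # H
      ... | no empty = ∅ , (λ _ ()) , (λ ()) , lin 2 {# H , # ∅ , _} ($0 ≼ 2 ⊠ $1) (con 1 ⊞ $0 ⊞ con 0 ≼ con 1 ⊞ 2 ⊠ $1) (≰⇒> empty ⊕ z≤n {2 * # (∅ {n})})
      half zero H iso h | yes pos = ⊥-elim (absurd-≤ 1 ($0 ⊞ con 1 ≼ con 0 ⊞ $0) (h ⊕ pos))
      half (suc m) H iso h | yes pos with #-pos H pos
      ... | a , a∈ with 1 ≤? deg H a
      ...   | no isolated = extend (half m (H ─ a) (λ w k → iso w (─-left k)) (lin 3 ($0 ≼ $1) ($2 ⊞ (con 1 ⊞ $0) ≼ con 1 ⊞ $1 ⊞ $2) (h ⊕ eq≥ (#-─ H a∈))))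
        where
        extend : ∃[ I ] (I ⊆ H ─ a × Stable I × # (H ─ a) ≤ 2 * # I) → ∃[ I ] (I ⊆ H × Stable I × # H ≤ 2 * # I)
        extend (I , I⊆ , st , e) = ⁅ a ⁆ ∪ I , insert-⊆ a∈ (λ w k → ─-left (I⊆ w k)) ,
          insert-stable {a} {I} st (λ {w} k → ¬true⇒false λ caw → isolated (lin 2 (con 1 ≼ $0) (con 1 ⊞ $1 ≼ $0) (eq≥ (#-─ (H ∩ c a) {w} (∩-in (─-left (I⊆ w k)) caw))))) ,
          lin 4 {_ , # (⁅ a ⁆ ∪ I) , _ , # I , _} ($0 ≼ 2 ⊠ $1) ($2 ⊞ $0 ⊞ 2 ⊠ (con 1 ⊞ $3) ≼ 2 ⊠ $3 ⊞ (con 1 ⊞ $2) ⊞ 2 ⊠ $1) (e ⊕ eq≤ (#-─ H a∈) ⊕ 2 ⊗ insert-size {a} {I} (λ k → ─-right {S = H} (I⊆ _ k)))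
      ...   | yes pos′ with #-pos (H ∩ c a) pos′
      ...     | b , b∈ = extend (half m R (λ w k → iso w (R⊆ k)) (lin 4 ($0 ≼ $1) ($2 ⊞ (con 1 ⊞ $3) ⊞ $0 ≼ con 1 ⊞ $1 ⊞ $2 ⊞ $3) (h ⊕ eq≥ (#-─ H a∈) ⊕ #-mono {S = R} {H ─ a} λ w k → ─-in (R⊆ k) λ { refl → clash a∈A (R∉A k) })))
        where
        A B R : Sub n
        A = H ∩ c b
        B = H ∩ c a
        R = (H ∖ c b) ∖ c a
        R⊆ : ∀ {w} → w ∈ R → w ∈ H
        R⊆ k = ∖-left (∖-left k)
        cba : c b a ≡ true
        cba = c-flip (∩-right {S = H} b∈)
        a∈A : c b a ≡ true
        a∈A = cba
        R∉A : ∀ {w} → w ∈ R → c b w ≡ false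
        R∉A k = ∖-right {S = H} (∖-left k)
        R∉B : ∀ {w} → w ∈ R → c a w ≡ false
        R∉B k = ∖-right {S = H ∖ c b} k
        sizes : # H ≤ # A + # B + # R
        sizes = lin 6 {# H , # A , # B , # R , # (H ∖ c b) , # ((H ∖ c b) ∩ c a) , _} ($0 ≼ $1 ⊞ $2 ⊞ $3) ($0 ⊞ $4 ⊞ $5 ≼ $1 ⊞ $4 ⊞ ($5 ⊞ $3) ⊞ $2) (eq≤ (#-split H (c b)) ⊕ eq≤ (#-split (H ∖ c b) (c a)) ⊕ #-mono {S = (H ∖ c b) ∩ c a} {B} λ w k → ∩-in (∖-left (∩-left k)) (∩-right {S = H ∖ c b} k))
        A–R : ∀ {x y} → x ∈ A → y ∈ R → c x y ≡ false
        A–R {x} {y} hx hy = ¬true⇒false λ e → no-gem {v} {y} {x} {b} {a} (c-flip e) (c-flip (∩-right {S = H} hx)) cba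
          (c-flip (R∉A hy)) (c-flip (R∉B hy)) (¬true⇒false λ k → c-tri b x a (∩-right {S = H} hx) k cba)
          (iso y (R⊆ hy)) (iso x (∩-left hx)) (iso b (∩-left b∈)) (iso a a∈)
        B–R : ∀ {x y} → x ∈ B → y ∈ R → c x y ≡ false
        B–R {x} {y} hx hy = ¬true⇒false λ e → no-gem {v} {y} {x} {a} {b} (c-flip e) (c-flip (∩-right {S = H} hx)) (c-flip cba)
          (c-flip (R∉B hy)) (c-flip (R∉A hy)) (¬true⇒false λ k → c-tri a x b (∩-right {S = H} hx) k (c-flip cba))
          (iso y (R⊆ hy)) (iso x (∩-left hx)) (iso a a∈) (iso b (∩-left b∈))
        extend : ∃[ I ] (I ⊆ R × Stable I × # R ≤ 2 * # I) → ∃[ I ] (I ⊆ H × Stable I × # H ≤ 2 * # I)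
        extend (I , I⊆ , st , e) with # A ≤? # B
        ... | yes le = B ∪ I , sub , stable-∪ {B} {I} (neighbours-stable H a) st (λ x y → B–R x (I⊆ _ y)) ,
              lin 6 {# H , # (B ∪ I) , # (H ∩ c b) , # (H ∖ c b ∖ c a) , # B , # I , _} ($0 ≼ 2 ⊠ $1) ($0 ⊞ $2 ⊞ $3 ⊞ 2 ⊠ ($4 ⊞ $5) ≼ $2 ⊞ $4 ⊞ $3 ⊞ $4 ⊞ (2 ⊠ $5) ⊞ 2 ⊠ $1) (sizes ⊕ le ⊕ e ⊕ 2 ⊗ ∪-size {B} {I} λ w x y → clash (∩-right {S = H} x) (R∉B (I⊆ w y)))
          where
          sub : B ∪ I ⊆ H
          sub w k with ∪-out {S = B} k
          ... | inj₁ x = ∩-left x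
          ... | inj₂ x = R⊆ (I⊆ w x)
        ... | no gt = A ∪ I , sub , stable-∪ {A} {I} (neighbours-stable H b) st (λ x y → A–R x (I⊆ _ y)) ,
              lin 6 {# H , # (A ∪ I) , # (H ∩ c a) , # (H ∖ c b ∖ c a) , # A , # I , _} ($0 ≼ 2 ⊠ $1) ($0 ⊞ (con 1 ⊞ $2) ⊞ $3 ⊞ 2 ⊠ ($4 ⊞ $5) ≼ $4 ⊞ $2 ⊞ $3 ⊞ $4 ⊞ (2 ⊠ $5) ⊞ 2 ⊠ $1) (sizes ⊕ ≰⇒> gt ⊕ e ⊕ 2 ⊗ ∪-size {A} {I} λ w x y → clash (∩-right {S = H} x) (R∉A (I⊆ w y)))
          where
          sub : A ∪ I ⊆ H
          sub w k with ∪-out {S = A} k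
          ... | inj₁ x = ∩-left x
          ... | inj₂ x = R⊆ (I⊆ w x)

    -- The complement of the kite is a fork, a claw with one edge subdivided. Hence a second
    -- neighbour of `v` misses at most one neighbour of `v`. If `v` has maximum degree `d`, counting
    -- the edges from its neighbours to its second neighbours gives (d - 1) `# B` ≤ (d - 1) `# A`,
    -- and for d ≥ 3 at most 2d + 1 ≤ 3d vertices are deleted for d gained.
    kite-free : (∀ {v a b x y} → c v a ≡ true → c v b ≡ true → c v x ≡ true → c x y ≡ true → c y a ≡ false → c y b ≡ false →
      a ≢ b → v ≢ y → ⊥) → # S + 3 ≤ 4 * # Q
    kite-free no-fork = large₃ (lin 2 {_ , # Q , _} ($0 ≼ 3 ⊠ $1) (1 ⊠ $0 ≼ 3 ⊠ $1) (greedy-bound 1 3 step))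
      where
      step : ∀ H → H ⊆ S → 1 ≤ # H → ∃[ A ] (A ⊆ H × Stable A × 1 ≤ # A × 1 * # (H ∩ (A ∪ touched A)) ≤ 3 * # A)
      step H _ pos with max-degree H pos
      ... | v , v∈ , max with deg H v ≤? 2
      ...   | yes le = ⁅ v ⁆ , single H v∈ , singleton-stable v , lin 1 (con 1 ≼ $0) (con 1 ≼ $0) (eq≥ (#-⁅⁆ v)) , lin 3 {# (H ∩ (⁅ v ⁆ ∪ touched ⁅ v ⁆)) , # ⁅ v ⁆ , # (H ∩ c v) , _} ($0 ⊞ con 0 ≼ $1 ⊞ (2 ⊠ $1)) ($0 ⊞ $2 ⊞ 3 ⊠ con 1 ≼ con 1 ⊞ $2 ⊞ con 2 ⊞ 3 ⊠ $1) (closed-single H v ⊕ le ⊕ 3 ⊗ eq≥ (#-⁅⁆ v))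
      ...   | no gt = A , (λ _ → ∩-left) , neighbours-stable H v , lin 1 (con 1 ≼ $0) (con 3 ≼ $0) (≰⇒> gt) , lin 3 {# (H ∩ (A ∪ touched A)) , # A , # B , _} ($0 ⊞ con 0 ≼ $1 ⊞ (2 ⊠ $1)) ($0 ⊞ $2 ⊞ con 3 ≼ $1 ⊞ (con 1 ⊞ $2) ⊞ $1 ⊞ $1) (closed-neighbours H v ⊕ few (deg H v) refl (≰⇒> gt) ⊕ ≰⇒> gt)
        where
        A B : Sub n
        A = H ∩ c v
        B = second H v
        few : ∀ d → deg H v ≡ d → 3 ≤ d → # B ≤ # A
        few (suc zero) e (s≤s ())
        few (suc (suc d)) e le = *-cancelˡ-≤ {# B} {# A} (suc d) (double-count A B c (suc d) (suc d)
          (λ a a∈ → lin 4 ($0 ≼ con 1 ⊞ $1) (con 1 ⊞ $0 ⊞ $2 ⊞ $3 ≼ $2 ⊞ $3 ⊞ (con 1 ⊞ (con 1 ⊞ $1))) (other-neighbours {H} {v} {B} v∈ (second-⊆ H v) a a∈ ⊕ max a (∩-left a∈) ⊕ eq≤ e))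
          λ y y∈ → lin 4 (con 1 ⊞ $0 ≼ $1) ($2 ⊞ (con 1 ⊞ (con 1 ⊞ $0)) ⊞ $3 ≼ $1 ⊞ $3 ⊞ $2 ⊞ con 1) (eq≤ (#-split A (λ a → c a y)) ⊕ eq≥ e ⊕ missed≤1 y y∈))
          where
          missed≤1 : ∀ y → y ∈ B → # (A ∖ λ a → c a y) ≤ 1
          missed≤1 y y∈ = ≮⇒≥ λ lt → case elements (A ∖ λ a → c a y) 2 lt of λ where
            (f , f∈ , inj) → case touched-out (∩-right {S = H} (─-left y∈)) of λ where
              (x , x∈ , cxy) → no-fork {v} {f 0F} {f 1F} {x} {y} (∩-right {S = H} (∖-left (f∈ 0F))) (∩-right {S = H} (∖-left (f∈ 1F)))
                (∩-right {S = H} x∈) cxy (c-flip (∖-right {S = A} (f∈ 0F))) (c-flip (∖-right {S = A} (f∈ 1F))) (λ e → case inj e of λ ()) (─-right y∈)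

    -- The forbidden complement is a star with four leaves and an isolated vertex, so a vertex far
    -- from `v` misses at most three neighbours of `v`. For a maximum degree from 4 to 6 double
    -- counting leaves fewer than 23 vertices. From 7 on, adjacent far vertices would each see more
    -- than half of the neighbours of `v`, so the non-neighbours are stable. Up to 3 the greedy
    -- ratio 10/3 is good enough.
    star₄-free : (∀ v w → v ≢ w → c v w ≡ false → (f : Fin 4 → Fin n) → (∀ {i j} → f i ≡ f j → i ≡ j) →
      (∀ i → c v (f i) ≡ true) → (∀ i → c w (f i) ≡ false) → ⊥) → # S + 3 ≤ 4 * # Q
    star₄-free no-star with max-degree S nonempty
    ... | v , v∈ , max = cases (deg S v) refl
      where
      A F : Sub n
      A = S ∩ c v
      F = far S v
      missed≤3 : ∀ w → w ∈ F → # (A ∖ c w) ≤ 3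
      missed≤3 w w∈ = ≮⇒≥ λ lt → case elements (A ∖ c w) 4 lt of λ where
        (f , f∈ , inj) → no-star v w (far-≢ {S} w∈) (far-c {S} w∈) f inj (λ i → ∩-right {S = S} (∖-left (f∈ i))) (λ i → ∖-right {S = A} (f∈ i))
      counted : ∀ d → deg S v ≡ suc d → (suc d ∸ 3) * # F ≤ d * # A
      counted d e = double-count A F c d (suc d ∸ 3)
        (λ a a∈ → lin 4 ($0 ≼ $1) (con 1 ⊞ $0 ⊞ $2 ⊞ $3 ≼ $2 ⊞ $3 ⊞ (con 1 ⊞ $1)) (other-neighbours {S} {v} {F} v∈ (λ w h → ─-in (far-⊆ h) (far-≢ {S} h)) a a∈ ⊕ max a (∩-left a∈) ⊕ eq≤ e))
        λ w w∈ → ≤-trans (m≤n+o⇒m∸n≤o (suc d) 3 (lin 4 (con 1 ⊞ $0 ≼ con 3 ⊞ $1) (con 1 ⊞ $0 ⊞ $2 ⊞ $3 ≼ $2 ⊞ ($1 ⊞ $3) ⊞ con 3) (eq≥ e ⊕ eq≤ (#-split A (c w)) ⊕ missed≤3 w w∈)))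
          (#-mono {S = A ∩ c w} {A ∩ λ a → c a w} λ a h → ∩-in (∩-left h) (c-flip (∩-right {S = A} h)))
      -- The worst case is a vertex with three neighbours: these and their at most 1 + 3 · 2 further
      -- neighbours are ten vertices deleted for three gained.
      small-degrees : deg S v ≤ 3 → ∀ H → H ⊆ S → 1 ≤ # H → ∃[ A ] (A ⊆ H × Stable A × 1 ≤ # A × 3 * # (H ∩ (A ∪ touched A)) ≤ 10 * # A)
      small-degrees le H H⊆ pos with #-pos H pos
      ... | u , u∈ with deg H u ≤? 2
      ...   | yes le₂ = ⁅ u ⁆ , single H u∈ , singleton-stable u , lin 1 (con 1 ≼ $0) (con 1 ≼ $0) (eq≥ (#-⁅⁆ u)) , lin 3 {# (H ∩ (⁅ u ⁆ ∪ touched ⁅ u ⁆)) , # ⁅ u ⁆ , # (H ∩ c u) , _} ($0 ⊞ (2 ⊠ $0) ≼ $1 ⊞ ($1 ⊞ ($1 ⊞ ($1 ⊞ ($1 ⊞ ($1 ⊞ ($1 ⊞ ($1 ⊞ (2 ⊠ $1))))))))) (3 ⊠ $0 ⊞ 3 ⊠ $2 ⊞ 10 ⊠ con 1 ≼ 3 ⊠ (con 1 ⊞ $2) ⊞ 3 ⊠ con 2 ⊞ 10 ⊠ $1) (3 ⊗ closed-single H u ⊕ 3 ⊗ le₂ ⊕ 10 ⊗ eq≥ (#-⁅⁆ u))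
      ...   | no gt = H ∩ c u , (λ _ → ∩-left) , neighbours-stable H u , lin 1 (con 1 ≼ $0) (con 3 ≼ $0) (≰⇒> gt) ,
              lin 3 {# (H ∩ (H ∩ c u ∪ touched (H ∩ c u))) , # (H ∩ c u) , # (second H u) , _} ($0 ⊞ (2 ⊠ $0) ≼ $1 ⊞ ($1 ⊞ ($1 ⊞ ($1 ⊞ ($1 ⊞ ($1 ⊞ ($1 ⊞ ($1 ⊞ (2 ⊠ $1))))))))) (3 ⊠ $0 ⊞ 3 ⊠ $2 ⊞ con 3 ≼ 3 ⊠ ($1 ⊞ (con 1 ⊞ $2)) ⊞ 3 ⊠ 2 ⊠ $1 ⊞ $1) (3 ⊗ closed-neighbours H u ⊕ 3 ⊗ few ⊕ ≰⇒> gt)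
        where
        deg≤3 : ∀ w → w ∈ H → deg H w ≤ 3
        deg≤3 w w∈ = lin 3 ($0 ≼ con 3) ($0 ⊞ $1 ⊞ $2 ≼ $1 ⊞ $2 ⊞ con 3) (#-mono {S = H ∩ c w} {S ∩ c w} (λ x h → ∩-in (H⊆ x (∩-left h)) (∩-right {S = H} h)) ⊕ max w (H⊆ w w∈) ⊕ le)
        reached : ∀ y → y ∈ second H u → 1 ≤ # ((H ∩ c u) ∩ λ a → c a y)
        reached y y∈ with touched-out (∩-right {S = H} (─-left y∈))
        ... | x , x∈ , cxy = lin 2 (con 1 ≼ $0) (con 1 ⊞ $1 ≼ $0) (eq≥ (#-─ ((H ∩ c u) ∩ λ a → c a y) {x} (∩-in x∈ cxy)))
        counted′ : 1 * # (second H u) ≤ 2 * # (H ∩ c u)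
        counted′ = double-count (H ∩ c u) (second H u) c 2 1
          (λ a a∈ → lin 2 ($0 ≼ con 2) (con 1 ⊞ $0 ⊞ $1 ≼ $1 ⊞ con 3) (other-neighbours {H} {u} {second H u} u∈ (second-⊆ H u) a a∈ ⊕ deg≤3 a (∩-left a∈))) reached
        few : # (second H u) ≤ 2 * # (H ∩ c u)
        few = lin 2 {_ , # (H ∩ c u) , _} ($0 ≼ 2 ⊠ $1) (1 ⊠ $0 ≼ 2 ⊠ $1) counted′
      rest-stable : 7 ≤ deg S v → Stable (S ∖ c v)
      rest-stable ge {x} {y} x∈ y∈ = ¬true⇒false λ cxy → by cxy (v ≟ᶠ x) (v ≟ᶠ y)
        where
        by : c x y ≡ true → Dec (v ≡ x) → Dec (v ≡ y) → ⊥
        by cxy (yes refl) _ = clash cxy (∖-right {S = S} y∈)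
        by cxy _ (yes refl) = clash (c-flip cxy) (∖-right {S = S} x∈)
        by cxy (no v≢x) (no v≢y) = absurd-≤ 5 {# A , # (A ∖ c x) , # (A ∖ c y) , # (A ∩ c x) , # (A ∩ c y) , _} (con 7 ⊞ $0 ⊞ $0 ⊞ $1 ⊞ $2 ⊞ ($3 ⊞ $4) ≼ $0 ⊞ ($3 ⊞ $1) ⊞ ($4 ⊞ $2) ⊞ con 3 ⊞ con 3 ⊞ $0) (ge ⊕ eq≤ (#-split A (c x)) ⊕ eq≤ (#-split A (c y)) ⊕ missed≤3 x (─-in x∈ v≢x) ⊕ missed≤3 y (─-in y∈ v≢y)
          ⊕ #-⊎ {S = A} {A ∩ c x} {A ∩ c y} (λ _ → ∩-left) (λ _ → ∩-left) λ z hx hy → c-tri x y z cxy (∩-right {S = A} hy) (∩-right {S = A} hx))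
      cases : ∀ d → deg S v ≡ d → # S + 3 ≤ 4 * # Q
      cases d e with d ≤? 3
      ... | yes le = *-cancelˡ-≤ {# S + 3} {4 * # Q} 10 (lin 2 {# S , # Q , _} (10 ⊠ ($0 ⊞ con 3) ≼ 10 ⊠ 4 ⊠ $1) (4 ⊠ 3 ⊠ $0 ⊞ 2 ⊠ con 23 ≼ 4 ⊠ 10 ⊠ $1 ⊞ 2 ⊠ $0) (4 ⊗ greedy-bound 3 10 (small-degrees (lin 2 ($0 ≼ con 3) ($0 ⊞ $1 ≼ $1 ⊞ con 3) (eq≤ e ⊕ le))) ⊕ 2 ⊗ big))
      cases 4 e | no _ = ⊥-elim (absurd-≤ 3 {# F , # S , # (S ∩ c v) , _} (1 ⊠ $0 ⊞ $1 ⊞ 4 ⊠ $2 ⊞ con 23 ≼ 3 ⊠ $2 ⊞ ($2 ⊞ (con 1 ⊞ $0)) ⊞ 4 ⊠ con 4 ⊞ $1) (counted 3 e ⊕ eq≤ (#-far S v∈) ⊕ 4 ⊗ eq≤ e ⊕ big))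
      cases 5 e | no _ = ⊥-elim (absurd-≤ 3 {# F , # S , # (S ∩ c v) , _} (2 ⊠ $0 ⊞ 2 ⊠ $1 ⊞ 6 ⊠ $2 ⊞ 2 ⊠ con 23 ≼ 4 ⊠ $2 ⊞ 2 ⊠ ($2 ⊞ (con 1 ⊞ $0)) ⊞ 6 ⊠ con 5 ⊞ 2 ⊠ $1) (counted 4 e ⊕ 2 ⊗ eq≤ (#-far S v∈) ⊕ 6 ⊗ eq≤ e ⊕ 2 ⊗ big))
      cases 6 e | no _ = ⊥-elim (absurd-≤ 3 {# F , # S , # (S ∩ c v) , _} (3 ⊠ $0 ⊞ 3 ⊠ $1 ⊞ 8 ⊠ $2 ⊞ 3 ⊠ con 23 ≼ 5 ⊠ $2 ⊞ 3 ⊠ ($2 ⊞ (con 1 ⊞ $0)) ⊞ 8 ⊠ con 6 ⊞ 3 ⊠ $1) (counted 5 e ⊕ 3 ⊗ eq≤ (#-far S v∈) ⊕ 8 ⊗ eq≤ e ⊕ 3 ⊗ big))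
      cases (suc (suc (suc (suc (suc (suc (suc d))))))) e | no _ =
        large₂ (lin 4 ($0 ≼ 2 ⊠ $1) ($0 ⊞ $2 ⊞ $3 ≼ $2 ⊞ $3 ⊞ $1 ⊞ $1) (eq≤ (#-split S (c v)) ⊕ deg-bound stable≤ v ⊕ stable≤ (S ∖ c v) (λ _ → ∖-left) (rest-stable (lin 2 (con 7 ≼ $0) (con 1 ⊞ (con 1 ⊞ (con 1 ⊞ (con 1 ⊞ (con 1 ⊞ (con 1 ⊞ (con 1 ⊞ $1)))))) ⊞ con 0 ≼ $0 ⊞ $1) (eq≥ e ⊕ z≤n {d})))))
      cases zero e | no gt = ⊥-elim (gt z≤n)
      cases 1 e | no gt = ⊥-elim (gt (s≤s z≤n))
      cases 2 e | no gt = ⊥-elim (gt (s≤s (s≤s z≤n)))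
      cases 3 e | no gt = ⊥-elim (gt (s≤s (s≤s (s≤s z≤n))))

    -- The forbidden complement is a claw with two isolated vertices. For a maximum degree `d` of at
    -- least 3, covering the far set by the neighbourhoods of three neighbours of `v` gives
    -- `# S ≤ 4 * d`. As `# S` is odd, the claim can fail only if `# S + 1`, `4 * d` and `4 * # Q`
    -- coincide. Then these neighbourhoods hardly overlap, and six of them do not fit into the far
    -- set.
    star₃-free : (∀ v u w → u ≢ w → c u w ≡ false → v ≢ u → v ≢ w → c v u ≡ false → c v w ≡ false → (f : Fin 3 → Fin n) → (∀ {i j} → f i ≡ f j → i ≡ j) →
      (∀ i → c v (f i) ≡ true) → (∀ i → c u (f i) ≡ false) → (∀ i → c w (f i) ≡ false) → ⊥) → ∀ k → # S + 1 ≡ 2 * k → # S + 3 ≤ 4 * # Q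
    star₃-free no-star k odd with max-degree S nonempty
    ... | v , v∈ , max with deg S v ≤? 2
    ...   | yes le = large₃ (lin 2 {_ , # Q , _} ($0 ≼ 3 ⊠ $1) (1 ⊠ $0 ≼ 3 ⊠ $1) (greedy-bound 1 3 step))
      where
      step : ∀ H → H ⊆ S → 1 ≤ # H → ∃[ A ] (A ⊆ H × Stable A × 1 ≤ # A × 1 * # (H ∩ (A ∪ touched A)) ≤ 3 * # A)
      step H H⊆ pos with #-pos H pos
      ... | u , u∈ = ⁅ u ⁆ , single H u∈ , singleton-stable u , lin 1 (con 1 ≼ $0) (con 1 ≼ $0) (eq≥ (#-⁅⁆ u)) , lin 5 {# (H ∩ (⁅ u ⁆ ∪ touched ⁅ u ⁆)) , # ⁅ u ⁆ , # (S ∩ c u) , # (S ∩ c v) , # (H ∩ c u) , _} ($0 ⊞ con 0 ≼ $1 ⊞ (2 ⊠ $1)) ($0 ⊞ 3 ⊠ con 1 ⊞ $2 ⊞ $3 ⊞ $4 ≼ con 1 ⊞ $4 ⊞ 3 ⊠ $1 ⊞ $3 ⊞ con 2 ⊞ $2) (closed-single H u ⊕ 3 ⊗ eq≥ (#-⁅⁆ u) ⊕ max u (H⊆ u u∈) ⊕ le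
              ⊕ #-mono {S = H ∩ c u} {S ∩ c u} λ x h → ∩-in (H⊆ x (∩-left h)) (∩-right {S = H} h))
    ...   | no gt = ≮⇒≥ contra
      where
      A F : Sub n
      A = S ∩ c v
      F = far S v
      d : ℕ
      d = deg S v
      few : ∀ a → a ∈ A → suc (# (F ∩ c a)) ≤ d
      few a a∈ = lin 3 (con 1 ⊞ $0 ≼ $1) (con 1 ⊞ $0 ⊞ $2 ≼ $2 ⊞ $1) (other-neighbours {S} {v} {F} v∈ (λ w h → ─-in (far-⊆ h) (far-≢ {S} h)) a a∈ ⊕ max a (∩-left a∈))
      seen : (Fin 3 → Fin n) → Sub n
      seen f = F ∩ (c (f 0F) ∪ (c (f 1F) ∪ c (f 2F)))
      -- the vertices not seen from three neighbours of v form a clique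
      cover : (f : Fin 3 → Fin n) → (∀ i → f i ∈ A) → (∀ {i j} → f i ≡ f j → i ≡ j) → # F ≤ # (seen f) + 2
      cover f f∈ inj = lin 3 ($0 ≼ $1 ⊞ con 2) ($0 ⊞ $2 ≼ $1 ⊞ $2 ⊞ con 2) (eq≤ (#-split F (c (f 0F) ∪ (c (f 1F) ∪ c (f 2F)))) ⊕ ≮⇒≥ three)
        where
        U : Sub n
        U = F ∖ (c (f 0F) ∪ (c (f 1F) ∪ c (f 2F)))
        unseen : ∀ {w} → w ∈ U → ∀ i → c w (f i) ≡ false
        unseen h 0F = c-flip (¬true⇒false λ k → clash (∪-inˡ k) (∖-right {S = F} h))
        unseen h 1F = c-flip (¬true⇒false λ k → clash (∪-inʳ (∪-inˡ k)) (∖-right {S = F} h))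
        unseen h 2F = c-flip (¬true⇒false λ k → clash (∪-inʳ (∪-inʳ k)) (∖-right {S = F} h))
        adjacent : ∀ {x y} → x ∈ U → y ∈ U → x ≢ y → c x y ≡ true
        adjacent {x} {y} hx hy ne = ¬false⇒true λ e → no-star v x y ne e (far-≢ {S} (∖-left hx)) (far-≢ {S} (∖-left hy))
          (far-c {S} (∖-left hx)) (far-c {S} (∖-left hy)) f inj (λ i → ∩-right {S = S} (f∈ i)) (unseen hx) (unseen hy)
        three : ¬ 3 ≤ # U
        three le with elements U 3 le
        ... | h , h∈ , hinj = c-tri (h 0F) (h 1F) (h 2F) (off λ ()) (off λ ()) (off λ ())
          where
          off : ∀ {i j} → i ≢ j → c (h i) (h j) ≡ true
          off ne = adjacent (h∈ _) (h∈ _) (ne ∘ hinj)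
      ∪₃ : ∀ {X Y Z W : Sub n} → (∀ v → v ∈ X → v ∈ Y ⊎ v ∈ Z ⊎ v ∈ W) → # X ≤ # Y + (# Z + # W)
      ∪₃ {X} {Y} {Z} {W} h = ≤-trans (#-∪ {S = X} {Y} {Z ∪ W} λ v k → split (h v k)) (≤-refl {# Y} ⊕ #-∪ {S = Z ∪ W} {Z} {W} λ _ → ∪-out)
        where
        split : ∀ {v} → v ∈ Y ⊎ v ∈ Z ⊎ v ∈ W → v ∈ Y ⊎ v ∈ Z ∪ W
        split (inj₁ y) = inj₁ y
        split (inj₂ (inj₁ z)) = inj₂ (∪-inˡ z)
        split (inj₂ (inj₂ w)) = inj₂ (∪-inʳ w)
      seen-split : ∀ f (X : Sub n) v → v ∈ X ∩ seen f → v ∈ X ∩ c (f 0F) ⊎ v ∈ X ∩ c (f 1F) ⊎ v ∈ X ∩ c (f 2F)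
      seen-split f X v h with ∪-out {S = c (f 0F)} (∩-right {S = F} (∩-right {S = X} h))
      ... | inj₁ k = inj₁ (∩-in (∩-left h) k)
      ... | inj₂ k with ∪-out {S = c (f 1F)} k
      ...   | inj₁ l = inj₂ (inj₁ (∩-in (∩-left h) l))
      ...   | inj₂ l = inj₂ (inj₂ (∩-in (∩-left h) l))
      seen-size : ∀ f → # (seen f) ≤ # (F ∩ c (f 0F)) + (# (F ∩ c (f 1F)) + # (F ∩ c (f 2F)))
      seen-size f = ∪₃ λ w h → seen-split f F w (∩-in (∩-left h) h)
      three-in : 3 ≤ # A
      three-in = ≰⇒> gt
      size : # S ≤ 4 * d
      size with elements A 3 three-in
      ... | f , f∈ , inj = lin 7 {# S , # (S ∩ c v) , # F , # (seen f) , # (F ∩ c (f 0F)) , # (F ∩ c (f (suc 0F))) , # (F ∩ c (f (suc (suc 0F)))) , _} ($0 ≼ $1 ⊞ ($1 ⊞ (2 ⊠ $1))) ($0 ⊞ $2 ⊞ $3 ⊞ (con 1 ⊞ $4) ⊞ (con 1 ⊞ $5) ⊞ (con 1 ⊞ $6) ≼ $1 ⊞ (con 1 ⊞ $2) ⊞ ($3 ⊞ con 2) ⊞ ($4 ⊞ ($5 ⊞ $6)) ⊞ $1 ⊞ $1 ⊞ $1) (eq≤ (#-far S v∈) ⊕ cover f f∈ inj ⊕ seen-size f ⊕ few (f 0F) (f∈ 0F) ⊕ few (f 1F) (f∈ 1F) ⊕ few (f 2F) (f∈ 2F))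
      contra : ¬ 4 * # Q < # S + 3
      contra lt = overlaps (elements A 6 (*-cancelˡ-≤ {6} {# A} 4 (lin 2 {# A , _ , _} (4 ⊠ con 6 ≼ 4 ⊠ $0) (con 23 ⊞ ($1 ⊞ con 1) ≼ $1 ⊞ 4 ⊠ $0) (big ⊕ tight))))
        where
        d≤q : d ≤ # Q
        d≤q = deg-bound stable≤ v
        4q≤ : 4 * # Q ≤ # S + 1
        4q≤ = ≮⇒≥ λ gt → absurd-≤ 2 {_ , # Q , _} ($0 ⊞ con 1 ⊞ con 2 ⊞ (con 1 ⊞ 4 ⊠ $1) ≼ 4 ⊠ $1 ⊞ ($0 ⊞ con 3)) (even-step k (2 * # Q) odd (trans (four (# Q)) refl) gt ⊕ lt)
          where
          four : ∀ q → 4 * q ≡ 2 * (2 * q)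
          four = solve-∀
        tight : # S + 1 ≤ 4 * d
        tight = ≮⇒≥ λ gt → absurd-≤ 2 {d , _ , _} (4 ⊠ $0 ⊞ con 2 ⊞ $1 ≼ $1 ⊞ con 1 ⊞ 4 ⊠ $0) (even-step (2 * d) k (four d) odd gt ⊕ size)
          where
          four : ∀ q → 4 * q ≡ 2 * (2 * q)
          four = solve-∀
        F≥ : 3 * d ≤ # F + 2
        F≥ = lin 4 {d , # F , # S , # Q , _} (3 ⊠ $0 ≼ $1 ⊞ con 2) ($2 ⊞ 4 ⊠ $3 ⊞ 4 ⊠ $0 ≼ $0 ⊞ (con 1 ⊞ $1) ⊞ ($2 ⊞ con 1) ⊞ 4 ⊠ $3) (eq≤ (#-far S v∈) ⊕ 4q≤ ⊕ 4 ⊗ d≤q)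
        overlaps : (Σ (Fin 6 → Fin n) λ t → (∀ i → t i ∈ A) × (∀ {i j} → t i ≡ t j → i ≡ j)) → ⊥
        -- Each of the two triples sees all but two vertices of `F`, and they meet in at most 3 · 3
        -- vertices. So `# F` is at most 13, but `F≥` and `d≥6` require 16.
        overlaps (t , t∈ , t-inj) = absurd-≤ 7 {# F , d , # (seen (λ x → t (lo x))) , # (seen (λ x → t (hi x))) , # ((F ∩ c (t (lo 0F))) ∩ seen (λ x → t (hi x))) , # ((F ∩ c (t (lo (suc 0F)))) ∩ seen (λ x → t (hi x))) , # ((F ∩ c (t (lo (suc (suc 0F))))) ∩ seen (λ x → t (hi x))) , _} ($0 ⊞ $0 ⊞ 3 ⊠ $1 ⊞ ($2 ⊞ $3) ⊞ $4 ⊞ $5 ⊞ $6 ⊞ 3 ⊠ con 6 ≼ $2 ⊞ con 2 ⊞ ($3 ⊞ con 2) ⊞ ($0 ⊞ con 2) ⊞ ($0 ⊞ ($4 ⊞ ($5 ⊞ $6))) ⊞ con 3 ⊞ con 3 ⊞ con 3 ⊞ 3 ⊠ $1) (cover (t ∘ lo) (t∈ ∘ lo) (lo-inj ∘ t-inj) ⊕ cover (t ∘ hi) (t∈ ∘ hi) (hi-inj ∘ t-inj) ⊕ F≥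
            ⊕ both ⊕ meets 0F ⊕ meets 1F ⊕ meets 2F ⊕ 3 ⊗ d≥6)
          where
          lo hi : Fin 3 → Fin 6
          lo 0F = zero
          lo 1F = suc zero
          lo 2F = suc (suc zero)
          hi 0F = suc (suc (suc zero))
          hi 1F = suc (suc (suc (suc zero)))
          hi 2F = suc (suc (suc (suc (suc zero))))
          lo-inj : ∀ {i j} → lo i ≡ lo j → i ≡ j
          lo-inj {0F} {0F} _ = refl
          lo-inj {1F} {1F} _ = refl
          lo-inj {2F} {2F} _ = refl
          lo-inj {0F} {1F} ()
          lo-inj {0F} {2F} ()
          lo-inj {1F} {0F} ()
          lo-inj {1F} {2F} ()
          lo-inj {2F} {0F} ()
          lo-inj {2F} {1F} ()
          hi-inj : ∀ {i j} → hi i ≡ hi j → i ≡ j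
          hi-inj {0F} {0F} _ = refl
          hi-inj {1F} {1F} _ = refl
          hi-inj {2F} {2F} _ = refl
          hi-inj {0F} {1F} ()
          hi-inj {0F} {2F} ()
          hi-inj {1F} {0F} ()
          hi-inj {1F} {2F} ()
          hi-inj {2F} {0F} ()
          hi-inj {2F} {1F} ()
          d≥6 : 6 ≤ d
          d≥6 = *-cancelˡ-≤ {6} {d} 4 (lin 2 {d , _ , _} (4 ⊠ con 6 ≼ 4 ⊠ $0) (con 23 ⊞ ($1 ⊞ con 1) ≼ $1 ⊞ 4 ⊠ $0) (big ⊕ tight))
          -- With a third neighbour `t e` at least 3d - 4 vertices are seen, while the three
          -- neighbourhoods in `F` have at most 3(d - 1) elements in total. This leaves room for an
          -- overlap of one.
          pair : ∀ a b e → a ≢ b → a ≢ e → b ≢ e → # ((F ∩ c (t a)) ∩ c (t b)) ≤ 1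
          pair a b e a≢b a≢e b≢e = ≮⇒≥ λ two → absurd-≤ 7 {# F , # (seen f) , # ((F ∩ c (t a)) ∩ c (t b)) , # (F ∩ c (t a)) , # (F ∩ c (t b)) , # (F ∩ c (t e)) , d , _} ($0 ⊞ ($1 ⊞ $2) ⊞ con 2 ⊞ (con 1 ⊞ $3) ⊞ (con 1 ⊞ $4) ⊞ (con 1 ⊞ $5) ⊞ 3 ⊠ $6 ≼ $1 ⊞ con 2 ⊞ ($3 ⊞ ($4 ⊞ $5)) ⊞ $2 ⊞ $6 ⊞ $6 ⊞ $6 ⊞ ($0 ⊞ con 2)) (cover f f∈ f-inj ⊕ seen-size′ ⊕ two ⊕ few (t a) (t∈ a) ⊕ few (t b) (t∈ b) ⊕ few (t e) (t∈ e) ⊕ F≥)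
            where
            f : Fin 3 → Fin n
            f 0F = t a
            f 1F = t b
            f 2F = t e
            f∈ : ∀ i → f i ∈ A
            f∈ 0F = t∈ a
            f∈ 1F = t∈ b
            f∈ 2F = t∈ e
            f-inj : ∀ {i j} → f i ≡ f j → i ≡ j
            f-inj {0F} {0F} _ = refl
            f-inj {1F} {1F} _ = refl
            f-inj {2F} {2F} _ = refl
            f-inj {0F} {1F} h = ⊥-elim (a≢b (t-inj h))
            f-inj {0F} {2F} h = ⊥-elim (a≢e (t-inj h))
            f-inj {1F} {0F} h = ⊥-elim (a≢b (sym (t-inj h)))
            f-inj {1F} {2F} h = ⊥-elim (b≢e (t-inj h))
            f-inj {2F} {0F} h = ⊥-elim (a≢e (sym (t-inj h)))
            f-inj {2F} {1F} h = ⊥-elim (b≢e (sym (t-inj h)))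
            split : ∀ w → w ∈ seen f → w ∈ (F ∩ c (t a)) ∖ c (t b) ⊎ w ∈ F ∩ c (t b) ⊎ w ∈ F ∩ c (t e)
            split w h with true-or-false (c (t b) w) | seen-split f F w (∩-in (∩-left h) h)
            ... | inj₁ k | _ = inj₂ (inj₁ (∩-in (∩-left h) k))
            ... | inj₂ k | inj₁ l = inj₁ (∖-in l k)
            ... | inj₂ k | inj₂ l = inj₂ l
            seen-size′ : # (seen f) + # ((F ∩ c (t a)) ∩ c (t b)) ≤ # (F ∩ c (t a)) + (# (F ∩ c (t b)) + # (F ∩ c (t e)))
            seen-size′ = lin 6 {# (seen f) , # ((F ∩ c (t a)) ∩ c (t b)) , # (F ∩ c (t a)) , # (F ∩ c (t b)) , # (F ∩ c (t e)) , # ((F ∩ c (t a)) ∖ c (t b)) , _} ($0 ⊞ $1 ≼ $2 ⊞ ($3 ⊞ $4)) ($0 ⊞ ($1 ⊞ $5) ≼ $5 ⊞ ($3 ⊞ $4) ⊞ $2) (∪₃ {seen f} split ⊕ eq≥ (#-split (F ∩ c (t a)) (c (t b))))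
          meets : ∀ i → # ((F ∩ c (t (lo i))) ∩ seen (t ∘ hi)) ≤ 3
          meets i = lin 4 ($0 ≼ con 3) ($0 ⊞ $1 ⊞ $2 ⊞ $3 ≼ $1 ⊞ ($2 ⊞ $3) ⊞ con 1 ⊞ con 1 ⊞ con 1) (∪₃ (λ w → seen-split (t ∘ hi) (F ∩ c (t (lo i))) w) ⊕ p i 0F ⊕ p i 1F ⊕ p i 2F)
            where
            p : ∀ i j → # ((F ∩ c (t (lo i))) ∩ c (t (hi j))) ≤ 1
            p 0F 0F = pair _ _ (lo 1F) (λ ()) (λ ()) (λ ())
            p 0F 1F = pair _ _ (lo 1F) (λ ()) (λ ()) (λ ())
            p 0F 2F = pair _ _ (lo 1F) (λ ()) (λ ()) (λ ())
            p 1F 0F = pair _ _ (lo 0F) (λ ()) (λ ()) (λ ())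
            p 1F 1F = pair _ _ (lo 0F) (λ ()) (λ ()) (λ ())
            p 1F 2F = pair _ _ (lo 0F) (λ ()) (λ ()) (λ ())
            p 2F 0F = pair _ _ (lo 0F) (λ ()) (λ ()) (λ ())
            p 2F 1F = pair _ _ (lo 0F) (λ ()) (λ ()) (λ ())
            p 2F 2F = pair _ _ (lo 0F) (λ ()) (λ ()) (λ ())
          both : # (seen (t ∘ lo)) + # (seen (t ∘ hi)) ≤ # F + (# ((F ∩ c (t (lo 0F))) ∩ seen (t ∘ hi)) + (# ((F ∩ c (t (lo 1F))) ∩ seen (t ∘ hi)) + # ((F ∩ c (t (lo 2F))) ∩ seen (t ∘ hi))))
          both = lin 8 {# (seen ((λ {x} → t) ∘ lo)) , # (seen (λ x → t (hi x))) , # F , # ((F ∩ c (t (lo 0F))) ∩ seen (λ x → t (hi x))) , # ((F ∩ c (t (lo (suc 0F)))) ∩ seen (λ x → t (hi x))) , # ((F ∩ c (t (lo (suc (suc 0F))))) ∩ seen (λ x → t (hi x))) , # (seen (λ x → t (lo x)) ∖ seen (λ x → t (hi x))) , # (seen (λ x → t (lo x)) ∩ seen (λ x → t (hi x))) , _} ($0 ⊞ $1 ≼ $2 ⊞ ($3 ⊞ ($4 ⊞ $5))) ($6 ⊞ $1 ⊞ $0 ⊞ $7 ≼ $2 ⊞ ($7 ⊞ $6) ⊞ ($3 ⊞ ($4 ⊞ $5))) (#-⊎ {S = F} {seen (t ∘ lo) ∖ seen (t ∘ hi)} {seen (t ∘ hi)} (λ _ h → ∩-left (∖-left h)) (λ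 _ → ∩-left)
                  (λ _ h k → clash k (∖-right {S = seen (t ∘ lo)} h)) ⊕ eq≤ (#-split (seen (t ∘ lo)) (seen (t ∘ hi)))
                  ⊕ ∪₃ {seen (t ∘ lo) ∩ seen (t ∘ hi)} split)
            where
            split : ∀ w → w ∈ seen (t ∘ lo) ∩ seen (t ∘ hi) → w ∈ (F ∩ c (t (lo 0F))) ∩ seen (t ∘ hi) ⊎ w ∈ (F ∩ c (t (lo 1F))) ∩ seen (t ∘ hi) ⊎ w ∈ (F ∩ c (t (lo 2F))) ∩ seen (t ∘ hi)
            split w h with seen-split (t ∘ lo) F w (∩-in (∩-left (∩-left h)) (∩-left h))
            ... | inj₁ k = inj₁ (∩-in k (∩-right {S = seen (t ∘ lo)} h))
            ... | inj₂ (inj₁ k) = inj₂ (inj₁ (∩-in k (∩-right {S = seen (t ∘ lo)} h)))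
            ... | inj₂ (inj₂ k) = inj₂ (inj₂ (∩-in k (∩-right {S = seen (t ∘ lo)} h)))

    -- A vertex outside `Q` has a neighbour in `Q` by `hall`; together with five non-neighbours in
    -- `Q` these would form the complement of K₇⁻, so it misses at most four vertices of `Q`. Double
    -- counting settles `# Q` = 7 and 8. From 9 on, two adjacent vertices outside `Q` would have a
    -- common neighbour in `Q`, so `D` is stable.
    K₇⁻-free : (∀ x y P → c x y ≡ true → Stable P → 5 ≤ # P → (∀ w → w ∈ P → c x w ≡ false) → (∀ w → w ∈ P → c y w ≡ false) → ⊥) →
      7 ≤ # Q → # S + 3 ≤ 4 * # Q
    K₇⁻-free no-K₇⁻ seven = cases (# Q) refl seven
      where
      D : Sub n
      D = S ∖ Q
      missed≤4 : ∀ v → v ∈ D → # (Q ∖ c v) ≤ 4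
      missed≤4 v v∈ = ≮⇒≥ λ five → case touching of λ where
          (x , x∈ , cvx) → no-K₇⁻ v x (Q ∖ c v) cvx (λ a b → proj₁ (proj₂ L) (∖-left a) (∖-left b)) five
            (λ w h → ∖-right {S = Q} h) (λ w h → proj₁ (proj₂ L) x∈ (∖-left h))
        where
        touching : ∃[ x ] (x ∈ Q × c v x ≡ true)
        touching = case #-pos (Q ∩ touched ⁅ v ⁆) (≤-trans (eq≥ (#-⁅⁆ v)) (hall L (single D v∈) (singleton-stable v))) of λ where
          (x , h) → case touched-out (∩-right {S = Q} h) of λ where
            (a , a∈ , e) → x , ∩-left h , subst (λ y → c y x ≡ true) (sym (eqᵇ-true {i = v} a∈)) e
      sizes : # S ≤ # Q + # D
      sizes = lin 4 ($0 ≼ $1 ⊞ $2) ($0 ⊞ $3 ≼ $3 ⊞ $2 ⊞ $1) (eq≤ (#-split S Q) ⊕ #-mono {S = S ∩ Q} {Q} λ _ → ∩-right {S = S})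
      counted : ∀ l → # Q ≡ l + 4 → l * # D ≤ # Q * # Q
      counted l e = double-count Q D c (# Q) l
        (λ a a∈ → ≤-trans (#-mono {S = D ∩ c a} {S ∩ c a} λ w h → ∩-in (∖-left (∩-left h)) (∩-right {S = D} h)) (deg-bound stable≤ a))
        λ b b∈ → lin 5 ($0 ≼ $1) ($0 ⊞ con 4 ⊞ $2 ⊞ $3 ⊞ $4 ≼ $2 ⊞ ($4 ⊞ $3) ⊞ con 4 ⊞ $1) (eq≥ e ⊕ eq≤ (#-split Q (c b)) ⊕ missed≤4 b b∈ ⊕ #-mono {S = Q ∩ c b} {Q ∩ λ a → c a b} λ a h → ∩-in (∩-left h) (c-flip (∩-right {S = Q} h)))
      rest-stable : 9 ≤ # Q → Stable D
      rest-stable ge {x} {y} x∈ y∈ = ¬true⇒false λ cxy → absurd-≤ 5 {# Q , # (Q ∖ c x) , # (Q ∖ c y) , # (Q ∩ c x) , # (Q ∩ c y) , _} (con 9 ⊞ $0 ⊞ $0 ⊞ $1 ⊞ $2 ⊞ ($3 ⊞ $4) ≼ $0 ⊞ ($3 ⊞ $1) ⊞ ($4 ⊞ $2) ⊞ con 4 ⊞ con 4 ⊞ $0) (ge ⊕ eq≤ (#-split Q (c x)) ⊕ eq≤ (#-split Q (c y)) ⊕ missed≤4 x x∈ ⊕ missed≤4 y y∈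
        ⊕ #-⊎ {S = Q} {Q ∩ c x} {Q ∩ c y} (λ _ → ∩-left) (λ _ → ∩-left) λ z hx hy → c-tri x y z cxy (∩-right {S = Q} hy) (∩-right {S = Q} hx))
      cases : ∀ q → # Q ≡ q → 7 ≤ q → # S + 3 ≤ 4 * # Q
      cases 7 e _ = *-cancelˡ-≤ {# S + 3} {4 * # Q} 3 (lin 3 {# S , # Q , # D , _} (3 ⊠ ($0 ⊞ con 3) ≼ 3 ⊠ 4 ⊠ $1) (3 ⊠ $2 ⊞ 3 ⊠ $0 ⊞ 9 ⊠ con 7 ≼ 7 ⊠ con 7 ⊞ 3 ⊠ ($1 ⊞ $2) ⊞ 9 ⊠ $1) (subst (λ q → 3 * # D ≤ q * q) e (counted 3 e) ⊕ 3 ⊗ sizes ⊕ 9 ⊗ eq≥ e))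
      cases 8 e _ = *-cancelˡ-≤ {# S + 3} {4 * # Q} 4 (lin 3 {# S , # Q , # D , _} (4 ⊠ ($0 ⊞ con 3) ≼ 4 ⊠ 4 ⊠ $1) (4 ⊠ $2 ⊞ 4 ⊠ $0 ⊞ 12 ⊠ con 8 ≼ 8 ⊠ con 8 ⊞ 4 ⊠ ($1 ⊞ $2) ⊞ 12 ⊠ $1) (subst (λ q → 4 * # D ≤ q * q) e (counted 4 e) ⊕ 4 ⊗ sizes ⊕ 12 ⊗ eq≥ e))
      cases (suc (suc (suc (suc (suc (suc (suc (suc (suc q))))))))) e _ = large₂ (lin 3 {# S , # Q , # D , _} ($0 ≼ 2 ⊠ $1) ($0 ⊞ $2 ≼ $1 ⊞ $2 ⊞ $1) (sizes ⊕ stable≤ D (λ _ → ∖-left) (rest-stable (lin 2 (con 9 ≼ $0) (con 1 ⊞ (con 1 ⊞ (con 1 ⊞ (con 1 ⊞ (con 1 ⊞ (con 1 ⊞ (con 1 ⊞ (con 1 ⊞ (con 1 ⊞ $1)))))))) ⊞ con 0 ≼ $0 ⊞ $1) (eq≥ e ⊕ z≤n {q})))))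
      cases 0 e ()
      cases 1 e (s≤s ())
      cases 2 e (s≤s (s≤s ()))
      cases 3 e (s≤s (s≤s (s≤s ())))
      cases 4 e (s≤s (s≤s (s≤s (s≤s ()))))
      cases 5 e (s≤s (s≤s (s≤s (s≤s (s≤s ())))))
      cases 6 e (s≤s (s≤s (s≤s (s≤s (s≤s (s≤s ()))))))

-- Counting edges in graphs with bounded stable sets

opaque
  unfolding sumOver
  sumOver-⊎ : ∀ {n} {S T U : Sub n} (f : Fin n → ℕ) → T ⊆ S → U ⊆ S → (∀ v → v ∈ T → v ∈ U → ⊥) → sumOver T f + sumOver U f ≤ sumOver S f
  sumOver-⊎ {S = S} {T} {U} f h k d = ≤-trans (≤-reflexive (sym (sum-+ (λ v → b2n (T v) * f v) (λ v → b2n (U v) * f v))))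
    (sum-mono λ v → pt (S v) (T v) (U v) (f v) (h v) (k v) (d v))
    where
    pt : ∀ a b c x → (b ≡ true → a ≡ true) → (c ≡ true → a ≡ true) → (b ≡ true → c ≡ true → ⊥) → b2n b * x + b2n c * x ≤ b2n a * x
    pt a false false _ _ _ _ = z≤n
    pt a true false x f _ _ rewrite f refl = ≤-reflexive (+-identityʳ _)
    pt a false true x _ g _ rewrite g refl = ≤-refl
    pt a true true _ _ _ e = ⊥-elim (e refl refl)

  sumOver-⁅⁆ : ∀ {n} (x : Fin n) (f : Fin n → ℕ) → sumOver ⁅ x ⁆ f ≡ f x
  sumOver-⁅⁆ {n} x f = trans (sum-cong λ v → pt v (true-or-false (eqᵇ x v))) (trans (sumOver-const ⁅ x ⁆ (f x)) (trans (cong (f x *_) (#-⁅⁆ x)) (*-identityʳ _)))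
    where
    pt : ∀ v → eqᵇ x v ≡ true ⊎ eqᵇ x v ≡ false → b2n (eqᵇ x v) * f v ≡ b2n (eqᵇ x v) * f x
    pt v (inj₁ e) = cong (λ w → b2n (eqᵇ x v) * f w) (sym (eqᵇ-true {i = x} e))
    pt v (inj₂ e) rewrite e = refl

opaque
  unfolding sumOver _∖_
  sumOver-∩ : ∀ {n} (S T : Sub n) (f : Fin n → ℕ) → sumOver (S ∩ T) f ≡ sumOver S (λ v → b2n (T v) * f v)
  sumOver-∩ S T f = sum-cong λ v → pt (S v) (T v) (f v)
    where
    pt : ∀ a b x → b2n (a ∧ b) * x ≡ b2n a * (b2n b * x)
    pt false b x = refl
    pt true b x = sym (+-identityʳ _)

  sumOver-*ʳ : ∀ {n} (S : Sub n) (T : Fin n → Bool) k → sumOver S (λ v → b2n (T v) * k) ≡ k * # (S ∩ T)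
  sumOver-*ʳ S T k = trans (sym (sumOver-∩ S T (λ _ → k))) (sumOver-const (S ∩ T) k)

sumOver-─ : ∀ {n} (S : Sub n) {x} (f : Fin n → ℕ) → x ∈ S → f x + sumOver (S ─ x) f ≤ sumOver S f
sumOver-─ S {x} f x∈ = subst (λ k → k + sumOver (S ─ x) f ≤ sumOver S f) (sumOver-⁅⁆ x f)
  (sumOver-⊎ {S = S} {⁅ x ⁆} {S ─ x} f (λ v h → subst (_∈ S) (eqᵇ-true {i = x} h) x∈) (λ _ → ─-left) λ v h k → ─-right {S = S} k (eqᵇ-true {i = x} h))

module Counting {n} (𝒞 : TriangleFree n) where
  open TriangleFree 𝒞
  open Families 𝒞 using (Stable)
  open Ramsey 𝒞

  -- twice the number of edges
  esum : Sub n → ℕ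
  esum S = sumOver S (deg S)

  opaque
    -- The neighbours of `v` are stable, so every edge meeting them has exactly one end among them;
    -- deleting the closed neighbourhood loses the sum of their degrees.
    esum-far : ∀ S {v} → v ∈ S → esum (far S v) + 2 * sumOver (S ∩ c v) (deg S) ≤ esum S
    esum-far S {v} v∈ = lin 11 ($0 ⊞ 2 ⊠ $1 ≼ $2) ($3 ⊞ $4 ⊞ ($1 ⊞ $5) ⊞ $6 ⊞ ($0 ⊞ $7) ⊞ $8 ⊞ $1 ⊞ $9 ⊞ $10 ≼ $2 ⊞ $4 ⊞ $5 ⊞ $6 ⊞ $7 ⊞ $9 ⊞ ($10 ⊞ $8) ⊞ 1 ⊠ $3) (sumOver-─ S (deg S) v∈ ⊕ sumOver-⊎ {S = S ─ v} {N} {F} (deg S) sub₁ sub₂ disjoint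
        ⊕ sumOver-mono F (λ u _ → split u) ⊕ eq≥ (sumOver-+ F (deg F) (λ u → # (N ∩ λ w → c w u))) ⊕ eq≤ swap
        ⊕ sumOver-mono N inner ⊕ eq≤ (sumOver-+ N (λ _ → 1) (λ u → # (F ∩ c u))) ⊕ eq≤ (sumOver-const N 1))
      where
      N F : Sub n
      N = S ∩ c v
      F = far S v
      sub₁ : N ⊆ S ─ v
      sub₁ w h = ─-in (∩-left h) λ { refl → clash (∩-right {S = S} h) (c-irr v) }
      sub₂ : F ⊆ S ─ v
      sub₂ w h = ─-in (far-⊆ {S} h) (far-≢ {S} h)
      disjoint : ∀ w → w ∈ N → w ∈ F → ⊥
      disjoint w h k = clash (∩-right {S = S} h) (far-c {S} k)
      split : ∀ u → deg F u + # (N ∩ λ w → c w u) ≤ deg S u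
      split u = #-⊎ {S = S ∩ c u} {F ∩ c u} {N ∩ λ w → c w u}
        (λ w h → ∩-in (far-⊆ {S} (∩-left h)) (∩-right {S = F} h))
        (λ w h → ∩-in (∩-left (∩-left h)) (trans (c-sym u w) (∩-right {S = N} h)))
        λ w h k → disjoint w (∩-left k) (∩-left h)
      inner : ∀ u → u ∈ N → deg S u ≤ 1 + # (F ∩ c u)
      inner u u∈ = lin 3 ($0 ≼ con 1 ⊞ $1) ($0 ⊞ $2 ≼ $2 ⊞ $1 ⊞ con 1) (#-∪ {S = S ∩ c u} {⁅ v ⁆} {F ∩ c u} cover ⊕ eq≤ (#-⁅⁆ v))
        where
        cover : ∀ w → w ∈ S ∩ c u → w ∈ ⁅ v ⁆ ⊎ w ∈ F ∩ c u
        cover w h with true-or-false (eqᵇ v w)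
        ... | inj₁ e = inj₁ e
        ... | inj₂ e = inj₂ (∩-in (far-in {S} (∩-left h) (¬true⇒false λ k → c-tri v u w (∩-right {S = S} u∈) (∩-right {S = S} h) k) (eqᵇ-≢ e)) (∩-right {S = S} h))
      swap : sumOver N (λ u → # (F ∩ c u)) ≡ sumOver F (λ u → # (N ∩ λ w → c w u))
      swap = trans (sym (sumOver-#′ N F c)) (trans (sumOver-swap N F (λ a b → b2n (c a b))) (sumOver-#″ F N c))
        where
        sumOver-#′ : ∀ (A B : Sub n) (r : Fin n → Fin n → Bool) → sumOver A (λ a → sumOver B (λ b → b2n (r a b))) ≡ sumOver A (λ a → # (B ∩ r a))
        sumOver-#′ A B r = ≤-antisym (sumOver-mono A λ a _ → ≤-reflexive (sumOver-# B (r a))) (sumOver-mono A λ a _ → ≤-reflexive (sym (sumOver-# B (r a))))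
        sumOver-#″ : ∀ (B A : Sub n) (r : Fin n → Fin n → Bool) → sumOver B (λ b → sumOver A (λ a → b2n (r a b))) ≡ sumOver B (λ b → # (A ∩ λ a → r a b))
        sumOver-#″ B A r = sumOver-#′ B A (λ b a → r a b)

    -- The degree of `u` is counted once for each of the `deg S u` neighbours of `u`.
    degree-squares : ∀ S → sumOver S (λ v → sumOver (S ∩ c v) (deg S)) ≡ sumOver S (λ v → deg S v * deg S v)
    degree-squares S = begin
      sumOver S (λ v → sumOver (S ∩ c v) (deg S))               ≡⟨ over-cong (λ v → sumOver-∩ S (c v) (deg S)) ⟩
      sumOver S (λ v → sumOver S (λ u → b2n (c v u) * deg S u))  ≡⟨ sumOver-swap S S (λ v u → b2n (c v u) * deg S u) ⟩
      sumOver S (λ u → sumOver S (λ v → b2n (c v u) * deg S u))  ≡⟨ over-cong (λ u → trans (sumOver-*ʳ S (λ v → c v u) (deg S u))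
                                                                     (cong (deg S u *_) (#-∩-cong S λ v → c-sym v u))) ⟩
      sumOver S (λ u → deg S u * deg S u)                        ∎
      where
      open ≡-Reasoning
      over-cong : ∀ {f g : Fin n → ℕ} → (∀ v → f v ≡ g v) → sumOver S f ≡ sumOver S g
      over-cong h = ≤-antisym (sumOver-mono S λ v _ → ≤-reflexive (h v)) (sumOver-mono S λ v _ → ≤-reflexive (sym (h v)))
      #-∩-cong : ∀ (S : Sub n) {T U : Sub n} → (∀ v → T v ≡ U v) → # (S ∩ T) ≡ # (S ∩ U)
      #-∩-cong S {T} {U} h = ≤-antisym (#-mono λ v k → ∩-in (∩-left k) (trans (sym (h v)) (∩-right {S = S} k)))
        (#-mono λ v k → ∩-in (∩-left k) (trans (h v) (∩-right {S = S} k)))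

  -- A local inequality to be summed over `S`, where by `esum-far` the far sets and the squares
  -- amount to at most `N * esum S`. The numbers `l` and `μ` act as dual variables of a linear
  -- program and usually make the inequality sharp for two consecutive degrees; with `l` = 0 and
  -- positive `μ` the sum is a contradiction.
  Weighs : Sub n → ℕ → ℕ → ℕ → Fin n → Set
  Weighs S N l μ v = N * deg S v + μ ≤ esum (far S v) + 2 * (deg S v * deg S v) + l * deg S v

  opaque
    -- Summing over v the number of edges avoiding the closed neighbourhood of v.
    weighted : ∀ S N l μ → # S ≡ N → (∀ v → v ∈ S → Weighs S N l μ v) → μ * N ≤ l * esum S
    weighted S N l μ size h = lin 15 {μ * N , l * esum S , sumOver S (λ z → N * deg S z + μ) , sumOver S (λ v → N * deg S v) , sumOver S (λ z → μ) , N * sumOver S (deg S) , sumOver S (λ v → esum (far S v) + 2 * (deg S v * deg S v) + l * deg S v) , sumOver S (λ v → l * deg S v) , sumOver S (λ v → esum (far S v) + 2 * (deg S v * deg S v)) , sumOver S (λ v → 2 * (deg S v * deg S v)) , sumOver S (λ v → sumOver (S ∩ c v) (deg S)) , sumOver S (λ v → esum (far S v)) , sumOver S (λ v → 2 * sumOver (S ∩ c v) (deg S)) , _ , sumOver S (λ z → esum S) , _} ($0 ≼ $1) ($2 ⊞ ($3 ⊞ $4) ⊞ $5 ⊞ $0 ⊞ $6 ⊞ $7 ⊞ $8 ⊞ $9 ⊞ 2 ⊠ $10 ⊞ ($11 ⊞ var 12) ⊞ var 13 ⊞ var 14 ≼ $6 ⊞ $2 ⊞ $3 ⊞ $4 ⊞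 ($8 ⊞ $7) ⊞ $1 ⊞ ($11 ⊞ $9) ⊞ 2 ⊠ $10 ⊞ var 12 ⊞ var 13 ⊞ var 14 ⊞ $5) (sumOver-mono S h
        ⊕ eq≥ (sumOver-+ S (λ v → N * deg S v) (λ _ → μ)) ⊕ eq≥ (sumOver-* S N (deg S)) ⊕ eq≥ (trans (sumOver-const S μ) (cong (μ *_) size))
        ⊕ eq≤ (sumOver-+ S (λ v → esum (far S v) + 2 * (deg S v * deg S v)) (λ v → l * deg S v)) ⊕ eq≤ (sumOver-* S l (deg S))
        ⊕ eq≤ (sumOver-+ S (λ v → esum (far S v)) (λ v → 2 * (deg S v * deg S v)))
        ⊕ eq≤ (trans (sumOver-* S 2 (λ v → deg S v * deg S v)) (cong (2 *_) (sym (degree-squares S))))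
        ⊕ eq≥ (sumOver-* S 2 (λ v → sumOver (S ∩ c v) (deg S)))
        ⊕ eq≥ (sumOver-+ S (λ v → esum (far S v)) (λ v → 2 * sumOver (S ∩ c v) (deg S)))
        ⊕ sumOver-mono S (λ v v∈ → esum-far S v∈)
        ⊕ eq≤ (trans (sumOver-const S (esum S)) (trans (cong (esum S *_) size) (*-comm (esum S) N))))

    weigh : ∀ {S v} N l μ d L → deg S v ≡ d → L ≤ esum (far S v) → (N * d + μ ≤ᵇ L + 2 * (d * d) + l * d) ≡ true → Weighs S N l μ v
    weigh N l μ d L refl h e = ≤-trans (≤ᵇ-sound e) (h ⊕ ≤-refl {2 * (d * d)} ⊕ ≤-refl {l * d})

    far-size : ∀ {S v N d} k → v ∈ S → # S ≡ N → deg S v ≡ d → d + suc k ≡ N → # (far S v) ≡ k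
    far-size {S} {v} {N} {d} k v∈ size e f = ≤-antisym (lin 6 {# (far S v) , k , deg S v , # S , d , N , _} ($0 ≼ $1) ($2 ⊞ (con 1 ⊞ $0) ⊞ $3 ⊞ $4 ⊞ $5 ≼ $3 ⊞ $5 ⊞ $2 ⊞ ($4 ⊞ (con 1 ⊞ $1))) (eq≥ (#-far S v∈) ⊕ eq≤ size ⊕ eq≥ e ⊕ eq≥ f)) (lin 6 {k , # (far S v) , # S , N , deg S v , d , _} ($0 ≼ $1) ($2 ⊞ $3 ⊞ $4 ⊞ ($5 ⊞ (con 1 ⊞ $0)) ≼ $4 ⊞ (con 1 ⊞ $1) ⊞ $2 ⊞ $5 ⊞ $3) (eq≤ (#-far S v∈) ⊕ eq≥ size ⊕ eq≤ e ⊕ eq≤ f))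

    min-degree : ∀ S d → (∀ v → v ∈ S → d ≤ deg S v) → d * # S ≤ esum S
    min-degree S d h = ≤-trans (≤-reflexive (sym (sumOver-const S d))) (sumOver-mono S h)

    esum-even : ∀ S k → 2 * k + 1 ≤ esum S → 2 * k + 2 ≤ esum S
    esum-even S k h with degree-sum-even S
    ... | j , e = lin 2 {k , sumOver S (λ v → # (S ∩ c v)) , _} (2 ⊠ $0 ⊞ con 2 ≼ $1) (2 ⊠ $0 ⊞ con 2 ≼ $1) (even-step k j refl e (lin 2 {k , sumOver S (λ v → # (S ∩ c v)) , _} (con 1 ⊞ 2 ⊠ $0 ≼ $1) (2 ⊠ $0 ⊞ con 1 ≼ $1) h))

  -- `L` bounds twice e(3, m + 1, N) from below, the least number of edges of a triangle-free graph
  -- on `N` vertices without m + 1 independent ones.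
  Edges : ℕ → ℕ → ℕ → Set
  Edges m N L = ∀ S → StableBound S m → # S ≡ N → L ≤ esum S

  module _ {S m r N} (b : StableBound S (suc m)) (R : RamseyBound m r) (size : # S ≡ N) where
    degree-≥ : ∀ d → d + suc r ≤ N → ∀ v → v ∈ S → d ≤ deg S v
    degree-≥ d h v v∈ = lin 6 ($0 ≼ $1) ($0 ⊞ (con 1 ⊞ $2) ⊞ $3 ⊞ $4 ⊞ $5 ≼ $3 ⊞ $4 ⊞ ($1 ⊞ (con 1 ⊞ $5)) ⊞ $2) (h ⊕ eq≥ size ⊕ eq≤ (#-far S v∈) ⊕ R (far S v) (far-bound b v∈))

  edges₂-5 : Edges 2 5 10
  edges₂-5 S b size = lin 2 {_ , # S , _} (con 10 ≼ $0) (2 ⊠ $1 ⊞ 2 ⊠ con 5 ≼ $0 ⊞ 2 ⊠ $1) (min-degree S 2 (degree-≥ b ramsey₁ size 2 (≤ᵇ-sound refl)) ⊕ 2 ⊗ eq≥ size)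

  edges₂-4 : Edges 2 4 4
  edges₂-4 S b size = lin 2 (con 4 ≼ $0) (1 ⊠ $1 ⊞ con 4 ≼ $0 ⊞ $1) (min-degree S 1 (degree-≥ b ramsey₁ size 1 (≤ᵇ-sound refl)) ⊕ eq≥ size)

  between : ∀ {x} a b → a ≤ x → x ≤ b → ∃[ i ] x ≡ a + i × a + i ≤ b
  between {x} a b h k = x ∸ a , trans (sym (m∸n+n≡m h)) (+-comm (x ∸ a) a) , subst (_≤ b) (trans (sym (m∸n+n≡m h)) (+-comm (x ∸ a) a)) k

  -- Division by `l`, rounded up.
  finish : ∀ {x l y} L → y ≤ l * x → (l * (L ∸ 1) <ᵇ y) ≡ true → L ≤ x
  finish {x} {l} {y} L h e = ≮⇒≥ λ lt → <⇒≱ (<ᵇ-sound e) (≤-trans h (*-monoʳ-≤ l (pred≤ lt)))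
    where
    <ᵇ-sound : ∀ {a b} → (a <ᵇ b) ≡ true → a < b
    <ᵇ-sound {a} {b} h = <ᵇ⇒< a b (subst T (sym h) tt)
    pred≤ : x < L → x ≤ L ∸ 1
    pred≤ (s≤s h) = h

  edges₃-8 : Edges 3 8 20
  edges₃-8 S b size = finish {l = 4} 20 (weighted S 8 4 10 size local) refl
    where
    local : ∀ v → v ∈ S → Weighs S 8 4 10 v
    local v v∈ with between 2 3 (degree-≥ b ramsey₂ size 2 (≤ᵇ-sound refl) v v∈) (deg-bound b v)
    ... | 0 , e , _ = weigh 8 4 10 2 10 e (edges₂-5 _ (far-bound b v∈) (far-size 5 v∈ size e refl)) refl
    ... | 1 , e , _ = weigh 8 4 10 3 4 e (edges₂-4 _ (far-bound b v∈) (far-size 4 v∈ size e refl)) refl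
    ... | suc (suc _) , _ , s≤s (s≤s (s≤s ()))

  edges₃-7 : Edges 3 7 12
  edges₃-7 S b size = finish {l = 7} 12 (weighted S 7 7 12 size local) refl
    where
    local : ∀ v → v ∈ S → Weighs S 7 7 12 v
    local v v∈ with between 1 3 (degree-≥ b ramsey₂ size 1 (≤ᵇ-sound refl) v v∈) (deg-bound b v)
    ... | 0 , e , _ = weigh 7 7 12 1 10 e (edges₂-5 _ (far-bound b v∈) (far-size 5 v∈ size e refl)) refl
    ... | 1 , e , _ = weigh 7 7 12 2 4 e (edges₂-4 _ (far-bound b v∈) (far-size 4 v∈ size e refl)) refl
    ... | 2 , e , _ = weigh 7 7 12 3 0 e z≤n refl
    ... | suc (suc (suc _)) , _ , s≤s (s≤s (s≤s ()))

  edges₃-6 : Edges 3 6 6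
  edges₃-6 S b size = finish {l = 4} 6 (weighted S 6 4 4 size local) refl
    where
    local : ∀ v → v ∈ S → Weighs S 6 4 4 v
    local v v∈ with between 0 3 z≤n (deg-bound b v)
    ... | 0 , e , _ = weigh 6 4 4 0 10 e (edges₂-5 _ (far-bound b v∈) (far-size 5 v∈ size e refl)) refl
    ... | 1 , e , _ = weigh 6 4 4 1 4 e (edges₂-4 _ (far-bound b v∈) (far-size 4 v∈ size e refl)) refl
    ... | 2 , e , _ = weigh 6 4 4 2 0 e z≤n refl
    ... | 3 , e , _ = weigh 6 4 4 3 0 e z≤n refl
    ... | suc (suc (suc (suc _))) , _ , s≤s (s≤s (s≤s ()))

  edges₄-13 : Edges 4 13 52
  edges₄-13 S b size = lin 2 {_ , # S , _} (con 52 ≼ $0) (4 ⊠ $1 ⊞ 4 ⊠ con 13 ≼ $0 ⊞ 4 ⊠ $1) (min-degree S 4 (degree-≥ b ramsey₃ size 4 (≤ᵇ-sound refl)) ⊕ 4 ⊗ eq≥ size)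

  edges₄-12 : Edges 4 12 40
  edges₄-12 S b size = finish {l = 6} 40 (weighted S 12 6 20 size local) refl
    where
    local : ∀ v → v ∈ S → Weighs S 12 6 20 v
    local v v∈ with between 3 4 (degree-≥ b ramsey₃ size 3 (≤ᵇ-sound refl) v v∈) (deg-bound b v)
    ... | 0 , e , _ = weigh 12 6 20 3 20 e (edges₃-8 _ (far-bound b v∈) (far-size 8 v∈ size e refl)) refl
    ... | 1 , e , _ = weigh 12 6 20 4 12 e (edges₃-7 _ (far-bound b v∈) (far-size 7 v∈ size e refl)) refl
    ... | suc (suc _) , _ , s≤s (s≤s (s≤s (s≤s ())))

  edges₄-11 : Edges 4 11 30
  edges₄-11 S b size = finish {l = 9} 30 (weighted S 11 9 24 size local) refl
    where
    local : ∀ v → v ∈ S → Weighs S 11 9 24 v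
    local v v∈ with between 2 4 (degree-≥ b ramsey₃ size 2 (≤ᵇ-sound refl) v v∈) (deg-bound b v)
    ... | 0 , e , _ = weigh 11 9 24 2 20 e (edges₃-8 _ (far-bound b v∈) (far-size 8 v∈ size e refl)) refl
    ... | 1 , e , _ = weigh 11 9 24 3 12 e (edges₃-7 _ (far-bound b v∈) (far-size 7 v∈ size e refl)) refl
    ... | 2 , e , _ = weigh 11 9 24 4 6 e (edges₃-6 _ (far-bound b v∈) (far-size 6 v∈ size e refl)) refl
    ... | suc (suc (suc _)) , _ , s≤s (s≤s (s≤s (s≤s ())))

  edges₅-17 : Edges 5 17 76
  edges₅-17 S b size = finish {l = 9} 76 (weighted S 17 9 40 size local) refl
    where
    local : ∀ v → v ∈ S → Weighs S 17 9 40 v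
    local v v∈ with between 3 5 (degree-≥ b ramsey₄ size 3 (≤ᵇ-sound refl) v v∈) (deg-bound b v)
    ... | 0 , e , _ = weigh 17 9 40 3 52 e (edges₄-13 _ (far-bound b v∈) (far-size 13 v∈ size e refl)) refl
    ... | 1 , e , _ = weigh 17 9 40 4 40 e (edges₄-12 _ (far-bound b v∈) (far-size 12 v∈ size e refl)) refl
    ... | 2 , e , _ = weigh 17 9 40 5 30 e (edges₄-11 _ (far-bound b v∈) (far-size 11 v∈ size e refl)) refl
    ... | suc (suc (suc _)) , _ , s≤s (s≤s (s≤s (s≤s (s≤s ()))))

  edges₅-18 : Edges 5 18 90
  edges₅-18 S b size = finish {l = 12} 90 (weighted S 18 12 60 size local) refl
    where
    local : ∀ v → v ∈ S → Weighs S 18 12 60 v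
    local v v∈ with between 4 5 (degree-≥ b ramsey₄ size 4 (≤ᵇ-sound refl) v v∈) (deg-bound b v)
    ... | 0 , e , _ = weigh 18 12 60 4 52 e (edges₄-13 _ (far-bound b v∈) (far-size 13 v∈ size e refl)) refl
    ... | 1 , e , _ = weigh 18 12 60 5 40 e (edges₄-12 _ (far-bound b v∈) (far-size 12 v∈ size e refl)) refl
    ... | suc (suc _) , _ , s≤s (s≤s (s≤s (s≤s (s≤s ()))))

  -- By `ramsey₅` such a graph is 6-regular with degree sum 150. Deleting a closed neighbourhood
  -- leaves 150 - 2 · 36 = 78, but 18 far vertices have degree sum at least 90.
  no-25 : ∀ S → StableBound S 6 → # S ≡ 25 → ⊥
  no-25 S b size = absurd-≤ 1 {esum S , _} (12 ⊠ con 25 ≼ 0 ⊠ $0) (weighted S 25 0 12 size local)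
    where
    local : ∀ v → v ∈ S → Weighs S 25 0 12 v
    local v v∈ with between 6 6 (degree-≥ b ramsey₅ size 6 (≤ᵇ-sound refl) v v∈) (deg-bound b v)
    ... | 0 , e , _ = weigh 25 0 12 6 90 e (edges₅-18 _ (far-bound b v∈) (far-size 18 v∈ size e refl)) refl
    ... | suc _ , _ , s≤s (s≤s (s≤s (s≤s (s≤s (s≤s ())))))

  -- NoFive j S: whenever j vertices of a stable set are chosen in S, at most four vertices are far from all of them
  NoFive : ℕ → Sub n → Set
  NoFive zero S = # S ≤ 4
  NoFive (suc j) S = ∀ v → v ∈ S → NoFive j (far S v)

  EdgesT : ℕ → ℕ → ℕ → Set
  EdgesT j N L = ∀ S → StableBound S (suc (suc j)) → NoFive j S → # S ≡ N → L ≤ esum S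

  module _ {S j r N} (R : ∀ T → StableBound T (suc (suc j)) → NoFive j T → # T ≤ r) (b : StableBound S (suc (suc (suc j)))) (t : NoFive (suc j) S) (size : # S ≡ N) where
    degree-≥T : ∀ d → d + suc r ≤ N → ∀ v → v ∈ S → d ≤ deg S v
    degree-≥T d h v v∈ = lin 6 ($0 ≼ $1) ($0 ⊞ (con 1 ⊞ $2) ⊞ $3 ⊞ $4 ⊞ $5 ≼ $3 ⊞ $4 ⊞ ($1 ⊞ (con 1 ⊞ $5)) ⊞ $2) (h ⊕ eq≥ size ⊕ eq≤ (#-far S v∈) ⊕ R (far S v) (far-bound b v∈) (t v v∈))

  sizeT-0 : ∀ T → StableBound T 2 → NoFive 0 T → # T ≤ 4
  sizeT-0 T _ t = t

  sizeT-1 : ∀ T → StableBound T 3 → NoFive 1 T → # T ≤ 8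
  sizeT-1 T b _ = ramsey₃ T b

  edgesT₁-8 : ∀ S → StableBound S 3 → NoFive 1 S → # S ≡ 8 → ∀ v → v ∈ S → 3 ≤ deg S v
  edgesT₁-8 S b t size = degree-≥T sizeT-0 b t size 3 (≤ᵇ-sound refl)

  edgesT₁-8′ : EdgesT 1 8 24
  edgesT₁-8′ S b t size = lin 2 {_ , # S , _} (con 24 ≼ $0) (3 ⊠ $1 ⊞ 3 ⊠ con 8 ≼ $0 ⊞ 3 ⊠ $1) (min-degree S 3 (edgesT₁-8 S b t size) ⊕ 3 ⊗ eq≥ size)

  edgesT₁-7 : EdgesT 1 7 14
  edgesT₁-7 S b t size = lin 2 {_ , # S , _} (con 14 ≼ $0) (2 ⊠ $1 ⊞ 2 ⊠ con 7 ≼ $0 ⊞ 2 ⊠ $1) (min-degree S 2 (degree-≥T sizeT-0 b t size 2 (≤ᵇ-sound refl)) ⊕ 2 ⊗ eq≥ size)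

  edgesT₁-6 : EdgesT 1 6 6
  edgesT₁-6 S b t size = lin 2 (con 6 ≼ $0) (1 ⊠ $1 ⊞ con 6 ≼ $0 ⊞ $1) (min-degree S 1 (degree-≥T sizeT-0 b t size 1 (≤ᵇ-sound refl)) ⊕ eq≥ size)

  -- Such a graph is 4-regular with degree sum 52. Deleting a closed neighbourhood leaves 52 - 2 ·
  -- 16 = 20, less than the 24 of `edgesT₁-8′`.
  no-T₂-13 : ∀ S → StableBound S 4 → NoFive 2 S → # S ≡ 13 → ⊥
  no-T₂-13 S b t size = absurd-≤ 1 {esum S , _} (4 ⊠ con 13 ≼ 0 ⊠ $0) (weighted S 13 0 4 size local)
    where
    local : ∀ v → v ∈ S → Weighs S 13 0 4 v
    local v v∈ with between 4 4 (degree-≥T sizeT-1 b t size 4 (≤ᵇ-sound refl) v v∈) (deg-bound b v)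
    ... | 0 , e , _ = weigh 13 0 4 4 24 e (edgesT₁-8′ _ (far-bound b v∈) (t v v∈) (far-size 8 v∈ size e refl)) refl
    ... | suc _ , _ , s≤s (s≤s (s≤s (s≤s ())))

  sizeT-2 : ∀ T → StableBound T 4 → NoFive 2 T → # T ≤ 12
  sizeT-2 T b t = ≮⇒≥ λ lt → no-T₂-13 T b t (≤-antisym (ramsey₄ T b) lt)

  edgesT₂-12 : EdgesT 2 12 45
  edgesT₂-12 S b t size = finish {l = 8} 45 (weighted S 12 8 30 size local) refl
    where
    local : ∀ v → v ∈ S → Weighs S 12 8 30 v
    local v v∈ with between 3 4 (degree-≥T sizeT-1 b t size 3 (≤ᵇ-sound refl) v v∈) (deg-bound b v)
    ... | 0 , e , _ = weigh 12 8 30 3 24 e (edgesT₁-8′ _ (far-bound b v∈) (t v v∈) (far-size 8 v∈ size e refl)) refl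
    ... | 1 , e , _ = weigh 12 8 30 4 14 e (edgesT₁-7 _ (far-bound b v∈) (t v v∈) (far-size 7 v∈ size e refl)) refl
    ... | suc (suc _) , _ , s≤s (s≤s (s≤s (s≤s ())))

  edgesT₂-10 : EdgesT 2 10 20
  edgesT₂-10 S b t size = finish {l = 8} 20 (weighted S 10 8 16 size local) refl
    where
    local : ∀ v → v ∈ S → Weighs S 10 8 16 v
    local v v∈ with between 1 4 (degree-≥T sizeT-1 b t size 1 (≤ᵇ-sound refl) v v∈) (deg-bound b v)
    ... | 0 , e , _ = weigh 10 8 16 1 24 e (edgesT₁-8′ _ (far-bound b v∈) (t v v∈) (far-size 8 v∈ size e refl)) refl
    ... | 1 , e , _ = weigh 10 8 16 2 14 e (edgesT₁-7 _ (far-bound b v∈) (t v v∈) (far-size 7 v∈ size e refl)) refl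
    ... | 2 , e , _ = weigh 10 8 16 3 6 e (edgesT₁-6 _ (far-bound b v∈) (t v v∈) (far-size 6 v∈ size e refl)) refl
    ... | 3 , e , _ = weigh 10 8 16 4 0 e z≤n refl
    ... | suc (suc (suc (suc _))) , _ , s≤s (s≤s (s≤s (s≤s ())))

  -- A vertex of degree 2 would have neighbours of degree 2 only, but the vertices far from it induce a cubic graph.
  edgesT₂-11 : EdgesT 2 11 34
  edgesT₂-11 S b t size = ≮⇒≥ λ lt → <⇒≱ lt (esum-even S 16 (lin 2 {_ , # S , _} (2 ⊠ con 16 ⊞ con 1 ≼ $0) (3 ⊠ $1 ⊞ 3 ⊠ con 11 ≼ $0 ⊞ 3 ⊠ $1) (min-degree S 3 (cubic lt) ⊕ 3 ⊗ eq≥ size)))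
    where
    deg≥2 : ∀ v → v ∈ S → 2 ≤ deg S v
    deg≥2 = degree-≥T sizeT-1 b t size 2 (≤ᵇ-sound refl)
    module _ (lt : esum S < 34) where
      -- The far set contributes 24. A neighbour of degree 3 beside one of degree 2 would raise the
      -- sum to 24 + 2 (3 + 2) = 34.
      degree-2 : ∀ y → y ∈ S → deg S y ≡ 2 → ∀ a → a ∈ S ∩ c y → deg S a ≡ 2
      degree-2 y y∈ e a a∈ = ≤-antisym (≮⇒≥ λ three → absurd-≤ 1 (2 ⊠ con 16 ⊞ con 2 ⊞ (con 1 ⊞ $0) ≼ $0 ⊞ con 34) (esum-even S 16 (lin 5 {_ , _ , sumOver (S ∩ c y) (deg S) , deg S a , sumOver ((S ∩ c y) ─ a) (deg S) , _} (2 ⊠ con 16 ⊞ con 1 ≼ $0) ($1 ⊞ 2 ⊠ $2 ⊞ con 24 ⊞ 2 ⊠ ($3 ⊞ $4) ⊞ 2 ⊠ con 3 ⊞ 2 ⊠ con 2 ≼ $0 ⊞ $1 ⊞ 2 ⊠ $2 ⊞ 2 ⊠ $3 ⊞ 2 ⊠ $4) (esum-far S y∈ ⊕ edgesT₁-8′ _ (far-bound b y∈) (t y y∈) (far-size 8 y∈ size e refl)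
          ⊕ 2 ⊗ sumOver-─ (S ∩ c y) (deg S) a∈ ⊕ 2 ⊗ three ⊕ 2 ⊗ others)) ⊕ lt)) (deg≥2 a (∩-left a∈))
        where
        others : 2 ≤ sumOver ((S ∩ c y) ─ a) (deg S)
        others = lin 4 {_ , _ , # ((S ∩ c y) ─ a) , # (S ∩ c y) , _} (con 2 ≼ $0) ($1 ⊞ 2 ⊠ $2 ⊞ 2 ⊠ $3 ⊞ 2 ⊠ con 2 ≼ $0 ⊞ $1 ⊞ 2 ⊠ (con 1 ⊞ $2) ⊞ 2 ⊠ $3) (sumOver-mono ((S ∩ c y) ─ a) (λ w h → deg≥2 w (∩-left (─-left h))) ⊕ eq≥ (sumOver-const ((S ∩ c y) ─ a) 2) ⊕ 2 ⊗ eq≤ (#-─ (S ∩ c y) a∈) ⊕ 2 ⊗ eq≥ e)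
      no-degree-2 : ∀ y → y ∈ S → deg S y ≡ 2 → ⊥
      no-degree-2 y y∈ e = from-a (#-pos (S ∩ c y) (lin 1 (con 1 ≼ $0) (con 2 ≼ $0) (eq≥ e)))
        where
        from-a : ∃[ a ] a ∈ S ∩ c y → ⊥
        from-a (a , a∈) = from-a′ (#-pos ((S ∩ c a) ─ y) (lin 2 (con 1 ≼ $0) ($1 ⊞ con 2 ≼ con 1 ⊞ $0 ⊞ $1) (#-─-≤ (S ∩ c a) y ⊕ eq≥ (degree-2 y y∈ e a a∈))))
          where
          from-a′ : ∃[ a′ ] a′ ∈ (S ∩ c a) ─ y → ⊥
          from-a′ (a′ , a′∈) = absurd-≤ 2 {deg S a′ , # (far S y ∩ c a′) , _} (con 3 ⊞ $0 ⊞ $1 ≼ $1 ⊞ con 2 ⊞ $0) (edgesT₁-8 (far S y) (far-bound b y∈) (t y y∈) (far-size 8 y∈ size e refl) a′ far-a′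
              ⊕ eq≤ (degree-2 a (∩-left a∈) (degree-2 y y∈ e a a∈) a′ (─-left a′∈))
              ⊕ #-mono {S = far S y ∩ c a′} {S ∩ c a′} λ w h → ∩-in (far-⊆ {S} (∩-left h)) (∩-right {S = far S y} h))
            where
            far-a′ : a′ ∈ far S y
            far-a′ = far-in {S} (∩-left (─-left a′∈)) (¬true⇒false λ k → c-tri y a a′ (∩-right {S = S} a∈) (∩-right {S = S} (─-left a′∈)) k) (─-right a′∈)
      cubic : ∀ v → v ∈ S → 3 ≤ deg S v
      cubic v v∈ = ≮⇒≥ λ small → no-degree-2 v v∈ (≤-antisym (≤-pred small) (deg≥2 v v∈))

  -- The weights give 800 / 12, which rounds up to 67; parity makes it 68.
  edgesT₃-16 : EdgesT 3 16 68
  edgesT₃-16 S b t size = esum-even S 33 (finish {l = 12} 67 (weighted S 16 12 50 size local) refl)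
    where
    local : ∀ v → v ∈ S → Weighs S 16 12 50 v
    local v v∈ with between 3 5 (degree-≥T sizeT-2 b t size 3 (≤ᵇ-sound refl) v v∈) (deg-bound b v)
    ... | 0 , e , _ = weigh 16 12 50 3 45 e (edgesT₂-12 _ (far-bound b v∈) (t v v∈) (far-size 12 v∈ size e refl)) refl
    ... | 1 , e , _ = weigh 16 12 50 4 34 e (edgesT₂-11 _ (far-bound b v∈) (t v v∈) (far-size 11 v∈ size e refl)) refl
    ... | 2 , e , _ = weigh 16 12 50 5 20 e (edgesT₂-10 _ (far-bound b v∈) (t v v∈) (far-size 10 v∈ size e refl)) refl
    ... | suc (suc (suc _)) , _ , s≤s (s≤s (s≤s (s≤s (s≤s ()))))

  -- The weights 0 and 2, which `weighted` refutes, leave room for degrees 4 and 5. For degree 6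
  -- they ask for degree sum 68 on the 16 far vertices, and this is what the absence of five
  -- remaining vertices would yield.
  five-exists : ∀ S → StableBound S 6 → # S ≡ 23 → ¬ (∀ v → v ∈ S → deg S v ≡ 6 → NoFive 3 (far S v))
  five-exists S b size t = absurd-≤ 1 {esum S , _} (2 ⊠ con 23 ≼ 0 ⊠ $0) (weighted S 23 0 2 size local)
    where
    local : ∀ v → v ∈ S → Weighs S 23 0 2 v
    local v v∈ with between 4 6 (degree-≥ b ramsey₅ size 4 (≤ᵇ-sound refl) v v∈) (deg-bound b v)
    ... | 0 , e , _ = weigh 23 0 2 4 90 e (edges₅-18 _ (far-bound b v∈) (far-size 18 v∈ size e refl)) refl
    ... | 1 , e , _ = weigh 23 0 2 5 76 e (edges₅-17 _ (far-bound b v∈) (far-size 17 v∈ size e refl)) refl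
    ... | 2 , e , _ = weigh 23 0 2 6 68 e (edgesT₃-16 _ (far-bound b v∈) (t v v∈ e) (far-size 16 v∈ size e refl)) refl
    ... | suc (suc (suc _)) , _ , s≤s (s≤s (s≤s (s≤s (s≤s (s≤s ())))))

-- A decision procedure for disjunctive normal forms, branching on a variable of a shortest term

Literal Term′ DNF : Set
Literal = (ℕ × ℕ) × Bool
Term′ = List Literal
DNF = List Term′

module Valuation (ρ : ℕ × ℕ → Bool) where
  True : Literal → Set
  True (x , b) = ρ x ≡ b

  Satisfied : DNF → Set
  Satisfied = Any (All True)

eqᵛ : ℕ × ℕ → ℕ × ℕ → Bool
eqᵛ (i , j) (k , l) = (i ≡ᵇ k) ∧ (j ≡ᵇ l)

eqᵛ-sound : ∀ x y → eqᵛ x y ≡ true → x ≡ y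
eqᵛ-sound (i , j) (k , l) h = cong₂ _,_ (≡ᵇ⇒≡ i k (subst T (sym (∧-fst h)) tt)) (≡ᵇ⇒≡ j l (subst T (sym (∧-snd {i ≡ᵇ k} h)) tt))

-- `nothing` stands for a term that has become false.
restrictTerm : ℕ × ℕ → Bool → Term′ → Maybe Term′
restrictTerm x b [] = just []
restrictTerm x b ((y , d) ∷ t) with restrictTerm x b t
... | nothing = nothing
... | just t′ = if eqᵛ x y then (if b xor d then nothing else just t′) else just ((y , d) ∷ t′)

restrict : ℕ × ℕ → Bool → DNF → DNF
restrict x b [] = []
restrict x b (t ∷ D) with restrictTerm x b t
... | nothing = restrict x b D
... | just t′ = t′ ∷ restrict x b D

shortest : Term′ → DNF → Term′
shortest t [] = t
shortest t (s ∷ D) = if length s <ᵇ length t then shortest s D else shortest t D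

-- The number bounds the depth of branching. An empty term is true already; an empty disjunction is
-- false.
valid? : ℕ → DNF → Bool
branch : ℕ → DNF → Term′ → Bool
valid? k [] = false
valid? k (t ∷ D) = branch k (t ∷ D) (shortest t D)
branch k D [] = true
branch zero D (_ ∷ _) = false
branch (suc k) D ((x , _) ∷ _) = valid? k (restrict x true D) ∧ valid? k (restrict x false D)

module _ (ρ : ℕ × ℕ → Bool) where
  open Valuation ρ

  restrictTerm-sound : ∀ x b t {t′} → ρ x ≡ b → restrictTerm x b t ≡ just t′ → All True t′ → All True t
  restrictTerm-sound x b [] e refl h = []
  restrictTerm-sound x b ((y , d) ∷ t) e q h with restrictTerm x b t in r
  restrictTerm-sound x b ((y , d) ∷ t) e q h | just s with eqᵛ x y in xy
  restrictTerm-sound x b ((y , d) ∷ t) e refl (l ∷ h) | just s | false = l ∷ restrictTerm-sound x b t e r h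
  restrictTerm-sound x b ((y , d) ∷ t) e q h | just s | true with b xor d in bd
  restrictTerm-sound x b ((y , d) ∷ t) e refl h | just s | true | false =
    trans (cong ρ (sym (eqᵛ-sound x y xy))) (trans e (xor-false b d bd)) ∷ restrictTerm-sound x b t e r h
    where
    xor-false : ∀ b d → b xor d ≡ false → b ≡ d
    xor-false true true _ = refl
    xor-false false false _ = refl

  restrict-sound : ∀ x b D → ρ x ≡ b → Satisfied (restrict x b D) → Satisfied D
  restrict-sound x b (t ∷ D) e s with restrictTerm x b t in r
  restrict-sound x b (t ∷ D) e s | nothing = there (restrict-sound x b D e s)
  restrict-sound x b (t ∷ D) e (here h) | just t′ = here (restrictTerm-sound x b t e r h)
  restrict-sound x b (t ∷ D) e (there s) | just t′ = there (restrict-sound x b D e s)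

  shortest-∈ : ∀ t D → shortest t D ≡ [] → Satisfied (t ∷ D)
  shortest-∈ t [] refl = here []
  shortest-∈ t (s ∷ D) e with length s <ᵇ length t
  ... | true = there (shortest-∈ s D e)
  ... | false with shortest-∈ t D e
  ...   | here h = here h
  ...   | there h = there (there h)

  valid-sound : ∀ k D → valid? k D ≡ true → Satisfied D
  branch-sound : ∀ k t D s → shortest t D ≡ s → branch k (t ∷ D) s ≡ true → Satisfied (t ∷ D)
  valid-sound k (t ∷ D) h = branch-sound k t D (shortest t D) refl h
  branch-sound k t D [] e h = shortest-∈ t D e
  branch-sound (suc k) t D ((x , _) ∷ _) e h with ρ x in r
  ... | true = restrict-sound x true (t ∷ D) r (valid-sound k _ (∧-fst h))
  ... | false = restrict-sound x false (t ∷ D) r (valid-sound k _ (∧-snd {valid? k (restrict x true (t ∷ D))} h))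

-- Matching a pentagon with five further vertices

next : Fin 5 → Fin 5
next zero = suc zero
next (suc zero) = suc (suc zero)
next (suc (suc zero)) = suc (suc (suc zero))
next (suc (suc (suc zero))) = suc (suc (suc (suc zero)))
next (suc (suc (suc (suc zero)))) = zero

-- Partners for the vertices of a pentagon: M i j says that j is not available for i.
module Partners (M : Fin 5 → Fin 5 → Bool)
  (adjacent : ∀ i j → M i j ≡ true → M (next i) j ≡ true → ⊥)
  (some : ∀ i → ¬ (∀ j → M i j ≡ true))
  (four : ∀ i j → ¬ (∀ k → k ≢ j → M i k ≡ true × M (next (next i)) k ≡ true)) where

  private
    clip : ℕ → Fin 5
    clip 0 = zero
    clip 1 = suc zero
    clip 2 = suc (suc zero)
    clip 3 = suc (suc (suc zero))
    clip _ = suc (suc (suc (suc zero)))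

    clip-toℕ : ∀ i → clip (toℕ i) ≡ i
    clip-toℕ zero = refl
    clip-toℕ (suc zero) = refl
    clip-toℕ (suc (suc zero)) = refl
    clip-toℕ (suc (suc (suc zero))) = refl
    clip-toℕ (suc (suc (suc (suc zero)))) = refl

    ρ : ℕ × ℕ → Bool
    ρ (i , j) = M (clip i) (clip j)

    open Valuation ρ

    literal : Fin 5 → Fin 5 → Bool → Literal
    literal i j b = (toℕ i , toℕ j) , b

    true-literal : ∀ {i j b} → True (literal i j b) → M i j ≡ b
    true-literal {i} {j} h = trans (sym (cong₂ M (clip-toℕ i) (clip-toℕ j))) h

    five : List (Fin 5)
    five = allFin 5

    insertions : Fin 5 → List (Fin 5) → List (List (Fin 5))
    insertions x [] = (x ∷ []) ∷ []
    insertions x (y ∷ ys) = (x ∷ y ∷ ys) ∷ map (y ∷_) (insertions x ys)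

    permutations : List (Fin 5) → List (List (Fin 5))
    permutations [] = [] ∷ []
    permutations (x ∷ xs) = concatMap (insertions x) (permutations xs)

    entry : List (Fin 5) → Fin 5 → Fin 5
    entry [] i = i
    entry (x ∷ xs) zero = x
    entry (x ∷ xs) (suc i) = entry xs (inject₁ i)

    Injective′ : List (Fin 5) → Set
    Injective′ p = ∀ i j → entry p i ≡ entry p j → i ≡ j

    all-injective : All Injective′ (permutations five)
    all-injective = toWitness {a? = all?ᴸ (λ p → all? λ i → all? λ j → (entry p i ≟ᶠ entry p j) →-dec (i ≟ᶠ j)) (permutations five)} tt

    matchingTerm : List (Fin 5) → Term′
    matchingTerm p = map (λ i → literal i (entry p i) false) five

    adjacentTerm : Fin 5 × Fin 5 → Term′
    adjacentTerm (i , j) = literal i j true ∷ literal (next i) j true ∷ []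

    someTerm : Fin 5 → Term′
    someTerm i = map (λ j → literal i j true) five

    others : Fin 5 → List (Fin 5)
    others j = filter (λ k → ¬? (k ≟ᶠ j)) five

    fourTerm : Fin 5 × Fin 5 → Term′
    fourTerm (i , j) = concatMap (λ k → literal i k true ∷ literal (next (next i)) k true ∷ []) (others j)

    pairs : List (Fin 5 × Fin 5)
    pairs = cartesianProduct five five

    -- A statement about all Boolean 5 × 5 matrices: some permutation avoids `M`, or one of the
    -- three hypotheses of the module is violated. The 25 entries are the variables, hence the depth
    -- 25.
    hall : Satisfied (map matchingTerm (permutations five) ++ map adjacentTerm pairs ++ map someTerm five ++ map fourTerm pairs)
    hall = valid-sound ρ 25 _ refl

    decode : ∀ {X : Set} (f : X → Term′) xs → Satisfied (map f xs) → ∃[ x ] (x ∈ᴸ xs × All True (f x))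
    decode f (x ∷ xs) (here h) = x , here refl , h
    decode f (x ∷ xs) (there h) with decode f xs h
    ... | y , y∈ , k = y , there y∈ , k

    lookup-map : ∀ {X : Set} (f : X → Literal) xs → All True (map f xs) → ∀ {x} → x ∈ᴸ xs → True (f x)
    lookup-map f (x ∷ xs) (h ∷ hs) (here refl) = h
    lookup-map f (x ∷ xs) (h ∷ hs) (there x∈) = lookup-map f xs hs x∈

    lookup-concatMap : ∀ {X : Set} (f : X → Term′) xs → All True (concatMap f xs) → ∀ {x} → x ∈ᴸ xs → All True (f x)
    lookup-concatMap f (x ∷ xs) h (here refl) = Allₚ.++⁻ˡ (f x) h
    lookup-concatMap f (x ∷ xs) h (there x∈) = lookup-concatMap f xs (Allₚ.++⁻ʳ (f x) h) x∈

    either : ∀ (A : DNF) {B} → Satisfied (A ++ B) → Satisfied A ⊎ Satisfied B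
    either A = Anyₚ.++⁻ A

    from-matching : ∃[ p ] (p ∈ᴸ permutations five × All True (matchingTerm p)) → Σ (Fin 5 → Fin 5) λ σ → (∀ {i j} → σ i ≡ σ j → i ≡ j) × (∀ i → M i (σ i) ≡ false)
    from-matching (p , p∈ , holds) = entry p , (λ {i} {j} → Allₚ.lookup all-injective p∈ i j) ,
      λ i → true-literal {i} (lookup-map (λ i → literal i (entry p i) false) five holds (∈-allFin i))

    not-adjacent : ∃[ x ] (x ∈ᴸ pairs × All True (adjacentTerm x)) → ⊥
    not-adjacent ((i , j) , _ , (a ∷ b ∷ [])) = adjacent i j (true-literal {i} a) (true-literal {next i} b)

    not-some : ∃[ x ] (x ∈ᴸ five × All True (someTerm x)) → ⊥
    not-some (i , _ , holds) = some i λ j → true-literal {i} (lookup-map (λ j → literal i j true) five holds (∈-allFin j))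

    not-four : ∃[ x ] (x ∈ᴸ pairs × All True (fourTerm x)) → ⊥
    not-four ((i , j) , _ , holds) = four i j λ k k≢j →
      both k (lookup-concatMap two (others j) holds (∈-filter⁺ (λ k → ¬? (k ≟ᶠ j)) (∈-allFin k) k≢j))
      where
      two : Fin 5 → Term′
      two k = literal i k true ∷ literal (next (next i)) k true ∷ []
      both : ∀ k → All True (two k) → M i k ≡ true × M (next (next i)) k ≡ true
      both k (a ∷ b ∷ []) = true-literal {i} a , true-literal {next (next i)} b

  partners : Σ (Fin 5 → Fin 5) λ σ → (∀ {i j} → σ i ≡ σ j → i ≡ j) × (∀ i → M i (σ i) ≡ false)
  partners = case either (map matchingTerm (permutations five)) hall of λ where
    (inj₁ h) → from-matching (decode matchingTerm (permutations five) h)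
    (inj₂ h) → case either (map adjacentTerm pairs) h of λ where
      (inj₁ k) → ⊥-elim (not-adjacent (decode adjacentTerm pairs k))
      (inj₂ k) → case either (map someTerm five) k of λ where
        (inj₁ l) → ⊥-elim (not-some (decode someTerm five l))
        (inj₂ l) → ⊥-elim (not-four (decode fourTerm pairs l))

-- Coherent sets split by outside vertices

module Splitting {n} (𝒞 : TriangleFree n) where
  open TriangleFree 𝒞
  open Gulls 𝒞

  coherent-from : ∀ {Z} x → (∀ {a b} → a ∈ Z → b ∈ Z → g x a b ≡ false) → Coherent Z
  coherent-from x h ha hb hd = even {x} (h ha hb) (h ha hd) (h hb hd)

  insert-coherent : ∀ {Z m} → (∀ {a b} → a ∈ Z → b ∈ Z → g m a b ≡ false) → Coherent (⁅ m ⁆ ∪ Z)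
  insert-coherent {Z} {m} h = coherent-from m λ ha hb → go (∪-out {S = ⁅ m ⁆} ha) (∪-out {S = ⁅ m ⁆} hb)
    where
    go : ∀ {a b} → a ∈ ⁅ m ⁆ ⊎ a ∈ Z → b ∈ ⁅ m ⁆ ⊎ b ∈ Z → g m a b ≡ false
    go {a} {b} (inj₁ e) _ rewrite sym (eqᵇ-true {i = m} {a} e) = g-irr m b
    go {a} {b} _ (inj₁ e) rewrite sym (eqᵇ-true {i = m} {b} e) = trans (g-swap₂ m a m) (g-irr m a)
    go (inj₂ ha) (inj₂ hb) = h ha hb

  private
    beside : ∀ {x y t} → c x y ≡ true → g x y t ≡ true → c x t ≡ false
    beside {x} {y} {t} e h = ¬true⇒false λ k → c-tri x y t e (solve′ _ _ _ e k h) k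
      where
      solve′ : ∀ a b d → a ≡ true → b ≡ true → a xor (b xor d) ≡ true → d ≡ true
      solve′ true true true _ _ _ = refl

    opposite : ∀ {x y t k} → c x y ≡ true → g x y t ≡ true → g x y k ≡ true → g x t k ≡ true → c t k ≡ true
    opposite e h h′ h″ = solve′ _ _ _ (beside e h) (beside e h′) h″
      where
      solve′ : ∀ a b d → a ≡ false → b ≡ false → a xor (b xor d) ≡ true → d ≡ true
      solve′ false false true _ _ _ = refl

  -- m and m′ split the coherent set Z, but not in disjoint pairs: then both of them isolate the same o.
  module Isolation {Z} (coh : Coherent Z) (six : 6 ≤ # Z) {m m′}
    (disjoint : ∀ {a d a′ d′} → a ∈ Z → d ∈ Z → a′ ∈ Z → d′ ∈ Z → a ≢ a′ → a ≢ d′ → d ≢ a′ → d ≢ d′ → g m a d ≡ true → g m′ a′ d′ ≡ true → ⊥) where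

    private
      avoid : ∀ a b d e → ∃[ z ] (z ∈ Z × a ≢ z × b ≢ z × d ≢ z × e ≢ z)
      avoid a b d e = pack (#-pos (Z ─ a ─ b ─ d ─ e) (lin 5 (con 1 ≼ $0) (con 6 ⊞ $1 ⊞ $2 ⊞ $3 ⊞ $4 ≼ $1 ⊞ (con 1 ⊞ $2) ⊞ (con 1 ⊞ $3) ⊞ (con 1 ⊞ $4) ⊞ (con 1 ⊞ $0)) (six ⊕ #-─-≤ Z a ⊕ #-─-≤ (Z ─ a) b ⊕ #-─-≤ (Z ─ a ─ b) d ⊕ #-─-≤ (Z ─ a ─ b ─ d) e)))
        where
        pack : ∃[ z ] z ∈ Z ─ a ─ b ─ d ─ e → ∃[ z ] (z ∈ Z × a ≢ z × b ≢ z × d ≢ z × e ≢ z)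
        pack (z , h) = z , ─-left (─-left (─-left (─-left h))) , ─-right (─-left (─-left (─-left h))) , ─-right (─-left (─-left h)) , ─-right (─-left h) , ─-right h

      -- Any vertex `x` splits a coherent set into two classes, `a` and `b` being separated when
      -- `g x a b` is true. This identity says that there are at most two classes.
      via : ∀ x {a b d} → a ∈ Z → b ∈ Z → d ∈ Z → g x a b ≡ g x a d xor g x b d
      via x {a} {b} {d} ha hb hd = solve′ (g x a b) (g x a d) (g x b d) (g a b d) (cocycle x a b d) (coh ha hb hd)
        where
        solve′ : ∀ p q r s → p xor (q xor (r xor s)) ≡ false → s ≡ false → p ≡ q xor r
        solve′ true true false false _ _ = refl
        solve′ true false true false _ _ = refl
        solve′ false true true false _ _ = refl
        solve′ false false false false _ _ = refl

      via₁ : ∀ x {a b d} → a ∈ Z → b ∈ Z → d ∈ Z → g x a d ≡ true → g x b d ≡ false → g x a b ≡ true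
      via₁ x ha hb hd h k = trans (via x ha hb hd) (cong₂ _xor_ h k)

      via₀ : ∀ x {a b d} → a ∈ Z → b ∈ Z → d ∈ Z → g x a d ≡ false → g x b d ≡ false → g x a b ≡ false
      via₀ x ha hb hd h k = trans (via x ha hb hd) (cong₂ _xor_ h k)

    Isolated : Fin n → Set
    Isolated o = o ∈ Z × (∀ {z} → z ∈ Z → o ≢ z → g m o z ≡ true × g m′ o z ≡ true)
      × (∀ {y z} → y ∈ Z → z ∈ Z → o ≢ y → o ≢ z → g m y z ≡ false × g m′ y z ≡ false)

    private
      -- Outside `o` and `o₂` nothing is separated by `m′`, so `m′` separates `o` from every spare
      -- vertex `f`. The pair of `o` and `f` is disjoint from any pair avoiding both, so `m`
      -- separates no pair without `o`. Hence `m` isolates `o`, and the same argument with `m` and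
      -- `m′` interchanged shows it for `m′`.
      isolate : ∀ {o o₂ e} → o ∈ Z → o₂ ∈ Z → e ∈ Z → o ≢ e → o₂ ≢ e → g m o o₂ ≡ true → g m′ o e ≡ true → Isolated o
      isolate {o} {o₂} {e} ho ho₂ he o≢e o₂≢e h h′ = ho , (λ hz ne → o-m hz ne , o-m′ hz ne) , λ hy hz ny nz → const-m hy hz ny nz , const-m′ hy hz ny nz
        where
        far-m′ : ∀ {y z} → y ∈ Z → z ∈ Z → o ≢ y → o ≢ z → o₂ ≢ y → o₂ ≢ z → g m′ y z ≡ false
        far-m′ hy hz a b d e = ¬true⇒false λ k → disjoint ho ho₂ hy hz a b d e h k
        const-m : ∀ {y z} → y ∈ Z → z ∈ Z → o ≢ y → o ≢ z → g m y z ≡ false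
        const-m {y} {z} hy hz ny nz with avoid o o₂ y z
        ... | f , hf , nf , n₂f , nyf , nzf = ¬true⇒false λ k → disjoint hy hz ho hf (ny ∘ sym) nyf (nz ∘ sym) nzf k
              (via₁ m′ ho hf he h′ (far-m′ hf he nf o≢e n₂f o₂≢e))
        o-m : ∀ {z} → z ∈ Z → o ≢ z → g m o z ≡ true
        o-m hz nz = via₁ m ho hz ho₂ h (const-m hz ho₂ nz (gull-≢₂₃ h))
        const-m′ : ∀ {y z} → y ∈ Z → z ∈ Z → o ≢ y → o ≢ z → g m′ y z ≡ false
        const-m′ {y} {z} hy hz ny nz with avoid o o₂ y z
        ... | f , hf , nf , _ , nyf , nzf = ¬true⇒false λ k → disjoint ho hf hy hz ny nz (nyf ∘ sym) (nzf ∘ sym) (o-m hf nf) k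
        o-m′ : ∀ {z} → z ∈ Z → o ≢ z → g m′ o z ≡ true
        o-m′ hz nz = via₁ m′ ho hz he h′ (const-m′ hz he nz o≢e)

    -- Let `m` separate `a` and `d`, and let `e` be a third vertex. Either `m′` separates `e` from
    -- `a` or from `d`, and that vertex is isolated, or `m′` separates `e` from nothing and so does
    -- not split `Z`.
    isolated : ∀ {a d x y} → a ∈ Z → d ∈ Z → g m a d ≡ true → x ∈ Z → y ∈ Z → g m′ x y ≡ true → ∃[ o ] Isolated o
    isolated {a} {d} {x} {y} ha hd h hx hy h′ = go (avoid a d a d)
      where
      go : ∃[ e ] (e ∈ Z × a ≢ e × d ≢ e × a ≢ e × d ≢ e) → ∃[ o ] Isolated o
      go (e , he , a≢e , d≢e , _) = by (true-or-false (g m′ a e)) (true-or-false (g m′ d e))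
        where
        by : g m′ a e ≡ true ⊎ g m′ a e ≡ false → g m′ d e ≡ true ⊎ g m′ d e ≡ false → ∃[ o ] Isolated o
        by (inj₁ k) _ = a , isolate ha hd he a≢e d≢e h k
        by _ (inj₁ k) = d , isolate hd ha he d≢e a≢e (trans (g-swap₂ _ _ _) h) k
        by (inj₂ k) (inj₂ l) = clash h′ (via₀ m′ hx hy he (all hx) (all hy))
          where
          all : ∀ {z} → z ∈ Z → g m′ z e ≡ false
          all {z} hz with a ≟ᶠ z | d ≟ᶠ z
          ... | yes refl | _ = k
          ... | _ | yes refl = l
          ... | no a≢z | no d≢z = ¬true⇒false (disjoint ha hd hz he a≢z a≢e d≢z d≢e h)

    -- m, m′, o and any other vertex of Z span a perfect matching, so the one of m, m′, o beside the edge spanned by them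
    -- is adjacent to the rest of Z
    spoke : ∀ {o} → Isolated o → ∀ {k} → k ∈ Z ─ o → g m m′ k ≡ true →
      ∃[ t ] ((t ≡ m ⊎ t ≡ m′ ⊎ t ≡ o) × (∀ {z} → z ∈ Z ─ o → c t z ≡ true))
    spoke {o} (ho , out , in′) {k} hk h = by (true-or-false (c m m′)) (true-or-false (c m o)) (true-or-false (c m′ o))
      where
      mm′ : ∀ {z} → z ∈ Z ─ o → g m m′ z ≡ true
      mm′ {z} hz = solve′ _ _ _ _ (cocycle m m′ z k) h (in′ (─-left hz) (─-left hk) (─-right hz) (─-right hk))
        where
        solve′ : ∀ p q r s → p xor (q xor (r xor s)) ≡ false → q ≡ true → r ≡ false × s ≡ false → p ≡ true
        solve′ true true false false _ _ _ = refl
      mo : ∀ {z} → z ∈ Z ─ o → g m o z ≡ true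
      mo hz = proj₁ (out (─-left hz) (─-right hz))
      m′o : ∀ {z} → z ∈ Z ─ o → g m′ o z ≡ true
      m′o hz = proj₂ (out (─-left hz) (─-right hz))
      mm′o : g m m′ o ≡ true
      mm′o = solve′ _ _ _ _ (cocycle m m′ o k) h (mo hk) (m′o hk)
        where
        solve′ : ∀ p q r s → p xor (q xor (r xor s)) ≡ false → q ≡ true → r ≡ true → s ≡ true → p ≡ true
        solve′ true true true true _ _ _ _ = refl
      by : c m m′ ≡ true ⊎ c m m′ ≡ false → c m o ≡ true ⊎ c m o ≡ false → c m′ o ≡ true ⊎ c m′ o ≡ false →
        ∃[ t ] ((t ≡ m ⊎ t ≡ m′ ⊎ t ≡ o) × (∀ {z} → z ∈ Z ─ o → c t z ≡ true))
      by (inj₁ e) _ _ = o , inj₂ (inj₂ refl) , λ hz → opposite e mm′o (mm′ hz) (mo hz)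
      by _ (inj₁ e) _ = m′ , inj₂ (inj₁ refl) , λ hz → opposite e (trans (g-swap₂ _ _ _) mm′o) (mo hz) (mm′ hz)
      by _ _ (inj₁ e) = m , inj₁ refl , λ hz → opposite e (trans (sym (g-rot _ _ _)) mm′o) (m′o hz) (trans (g-swap₁ _ _ _) (mm′ hz))
      by (inj₂ a) (inj₂ b) (inj₂ d) = clash mm′o (cong₂ _xor_ a (cong₂ _xor_ b d))

  two-gulls : ∀ {D} (s t : Fin 3 → Fin n) → (∀ a → s a ∈ D) → (∀ a → t a ∈ D) → gull s ≡ true → gull t ≡ true → (∀ a b → s a ≢ t b) → Packing D 2
  two-gulls {D} s t s∈ t∈ hs ht ne = extend one (out 0F) (out 1F) (out 2F) ht
    where
    one : Packing D 1
    one = extend empty (s∈ 0F , λ ()) (s∈ 1F , λ ()) (s∈ 2F , λ ()) hs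
    out : ∀ b → Packing.Out one (t b)
    out b = t∈ b , λ { zero 0F → ne 0F b ; zero 1F → ne 1F b ; zero 2F → ne 2F b }

  lift-packing : ∀ {D D′ r} → D ⊆ D′ → Packing D r → Packing D′ r
  lift-packing h P = record { p = p P ; p∈ = λ i a → h _ (p∈ P i a) ; gulls = gulls P ; p-injective = p-injective P }
    where open Packing

-- 23 vertices without a stable set of size 7 in the complement

fin5 : ∀ (i j : Fin 5) → i ≡ j ⊎ j ≡ next i ⊎ j ≡ next (next i) ⊎ i ≡ next j ⊎ i ≡ next (next j)
fin5 = toWitness {a? = all? λ i → all? λ j → (i ≟ᶠ j) ⊎-dec ((j ≟ᶠ next i) ⊎-dec ((j ≟ᶠ next (next i)) ⊎-dec ((i ≟ᶠ next j) ⊎-dec (i ≟ᶠ next (next j)))))} tt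

next⁴ : ∀ i → next (next (next (next (next i)))) ≡ i
next⁴ = toWitness {a? = all? λ i → next (next (next (next (next i)))) ≟ᶠ i} tt

module TwentyThree {n} (𝒞 : TriangleFree n) where
  open TriangleFree 𝒞
  open Gulls 𝒞
  open Families 𝒞
  open Seagulls 𝒞
  open Ramsey 𝒞
  open Counting 𝒞
  open Splitting 𝒞

  private
    flip : ∀ {u v b} → c u v ≡ b → c v u ≡ b
    flip {u} {v} h = trans (c-sym v u) h

  clique : ∀ {T p q} → StableBound T 1 → p ∈ T → q ∈ T → p ≢ q → c p q ≡ true
  clique {T} {p} {q} b p∈ q∈ ne = ¬false⇒true λ e → absurd-≤ 2 ($0 ⊞ (con 1 ⊞ $1) ⊞ con 1 ≼ con 1 ⊞ $0 ⊞ $1) (b (⁅ p ⁆ ∪ ⁅ q ⁆) (insert-⊆ p∈ λ w h → subst (_∈ T) (eqᵇ-true {i = q} h) q∈)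
      (insert-stable {p} {⁅ q ⁆} (singleton-stable q) (λ h → subst (λ w → c p w ≡ false) (eqᵇ-true {i = q} h) e))
    ⊕ insert-size {p} {⁅ q ⁆} (λ h e → ne (trans e (sym (eqᵇ-true {i = q} h)))) ⊕ eq≥ (#-⁅⁆ q))

  Pentagon₅ : Sub n → Set
  Pentagon₅ U = Σ (Fin 5 → Fin n) λ u → (∀ i → u i ∈ U) × (∀ i → c (u i) (u (next i)) ≡ true) × (∀ {i j} → u i ≡ u j → i ≡ j)

  -- All degrees are at least two, and the far set of `o` is a clique. Continuing from the two
  -- neighbours of `o` one reaches far vertices `p` and `q`. They are different, since otherwise `p`
  -- would have a third neighbour in the far set; so they are adjacent and close the pentagon.
  pentagon₅ : ∀ U → StableBound U 2 → 5 ≤ # U → Pentagon₅ U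
  pentagon₅ U b five = start (#-pos U (lin 1 (con 1 ≼ $0) (con 5 ≼ $0) five))
    where
    deg≥2 : ∀ v → v ∈ U → 2 ≤ deg U v
    deg≥2 v v∈ = lin 3 {deg U v , # U , # (far U v) , _} (con 2 ≼ $0) (con 5 ⊞ $1 ⊞ $2 ≼ $1 ⊞ ($0 ⊞ (con 1 ⊞ $2)) ⊞ con 2) (five ⊕ eq≤ (#-far U v∈) ⊕ ramsey₁ (far U v) (far-bound b v∈))
    other : ∀ {v} → v ∈ U → ∀ x → ∃[ y ] y ∈ (U ∩ c v) ─ x
    other {v} v∈ x = #-pos ((U ∩ c v) ─ x) (lin 2 (con 1 ≼ $0) (con 2 ⊞ $1 ≼ $1 ⊞ (con 1 ⊞ $0)) (deg≥2 v v∈ ⊕ #-─-≤ (U ∩ c v) x))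
    start : ∃[ o ] o ∈ U → Pentagon₅ U
    start (o , o∈) = neighbours (elements (U ∩ c o) 2 (deg≥2 o o∈))
      where
      F : Sub n
      F = far U o
      clique-far : ∀ {p q} → p ∈ F → q ∈ F → p ≢ q → c p q ≡ true
      clique-far = clique (far-bound b o∈)
      neighbours : (Σ (Fin 2 → Fin n) λ f → (∀ i → f i ∈ U ∩ c o) × (∀ {i j} → f i ≡ f j → i ≡ j)) → Pentagon₅ U
      neighbours (f , f∈ , inj) = close (f zero) (f (suc zero)) (f∈ zero) (f∈ (suc zero)) (λ e → case inj e of λ ())
        where
        close : ∀ a b′ → a ∈ U ∩ c o → b′ ∈ U ∩ c o → a ≢ b′ → Pentagon₅ U
        close a b′ a∈ b∈ a≢b = finish₅ (other (∩-left a∈) o) (other (∩-left b∈) o)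
          where
          oa : c o a ≡ true
          oa = ∩-right {S = U} a∈
          ob : c o b′ ≡ true
          ob = ∩-right {S = U} b∈
          beyond : ∀ {x y} → c o x ≡ true → y ∈ (U ∩ c x) ─ o → y ∈ F
          beyond {x} {y} ox h = far-in {U} (∩-left (─-left h)) (¬true⇒false λ k → c-tri o x y ox (∩-right {S = U} (─-left h)) k) (─-right h)
          finish₅ : ∃[ p ] p ∈ (U ∩ c a) ─ o → ∃[ q ] q ∈ (U ∩ c b′) ─ o → Pentagon₅ U
          finish₅ (p , p∈) (q , q∈) = u , u∈ , edge , injective
            where
            ap : c a p ≡ true
            ap = ∩-right {S = U} (─-left p∈)
            bq : c b′ q ≡ true
            bq = ∩-right {S = U} (─-left q∈)
            pF : p ∈ F
            pF = beyond oa p∈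
            qF : q ∈ F
            qF = beyond ob q∈
            p≢q : p ≢ q
            p≢q e = third (#-pos (F ─ p) (lin 4 {# (F ─ p) , # U , deg U o , # F , _} (con 1 ≼ $0) (con 5 ⊞ $1 ⊞ $2 ⊞ $3 ≼ $1 ⊞ ($2 ⊞ (con 1 ⊞ $3)) ⊞ con 2 ⊞ (con 1 ⊞ $0)) (five ⊕ eq≤ (#-far U o∈) ⊕ deg-bound b o ⊕ #-─-≤ F p)))
              where
              third : ∃[ r ] r ∈ F ─ p → ⊥
              third (r , r∈) = absurd-≤ 4 ($0 ⊞ (con 1 ⊞ $1) ⊞ (con 1 ⊞ $2) ⊞ (con 1 ⊞ $3) ≼ con 2 ⊞ $0 ⊞ $1 ⊞ $2) (deg-bound b p ⊕ eq≥ (#-─ (U ∩ c p) {a} (∩-in (∩-left a∈) (flip ap)))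
                  ⊕ eq≥ (#-─ ((U ∩ c p) ─ a) {b′} (─-in (∩-in (∩-left b∈) (flip (subst (λ x → c b′ x ≡ true) (sym e) bq))) a≢b))
                  ⊕ eq≥ (#-─ ((U ∩ c p) ─ a ─ b′) {r} (─-in (─-in (∩-in (far-⊆ {U} (─-left r∈)) (clique-far pF (─-left r∈) (─-right r∈))) (apart oa)) (apart ob))))
                where
                apart : ∀ {x} → c o x ≡ true → x ≢ r
                apart h refl = clash h (far-c {U} (─-left r∈))
            u : Fin 5 → Fin n
            u zero = o
            u (suc zero) = a
            u (suc (suc zero)) = p
            u (suc (suc (suc zero))) = q
            u (suc (suc (suc (suc zero)))) = b′
            u∈ : ∀ i → u i ∈ U
            u∈ zero = o∈
            u∈ (suc zero) = ∩-left a∈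
            u∈ (suc (suc zero)) = far-⊆ {U} pF
            u∈ (suc (suc (suc zero))) = far-⊆ {U} qF
            u∈ (suc (suc (suc (suc zero)))) = ∩-left b∈
            edge : ∀ i → c (u i) (u (next i)) ≡ true
            edge zero = oa
            edge (suc zero) = ap
            edge (suc (suc zero)) = clique-far pF qF p≢q
            edge (suc (suc (suc zero))) = flip bq
            edge (suc (suc (suc (suc zero)))) = flip ob
            by-o : ∀ {x y} → c o x ≡ true → y ∈ F → x ≢ y
            by-o h k refl = clash h (far-c {U} k)
            skip : ∀ i → u i ≢ u (next (next i))
            skip zero = far-≢ {U} pF
            skip (suc zero) = by-o oa qF
            skip (suc (suc zero)) = by-o ob pF ∘ sym
            skip (suc (suc (suc zero))) = far-≢ {U} qF ∘ sym
            skip (suc (suc (suc (suc zero)))) = a≢b ∘ sym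
            step : ∀ i → u i ≢ u (next i)
            step i e = clash (edge i) (trans (cong (c (u i)) (sym e)) (c-irr (u i)))
            injective : ∀ {i j} → u i ≡ u j → i ≡ j
            injective {i} {j} e with fin5 i j
            ... | inj₁ h = h
            ... | inj₂ (inj₁ refl) = ⊥-elim (step i e)
            ... | inj₂ (inj₂ (inj₁ refl)) = ⊥-elim (skip i e)
            ... | inj₂ (inj₂ (inj₂ (inj₁ refl))) = ⊥-elim (step j (sym e))
            ... | inj₂ (inj₂ (inj₂ (inj₂ refl))) = ⊥-elim (skip j (sym e))

  NoFive-stable : ∀ j S → ¬¬ NoFive j S → NoFive j S
  NoFive-stable zero S h with # S ≤? 4
  ... | yes p = p
  ... | no ¬p = ⊥-elim (h ¬p)
  NoFive-stable (suc j) S h v v∈ = NoFive-stable j (far S v) λ k → h λ t → k (t v v∈)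

  some-five : ∀ {j S} → ¬ NoFive (suc j) S → ¬¬ (∃[ v ] (v ∈ S × ¬ NoFive j (far S v)))
  some-five {j} {S} h k = h λ v v∈ → NoFive-stable j (far S v) λ t → k (v , v∈ , t)

  -- v₁, …, v₄ are stable, U is a pentagon far from them and P consists of the neighbours of v₁.
  module Configuration {S} (b : StableBound S 6) (size : # S ≡ 23)
    {v₁ v₂ v₃ v₄} (v₁∈ : v₁ ∈ S) (six : deg S v₁ ≡ 6) (v₂∈ : v₂ ∈ far S v₁) (v₃∈ : v₃ ∈ far (far S v₁) v₂) (v₄∈ : v₄ ∈ far (far (far S v₁) v₂) v₃)
    (five : 5 ≤ # (far (far (far (far S v₁) v₂) v₃) v₄)) where

    S₁ S₂ S₃ U : Sub n
    S₁ = far S v₁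
    S₂ = far S₁ v₂
    S₃ = far S₂ v₃
    U = far S₃ v₄

    boundU : StableBound U 2
    boundU = far-bound (far-bound (far-bound (far-bound b v₁∈) v₂∈) v₃∈) v₄∈

    v : Fin 4 → Fin n
    v zero = v₁
    v (suc zero) = v₂
    v (suc (suc zero)) = v₃
    v (suc (suc (suc zero))) = v₄

    v∈ : ∀ i → v i ∈ S
    v∈ zero = v₁∈
    v∈ (suc zero) = far-⊆ {S} v₂∈
    v∈ (suc (suc zero)) = far-⊆ {S} (far-⊆ {S₁} v₃∈)
    v∈ (suc (suc (suc zero))) = far-⊆ {S} (far-⊆ {S₁} (far-⊆ {S₂} v₄∈))

    U-S₁ : ∀ {x} → x ∈ U → x ∈ S₁
    U-S₁ h = far-⊆ {S₁} (far-⊆ {S₂} (far-⊆ {S₃} h))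

    U⊆S : ∀ {x} → x ∈ U → x ∈ S
    U⊆S h = far-⊆ {S} (U-S₁ h)

    Far : Fin n → Fin n → Set
    Far x y = c x y ≡ false × x ≢ y

    far-pair : ∀ {T x y} → y ∈ far T x → Far x y
    far-pair {T} h = far-c {T} h , far-≢ {T} h

    Far-sym : ∀ {x y} → Far x y → Far y x
    Far-sym (h , k) = flip h , k ∘ sym

    v-U : ∀ i {x} → x ∈ U → Far (v i) x
    v-U zero h = far-pair {S} (U-S₁ h)
    v-U (suc zero) h = far-pair {S₁} (far-⊆ {S₂} (far-⊆ {S₃} h))
    v-U (suc (suc zero)) h = far-pair {S₂} (far-⊆ {S₃} h)
    v-U (suc (suc (suc zero))) h = far-pair {S₃} h

    v-v : ∀ i j → i <ᶠ j → Far (v i) (v j)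
    v-v zero (suc zero) _ = far-pair {S} v₂∈
    v-v zero (suc (suc zero)) _ = far-pair {S} (far-⊆ {S₁} v₃∈)
    v-v zero (suc (suc (suc zero))) _ = far-pair {S} (far-⊆ {S₁} (far-⊆ {S₂} v₄∈))
    v-v (suc zero) (suc (suc zero)) _ = far-pair {S₁} v₃∈
    v-v (suc zero) (suc (suc (suc zero))) _ = far-pair {S₁} (far-⊆ {S₂} v₄∈)
    v-v (suc (suc zero)) (suc (suc (suc zero))) _ = far-pair {S₂} v₄∈
    v-v zero zero ()
    v-v (suc zero) (suc zero) (s≤s ())
    v-v (suc (suc zero)) (suc zero) (s≤s ())
    v-v (suc (suc (suc zero))) (suc zero) (s≤s ())
    v-v (suc (suc zero)) (suc (suc zero)) (s≤s (s≤s ()))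
    v-v (suc (suc (suc zero))) (suc (suc zero)) (s≤s (s≤s ()))
    v-v (suc (suc (suc zero))) (suc (suc (suc zero))) (s≤s (s≤s (s≤s ())))

    v-far : ∀ i j → i ≢ j → Far (v i) (v j)
    v-far i j ne with <-cmpᶠ i j
    ... | tri< lt _ _ = v-v i j lt
    ... | tri≈ _ e _ = ⊥-elim (ne e)
    ... | tri> _ _ gt = Far-sym (v-v j i gt)

    v-injective : ∀ {i j} → v i ≡ v j → i ≡ j
    v-injective {i} {j} e with i ≟ᶠ j
    ... | yes h = h
    ... | no ne = ⊥-elim (proj₂ (v-far i j ne) e)

    I : Sub n
    I = image v

    I-stable : Stable I
    I-stable hx hy with image-out v hx | image-out v hy
    ... | i , refl | j , refl with i ≟ᶠ j
    ...   | yes refl = c-irr (v i)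
    ...   | no ne = proj₁ (v-far i j ne)

    opaque
      pentagon-U : Pentagon₅ U
      pentagon-U = pentagon₅ U boundU five

    u : Fin 5 → Fin n
    u = proj₁ pentagon-U

    u∈ : ∀ i → u i ∈ U
    u∈ = proj₁ (proj₂ pentagon-U)

    u-edge : ∀ i → c (u i) (u (next i)) ≡ true
    u-edge = proj₁ (proj₂ (proj₂ pentagon-U))

    u-injective : ∀ {i j} → u i ≡ u j → i ≡ j
    u-injective = proj₂ (proj₂ (proj₂ pentagon-U))

    u-skip : ∀ i → c (u i) (u (next (next i))) ≡ false
    u-skip i = ¬true⇒false λ h → c-tri _ _ _ (u-edge i) (u-edge (next i)) h

    opaque
      W : Sub n
      W = (S ∖ I) ∖ U

      W⊆S : ∀ {x} → x ∈ W → x ∈ S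
      W⊆S h = ∖-left (∖-left h)

      W∉I : ∀ {x} → x ∈ W → x ∉ I
      W∉I h = ∖-right {S = S} (∖-left h)

      W∉U : ∀ {x} → x ∈ W → x ∉ U
      W∉U h = ∖-right {S = S ∖ I} h

      W-in : ∀ {x} → x ∈ S → x ∉ I → x ∉ U → x ∈ W
      W-in h k l = ∖-in (∖-in h k) l

      #-W : 14 ≤ # W
      #-W = lin 7 {# W , # S , # (S ∖ I) , # (image v) , # U , # (S ∩ I) , # ((S ∖ I) ∩ U) , _} (con 14 ≼ $0) (con 23 ⊞ $1 ⊞ $2 ⊞ $3 ⊞ $4 ⊞ $5 ⊞ $6 ≼ $1 ⊞ ($5 ⊞ $2) ⊞ ($6 ⊞ $0) ⊞ con 4 ⊞ con 5 ⊞ $3 ⊞ $4) (eq≥ size ⊕ eq≤ (#-split S I) ⊕ eq≤ (#-split (S ∖ I) U) ⊕ #-image-≤ v ⊕ ramsey₂ U boundU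
        ⊕ #-mono {S = S ∩ I} {I} (λ _ → ∩-right {S = S}) ⊕ #-mono {S = (S ∖ I) ∩ U} {U} (λ _ → ∩-right {S = S ∖ I}))

    W≢v : ∀ {x} → x ∈ W → ∀ i → v i ≢ x
    W≢v h i = image-∉ v (W∉I h) i

    W≢u : ∀ {x} → x ∈ W → ∀ i → u i ≢ x
    W≢u h i refl = clash (u∈ i) (W∉U h)

    W-touches : ∀ {x} → x ∈ W → ∃[ i ] c (v i) x ≡ true
    W-touches {x} h with true-or-false (c v₁ x) | true-or-false (c v₂ x) | true-or-false (c v₃ x) | true-or-false (c v₄ x)
    ... | inj₁ e | _ | _ | _ = zero , e
    ... | _ | inj₁ e | _ | _ = suc zero , e
    ... | _ | _ | inj₁ e | _ = suc (suc zero) , e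
    ... | _ | _ | _ | inj₁ e = suc (suc (suc zero)) , e
    ... | inj₂ e₁ | inj₂ e₂ | inj₂ e₃ | inj₂ e₄ = clash (far-in {S₃} (far-in {S₂} (far-in {S₁} (far-in {S} (W⊆S h) e₁ (W≢v h zero)) e₂ (W≢v h (suc zero)))
          e₃ (W≢v h (suc (suc zero)))) e₄ (W≢v h (suc (suc (suc zero))))) (W∉U h)

    opaque
      -- `I` together with two non-adjacent vertices of the pentagon is stable of size six and
      -- therefore a largest stable set. `W` avoids it, so `coherent-bound` applies.
      coherent≤6 : ∀ Z → (∀ {x} → x ∈ Z → x ∈ W) → Coherent Z → # Z ≤ 6
      coherent≤6 Z Z⊆ coh = ≤-trans (coherent-bound {S} {Q} {Z} (Q⊆ , Q-stable , λ Q′ s t → ≤-trans (b Q′ s t) six′) sub coh) (b Q Q⊆ Q-stable)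
        where
        x y : Fin n
        x = u 0F
        y = u 2F
        R Q : Sub n
        R = ⁅ x ⁆ ∪ ⁅ y ⁆
        Q = I ∪ R
        R-out : ∀ {z} → z ∈ R → z ≡ x ⊎ z ≡ y
        R-out h with ∪-out {S = ⁅ x ⁆} h
        ... | inj₁ e = inj₁ (sym (eqᵇ-true {i = x} e))
        ... | inj₂ e = inj₂ (sym (eqᵇ-true {i = y} e))
        R∈U : ∀ {z} → z ∈ R → z ∈ U
        R∈U h with R-out h
        ... | inj₁ refl = u∈ 0F
        ... | inj₂ refl = u∈ 2F
        R-stable : Stable R
        R-stable = insert-stable {x} {⁅ y ⁆} (singleton-stable y) λ h → subst (λ z → c x z ≡ false) (eqᵇ-true {i = y} h) (u-skip 0F)
        Q-stable : Stable Q
        Q-stable = stable-∪ {I} {R} I-stable R-stable λ h k → case image-out v h of λ { (i , refl) → proj₁ (v-U i (R∈U k)) }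
        Q⊆ : Q ⊆ S
        Q⊆ z h with ∪-out {S = I} h
        ... | inj₁ k = case image-out v k of λ { (i , refl) → v∈ i }
        ... | inj₂ k = U⊆S (R∈U k)
        I-R : ∀ z → z ∈ I → z ∈ R → ⊥
        I-R z h k with image-out v h
        ... | i , refl = proj₂ (v-U i (R∈U k)) refl
        x≢y : ∀ {z} → z ∈ ⁅ y ⁆ → x ≢ z
        x≢y h e with u-injective (trans e (sym (eqᵇ-true {i = y} h)))
        ... | ()
        six′ : 6 ≤ # Q
        six′ = lin 4 {# Q , # I , # R , # ⁅ y ⁆ , _} (con 6 ≼ $0) (con 4 ⊞ ($1 ⊞ $2) ⊞ (con 1 ⊞ $3) ⊞ con 1 ≼ $1 ⊞ $0 ⊞ $2 ⊞ $3) (#-image-≥ v v-injective ⊕ ∪-size {I} {R} I-R ⊕ insert-size {x} {⁅ y ⁆} x≢y ⊕ eq≥ (#-⁅⁆ y))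
        sub : Z ⊆ S ∖ Q
        sub z h = ∖-in (W⊆S (Z⊆ h)) (¬true⇒false λ k → case ∪-out {S = I} k of λ where
          (inj₁ i) → clash i (W∉I (Z⊆ h))
          (inj₂ r) → clash (R∈U r) (W∉U (Z⊆ h)))

    P : Sub n
    P = S ∩ c v₁

    P-stable : Stable P
    P-stable = neighbours-stable S v₁

    P⊆W : ∀ {x} → x ∈ P → x ∈ W
    P⊆W {x} h = W-in (∩-left h) (∉-image v λ i e → clash (∩-right {S = S} h) (subst (λ z → c v₁ z ≡ false) e (v₁-v i)))
        (¬true⇒false λ k → clash (∩-right {S = S} h) (far-c {S} (U-S₁ k)))
      where
      v₁-v : ∀ i → c v₁ (v i) ≡ false
      v₁-v zero = c-irr v₁
      v₁-v (suc i) = proj₁ (v-far zero (suc i) λ ())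

    P-largest : LargestStable S P
    P-largest = (λ _ → ∩-left) , (λ {x} {y} → P-stable {x} {y}) , λ Q s t → ≤-trans (b Q s t) (eq≥ six)

    opaque
      Y : Sub n
      Y = W ∖ P

      Y⊆W : ∀ {x} → x ∈ Y → x ∈ W
      Y⊆W = ∖-left

      Y∉P : ∀ {x} → x ∈ Y → x ∉ P
      Y∉P h = ∖-right {S = W} h

      #-Y : 8 ≤ # Y
      #-Y = lin 4 {# Y , # W , # (W ∩ P) , deg S v₁ , _} (con 8 ≼ $0) (con 14 ⊞ $1 ⊞ $2 ⊞ $3 ≼ $1 ⊞ ($2 ⊞ $0) ⊞ $3 ⊞ con 6) (#-W ⊕ eq≤ (#-split W P) ⊕ #-mono {S = W ∩ P} {P} (λ _ → ∩-right {S = W}) ⊕ eq≤ six)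

    -- Of at most six neighbours of `t`, one lies in `P` by `hall`, because `P` is a largest stable
    -- set, and one is among v₁, ..., v₄.
    Y-degree : ∀ {t} → t ∈ Y → ∀ Z → (∀ {x} → x ∈ Z → x ∈ Y) → (∀ {x} → x ∈ Z → c t x ≡ true) → # Z ≤ 4
    Y-degree {t} t∈ Z Z⊆ adjacent = ≤-trans room (≤-refl {4})
      where
      in-P : ∃[ x ] (x ∈ P × c t x ≡ true)
      in-P = case #-pos (P ∩ touched ⁅ t ⁆) (≤-trans (eq≥ (#-⁅⁆ t)) (hall P-largest
          (λ w h → subst (_∈ S ∖ P) (eqᵇ-true {i = t} h) (∖-in (W⊆S (Y⊆W t∈)) (Y∉P t∈))) (singleton-stable t))) of λ where
        (x , h) → case touched-out (∩-right {S = P} h) of λ where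
          (a , a∈ , e) → x , ∩-left h , subst (λ y → c y x ≡ true) (sym (eqᵇ-true {i = t} a∈)) e
      in-I : ∃[ i ] c (v i) t ≡ true
      in-I = W-touches (Y⊆W t∈)
      room : # Z ≤ 4
      room = count (proj₁ in-P) (proj₁ (proj₂ in-P)) (proj₂ (proj₂ in-P)) (proj₁ in-I) (proj₂ in-I)
        where
        count : ∀ x → x ∈ P → c t x ≡ true → ∀ i → c (v i) t ≡ true → # Z ≤ 4
        count x x∈ tx i it = lin 4 ($0 ≼ con 4) ($1 ⊞ (con 1 ⊞ $2) ⊞ (con 1 ⊞ $3) ⊞ $0 ≼ con 6 ⊞ $1 ⊞ $2 ⊞ $3) (deg-bound b t ⊕ eq≥ (#-─ (S ∩ c t) {x} (∩-in (W⊆S (P⊆W x∈)) tx))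
          ⊕ eq≥ (#-─ ((S ∩ c t) ─ x) {v i} (─-in (∩-in (v∈ i) (flip it)) (λ e → W≢v (P⊆W x∈) i (sym e))))
          ⊕ #-mono {S = Z} {(S ∩ c t) ─ x ─ v i} λ w h → ─-in (─-in (∩-in (W⊆S (Y⊆W (Z⊆ h))) (adjacent h)) (λ { refl → clash x∈ (Y∉P (Z⊆ h)) })) (W≢v (Y⊆W (Z⊆ h)) i))

    opaque
      -- A larger `Z` has six vertices and leaves `m` and `m′` in `Y`. Each of them splits `Z`, as a
      -- coherent set of seven in `W` is impossible, and without disjoint gulls both isolate the
      -- same `o`. Then either `m`, `m′` and `Z ─ o` form a coherent set of seven, or `spoke`
      -- provides a vertex of `Y` with five neighbours in `Y`.
      small-coherent : ¬ Packing Y 2 → ∀ Z → Z ⊆ Y → Coherent Z → # Z ≤ 5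
      small-coherent none Z Z⊆ coh = ≮⇒≥ big
        where
        Z⊆W : ∀ {x} → x ∈ Z → x ∈ W
        Z⊆W h = Y⊆W (Z⊆ _ h)
        big : 5 < # Z → ⊥
        big six = outside (elements (Y ∖ Z) 2 (lin 4 {# (Y ∖ Z) , # Y , # (Y ∩ Z) , # Z , _} (con 2 ≼ $0) (con 8 ⊞ $1 ⊞ $2 ⊞ $3 ≼ $1 ⊞ ($2 ⊞ $0) ⊞ $3 ⊞ con 6) (#-Y ⊕ eq≤ (#-split Y Z) ⊕ #-mono {S = Y ∩ Z} {Z} (λ _ → ∩-right {S = Y}) ⊕ coherent≤6 Z Z⊆W coh)))
          where
          outside : (Σ (Fin 2 → Fin n) λ f → (∀ i → f i ∈ Y ∖ Z) × (∀ {i j} → f i ≡ f j → i ≡ j)) → ⊥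
          outside (f , f∈ , inj) = split (f∈ 0F) λ { (a , d , ha , hd , h) → split (f∈ 1F) λ { (x , y , hx , hy , h′) → conclude-from (isolated ha hd h hx hy h′) } }
            where
            m m′ : Fin n
            m = f 0F
            m′ = f 1F
            m≢m′ : m ≢ m′
            m≢m′ e = case inj e of λ ()
            apart : ∀ {x y} → x ∈ Y ∖ Z → y ∈ Z → x ≢ y
            apart hx hy refl = clash hy (∖-right {S = Y} hx)
            split : ∀ {x} → x ∈ Y ∖ Z → ¬¬ (∃[ a ] ∃[ d ] (a ∈ Z × d ∈ Z × g x a d ≡ true))
            split {x} hx k = absurd-≤ 2 ($0 ⊞ (con 1 ⊞ $1) ⊞ con 6 ≼ con 6 ⊞ $0 ⊞ $1) (coherent≤6 (⁅ x ⁆ ∪ Z) sub (insert-coherent {Z} {x} λ ha hd → ¬true⇒false λ h → k (_ , _ , ha , hd , h))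
                ⊕ insert-size {x} {Z} (apart hx) ⊕ six)
              where
              sub : ∀ {y} → y ∈ ⁅ x ⁆ ∪ Z → y ∈ W
              sub {y} h = insert-⊆ {x} {Z} {W} (Y⊆W (∖-left hx)) (λ _ → Z⊆W) y h
            disjoint : ∀ {a d a′ d′} → a ∈ Z → d ∈ Z → a′ ∈ Z → d′ ∈ Z → a ≢ a′ → a ≢ d′ → d ≢ a′ → d ≢ d′ → g m a d ≡ true → g m′ a′ d′ ≡ true → ⊥
            disjoint {a} {d} {a′} {d′} ha hd ha′ hd′ p q r s h h′ = none (two-gulls t t′ t∈ t′∈ h h′ ne)
              where
              t t′ : Fin 3 → Fin n
              t 0F = m
              t 1F = a
              t 2F = d
              t′ 0F = m′
              t′ 1F = a′
              t′ 2F = d′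
              t∈ : ∀ a → t a ∈ Y
              t∈ 0F = ∖-left (f∈ 0F)
              t∈ 1F = Z⊆ _ ha
              t∈ 2F = Z⊆ _ hd
              t′∈ : ∀ a → t′ a ∈ Y
              t′∈ 0F = ∖-left (f∈ 1F)
              t′∈ 1F = Z⊆ _ ha′
              t′∈ 2F = Z⊆ _ hd′
              ne : ∀ a b → t a ≢ t′ b
              ne 0F 0F = m≢m′
              ne 0F 1F = apart (f∈ 0F) ha′
              ne 0F 2F = apart (f∈ 0F) hd′
              ne 1F 0F = apart (f∈ 1F) ha ∘ sym
              ne 1F 1F = p
              ne 1F 2F = q
              ne 2F 0F = apart (f∈ 1F) hd ∘ sym
              ne 2F 1F = r
              ne 2F 2F = s
            open Isolation {Z} coh six {m} {m′} disjoint
            conclude-from : ∃[ o ] Isolated o → ⊥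
            conclude-from (o , iso@(ho , _ , inside)) = pick (#-pos (Z ─ o) (lin 2 (con 1 ≼ $0) (con 6 ⊞ $1 ≼ $1 ⊞ (con 1 ⊞ $0)) (six ⊕ #-─-≤ Z o)))
              where
              pick : ∃[ k ] k ∈ Z ─ o → ⊥
              pick (k , hk) with true-or-false (g m m′ k)
              ... | inj₁ h = hub (spoke iso hk h)
                where
                hub : ∃[ t ] ((t ≡ m ⊎ t ≡ m′ ⊎ t ≡ o) × (∀ {z} → z ∈ Z ─ o → c t z ≡ true)) → ⊥
                hub (t , e , adjacent) = absurd-≤ 2 ($0 ⊞ con 6 ⊞ $1 ≼ con 4 ⊞ $1 ⊞ (con 1 ⊞ $0)) (Y-degree (t∈Y e) (Z ─ o) (λ h → Z⊆ _ (─-left h)) adjacent ⊕ six ⊕ #-─-≤ Z o)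
                  where
                  t∈Y : t ≡ m ⊎ t ≡ m′ ⊎ t ≡ o → t ∈ Y
                  t∈Y (inj₁ refl) = ∖-left (f∈ 0F)
                  t∈Y (inj₂ (inj₁ refl)) = ∖-left (f∈ 1F)
                  t∈Y (inj₂ (inj₂ refl)) = Z⊆ _ ho
              ... | inj₂ h = absurd-≤ 4 {# (⁅ m ⁆ ∪ X) , # X , # (Z ─ o) , # Z , _} ($0 ⊞ (con 1 ⊞ $1) ⊞ (con 1 ⊞ $2) ⊞ con 6 ⊞ $3 ≼ con 6 ⊞ $0 ⊞ $1 ⊞ $3 ⊞ (con 1 ⊞ $2)) (coherent≤6 (⁅ m ⁆ ∪ X) sub (insert-coherent {X} {m} λ ha hb → joins (∪-out {S = ⁅ m′ ⁆} ha) (∪-out {S = ⁅ m′ ⁆} hb))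
                  ⊕ insert-size {m} {X} m∉X ⊕ insert-size {m′} {Z ─ o} (λ h → apart (f∈ 1F) (─-left h)) ⊕ six ⊕ #-─-≤ Z o)
                where
                X : Sub n
                X = ⁅ m′ ⁆ ∪ (Z ─ o)
                m∉X : ∀ {w} → w ∈ X → m ≢ w
                m∉X h with ∪-out {S = ⁅ m′ ⁆} h
                ... | inj₁ e = λ e′ → m≢m′ (trans e′ (sym (eqᵇ-true {i = m′} e)))
                ... | inj₂ k = apart (f∈ 0F) (─-left k)
                mm′ : ∀ {z} → z ∈ Z ─ o → g m m′ z ≡ false
                mm′ {z} hz = solve′ _ _ _ _ (cocycle m m′ z k) h (inside (─-left hz) (─-left hk) (─-right hz) (─-right hk))
                  where
                  solve′ : ∀ p q r s → p xor (q xor (r xor s)) ≡ false → q ≡ false → r ≡ false × s ≡ false → p ≡ false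
                  solve′ false false false false _ _ _ = refl
                joins : ∀ {a b} → a ∈ ⁅ m′ ⁆ ⊎ a ∈ Z ─ o → b ∈ ⁅ m′ ⁆ ⊎ b ∈ Z ─ o → g m a b ≡ false
                joins {a} {b} (inj₁ e) (inj₁ e′) rewrite sym (eqᵇ-true {i = m′} {a} e) | sym (eqᵇ-true {i = m′} {b} e′) = trans (g-rot m m′ m′) (g-irr m′ m)
                joins {a} {b} (inj₁ e) (inj₂ hb) rewrite sym (eqᵇ-true {i = m′} {a} e) = mm′ hb
                joins {a} {b} (inj₂ ha) (inj₁ e) rewrite sym (eqᵇ-true {i = m′} {b} e) = trans (g-swap₂ _ _ _) (mm′ ha)
                joins (inj₂ ha) (inj₂ hb) = proj₁ (inside (─-left ha) (─-left hb) (─-right ha) (─-right hb))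
                sub : ∀ {y} → y ∈ ⁅ m ⁆ ∪ X → y ∈ W
                sub {y} h = insert-⊆ {m} {X} {W} (Y⊆W (∖-left (f∈ 0F))) (insert-⊆ {m′} {Z ─ o} {W} (Y⊆W (∖-left (f∈ 1F))) λ _ h → Z⊆W (─-left h)) y h

      two-packing : ¬¬ Packing Y 2
      two-packing none = gull-packing Y 2 (lin 1 (3 ⊠ con 2 ≼ $0) (con 8 ≼ $0) #-Y) (λ Z Z⊆ coh → lin 2 ($0 ⊞ 2 ⊠ con 2 ≼ $1 ⊞ con 1) ($0 ⊞ con 8 ≼ con 5 ⊞ $1) (small-coherent none Z Z⊆ coh ⊕ #-Y)) (λ _ → lin 1 (con 7 ≼ $0) (con 8 ≼ $0) #-Y) none

    module Blocked (none : ∀ {p} → p ∈ P → ¬ Packing (Y ∪ ⁅ p ⁆) 3) (Q : Packing Y 2) where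

      open Packing Q using (rest; #-rest; rest-out; out-rest) renaming (p to q; p∈ to q∈; p-injective to q-injective)

      lifted : ∀ p → Packing (Y ∪ ⁅ p ⁆) 2
      lifted p = lift-packing (λ _ → ∪-inˡ) Q

      OutOf : Fin n → Fin n → Set
      OutOf p = Packing.Out (lifted p)

      out : ∀ p {z} → z ∈ rest → OutOf p z
      out p h = ∪-inˡ (proj₁ (rest-out h)) , proj₂ (rest-out h)

      outₚ : ∀ {p} → p ∈ P → OutOf p p
      outₚ {p} p∈ = ∪-inʳ {S = Y} (eqᵇ-refl p) , λ i a e → clash p∈ (Y∉P (subst (_∈ Y) e (q∈ i a)))

      out-Y : ∀ p {z} → OutOf p z → z ≢ p → z ∈ rest
      out-Y p (h , k) ne with ∪-out {S = Y} h
      ... | inj₁ z∈ = out-rest (z∈ , k)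
      ... | inj₂ e = ⊥-elim (ne (sym (eqᵇ-true {i = p} e)))

      rest≢P : ∀ {z p} → z ∈ rest → p ∈ P → z ≢ p
      rest≢P h p∈ refl = clash p∈ (Y∉P (proj₁ (rest-out h)))

      opaque
        room : ∀ {p} → p ∈ P → 3 ≤ # (Packing.rest (lifted p))
        room {p} p∈ = lin 4 {# (Packing.rest (lifted p)) , # (Y ∪ ⁅ p ⁆) , # Y , # ⁅ p ⁆ , _} (con 3 ≼ $0) (con 8 ⊞ $1 ⊞ ($2 ⊞ $3) ⊞ con 1 ≼ $2 ⊞ ($0 ⊞ 2 ⊠ con 3) ⊞ $1 ⊞ $3) (#-Y ⊕ Packing.#-rest (lifted p) ⊕ ∪-size {Y} {⁅ p ⁆} (λ z h e → clash (subst (_∈ P) (eqᵇ-true {i = p} e) p∈) (Y∉P h)) ⊕ eq≥ (#-⁅⁆ p))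

        two : Σ (Fin 2 → Fin n) λ f → (∀ i → f i ∈ rest) × (∀ {i j} → f i ≡ f j → i ≡ j)
        two = elements rest 2 (lin 2 (con 2 ≼ $0) (con 8 ⊞ $1 ≼ $1 ⊞ ($0 ⊞ 2 ⊠ con 3)) (#-Y ⊕ #-rest))

      y y′ : Fin n
      y = proj₁ two 0F
      y′ = proj₁ two 1F

      y∈ : y ∈ rest
      y∈ = proj₁ (proj₂ two) 0F

      y′∈ : y′ ∈ rest
      y′∈ = proj₁ (proj₂ two) 1F

      y≢y′ : y ≢ y′
      y≢y′ e = case proj₂ (proj₂ two) e of λ ()

      module Core {p₀} (p₀∈ : p₀ ∈ P) where

        doubled : ∀ i → Saturated.Double (none p₀∈) (lifted p₀) i
        doubled = Saturated.doubles (none p₀∈) (lifted p₀) (room p₀∈) (inj₂ λ { 0F → 1F , (λ ()) ; 1F → 0F , (λ ()) })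

        open Saturated.Extension (none p₀∈) (lifted p₀) (room p₀∈) doubled using (w; joins-rest; joins-each-other)

        -- One of the two leftovers that fit the slot differs from `p₀` and hence lies in `Y`. So
        -- `w i`, although found with the help of `p₀`, can be freed with any other vertex of `P` as
        -- the additional leftover.
        spare : ∀ i → ∃[ x ] (x ∈ rest × swapped (q i) (proj₁ (doubled i)) x ≡ true)
        spare i = choose (doubled i)
          where
          choose : (d : Saturated.Double (none p₀∈) (lifted p₀) i) → ∃[ x ] (x ∈ rest × swapped (q i) (proj₁ d) x ≡ true)
          choose (k , x , x′ , x≢x′ , ox , ox′ , h , h′) with x ≟ᶠ p₀
          ... | no ne = x , out-Y p₀ ox ne , h
          ... | yes refl = x′ , out-Y p₀ ox′ (x≢x′ ∘ sym) , h′

        yy′p : ∀ {p} → p ∈ P → g y y′ p ≡ false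
        yy′p {p} p∈ = Saturated.leftover (none p∈) (lifted p) (out p y∈) (out p y′∈) (outₚ p∈)

        yy′w : ∀ i → g y y′ (w i) ≡ false
        yy′w i = trans (sym (g-rot _ _ _)) (joins-rest i (out p₀ y∈) (out p₀ y′∈))

        yww : g y (w 0F) (w 1F) ≡ false
        yww = trans (g-rot _ _ _) (joins-each-other {0F} {1F} (λ ()) (out p₀ y∈))

        ywp : ∀ i {p} → p ∈ P → g y (w i) p ≡ false
        ywp i {p} p∈ = by (spare i)
          where
          by : ∃[ x ] (x ∈ rest × swapped (q i) (proj₁ (doubled i)) x ≡ true) → g y (w i) p ≡ false
          by (x , x∈ , h) with x ≟ᶠ y
          ... | no x≢y = trans (g-swap₁ _ _ _) (Saturated.joins (none p∈) (lifted p) i _ (out p x∈) h (out p y∈) (outₚ p∈) x≢y (rest≢P x∈ p∈))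
          ... | yes refl = even {y′} (trans (g-swap₁ _ _ _) (yy′w i)) (trans (g-swap₁ _ _ _) (yy′p p∈))
                (trans (g-swap₁ _ _ _) (Saturated.joins (none p∈) (lifted p) i _ (out p x∈) h (out p y′∈) (outₚ p∈) y≢y′ (rest≢P x∈ p∈)))

        κ : Fin 4 → Fin n
        κ zero = y
        κ (suc zero) = y′
        κ (suc (suc zero)) = w 0F
        κ (suc (suc (suc zero))) = w 1F

        κ-κ : ∀ a b → g y (κ a) (κ b) ≡ false
        κ-κ zero b = g-irr y (κ b)
        κ-κ a zero = trans (g-swap₂ _ _ _) (g-irr y (κ a))
        κ-κ (suc zero) (suc zero) = trans (g-rot _ _ _) (g-irr _ _)
        κ-κ (suc (suc zero)) (suc (suc zero)) = trans (g-rot _ _ _) (g-irr _ _)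
        κ-κ (suc (suc (suc zero))) (suc (suc (suc zero))) = trans (g-rot _ _ _) (g-irr _ _)
        κ-κ (suc zero) (suc (suc zero)) = yy′w 0F
        κ-κ (suc zero) (suc (suc (suc zero))) = yy′w 1F
        κ-κ (suc (suc zero)) (suc zero) = trans (g-swap₂ _ _ _) (yy′w 0F)
        κ-κ (suc (suc (suc zero))) (suc zero) = trans (g-swap₂ _ _ _) (yy′w 1F)
        κ-κ (suc (suc zero)) (suc (suc (suc zero))) = yww
        κ-κ (suc (suc (suc zero))) (suc (suc zero)) = trans (g-swap₂ _ _ _) yww

        κ-P : ∀ a {p} → p ∈ P → g y (κ a) p ≡ false
        κ-P zero _ = g-irr y _
        κ-P (suc zero) = yy′p
        κ-P (suc (suc zero)) = ywp 0F
        κ-P (suc (suc (suc zero))) = ywp 1F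

        κ∈Y : ∀ a → κ a ∈ Y
        κ∈Y zero = proj₁ (rest-out y∈)
        κ∈Y (suc zero) = proj₁ (rest-out y′∈)
        κ∈Y (suc (suc zero)) = q∈ 0F _
        κ∈Y (suc (suc (suc zero))) = q∈ 1F _

        w≢ : ∀ i {z} → z ∈ rest → w i ≢ z
        w≢ i h = proj₂ (rest-out h) i _

        w≢w : w 0F ≢ w 1F
        w≢w e with q-injective e
        ... | () , _

        κ-injective : ∀ {a b} → κ a ≡ κ b → a ≡ b
        κ-injective {zero} {zero} _ = refl
        κ-injective {suc zero} {suc zero} _ = refl
        κ-injective {suc (suc zero)} {suc (suc zero)} _ = refl
        κ-injective {suc (suc (suc zero))} {suc (suc (suc zero))} _ = refl
        κ-injective {zero} {suc zero} e = ⊥-elim (y≢y′ e)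
        κ-injective {zero} {suc (suc zero)} e = ⊥-elim (w≢ 0F y∈ (sym e))
        κ-injective {zero} {suc (suc (suc zero))} e = ⊥-elim (w≢ 1F y∈ (sym e))
        κ-injective {suc zero} {zero} e = ⊥-elim (y≢y′ (sym e))
        κ-injective {suc zero} {suc (suc zero)} e = ⊥-elim (w≢ 0F y′∈ (sym e))
        κ-injective {suc zero} {suc (suc (suc zero))} e = ⊥-elim (w≢ 1F y′∈ (sym e))
        κ-injective {suc (suc zero)} {zero} e = ⊥-elim (w≢ 0F y∈ e)
        κ-injective {suc (suc zero)} {suc zero} e = ⊥-elim (w≢ 0F y′∈ e)
        κ-injective {suc (suc zero)} {suc (suc (suc zero))} e = ⊥-elim (w≢w e)
        κ-injective {suc (suc (suc zero))} {zero} e = ⊥-elim (w≢ 1F y∈ e)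
        κ-injective {suc (suc (suc zero))} {suc zero} e = ⊥-elim (w≢ 1F y′∈ e)
        κ-injective {suc (suc (suc zero))} {suc (suc zero)} e = ⊥-elim (w≢w (sym e))

        opaque
          -- The four vertices `κ` are coherent, also with every single vertex of `P`. Adding
          -- vertices of `P` on one side of the split by `y` keeps them coherent, so `coherent≤6`
          -- leaves room for two. The six vertices of `P` do not fit into two such sides.
          side : ∀ B → (∀ {p} → p ∈ B → p ∈ P) → (∀ {p p′} → p ∈ B → p′ ∈ B → c y p ≡ c y p′) → # B ≤ 2
          side B B⊆ same = lin 3 {# B , # (image κ ∪ B) , # (image κ) , _} ($0 ≼ con 2) ($1 ⊞ ($2 ⊞ $0) ⊞ con 4 ≼ con 6 ⊞ $1 ⊞ $2) (coherent≤6 (image κ ∪ B) sub (coherent-from y λ ha hb → rel (∪-out {S = image κ} ha) (∪-out {S = image κ} hb))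
              ⊕ ∪-size {image κ} {B} apart ⊕ #-image-≥ κ κ-injective)
            where
            sub : ∀ {x} → x ∈ image κ ∪ B → x ∈ W
            sub h with ∪-out {S = image κ} h
            ... | inj₂ k = P⊆W (B⊆ k)
            ... | inj₁ k with image-out κ k
            ...   | a , refl = Y⊆W (κ∈Y a)
            apart : ∀ x → x ∈ image κ → x ∈ B → ⊥
            apart x h k with image-out κ h
            ... | a , refl = clash (B⊆ k) (Y∉P (κ∈Y a))
            flat : ∀ {a b d} → a ≡ b → d ≡ false → a xor (b xor d) ≡ false
            flat {true} refl refl = refl
            flat {false} refl refl = refl
            rel : ∀ {a b} → a ∈ image κ ⊎ a ∈ B → b ∈ image κ ⊎ b ∈ B → g y a b ≡ false
            rel (inj₂ ha) (inj₂ hb) = flat (same ha hb) (P-stable (B⊆ ha) (B⊆ hb))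
            rel (inj₁ ha) (inj₂ hb) with image-out κ ha
            ... | a , refl = κ-P a (B⊆ hb)
            rel (inj₂ ha) (inj₁ hb) with image-out κ hb
            ... | b , refl = trans (g-swap₂ _ _ _) (κ-P b (B⊆ ha))
            rel (inj₁ ha) (inj₁ hb) with image-out κ ha | image-out κ hb
            ... | a , refl | b , refl = κ-κ a b

        contradictory : ⊥
        contradictory = absurd-≤ 3 {# P , # (P ∩ c y) , # (P ∖ c y) , _} (con 6 ⊞ $0 ⊞ $1 ⊞ $2 ≼ $0 ⊞ ($1 ⊞ $2) ⊞ con 2 ⊞ con 2) (eq≥ six ⊕ eq≤ (#-split P (c y)) ⊕ side (P ∩ c y) ∩-left (λ h k → trans (∩-right {S = P} h) (sym (∩-right {S = P} k)))
          ⊕ side (P ∖ c y) ∖-left (λ h k → trans (∖-right {S = P} h) (sym (∖-right {S = P} k))))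

    opaque
      three-packing : ¬¬ (∃[ p ] (p ∈ P × Packing (Y ∪ ⁅ p ⁆) 3))
      three-packing k = two-packing λ Q → start Q (#-pos P (lin 1 (con 1 ≼ $0) (con 6 ≼ $0) (eq≥ six)))
        where
        start : Packing Y 2 → ∃[ p ] p ∈ P → ⊥
        start Q (p , p∈) = Blocked.Core.contradictory (λ p∈ R → k (_ , p∈ , R)) Q p∈

    module Assembly {p} (p∈ : p ∈ P) (R : Packing (Y ∪ ⁅ p ⁆) 3) where

      V : Sub n
      V = P ─ p

      opaque
        five-V : Σ (Fin 5 → Fin n) λ f → (∀ i → f i ∈ V) × (∀ {i j} → f i ≡ f j → i ≡ j)
        five-V = elements V 5 (lin 2 (con 5 ≼ $0) (con 6 ⊞ $1 ≼ $1 ⊞ (con 1 ⊞ $0)) (eq≥ six ⊕ #-─-≤ P p))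

      e : Fin 5 → Fin n
      e = proj₁ five-V

      e∈V : ∀ i → e i ∈ V
      e∈V = proj₁ (proj₂ five-V)

      e∈P : ∀ i → e i ∈ P
      e∈P i = ─-left (e∈V i)

      e-injective : ∀ {i j} → e i ≡ e j → i ≡ j
      e-injective = proj₂ (proj₂ five-V)

      u≢e : ∀ i j → u i ≢ e j
      u≢e i j = W≢u (P⊆W (e∈P j)) i

      M : Fin 5 → Fin 5 → Bool
      M i j = c (u i) (e j)

      adjacent : ∀ i j → M i j ≡ true → M (next i) j ≡ true → ⊥
      adjacent i j h k = c-tri (u i) (u (next i)) (e j) (u-edge i) k h

      opaque
        -- Otherwise `u i` has seven neighbours: two on the pentagon and all five `e j`, a stable
        -- set that is too large.
        some : ∀ i → ¬ (∀ j → M i j ≡ true)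
        some i all = absurd-≤ 4 {deg S (u i) , # (⁅ a ⁆ ∪ ⁅ d ⁆ ∪ image e) , # (⁅ d ⁆ ∪ image e) , # (image e) , _} ($0 ⊞ $1 ⊞ (con 1 ⊞ $2) ⊞ (con 1 ⊞ $3) ⊞ con 5 ≼ con 6 ⊞ $0 ⊞ $1 ⊞ $2 ⊞ $3) (deg-bound b (u i) ⊕ #-mono {S = ⁅ a ⁆ ∪ (⁅ d ⁆ ∪ image e)} {S ∩ c (u i)} sub
            ⊕ insert-size {a} {⁅ d ⁆ ∪ image e} a≢ ⊕ insert-size {d} {image e} (not-e (next (next (next (next i))))) ⊕ #-image-≥ e e-injective)
          where
          a d : Fin n
          a = u (next i)
          d = u (next (next (next (next i))))
          not-e : ∀ k {z} → z ∈ image e → u k ≢ z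
          not-e k h with image-out e h
          ... | j , refl = u≢e k j
          a≢ : ∀ {z} → z ∈ ⁅ d ⁆ ∪ image e → a ≢ z
          a≢ h with ∪-out {S = ⁅ d ⁆} h
          ... | inj₂ k = not-e (next i) k
          ... | inj₁ k = λ eq → next≢next⁴ i (u-injective (trans eq (sym (eqᵇ-true {i = d} k))))
            where
            next≢next⁴ : ∀ i → next i ≢ next (next (next (next i)))
            next≢next⁴ = toWitness {a? = all? λ i → ¬? (next i ≟ᶠ next (next (next (next i))))} tt
          back : c (u i) d ≡ true
          back = flip (subst (λ k → c d (u k) ≡ true) (next⁴ i) (u-edge (next (next (next (next i))))))
          sub : ⁅ a ⁆ ∪ (⁅ d ⁆ ∪ image e) ⊆ S ∩ c (u i)
          sub = insert-⊆ {a} (∩-in (U⊆S (u∈ _)) (u-edge i)) (insert-⊆ {d} (∩-in (U⊆S (u∈ _)) back) in-e)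
            where
            in-e : image e ⊆ S ∩ c (u i)
            in-e z h with image-out e h
            ... | j , refl = ∩-in (W⊆S (P⊆W (e∈P j))) (all j)

        -- Otherwise `x` and `y` have five common neighbours, the pentagon vertex between them and
        -- four of the `e k`. Then `S` has at most 22 vertices: `x` and its six neighbours, `y` and
        -- at most one further neighbour, and at most 13 vertices far from both.
        four : ∀ i j → ¬ (∀ k → k ≢ j → M i k ≡ true × M (next (next i)) k ≡ true)
        four i j all = absurd-≤ 9 {# S , deg S x , # (far S x) , deg S y , # B , # (far S x ∩ c y) , # (image e ─ e j) , # (image e) , # (far (far S x) y) , _} (con 23 ⊞ $0 ⊞ $1 ⊞ $2 ⊞ $3 ⊞ ($4 ⊞ $5) ⊞ (con 1 ⊞ $6) ⊞ con 5 ⊞ $7 ⊞ $8 ≼ $0 ⊞ ($1 ⊞ (con 1 ⊞ $2)) ⊞ con 6 ⊞ ($5 ⊞ (con 1 ⊞ $8)) ⊞ con 6 ⊞ $3 ⊞ $4 ⊞ $7 ⊞ (con 1 ⊞ $6) ⊞ con 13) (eq≥ size ⊕ eq≤ (#-far S {x} (U⊆S (u∈ i))) ⊕ deg-bound b x ⊕ eq≤ (#-far (far S x) {y} y∈) ⊕ deg-bound b y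
            ⊕ #-⊎ {S = S ∩ c y} {B} {far S x ∩ c y} (λ z h → ∩-in (∩-left (∩-left (B⊆ z h))) (∩-right {S = S ∩ c x} (B⊆ z h)))
                (λ z h → ∩-in (far-⊆ {S} (∩-left h)) (∩-right {S = far S x} h)) (λ z h k → clash (∩-right {S = S} (∩-left (B⊆ z h))) (far-c {S} (∩-left k)))
            ⊕ insert-size {u (next i)} {image e ─ e j} mid≢ ⊕ #-image-≥ e e-injective ⊕ #-─-≤ (image e) (e j)
            ⊕ ramsey₄ (far (far S x) y) (far-bound (far-bound b (U⊆S (u∈ i))) y∈))
          where
          x y : Fin n
          x = u i
          y = u (next (next i))
          B : Sub n
          B = ⁅ u (next i) ⁆ ∪ (image e ─ e j)
          mid≢ : ∀ {z} → z ∈ image e ─ e j → u (next i) ≢ z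
          mid≢ h with image-out e (─-left h)
          ... | k , refl = u≢e (next i) k
          y∈ : y ∈ far S x
          y∈ = far-in {S} (U⊆S (u∈ _)) (u-skip i) λ eq → next²≢ i (u-injective eq)
            where
            next²≢ : ∀ i → i ≢ next (next i)
            next²≢ = toWitness {a? = all? λ i → ¬? (i ≟ᶠ next (next i))} tt
          B⊆ : B ⊆ (S ∩ c x) ∩ c y
          B⊆ = insert-⊆ {u (next i)} (∩-in (∩-in (U⊆S (u∈ _)) (u-edge i)) (flip (u-edge (next i)))) in-e
            where
            in-e : image e ─ e j ⊆ (S ∩ c x) ∩ c y
            in-e z h with image-out e (─-left h)
            ... | k , refl = ∩-in (∩-in (W⊆S (P⊆W (e∈P k))) (proj₁ (all k λ { refl → ─-right h refl }))) (proj₂ (all k λ { refl → ─-right h refl }))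

      open Partners M adjacent some four using (partners)

      σ : Fin 5 → Fin 5
      σ = proj₁ partners

      -- The ends are the pentagon vertices, because these are adjacent in the graph to all of `I`.
      -- Among themselves the trees are linked at their middles, which lie in the stable set `P`.
      doubles-family : Family (U ∪ V) 5
      doubles-family = record
        { trees = t
        ; valid = λ i → inj₂ ((u≢e i (σ i) , proj₂ (proj₂ partners) i) , (u≢e i (σ i) , proj₂ (proj₂ partners) i))
        ; within = λ i h → within′ i (parts i h)
        ; apart = λ {i} {j} ne → (λ h k → separate ne (parts i h) (parts j k)) , inj₂ (u≢e i (σ i) , u≢e j (σ j) ,
            (λ eq → ne (proj₁ (proj₂ partners) (e-injective eq))) , P-stable (e∈P (σ i)) (e∈P (σ j)))
        }
        where
        t : Fin 5 → Tree
        t i = tree (u i) (e (σ i)) (u i)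
        parts : ∀ i {x} → x isIn t i → x ≡ u i ⊎ x ≡ e (σ i)
        parts i (inj₁ (isLeft h)) = inj₁ h
        parts i (inj₁ (isRight h)) = inj₁ h
        parts i (inj₂ h) = inj₂ h
        within′ : ∀ i {x} → x ≡ u i ⊎ x ≡ e (σ i) → x ∈ U ∪ V
        within′ i (inj₁ refl) = ∪-inˡ (u∈ i)
        within′ i (inj₂ refl) = ∪-inʳ {S = U} (e∈V (σ i))
        separate : ∀ {i j x} → i ≢ j → x ≡ u i ⊎ x ≡ e (σ i) → x ≡ u j ⊎ x ≡ e (σ j) → ⊥
        separate ne (inj₁ h) (inj₁ k) = ne (u-injective (trans (sym h) k))
        separate ne (inj₁ h) (inj₂ k) = u≢e _ _ (trans (sym h) k)
        separate ne (inj₂ h) (inj₁ k) = u≢e _ _ (trans (sym k) h)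
        separate ne (inj₂ h) (inj₂ k) = ne (proj₁ (proj₂ partners) (e-injective (trans (sym h) k)))

      I-UV : ∀ {x} → x ∈ I → x ∈ U ∪ V → ⊥
      I-UV h k with image-out v h | ∪-out {S = U} k
      ... | i , refl | inj₁ x∈U = proj₂ (v-U i x∈U) refl
      ... | i , refl | inj₂ x∈V = W≢v (P⊆W (─-left x∈V)) i refl

      opaque
        ones : Σ (Family I 4) λ F → ∀ i → ∃[ x ] (x ∈ I × Family.trees F i ≡ tree x x x)
        ones = singles 4 (λ {x} {y} → I-stable {x} {y}) (#-image-≥ v v-injective)

      opaque
        nine-trees : Family (I ∪ (U ∪ V)) 9
        nine-trees = family-++ (proj₁ ones) doubles-family cross
          where
          cross : ∀ i j → Apart (Family.trees (proj₁ ones) i) (Family.trees doubles-family j)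
          cross i j = (λ h k → I-UV (Family.within (proj₁ ones) i h) (Family.within doubles-family j k)) , link (proj₂ ones i)
            where
            link : ∃[ x ] (x ∈ I × Family.trees (proj₁ ones) i ≡ tree x x x) → Linked (Family.trees (proj₁ ones) i) (Family.trees doubles-family j)
            link (x , x∈ , eq) rewrite eq = from (image-out v x∈)
              where
              from : ∃[ a ] v a ≡ x → Linked (tree x x x) (Family.trees doubles-family j)
              from (a , refl) = inj₁ (_ , _ , isLeft refl , isLeft refl , proj₂ (v-U a (u∈ j)) , proj₁ (v-U a (u∈ j)))

        twelve-trees : Family S 12
        twelve-trees = family-⊆ sub (add-gulls nine-trees R disjoint)
          where
          D⊆W : ∀ {x} → x ∈ Y ∪ ⁅ p ⁆ → x ∈ W
          D⊆W h with ∪-out {S = Y} h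
          ... | inj₁ k = Y⊆W k
          ... | inj₂ k = subst (_∈ W) (eqᵇ-true {i = p} k) (P⊆W p∈)
          disjoint : ∀ x → x ∈ I ∪ (U ∪ V) → x ∈ Y ∪ ⁅ p ⁆ → ⊥
          disjoint x h k with ∪-out {S = I} h
          ... | inj₁ i = clash i (W∉I (D⊆W k))
          ... | inj₂ h′ with ∪-out {S = U} h′
          ...   | inj₁ i = clash i (W∉U (D⊆W k))
          ...   | inj₂ i with ∪-out {S = Y} k
          ...     | inj₁ y = clash (─-left i) (Y∉P y)
          ...     | inj₂ y = ─-right i (eqᵇ-true {i = p} y)
          sub : (Y ∪ ⁅ p ⁆) ∪ (I ∪ (U ∪ V)) ⊆ S
          sub x h with ∪-out {S = Y ∪ ⁅ p ⁆} h
          ... | inj₁ k = W⊆S (D⊆W k)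
          ... | inj₂ k with ∪-out {S = I} k
          ...   | inj₂ l = case ∪-out {S = U} l of λ { (inj₁ a) → U⊆S a ; (inj₂ a) → ∩-left (─-left a) }
          ...   | inj₁ l with image-out v l
          ...     | i , refl = v∈ i

    conclusion : ¬¬ Family S 12
    conclusion = three-packing >>= λ (p , p∈ , R) → return (Assembly.twelve-trees p∈ R)

  twenty-three : ∀ S → StableBound S 6 → # S ≡ 23 → ¬¬ Family S 12
  twenty-three S b size k = five-exists S b size λ v₁ v₁∈ six → NoFive-stable 3 (far S v₁) λ t →
    some-five {2} {far S v₁} t λ (v₂ , v₂∈ , t₂) → some-five {1} {far (far S v₁) v₂} t₂ λ (v₃ , v₃∈ , t₃) →
    some-five {0} {far (far (far S v₁) v₂) v₃} t₃ λ (v₄ , v₄∈ , t₄) →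
    Configuration.conclusion b size v₁∈ six v₂∈ v₃∈ v₄∈ (≰⇒> t₄) k

-- Forbidden induced subgraphs

free-⊑ : ∀ {a b n} (A : Graph a) (B : Graph b) (G : Graph n) → InducedSub A B → Free A G → Free B G
free-⊑ A B G (f , f-injective , f-adj) free (h , h-injective , h-adj) =
  free (h ∘ f , (λ i j e → f-injective i j (h-injective _ _ e)) , λ i j → trans (f-adj i j) (h-adj _ _))

-- A condition on all pairs i < j as a nested product: for a concrete `m` a proof is a tuple with
-- one entry per row of the upper triangle.
Pairs : ∀ m → (Fin m → Fin m → Set) → Set
Pairs zero P = ⊤
Pairs (suc m) P = (∀ i → P zero (suc i)) × Pairs m (λ i j → P (suc i) (suc j))

pair : ∀ {m} {P : Fin m → Fin m → Set} → Pairs m P → ∀ i j → i <ᶠ j → P i j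
pair (h , _) zero (suc j) _ = h j
pair (_ , hs) (suc i) (suc j) (s≤s lt) = pair hs i j lt

module Assembled {n} (G : Graph n) (α : αAtMost G 2) where
  open Conclusion G α
  open TriangleFree 𝒞
  open Families 𝒞
  open Seagulls 𝒞
  open Ramsey 𝒞
  open Forbidden 𝒞
  open Counting 𝒞 using (no-25)
  open TwentyThree 𝒞 using (twenty-three)

  private
    flip : ∀ {u v b} → c u v ≡ b → c v u ≡ b
    flip {u} {v} h = trans (c-sym v u) h

    apart : ∀ {u v w} → c u w ≡ true → c v w ≡ false → u ≢ v
    apart h k refl = clash h k

  Matches : Bool → Fin n → Fin n → Set
  Matches true u v = Near u v
  Matches false u v = c u v ≡ true

  induced : ∀ {m} (F : Graph m) (f : Fin m → Fin n) → Pairs m (λ i j → Matches (adj F i j) (f i) (f j)) → InducedSub F G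
  induced {m} F f h = f , injective , adjacency
    where
    read : ∀ b {u v} → Matches b u v → u ≢ v × b ≡ adj G u v
    read true near = proj₁ near , sym (near⇒adjacent near)
    read false {u} {v} e = apart e (c-irr v) , sym (¬true⇒false λ k → clash e (proj₂ (adjacent⇒near k)))
    injective : ∀ i j → f i ≡ f j → i ≡ j
    injective i j e with <-cmpᶠ i j
    ... | tri< lt _ _ = ⊥-elim (proj₁ (read _ (pair h i j lt)) e)
    ... | tri≈ _ eq _ = eq
    ... | tri> _ _ gt = ⊥-elim (proj₁ (read _ (pair h j i gt)) (sym e))
    adjacency : ∀ i j → adj F i j ≡ adj G (f i) (f j)
    adjacency i j with <-cmpᶠ i j
    ... | tri< lt _ _ = proj₂ (read _ (pair h i j lt))
    ... | tri≈ _ refl _ = trans (adj-irr F i) (sym (adj-irr G (f i)))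
    ... | tri> _ _ gt = trans (adj-sym F i j) (trans (proj₂ (read _ (pair h j i gt))) (adj-sym G (f j) (f i)))

  -- The complement of the path `p`, `q`, `r`, `s` is the path `r`, `p`, `s`, `q`, which explains
  -- the order in `f`.
  gem : ∀ {v p q r s} → c p q ≡ true → c q r ≡ true → c r s ≡ true → c p r ≡ false → c p s ≡ false → c q s ≡ false →
    c v p ≡ false → c v q ≡ false → c v r ≡ false → c v s ≡ false → InducedSub (K 1 +ᴳ P4) G
  gem {v} {p} {q} {r} {s} pq qr rs pr ps qs vp vq vr vs = induced (K 1 +ᴳ P4) f
    ( (λ { 0F → apart rs vs ∘ sym , vr ; 1F → apart pq vq ∘ sym , vp ; 2F → apart (flip rs) vr ∘ sym , vs ; (suc (suc (suc zero))) → apart qr vr ∘ sym , vq })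
    , (λ { 0F → apart rs ps , flip pr ; 1F → rs ; 2F → flip qr })
    , (λ { 0F → apart pq (flip qs) , ps ; 1F → pq })
    , (λ { 0F → apart (flip pq) (flip ps) ∘ sym , flip qs })
    , (λ ()) , tt )
    where
    f : Fin 5 → Fin n
    f zero = v
    f (suc zero) = r
    f (suc (suc zero)) = p
    f (suc (suc (suc zero))) = s
    f (suc (suc (suc (suc zero)))) = q

  fork : ∀ {v a b x y} → c v a ≡ true → c v b ≡ true → c v x ≡ true → c x y ≡ true → c y a ≡ false → c y b ≡ false →
    a ≢ b → v ≢ y → InducedSub kite G
  fork {v} {a} {b} {x} {y} va vb vx xy ya yb a≢b v≢y = induced kite f
    ( (λ { 0F → a≢b , beside va vb ; 1F → apart xy (flip ya) ∘ sym , beside va vx ; 2F → apart (flip va) yv , flip ya ; (suc (suc (suc zero))) → flip va })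
    , (λ { 0F → apart xy (flip yb) ∘ sym , beside vb vx ; 1F → apart (flip vb) yv , flip yb ; 2F → flip vb })
    , (λ { 0F → xy ; 1F → flip vx })
    , (λ { 0F → v≢y ∘ sym , yv })
    , (λ ()) , tt )
    where
    beside : ∀ {p q} → c v p ≡ true → c v q ≡ true → c p q ≡ false
    beside h k = ¬true⇒false λ e → c-tri v _ _ h e k
    yv : c y v ≡ false
    yv = ¬true⇒false λ e → c-tri v x y vx xy (flip e)
    f : Fin 5 → Fin n
    f zero = a
    f (suc zero) = b
    f (suc (suc zero)) = x
    f (suc (suc (suc zero))) = y
    f (suc (suc (suc (suc zero)))) = v

  star₄ : ∀ v w → v ≢ w → c v w ≡ false → (f : Fin 4 → Fin n) → (∀ {i j} → f i ≡ f j → i ≡ j) →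
    (∀ i → c v (f i) ≡ true) → (∀ i → c w (f i) ≡ false) → InducedSub (K 1 +ᴳ (K 1 ∪ᴳ K 4)) G
  star₄ v w v≢w vw f f-injective vf wf = induced (K 1 +ᴳ (K 1 ∪ᴳ K 4)) h
    ( (λ { zero → v≢w ∘ sym , flip vw ; (suc i) → apart (flip (vf i)) (flip vw) ∘ sym , wf i })
    , vf
    , (λ i → leaves 0F (suc i) λ ()) , (λ i → leaves 1F (suc (suc i)) λ ()) , (λ i → leaves 2F (suc (suc (suc i))) λ ())
    , (λ ()) , tt )
    where
    leaves : ∀ i j → i ≢ j → Near (f i) (f j)
    leaves i j ne = (λ e → ne (f-injective e)) , ¬true⇒false λ e → c-tri v _ _ (vf i) e (vf j)
    h : Fin 6 → Fin n
    h zero = w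
    h (suc zero) = v
    h (suc (suc i)) = f i

  star₃ : ∀ v u w → u ≢ w → c u w ≡ false → v ≢ u → v ≢ w → c v u ≡ false → c v w ≡ false → (f : Fin 3 → Fin n) → (∀ {i j} → f i ≡ f j → i ≡ j) →
    (∀ i → c v (f i) ≡ true) → (∀ i → c u (f i) ≡ false) → (∀ i → c w (f i) ≡ false) → InducedSub (K 2 +ᴳ (K 1 ∪ᴳ K 3)) G
  star₃ v u w u≢w uw v≢u v≢w vu vw f f-injective vf uf wf = induced (K 2 +ᴳ (K 1 ∪ᴳ K 3)) h
    ( (λ { zero → u≢w , uw ; (suc zero) → v≢u ∘ sym , flip vu ; (suc (suc i)) → apart (flip (vf i)) (flip vu) ∘ sym , uf i })
    , (λ { zero → v≢w ∘ sym , flip vw ; (suc i) → apart (flip (vf i)) (flip vw) ∘ sym , wf i })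
    , vf
    , (λ i → leaves 0F (suc i) λ ()) , (λ i → leaves 1F (suc (suc i)) λ ())
    , (λ ()) , tt )
    where
    leaves : ∀ i j → i ≢ j → Near (f i) (f j)
    leaves i j ne = (λ e → ne (f-injective e)) , ¬true⇒false λ e → c-tri v _ _ (vf i) e (vf j)
    h : Fin 6 → Fin n
    h zero = u
    h (suc zero) = w
    h (suc (suc zero)) = v
    h (suc (suc (suc i))) = f i

  private
    stable-near : ∀ {m P} (f : Fin m → Fin n) → Stable P → (∀ i → f i ∈ P) → (∀ {i j} → f i ≡ f j → i ≡ j) → ∀ i j → i ≢ j → Near (f i) (f j)
    stable-near f st f∈ inj i j ne = (λ e → ne (inj e)) , st (f∈ i) (f∈ j)

  clique₇⁻ : ∀ x y P → c x y ≡ true → Stable P → 5 ≤ # P → (∀ w → w ∈ P → c x w ≡ false) → (∀ w → w ∈ P → c y w ≡ false) → InducedSub K7⁻ G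
  clique₇⁻ x y P xy st five xP yP with elements P 5 five
  ... | f , f∈ , inj = induced K7⁻ h
    ( (λ { zero → xy ; (suc i) → apart xy (flip (yP _ (f∈ i))) , xP _ (f∈ i) })
    , (λ i → apart (flip xy) (flip (xP _ (f∈ i))) , yP _ (f∈ i))
    , (λ i → near 0F (suc i) λ ()) , (λ i → near 1F (suc (suc i)) λ ()) , (λ i → near 2F (suc (suc (suc i))) λ ())
    , (λ i → near (suc 2F) (suc (suc (suc (suc i)))) λ ()) , (λ ()) , tt )
    where
    near : ∀ i j → i ≢ j → Near (f i) (f j)
    near = stable-near f st f∈ inj
    h : Fin 7 → Fin n
    h zero = x
    h (suc zero) = y
    h (suc (suc i)) = f i

  clique₇ : ∀ P → Stable P → 7 ≤ # P → InducedSub (K 7) G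
  clique₇ P st seven with elements P 7 seven
  ... | f , f∈ , inj = induced (K 7) f
    ( (λ i → near 0F (suc i) λ ()) , (λ i → near 1F (suc (suc i)) λ ()) , (λ i → near 2F (suc (suc (suc i))) λ ())
    , (λ i → near (suc 2F) (suc (suc (suc (suc i)))) λ ()) , (λ i → near (suc (suc 2F)) (suc (suc (suc (suc (suc i))))) λ ())
    , (λ i → near (suc (suc (suc 2F))) (suc (suc (suc (suc (suc (suc i)))))) λ ()) , (λ ()) , tt )
    where
    near : ∀ i j → i ≢ j → Near (f i) (f j)
    near = stable-near f st f∈ inj

  -- `ramsey-step` applied to `ramsey₅` bounds `# S` by 18 + 7 = 25, and parity excludes 24.
  six-bounded : ∀ S → StableBound S 6 → 23 ≤ # S → ∀ k → # S + 1 ≡ 2 * k → ¬¬ Family S k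
  six-bounded S b large k e = cases (# S ≤? 23) (# S ≤? 24)
    where
    cases : Dec (# S ≤ 23) → Dec (# S ≤ 24) → ¬¬ Family S k
    cases (yes le) _ = twenty-three S b (≤-antisym le large) >>= λ F → return (family-≤ k≤12 F)
      where
      k≤12 : k ≤ 12
      k≤12 = *-cancelˡ-≤ {k} {12} 2 (lin 2 {k , _ , _} (2 ⊠ $0 ≼ 2 ⊠ con 12) ($1 ⊞ 2 ⊠ $0 ≼ con 23 ⊞ ($1 ⊞ con 1)) (le ⊕ eq≥ e))
    cases (no gt′) (yes le) = absurd (absurd-≤ 1 (con 24 ⊞ con 2 ⊞ $0 ≼ $0 ⊞ con 1 ⊞ con 24) (even-step {24} {# S + 1} 12 k refl e (lin 1 (con 25 ≼ $0 ⊞ con 1) (con 24 ≼ $0) (≰⇒> gt′)) ⊕ le))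
    cases _ (no gt) = absurd (no-25 S b (≤-antisym (ramsey-step ramsey₅ S b) (≰⇒> gt)))

  OrSix : Sub n → Sub n → Set
  OrSix S Q = # S + 3 ≤ 4 * # Q ⊎ StableBound S 6

  family-of : (∀ {S Q} → LargestStable S Q → 23 ≤ # S → ∀ k → # S + 1 ≡ 2 * k → OrSix S Q) → ∀ S k → # S + 1 ≡ 2 * k → ¬¬ Family S k
  family-of large S k e = largest-stable S >>= λ (Q , L) → by L (# S ≤? 21)
    where
    by : ∀ {Q} → LargestStable S Q → Dec (# S ≤ 21) → ¬¬ Family S k
    by L (yes le) = seagull-family k L e (small-case k L e le) (nine L)
    by {Q} L (no gt) = use (large L size k e)
      where
      size : 23 ≤ # S
      size = lin 1 (con 23 ≼ $0) (con 22 ⊞ con 2 ≼ $0 ⊞ con 1) (even-step {22} {# S + 1} 11 k refl e (lin 1 (con 23 ≼ $0 ⊞ con 1) (con 22 ≼ $0) (≰⇒> gt)))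
      use : OrSix S Q → ¬¬ Family S k
      use (inj₁ h) = seagull-family k L e h (nine L)
      use (inj₂ b) = six-bounded S b size k e

  large-case : ∀ {m} (H : Graph m) → InAllowedFamily H → Free H G → ∀ {S Q} → LargestStable S Q → 23 ≤ # S → ∀ k → # S + 1 ≡ 2 * k → OrSix S Q
  large-case H (inj₁ i) free L large k e = inj₁ (gem-free L large λ a b d p q r s t u v → free-⊑ H (K 1 +ᴳ P4) G i free (gem a b d p q r s t u v))
  large-case H (inj₂ (inj₁ i)) free L large k e = inj₁ (star₃-free L large (λ v u w a b d p q r f inj s t x → free-⊑ H (K 2 +ᴳ (K 1 ∪ᴳ K 3)) G i free (star₃ v u w a b d p q r f inj s t x)) k e)
  large-case H (inj₂ (inj₂ (inj₁ i))) free L large k e = inj₁ (star₄-free L large λ v w a b f inj s t → free-⊑ H (K 1 +ᴳ (K 1 ∪ᴳ K 4)) G i free (star₄ v w a b f inj s t))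
  large-case H (inj₂ (inj₂ (inj₂ (inj₁ i)))) free {S} {Q} L large k e with 7 ≤? # Q
  ... | yes seven = inj₁ (K₇⁻-free L large (λ x y P xy st five p q → free-⊑ H K7⁻ G i free (clique₇⁻ x y P xy (λ {u} {v} → st {u} {v}) five p q)) seven)
  ... | no few = inj₂ λ Q′ s t → ≤-trans (proj₂ (proj₂ L) Q′ s t) (≤-pred (≰⇒> few))
  large-case H (inj₂ (inj₂ (inj₂ (inj₂ (inj₁ i))))) free L large k e = inj₂ λ Q′ s t → ≮⇒≥ λ seven → free-⊑ H (K 7) G i free (clique₇ Q′ (λ {u} {v} → t {u} {v}) seven)
  large-case H (inj₂ (inj₂ (inj₂ (inj₂ (inj₂ i))))) free L large k e = inj₁ (kite-free L large λ a b d p q r s t → free-⊑ H kite G i free (fork a b d p q r s t))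

theorem1p9 : ∀ {m} (H : Graph m) → αAtMost H 2 → InAllowedFamily H →
    ∀ {n} (G : Graph n) → Free H G → αAtMost G 2 →
    ∀ (k : ℕ) → IsChromaticNumber G k → OhAtLeast G k
theorem1p9 H αH allowed G free αG k χ = Conclusion.conclude G αG (Assembled.family-of G αG (Assembled.large-case G αG H allowed free)) k χ
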